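{- Let $G$ be a near-bipartite brick other than $K_4$, with $n$ vertices. Then $G$ has at least $\frac{n-6}{2}$ removable edges. Moreover, $G$ has exactly $\frac{n-6}{2}$ removable edges if and only if $G$ is a tri-ladder.
   Context: Graphs are finite and may have multiple edges but no loops. A connected graph with at least two vertices is matching covered if every edge lies in some perfect matching. An edge $e$ of a matching covered graph $G$ is removable if $G-e$ is matching covered. For $X\subseteq V(G)$, $\partial(X)$ is the set of edges with exactly one end in $X$; it is nontrivial if $|X|\ge 2$ and $|V(G)\setminus X|\ge 2$. An edge cut $C$ of a matching covered graph is tight if every perfect matching contains exactly one edge of $C$. A brick is a nonbipartite matching covered graph with no nontrivial tight cuts. A nonbipartite matching covered graph $G$ is near-bipartite if it has a pair of edges $\{e_1,e_2\}$ such that $G-\{e_1,e_2\}$ is a bipartite matching covered graph. Splicing: given graphs $G_1,G_2$ and vertices $u_1\in V(G_1)$, $u_2\in V(G_2)$ of the same degree, a splicing of $G_1$ and $G_2$ at $u_1$ and $u_2$ is a graph obtained from the disjoint union of $G_1-u_1$ and $G_2-u_2$ by choosing a bijection between the edges of $G_1$ at $u_1$ and the edges of $G_2$ at $u_2$ and, for each matched pair $u_1a$, $u_2b$, adding an edge $ab$. $\overline{C_6}$ denotes the complement of the 6-cycle (the triangular prism). A graph is a tri-ladder if it is $\overline{C_6}$ or it is obtained from $\overline{C_6}$ by iteratively splicing with $K_4$ at vertices lying in triangles, i.e., there is a sequence $G_0=\overline{C_6},G_1,\dots,G_r=G$ where each $G_i$ ($1\le i\le r$) is a splicing of $G_{i-1}$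 and $K_4$ at a vertex of $G_{i-1}$ lying in a triangle and a vertex of $K_4$. -}

module Defs where

open import Data.Nat using (ℕ; zero; suc; _+_; _*_; _≤_)
open import Data.Fin using (Fin; zero; suc; #_)
open import Data.Fin.Subset using (Subset; _∈_; _∉_; ∁; ∣_∣)
open import Data.Product using (Σ; ∃; ∃₂; _×_; _,_)
open import Data.Sum using (_⊎_; inj₁; inj₂)
open import Data.Bool using (Bool)
open import Data.Unit using (⊤)
open import Relation.Binary.PropositionalEquality using (_≡_; _≢_)
open import Relation.Nullary using (¬_)
open import Function.Bundles using (_↔_; Inverse)

record Graph : Set where
  field
    n : ℕ
    m : ℕ
    end₁ : Fin m → Fin n
    end₂ : Fin m → Fin n
    loopless : ∀ e → end₁ e ≢ end₂ e

open Graph public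

SamePair : {A : Set} → A → A → A → A → Set
SamePair x y x' y' = (x ≡ x' × y ≡ y') ⊎ (x ≡ y' × y ≡ x')

Inc : (G : Graph) → Fin (m G) → Fin (n G) → Set
Inc G e v = end₁ G e ≡ v ⊎ end₂ G e ≡ v

Joins : (G : Graph) → Fin (m G) → Fin (n G) → Fin (n G) → Set
Joins G e u v = SamePair (end₁ G e) (end₂ G e) u v

Adj : (G : Graph) → Fin (n G) → Fin (n G) → Set
Adj G u v = ∃ λ e → Joins G e u v

-- Spanning subgraphs are given by a predicate S on the edges
-- (S e = "edge e is present").  G itself is S = All.

EdgeSet : Graph → Set₁
EdgeSet G = Fin (m G) → Set

All : (G : Graph) → EdgeSet G
All G _ = ⊤

Minus1 : (G : Graph) → Fin (m G) → EdgeSet G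
Minus1 G e f = f ≢ e

Minus2 : (G : Graph) → Fin (m G) → Fin (m G) → EdgeSet G
Minus2 G e₁ e₂ f = f ≢ e₁ × f ≢ e₂

data Reach (G : Graph) (S : EdgeSet G) : Fin (n G) → Fin (n G) → Set where
  here : ∀ {u} → Reach G S u u
  step : ∀ {u v w} (e : Fin (m G)) → S e → Joins G e u v → Reach G S v w → Reach G S u w

Connected : (G : Graph) → EdgeSet G → Set
Connected G S = ∀ u v → Reach G S u v

PerfectMatching : (G : Graph) → EdgeSet G → Subset (m G) → Set
PerfectMatching G S M =
  (∀ e → e ∈ M → S e) ×
  (∀ v → ∃ λ e → e ∈ M × Inc G e v) ×
  (∀ v e e' → e ∈ M → e' ∈ M → Inc G e v → Inc G e' v → e ≡ e')

MatchingCoveredOn : (G : Graph) → EdgeSet G → Set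
MatchingCoveredOn G S =
  2 ≤ n G × Connected G S ×
  (∀ e → S e → ∃ λ M → PerfectMatching G S M × e ∈ M)

MatchingCovered : Graph → Set
MatchingCovered G = MatchingCoveredOn G (All G)

BipartiteOn : (G : Graph) → EdgeSet G → Set
BipartiteOn G S = ∃ λ (c : Fin (n G) → Bool) → ∀ e → S e → c (end₁ G e) ≢ c (end₂ G e)

Bipartite : Graph → Set
Bipartite G = BipartiteOn G (All G)

InCut : (G : Graph) → Subset (n G) → Fin (m G) → Set
InCut G X e = (end₁ G e ∈ X × end₂ G e ∉ X) ⊎ (end₁ G e ∉ X × end₂ G e ∈ X)

TightCut : (G : Graph) → Subset (n G) → Set
TightCut G X = ∀ M → PerfectMatching G (All G) M →
  (∃ λ e → e ∈ M × InCut G X e) ×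
  (∀ e e' → e ∈ M → InCut G X e → e' ∈ M → InCut G X e' → e ≡ e')

Brick : Graph → Set
Brick G = MatchingCovered G × ¬ Bipartite G ×
  (∀ (X : Subset (n G)) → 2 ≤ ∣ X ∣ → 2 ≤ ∣ ∁ X ∣ → ¬ TightCut G X)

NearBipartite : Graph → Set
NearBipartite G = MatchingCovered G × ¬ Bipartite G ×
  ∃₂ λ e₁ e₂ → e₁ ≢ e₂ × BipartiteOn G (Minus2 G e₁ e₂) × MatchingCoveredOn G (Minus2 G e₁ e₂)

Removable : (G : Graph) → Fin (m G) → Set
Removable G e = MatchingCoveredOn G (Minus1 G e)

record Iso (G H : Graph) : Set where
  field
    vbij : Fin (n G) ↔ Fin (n H)
    ebij : Fin (m G) ↔ Fin (m H)
    ends : ∀ e → SamePair (Inverse.to vbij (end₁ G e)) (Inverse.to vbij (end₂ G e))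
                          (end₁ H (Inverse.to ebij e)) (end₂ H (Inverse.to ebij e))

-- K₄ and the triangular prism (complement of the 6-cycle 0-1-2-3-4-5-0)

private
  K4e₁ K4e₂ : Fin 6 → Fin 4
  K4e₁ zero = # 0
  K4e₁ (suc zero) = # 0
  K4e₁ (suc (suc zero)) = # 0
  K4e₁ (suc (suc (suc zero))) = # 1
  K4e₁ (suc (suc (suc (suc zero)))) = # 1
  K4e₁ (suc (suc (suc (suc (suc zero))))) = # 2
  K4e₂ zero = # 1
  K4e₂ (suc zero) = # 2
  K4e₂ (suc (suc zero)) = # 3
  K4e₂ (suc (suc (suc zero))) = # 2
  K4e₂ (suc (suc (suc (suc zero)))) = # 3
  K4e₂ (suc (suc (suc (suc (suc zero))))) = # 3

  K4ll : ∀ e → K4e₁ e ≢ K4e₂ e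
  K4ll zero ()
  K4ll (suc zero) ()
  K4ll (suc (suc zero)) ()
  K4ll (suc (suc (suc zero))) ()
  K4ll (suc (suc (suc (suc zero)))) ()
  K4ll (suc (suc (suc (suc (suc zero))))) ()

  -- the 9 non-adjacent pairs of the 6-cycle:
  -- 02 03 04 13 14 15 24 25 35
  Pe₁ Pe₂ : Fin 9 → Fin 6
  Pe₁ zero = # 0
  Pe₁ (suc zero) = # 0
  Pe₁ (suc (suc zero)) = # 0
  Pe₁ (suc (suc (suc zero))) = # 1
  Pe₁ (suc (suc (suc (suc zero)))) = # 1
  Pe₁ (suc (suc (suc (suc (suc zero))))) = # 1
  Pe₁ (suc (suc (suc (suc (suc (suc zero)))))) = # 2
  Pe₁ (suc (suc (suc (suc (suc (suc (suc zero))))))) = # 2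
  Pe₁ (suc (suc (suc (suc (suc (suc (suc (suc zero)))))))) = # 3
  Pe₂ zero = # 2
  Pe₂ (suc zero) = # 3
  Pe₂ (suc (suc zero)) = # 4
  Pe₂ (suc (suc (suc zero))) = # 3
  Pe₂ (suc (suc (suc (suc zero)))) = # 4
  Pe₂ (suc (suc (suc (suc (suc zero))))) = # 5
  Pe₂ (suc (suc (suc (suc (suc (suc zero)))))) = # 4
  Pe₂ (suc (suc (suc (suc (suc (suc (suc zero))))))) = # 5
  Pe₂ (suc (suc (suc (suc (suc (suc (suc (suc zero)))))))) = # 5

  Pll : ∀ e → Pe₁ e ≢ Pe₂ e
  Pll zero ()
  Pll (suc zero) ()
  Pll (suc (suc zero)) ()
  Pll (suc (suc (suc zero))) ()
  Pll (suc (suc (suc (suc zero)))) ()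
  Pll (suc (suc (suc (suc (suc zero))))) ()
  Pll (suc (suc (suc (suc (suc (suc zero)))))) ()
  Pll (suc (suc (suc (suc (suc (suc (suc zero))))))) ()
  Pll (suc (suc (suc (suc (suc (suc (suc (suc zero)))))))) ()

K4 : Graph
K4 = record { n = 4 ; m = 6 ; end₁ = K4e₁ ; end₂ = K4e₂ ; loopless = K4ll }

C6bar : Graph
C6bar = record { n = 6 ; m = 9 ; end₁ = Pe₁ ; end₂ = Pe₂ ; loopless = Pll }

-- G is a splicing of G₁ and G₂ at u₁ and u₂ (described up to the
-- naming of vertices/edges of G):
--  * V(G) is in bijection with (V(G₁) - u₁) ⊎ (V(G₂) - u₂)   (vmap);
--  * each edge of G is either an edge of G₁ not at u₁ (inj₁ f), an edge
--    of G₂ not at u₂ (inj₂ (inj₁ f)), or the new edge ab arising from a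
--    pair (u₁a , u₂b) of the chosen bijection (inj₂ (inj₂ (f₁ , f₂)));
--  * the pairs used form a bijection between the edges of G₁ at u₁ and
--    the edges of G₂ at u₂.

record Splicing (G G₁ : Graph) (u₁ : Fin (n G₁)) (G₂ : Graph) (u₂ : Fin (n G₂)) : Set where
  field
    vmap      : Fin (n G) → Fin (n G₁) ⊎ Fin (n G₂)
    vmap-inj  : ∀ x y → vmap x ≡ vmap y → x ≡ y
    vmap-no₁  : ∀ x → vmap x ≢ inj₁ u₁
    vmap-no₂  : ∀ x → vmap x ≢ inj₂ u₂
    vmap-on₁  : ∀ v → v ≢ u₁ → ∃ λ x → vmap x ≡ inj₁ v
    vmap-on₂  : ∀ v → v ≢ u₂ → ∃ λ x → vmap x ≡ inj₂ v
    emap      : Fin (m G) → Fin (m G₁) ⊎ (Fin (m G₂) ⊎ (Fin (m G₁) × Fin (m G₂)))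
    emap-inj  : ∀ g h → emap g ≡ emap h → g ≡ h
    old₁      : ∀ g f → emap g ≡ inj₁ f → ¬ Inc G₁ f u₁ ×
                  SamePair (vmap (end₁ G g)) (vmap (end₂ G g)) (inj₁ (end₁ G₁ f)) (inj₁ (end₂ G₁ f))
    old₁-on   : ∀ f → ¬ Inc G₁ f u₁ → ∃ λ g → emap g ≡ inj₁ f
    old₂      : ∀ g f → emap g ≡ inj₂ (inj₁ f) → ¬ Inc G₂ f u₂ ×
                  SamePair (vmap (end₁ G g)) (vmap (end₂ G g)) (inj₂ (end₁ G₂ f)) (inj₂ (end₂ G₂ f))
    old₂-on   : ∀ f → ¬ Inc G₂ f u₂ → ∃ λ g → emap g ≡ inj₂ (inj₁ f)
    new       : ∀ g f₁ f₂ → emap g ≡ inj₂ (inj₂ (f₁ , f₂)) →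
                  ∃₂ λ a b → Joins G₁ f₁ u₁ a × Joins G₂ f₂ u₂ b ×
                  SamePair (vmap (end₁ G g)) (vmap (end₂ G g)) (inj₁ a) (inj₂ b)
    new-on₁   : ∀ f₁ → Inc G₁ f₁ u₁ → ∃₂ λ g f₂ → emap g ≡ inj₂ (inj₂ (f₁ , f₂))
    new-on₂   : ∀ f₂ → Inc G₂ f₂ u₂ → ∃₂ λ g f₁ → emap g ≡ inj₂ (inj₂ (f₁ , f₂))
    new-fun₁  : ∀ g h f₁ f₂ f₂' → emap g ≡ inj₂ (inj₂ (f₁ , f₂)) → emap h ≡ inj₂ (inj₂ (f₁ , f₂')) → g ≡ h
    new-fun₂  : ∀ g h f₁ f₁' f₂ → emap g ≡ inj₂ (inj₂ (f₁ , f₂)) → emap h ≡ inj₂ (inj₂ (f₁' , f₂)) → g ≡ h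

InTriangle : (G : Graph) → Fin (n G) → Set
InTriangle G u = ∃₂ λ v w → Adj G u v × Adj G v w × Adj G u w

-- tri-ladders (closed under isomorphism, as "obtained from")
data TriLadder : Graph → Set where
  base   : ∀ {G} → Iso G C6bar → TriLadder G
  splice : ∀ {G H} → TriLadder H → (u : Fin (n H)) → InTriangle H u →
           (w : Fin (n K4)) → Splicing G H u K4 w → TriLadder G

{-# OPTIONS --safe #-}
-- Let A, B be the colour classes of H = G - {e₁, e₂}, with e₁ = a₁a₂ inside A and e₂ = b₁b₂ inside B, and let
-- d(X) = |N(X)| - |X|.  A perfect matching of G uses both of e₁, e₂ or neither.  Since X ∪ N(X) is not the shore of a
-- tight cut, d(X) ≤ 1 for a small X ⊆ A forces X to contain some aᵢ and N(X) to miss some bᵢ.  By Hall's theorem a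
-- nonremovable edge ab is blocked either by a set X ∋ a with d(X) = 1 in which a is the only neighbour of b (type α), or
-- because every perfect matching through e₁, e₂ contains ab (type β).  Uncrossing shows that a vertex has at most two α-edges
-- and one β-edge, and that a vertex a ≠ a₁, a₂ with three nonremovable edges is adjacent to b₁ and b₂; such a vertex is
-- unique.  So at most six vertices have no removable edge, which gives the bound.
--
-- In the case of equality G is cubic, and a vertex with two α-edges can only be the common neighbour of b₁ and b₂; hence
-- every a ≠ a₁, a₂ has a β-edge, i.e. the perfect matching through e₁, e₂ is unique.  Peeling off its edges in order, the
-- degrees and d ≥ 1 force a ladder, one splicing with K₄ per step.
--
-- Conversely, when u in a triangle uvw of a cubic graph is replaced by a triangle, every edge in or at the new triangle is
-- nonremovable if uv and uw were, and an old edge other than vw stays nonremovable if it was so before.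
module Submission where

open import Defs
open import Data.Nat using (ℕ; zero; suc; _+_; _*_; _≤_; _<_; z≤n; s≤s; s≤s⁻¹; _≤?_)
open import Data.Nat.Properties using (≤-refl; ≤-trans; ≤-reflexive; ≤-antisym; +-mono-≤; +-cancelʳ-≤; +-cancelˡ-≤; +-identityʳ; +-assoc; +-suc; +-comm; *-distribʳ-+; m≤m+n; m≤n+m; n≤1+n; ≰⇒>; ≮⇒≥; <-irrefl; _<?_; +-0-commutativeMonoid; *-monoˡ-≤; *-monoʳ-≤)
open import Data.Fin using (Fin; zero; suc; #_)
open import Data.Fin.Properties using (_≟_; any?; all?; injective⇒≤)
open import Data.Fin.Subset using (Subset; _∈_; ∣_∣) renaming (∁ to ∁ˢ)
open import Data.Fin.Subset.Properties using (anySubset?; _∈?_)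
open import Data.Bool.Properties using (not-involutive) renaming (_≟_ to _≟ᵇ_)
open import Data.Bool using (Bool; true; false; _∧_; _∨_; not; if_then_else_)
open import Data.Product using (Σ; ∃; ∃₂; _×_; _,_; proj₁; proj₂)
open import Data.Sum using (_⊎_; inj₁; inj₂)
open import Data.Empty using (⊥; ⊥-elim)
open import Data.Vec using (Vec; []; _∷_; lookup; tabulate)
open import Data.Vec.Properties using (lookup∘tabulate; []=⇒lookup; lookup⇒[]=; tabulate-∘; tabulate∘lookup)
open import Data.List using (List; []; _∷_; length; map)
open import Data.List.Properties using (length-map)
open import Data.List.Relation.Unary.Any using (here; there)
open import Data.List.Membership.Propositional using () renaming (_∈_ to _∈ˡ_)
open import Data.List.Membership.Propositional.Properties using (∈-map⁺)
open import Data.List.Relation.Unary.All using ([]; _∷_) renaming (All to AllL)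
open import Data.Unit using (tt)
open import Function.Bundles using (_↔_; _⇔_; Inverse; mk↔ₛ′; mk⇔; Equivalence)
open import Function using (_∘_; id; case_of_)
open import Relation.Binary.PropositionalEquality using (_≡_; _≢_; refl; sym; trans; cong; cong₂; subst; subst₂)
open import Relation.Nullary using (¬_; Dec; yes; no)
open import Relation.Nullary.Decidable using (True; toWitness; _×-dec_; _→-dec_; _⊎-dec_; ¬?; ⌊_⌋)
open import Algebra.Properties.CommutativeMonoid.Sum +-0-commutativeMonoid using (sum; sum-cong-≗; ∑-distrib-+; ∑-comm; sum-replicate-zero)

-- Linear arithmetic over ℕ

-- The obstacle is that `G` is not bipartite, while Hall's theorem needs two sides. Perfect
-- matchings avoiding the deleted edges live in `H`; those through both live in `H` without the four
-- ends. Deleting an edge can destroy matchings of both kinds at once, so a type α obstacle carries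
-- two statements: a small set in `H`, and the fact that the same lost edge `xy` is not rescued by a
-- matching of the other kind. The second is needed when two α-edges meet one β-edge. The constant 6
-- is four ends of deleted edges plus one exceptional vertex per colour class; every other vertex
-- meets a removable edge, and each such edge is counted at two vertices. Equality therefore leaves
-- no slack at any single vertex, and the local structure comes from that. For tri-ladders only an
-- upper bound on the number of removable edges has to be proved, since the lower bound supplies the
-- rest. It comes from an induction on the splicings, each adding two vertices and at most one
-- removable edge; the induction has to carry along that triangles are disjoint and meet no
-- removable edge.

infixl 6 _⊕_

-- Terms are reified with variables as positions in a vector of numbers, so that comparing two of
-- them becomes a decidable check on coefficients.
data Lin (k : ℕ) : Set where
  ′_  : Fin k → Lin k
  ♯_  : ℕ → Lin k
  _⊕_ : Lin k → Lin k → Lin k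

infix 8 ′_ ♯_

⟦_⟧ : ∀ {k} → Lin k → Vec ℕ k → ℕ
⟦ ′ i ⟧ ρ = lookup ρ i
⟦ ♯ c ⟧ ρ = c
⟦ s ⊕ t ⟧ ρ = ⟦ s ⟧ ρ + ⟦ t ⟧ ρ

coeff : ∀ {k} → Lin k → Fin k → ℕ
coeff (′ i) j = if ⌊ i ≟ j ⌋ then 1 else 0
coeff (♯ c) j = 0
coeff (s ⊕ t) j = coeff s j + coeff t j

const : ∀ {k} → Lin k → ℕ
const (′ i) = 0
const (♯ c) = c
const (s ⊕ t) = const s + const t

sum-mono : ∀ {n} {f g : Fin n → ℕ} → (∀ i → f i ≤ g i) → sum f ≤ sum g
sum-mono {zero} h = z≤n
sum-mono {suc n} h = +-mono-≤ (h zero) (sum-mono (h ∘ suc))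

sum-zero : ∀ {n} {f : Fin n → ℕ} → (∀ i → f i ≡ 0) → sum f ≡ 0
sum-zero {n} h = trans (sum-cong-≗ h) (sum-replicate-zero n)

sum-select : ∀ {n} (f : Fin n → ℕ) i → sum (λ j → (if ⌊ i ≟ j ⌋ then 1 else 0) * f j) ≡ f i
sum-select {suc n} f zero = trans (cong₂ _+_ (+-identityʳ (f zero)) (sum-zero {n} λ _ → refl)) (+-identityʳ (f zero))
sum-select {suc n} f (suc i) = trans (sum-cong-≗ λ j → cong (λ b → (if b then 1 else 0) * f (suc j)) (lower i j)) (sum-select (f ∘ suc) i)
  where
  lower : ∀ (i j : Fin n) → ⌊ suc i ≟ suc j ⌋ ≡ ⌊ i ≟ j ⌋
  lower i j with i ≟ j
  ... | yes _ = refl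
  ... | no _ = refl

swap-middle : ∀ a b c d → (a + b) + (c + d) ≡ (a + c) + (b + d)
swap-middle a b c d = trans (+-assoc a b (c + d)) (trans (cong (a +_) (trans (sym (+-assoc b c d)) (trans (cong (_+ d) (+-comm b c)) (+-assoc c b d)))) (sym (+-assoc a c (b + d))))

eval-normal : ∀ {k} (t : Lin k) ρ → ⟦ t ⟧ ρ ≡ const t + sum (λ j → coeff t j * lookup ρ j)
eval-normal (′ i) ρ = sym (sum-select (lookup ρ) i)
eval-normal {k} (♯ c) ρ = sym (trans (cong (c +_) (sum-zero {k} λ _ → refl)) (+-identityʳ c))
eval-normal (s ⊕ t) ρ =
  trans (cong₂ _+_ (eval-normal s ρ) (eval-normal t ρ))
  (trans (swap-middle (const s) _ (const t) _)
    (cong (const s + const t +_)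
      (trans (sym (∑-distrib-+ (λ j → coeff s j * lookup ρ j) (λ j → coeff t j * lookup ρ j)))
        (sum-cong-≗ λ j → sym (*-distribʳ-+ (lookup ρ j) (coeff s j) (coeff t j))))))

-- Variables range over ℕ, so larger coefficients give a larger value under every valuation.
Dominated : ∀ {k} → Lin k → Lin k → Set
Dominated s t = const s ≤ const t × (∀ j → coeff s j ≤ coeff t j)

dominated? : ∀ {k} (s t : Lin k) → Dec (Dominated s t)
dominated? s t = (const s ≤? const t) ×-dec all? (λ j → coeff s j ≤? coeff t j)

dominated⇒≤ : ∀ {k} (s t : Lin k) → Dominated s t → ∀ ρ → ⟦ s ⟧ ρ ≤ ⟦ t ⟧ ρ
dominated⇒≤ s t (p , q) ρ = subst₂ _≤_ (sym (eval-normal s ρ)) (sym (eval-normal t ρ))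
  (+-mono-≤ p (sum-mono λ j → *-monoˡ-≤ (lookup ρ j) (q j)))

infix 5 _≼_

record Ineq (k : ℕ) : Set where
  constructor _≼_
  field lhs rhs : Lin k

Holds : ∀ {k} → Vec ℕ k → Ineq k → Set
Holds ρ (s ≼ t) = ⟦ s ⟧ ρ ≤ ⟦ t ⟧ ρ

lhss rhss : ∀ {k} → List (Ineq k) → Lin k
lhss [] = ♯ 0
lhss ((s ≼ t) ∷ hs) = s ⊕ lhss hs
rhss [] = ♯ 0
rhss ((s ≼ t) ∷ hs) = t ⊕ rhss hs

lhss≤rhss : ∀ {k} (ρ : Vec ℕ k) hs → AllL (Holds ρ) hs → ⟦ lhss hs ⟧ ρ ≤ ⟦ rhss hs ⟧ ρ
lhss≤rhss ρ [] [] = z≤n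
lhss≤rhss ρ (_ ∷ hs) (p ∷ ps) = +-mono-≤ p (lhss≤rhss ρ hs ps)

-- s ≤ t follows by adding up the hypotheses: it suffices that
-- s + Σ rhs is dominated by t + Σ lhs coefficientwise.
linear : ∀ {k} (ρ : Vec ℕ k) (hs : List (Ineq k)) (g : Ineq k) → AllL (Holds ρ) hs →
  {_ : True (dominated? (Ineq.lhs g ⊕ rhss hs) (Ineq.rhs g ⊕ lhss hs))} → Holds ρ g
linear ρ hs (s ≼ t) ps {w} = +-cancelʳ-≤ (⟦ lhss hs ⟧ ρ) (⟦ s ⟧ ρ) (⟦ t ⟧ ρ)
  (≤-trans (+-mono-≤ (≤-refl {⟦ s ⟧ ρ}) (lhss≤rhss ρ hs ps)) (dominated⇒≤ (s ⊕ rhss hs) (t ⊕ lhss hs) (toWitness w) ρ))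

-- Finite sets as Boolean predicates

FSet : ℕ → Set
FSet n = Fin n → Bool

ind : Bool → ℕ
ind true = 1
ind false = 0

opaque
  card : ∀ {n} → FSet n → ℕ
  card X = sum (λ v → ind (X v))

  card-sum : ∀ {n} (X : FSet n) → card X ≡ sum (λ v → ind (X v))
  card-sum X = refl

infix 4 _∊_ _∉_ _⊆_

_∊_ _∉_ : ∀ {n} → Fin n → FSet n → Set
v ∊ X = X v ≡ true
v ∉ X = X v ≡ false

_⊆_ : ∀ {n} → FSet n → FSet n → Set
X ⊆ Y = ∀ {v} → v ∊ X → v ∊ Y

true≢false : ∀ {b : Bool} → b ≡ true → b ≡ false → ⊥
true≢false refl ()

∊∉ : ∀ {n} {X : FSet n} {v} → v ∊ X → ¬ v ∉ X
∊∉ p q = true≢false p q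

∊? : ∀ {n} (X : FSet n) v → v ∊ X ⊎ v ∉ X
∊? X v with X v
... | true = inj₁ refl
... | false = inj₂ refl

¬∊⇒∉ : ∀ {b : Bool} → ¬ b ≡ true → b ≡ false
¬∊⇒∉ {true} h = ⊥-elim (h refl)
¬∊⇒∉ {false} h = refl

¬∉⇒∊ : ∀ {b : Bool} → ¬ b ≡ false → b ≡ true
¬∉⇒∊ {true} h = refl
¬∉⇒∊ {false} h = ⊥-elim (h refl)

decBool : (b : Bool) → Dec (b ≡ true)
decBool true = yes refl
decBool false = no λ ()

∨-elim : ∀ {a b} → a ∨ b ≡ true → a ≡ true ⊎ b ≡ true
∨-elim {true} p = inj₁ refl
∨-elim {false} p = inj₂ p

∨-introˡ : ∀ {a b} → a ≡ true → a ∨ b ≡ true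
∨-introˡ refl = refl

∨-introʳ : ∀ {a b} → b ≡ true → a ∨ b ≡ true
∨-introʳ {true} p = refl
∨-introʳ {false} p = p

∨-false : ∀ {a b} → a ≡ false → b ≡ false → a ∨ b ≡ false
∨-false refl refl = refl

∧-intro : ∀ {a b} → a ≡ true → b ≡ true → a ∧ b ≡ true
∧-intro refl refl = refl

∧-elimˡ : ∀ {a b} → a ∧ b ≡ true → a ≡ true
∧-elimˡ {true} p = refl

∧-elimʳ : ∀ {a b} → a ∧ b ≡ true → b ≡ true
∧-elimʳ {true} p = p

not-true : ∀ {a} → not a ≡ true → a ≡ false
not-true {false} p = refl

not-false : ∀ {a} → a ≡ false → not a ≡ true
not-false refl = refl

⌊⌋-intro : ∀ {P : Set} (d : Dec P) → P → ⌊ d ⌋ ≡ true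
⌊⌋-intro (yes _) p = refl
⌊⌋-intro (no q) p = ⊥-elim (q p)

⌊⌋-elim : ∀ {P : Set} (d : Dec P) → ⌊ d ⌋ ≡ true → P
⌊⌋-elim (yes p) e = p

⌊⌋-false : ∀ {P : Set} (d : Dec P) → ¬ P → ⌊ d ⌋ ≡ false
⌊⌋-false (yes p) q = ⊥-elim (q p)
⌊⌋-false (no _) q = refl

infixr 6 _∪_
infixr 7 _∩_

_∪_ _∩_ : ∀ {n} → FSet n → FSet n → FSet n
(X ∪ Y) v = X v ∨ Y v
(X ∩ Y) v = X v ∧ Y v

∁ : ∀ {n} → FSet n → FSet n
∁ X v = not (X v)

∅ : ∀ {n} → FSet n
∅ _ = false

opaque
  unfolding card

  ⁅_⁆ : ∀ {n} → Fin n → FSet n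
  ⁅ a ⁆ v = ⌊ v ≟ a ⌋

  ≡⇒∊⁅⁆ : ∀ {n} {a v : Fin n} → v ≡ a → v ∊ ⁅ a ⁆
  ≡⇒∊⁅⁆ {a = a} {v} = ⌊⌋-intro (v ≟ a)

  ∊⁅⁆⇒≡ : ∀ {n} {a v : Fin n} → v ∊ ⁅ a ⁆ → v ≡ a
  ∊⁅⁆⇒≡ {a = a} {v} = ⌊⌋-elim (v ≟ a)

  ≢⇒∉⁅⁆ : ∀ {n} {a v : Fin n} → v ≢ a → v ∉ ⁅ a ⁆
  ≢⇒∉⁅⁆ {a = a} {v} = ⌊⌋-false (v ≟ a)

  card-⁅⁆ : ∀ {n} (a : Fin n) → card ⁅ a ⁆ ≡ 1
  card-⁅⁆ a = trans (sum-cong-≗ λ v → pt v) (sum-select (λ _ → 1) a)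
    where
    pt : ∀ v → ind ⌊ v ≟ a ⌋ ≡ (if ⌊ a ≟ v ⌋ then 1 else 0) * 1
    pt v with v ≟ a | a ≟ v
    ... | yes _ | yes _ = refl
    ... | no _ | no _ = refl
    ... | yes p | no q = ⊥-elim (q (sym p))
    ... | no p | yes q = ⊥-elim (p (sym q))

insert delete : ∀ {n} → Fin n → FSet n → FSet n
insert a X = ⁅ a ⁆ ∪ X
delete a X = X ∩ ∁ ⁅ a ⁆

∊⁅⁆ : ∀ {n} (a : Fin n) → a ∊ ⁅ a ⁆
∊⁅⁆ a = ≡⇒∊⁅⁆ refl

insert-self : ∀ {n} (a : Fin n) (X : FSet n) → a ∊ insert a X
insert-self a X = ∨-introˡ {⁅ a ⁆ a} {X a} (∊⁅⁆ a)

insert-old : ∀ {n} (a : Fin n) (X : FSet n) → X ⊆ insert a X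
insert-old a X {v} = ∨-introʳ {⁅ a ⁆ v} {X v}

insert-elim : ∀ {n} {a v : Fin n} {X : FSet n} → v ∊ insert a X → v ≡ a ⊎ v ∊ X
insert-elim {a = a} {v} {X} p with ∨-elim {⁅ a ⁆ v} {X v} p
... | inj₁ q = inj₁ (∊⁅⁆⇒≡ q)
... | inj₂ q = inj₂ q

insert-∉ : ∀ {n} {a v : Fin n} {X : FSet n} → v ≢ a → v ∉ X → v ∉ insert a X
insert-∉ p q = ∨-false (≢⇒∉⁅⁆ p) q

delete-intro : ∀ {n} {a v : Fin n} {X : FSet n} → v ∊ X → v ≢ a → v ∊ delete a X
delete-intro p q = ∧-intro p (not-false (≢⇒∉⁅⁆ q))

delete-sub : ∀ {n} {a : Fin n} {X : FSet n} → delete a X ⊆ X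
delete-sub {a = a} {X} {v} p = ∧-elimˡ {X v} p

delete-≢ : ∀ {n} {a v : Fin n} {X : FSet n} → v ∊ delete a X → v ≢ a
delete-≢ {a = a} {X = X} p refl = true≢false (∊⁅⁆ a) (not-true (∧-elimʳ {X a} p))

delete-∉ : ∀ {n} {a : Fin n} {X : FSet n} → a ∉ delete a X
delete-∉ {a = a} {X} = ¬∊⇒∉ λ p → delete-≢ {X = X} p refl

find : ∀ {n} (X : FSet n) → (∃ λ v → v ∊ X) ⊎ (∀ v → v ∉ X)
find X with any? (λ v → decBool (X v))
... | yes p = inj₁ p
... | no ¬p = inj₂ λ v → ¬∊⇒∉ λ q → ¬p (v , q)

ind-mono : ∀ {a b} → (a ≡ true → b ≡ true) → ind a ≤ ind b
ind-mono {false} h = z≤n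
ind-mono {true} {b} h rewrite h refl = ≤-refl

opaque
  unfolding card

  card-mono : ∀ {n} {X Y : FSet n} → X ⊆ Y → card X ≤ card Y
  card-mono {X = X} {Y} h = sum-mono {f = λ v → ind (X v)} {λ v → ind (Y v)} λ v → ind-mono (h {v})

card-cong : ∀ {n} {X Y : FSet n} → X ⊆ Y → Y ⊆ X → card X ≡ card Y
card-cong {X = X} {Y} p q = ≤-antisym (card-mono {X = X} {Y} p) (card-mono {X = Y} {X} q)

opaque
  unfolding card

  card-∪-∩ : ∀ {n} (X Y : FSet n) → card (X ∪ Y) + card (X ∩ Y) ≡ card X + card Y
  card-∪-∩ X Y = trans (sym (∑-distrib-+ (λ v → ind (X v ∨ Y v)) (λ v → ind (X v ∧ Y v))))
    (trans (sum-cong-≗ λ v → pt (X v) (Y v)) (∑-distrib-+ (λ v → ind (X v)) (λ v → ind (Y v))))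
    where
    pt : ∀ a b → ind (a ∨ b) + ind (a ∧ b) ≡ ind a + ind b
    pt true true = refl
    pt true false = refl
    pt false true = refl
    pt false false = refl

  card-∅ : ∀ {n} {X : FSet n} → (∀ v → v ∉ X) → card X ≡ 0
  card-∅ h = sum-zero λ v → cong ind (h v)

card-disjoint-∪ : ∀ {n} (X Y : FSet n) → (∀ v → v ∊ X → v ∉ Y) → card (X ∪ Y) ≡ card X + card Y
card-disjoint-∪ X Y h = trans (sym (trans (cong (card (X ∪ Y) +_) (card-∅ empty)) (+-identityʳ _))) (card-∪-∩ X Y)
  where
  empty : ∀ v → v ∉ (X ∩ Y)
  empty v = ¬∊⇒∉ λ p → ∊∉ {X = Y} (∧-elimʳ {X v} p) (h v (∧-elimˡ p))

card-insert : ∀ {n} {a : Fin n} {X : FSet n} → a ∉ X → card (insert a X) ≡ suc (card X)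
card-insert {a = a} {X} p = trans (card-disjoint-∪ ⁅ a ⁆ X λ v q → subst (_∉ X) (sym (∊⁅⁆⇒≡ q)) p) (cong (_+ card X) (card-⁅⁆ a))

card-delete : ∀ {n} {a : Fin n} {X : FSet n} → a ∊ X → card X ≡ suc (card (delete a X))
card-delete {a = a} {X} p = trans (card-cong {X = X} {insert a (delete a X)} to from) (card-insert {a = a} {delete a X} (delete-∉ {a = a} {X}))
  where
  to : X ⊆ insert a (delete a X)
  to {v} q with v ≟ a
  ... | yes refl = insert-self a (delete a X)
  ... | no r = insert-old a (delete a X) (delete-intro {X = X} q r)
  from : insert a (delete a X) ⊆ X
  from {v} q with insert-elim {a = a} {X = delete a X} q
  ... | inj₁ refl = p
  ... | inj₂ r = delete-sub {a = a} {X} r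

opaque
  unfolding card

  card-partition : ∀ {n} (X Y : FSet n) → card (X ∩ Y) + card (X ∩ ∁ Y) ≡ card X
  card-partition X Y = trans (sym (∑-distrib-+ (λ v → ind (X v ∧ Y v)) (λ v → ind (X v ∧ not (Y v))))) (sum-cong-≗ λ v → pt (X v) (Y v))
    where
    pt : ∀ a b → ind (a ∧ b) + ind (a ∧ not b) ≡ ind a
    pt true true = refl
    pt true false = refl
    pt false true = refl
    pt false false = refl

card-pos : ∀ {n} {X : FSet n} {v} → v ∊ X → 1 ≤ card X
card-pos {X = X} {v} p = ≤-trans (≤-reflexive (sym (card-⁅⁆ v))) (card-mono {X = ⁅ v ⁆} {X} λ q → subst (_∊ X) (sym (∊⁅⁆⇒≡ q)) p)

card≤1 : ∀ {n} {X : FSet n} → (∀ u v → u ∊ X → v ∊ X → u ≡ v) → card X ≤ 1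
card≤1 {X = X} h with find X
... | inj₂ empty = ≤-trans (≤-reflexive (card-∅ empty)) z≤n
... | inj₁ (v , p) = ≤-trans (card-mono {X = X} {⁅ v ⁆} λ {u} q → ≡⇒∊⁅⁆ (h u v q p)) (≤-reflexive (card-⁅⁆ v))

card-pair : ∀ {n} {a b : Fin n} {X : FSet n} → a ≢ b → a ∊ X → b ∊ X → 2 ≤ card X
card-pair {a = a} {b} {X} ne p q = ≤-trans (s≤s (card-pos {X = delete a X} (delete-intro {X = X} q (ne ∘ sym)))) (≤-reflexive (sym (card-delete {X = X} p)))

card≡1⇒unique : ∀ {n} {X : FSet n} → card X ≤ 1 → ∀ {u v} → u ∊ X → v ∊ X → u ≡ v
card≡1⇒unique {X = X} h {u} {v} p q with u ≟ v
... | yes e = e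
... | no ne = ⊥-elim (<-irrefl refl (≤-trans (card-pair {X = X} ne p q) h))

-- A strict inequality at one index could not be made up for at another. This serves both for
-- bijections between finite sets and for the extremal count over vertices.
sum-tight : ∀ {n} {f g : Fin n → ℕ} → (∀ i → f i ≤ g i) → sum g ≤ sum f → ∀ i → g i ≤ f i
sum-tight {suc n} {f} {g} h p zero = +-cancelʳ-≤ (sum (f ∘ suc)) (g zero) (f zero) (≤-trans (+-mono-≤ (≤-refl {g zero}) (sum-mono (h ∘ suc))) p)
sum-tight {suc n} {f} {g} h p (suc i) = sum-tight (h ∘ suc) (+-cancelˡ-≤ (f zero) _ _ (≤-trans (+-mono-≤ (h zero) (≤-refl {sum (g ∘ suc)})) p)) i

module _ {m n : ℕ} (f : Fin m → Fin n) (X : FSet m) (Y : FSet n) where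

  Fibre : Fin n → FSet m
  Fibre y x = X x ∧ ⌊ f x ≟ y ⌋

  opaque
    unfolding card

    -- Double counting of the pairs formed by a point of `X` and its image.
    fibre-sum : card X ≡ sum (λ y → card (Fibre y))
    fibre-sum = trans (sum-cong-≗ λ x → sym (row x)) (∑-comm (λ x y → ind (Fibre y x)))
      where
      row : ∀ x → sum (λ y → ind (X x ∧ ⌊ f x ≟ y ⌋)) ≡ ind (X x)
      row x with X x
      ... | false = sum-zero {n} λ _ → refl
      ... | true = trans (card-cong {X = λ y → ⌊ f x ≟ y ⌋} {⁅ f x ⁆} (λ {y} p → ≡⇒∊⁅⁆ (sym (⌊⌋-elim (f x ≟ y) p))) (λ {y} p → ⌊⌋-intro (f x ≟ y) (sym (∊⁅⁆⇒≡ p)))) (card-⁅⁆ (f x))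

  module _ (into : ∀ {x} → x ∊ X → f x ∊ Y) (inj : ∀ {x x'} → x ∊ X → x' ∊ X → f x ≡ f x' → x ≡ x') where

    fibre≤ : ∀ y → card (Fibre y) ≤ ind (Y y)
    fibre≤ y with ∊? Y y
    ... | inj₁ p = subst (λ b → card (Fibre y) ≤ ind b) (sym p) (card≤1 {X = Fibre y} λ u v q r → inj (∧-elimˡ q) (∧-elimˡ r) (trans (⌊⌋-elim (f u ≟ y) (∧-elimʳ {X u} q)) (sym (⌊⌋-elim (f v ≟ y) (∧-elimʳ {X v} r)))))
    ... | inj₂ p = subst (λ b → card (Fibre y) ≤ ind b) (sym p) (≤-reflexive (card-∅ {X = Fibre y} λ v → ¬∊⇒∉ λ q → ∊∉ {X = Y} (subst (_∊ Y) (⌊⌋-elim (f v ≟ y) (∧-elimʳ {X v} q)) (into (∧-elimˡ q))) p))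

    card-injection : card X ≤ card Y
    card-injection = ≤-trans (≤-reflexive fibre-sum) (≤-trans (sum-mono fibre≤) (≤-reflexive (sym (card-sum Y))))

    -- An empty fibre over a point of `Y` would be slack in the fibre count, which `sum-tight`
    -- forbids.
    card-surjection : card Y ≤ card X → ∀ {y} → y ∊ Y → ∃ λ x → x ∊ X × f x ≡ y
    card-surjection le {y} p with find (Fibre y)
    ... | inj₁ (x , q) = x , ∧-elimˡ q , ⌊⌋-elim (f x ≟ y) (∧-elimʳ {X x} q)
    ... | inj₂ empty = ⊥-elim (<-irrefl refl (≤-trans (subst (λ b → 1 ≤ ind b) (sym p) ≤-refl) (≤-trans (sum-tight fibre≤ (≤-trans (≤-reflexive (sym (card-sum Y))) (≤-trans le (≤-reflexive fibre-sum))) y) (≤-reflexive (card-∅ {X = Fibre y} empty)))))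

-- Neighbourhoods

opaque
  Nbr : ∀ {n} → (Fin n → Fin n → Bool) → FSet n → FSet n
  Nbr E X v = ⌊ any? (λ u → decBool (X u ∧ E u v)) ⌋

  Nbr-intro : ∀ {n} (E : Fin n → Fin n → Bool) {X : FSet n} {u v} → u ∊ X → E u v ≡ true → v ∊ Nbr E X
  Nbr-intro E {X} {u} {v} p q = ⌊⌋-intro (any? λ u → decBool (X u ∧ E u v)) (u , ∧-intro p q)

  Nbr-elim : ∀ {n} (E : Fin n → Fin n → Bool) {X : FSet n} {v} → v ∊ Nbr E X → ∃ λ u → u ∊ X × E u v ≡ true
  Nbr-elim E {X} {v} p with ⌊⌋-elim (any? λ u → decBool (X u ∧ E u v)) p
  ... | u , q = u , ∧-elimˡ q , ∧-elimʳ {X u} q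

module _ {n : ℕ} (E : Fin n → Fin n → Bool) where

  Nbr-∉ : ∀ {X : FSet n} {v} → (∀ u → u ∊ X → E u v ≡ true → ⊥) → v ∉ Nbr E X
  Nbr-∉ {X} h = ¬∊⇒∉ λ p → case Nbr-elim E {X} p of λ { (u , q , r) → h u q r }

  Nbr-mono : ∀ {X Y : FSet n} → X ⊆ Y → Nbr E X ⊆ Nbr E Y
  Nbr-mono {X} {Y} h p with Nbr-elim E {X} p
  ... | u , q , r = Nbr-intro E {Y} (h q) r

  Nbr-∪ : ∀ {X Y : FSet n} → Nbr E (X ∪ Y) ⊆ Nbr E X ∪ Nbr E Y
  Nbr-∪ {X} {Y} {v} p with Nbr-elim E {X ∪ Y} p
  ... | u , q , r with ∨-elim {X u} {Y u} q
  ... | inj₁ s = ∨-introˡ (Nbr-intro E {X} s r)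
  ... | inj₂ s = ∨-introʳ {Nbr E X v} (Nbr-intro E {Y} s r)

  -- Submodularity, with S standing for anything seen from both sides.
  uncross : ∀ {X Y S : FSet n} → S ⊆ Nbr E X → S ⊆ Nbr E Y → card S + card (Nbr E (X ∪ Y)) ≤ card (Nbr E X) + card (Nbr E Y)
  uncross {X} {Y} {S} p q = linear (card S ∷ card (Nbr E (X ∪ Y)) ∷ card (Nbr E X ∪ Nbr E Y) ∷ card (Nbr E X ∩ Nbr E Y) ∷ card (Nbr E X) ∷ card (Nbr E Y) ∷ [])
    ((′ # 0 ≼ ′ # 3) ∷ (′ # 1 ≼ ′ # 2) ∷ (′ # 2 ⊕ ′ # 3 ≼ ′ # 4 ⊕ ′ # 5) ∷ []) (′ # 0 ⊕ ′ # 1 ≼ ′ # 4 ⊕ ′ # 5)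
    (card-mono {X = S} {Nbr E X ∩ Nbr E Y} (λ r → ∧-intro (p r) (q r)) ∷ card-mono {X = Nbr E (X ∪ Y)} {Nbr E X ∪ Nbr E Y} (Nbr-∪ {X} {Y}) ∷ ≤-reflexive (card-∪-∩ (Nbr E X) (Nbr E Y)) ∷ [])

-- Hall's theorem

Rel : ℕ → Set
Rel n = Fin n → Fin n → Bool

opaque
  without : ∀ {n} → Rel n → Fin n → Fin n → Rel n
  without D a b u v = D u v ∧ not (⌊ u ≟ a ⌋ ∧ ⌊ v ≟ b ⌋)

  without-sub : ∀ {n} {D : Rel n} {a b u v} → without D a b u v ≡ true → D u v ≡ true
  without-sub {D = D} {a} {b} {u} {v} p = ∧-elimˡ {D u v} p

  without-≢ : ∀ {n} {D : Rel n} {a b u v} → without D a b u v ≡ true → ¬ (u ≡ a × v ≡ b)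
  without-≢ {D = D} {a} {b} p (refl , refl) = true≢false (∧-intro (⌊⌋-intro (a ≟ a) refl) (⌊⌋-intro (b ≟ b) refl)) (not-true (∧-elimʳ {D a b} p))

  without-intro : ∀ {n} {D : Rel n} {a b u v} → D u v ≡ true → ¬ (u ≡ a × v ≡ b) → without D a b u v ≡ true
  without-intro {D = D} {a} {b} {u} {v} p q = ∧-intro p (not-false (¬∊⇒∉ λ r → q (⌊⌋-elim (u ≟ a) (∧-elimˡ {⌊ u ≟ a ⌋} r) , ⌊⌋-elim (v ≟ b) (∧-elimʳ {⌊ u ≟ a ⌋} r))))

module _ {n : ℕ} where

  -- Only `P` is saturated. Outside `P` the values of `mate` are arbitrary, which keeps it a total
  -- function.
  record Matching (D : Rel n) (P : FSet n) : Set where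
    field
      mate : Fin n → Fin n
      edge : ∀ {x} → x ∊ P → D x (mate x) ≡ true
      inj  : ∀ {x x'} → x ∊ P → x' ∊ P → mate x ≡ mate x' → x ≡ x'

  HallCondition : Rel n → FSet n → Set
  HallCondition D P = ∀ X → X ⊆ P → card X ≤ card (Nbr D X)

  Violator : Rel n → FSet n → Set
  Violator D P = ∃ λ X → X ⊆ P × card (Nbr D X) < card X

  violator? : ∀ D P → Violator D P ⊎ HallCondition D P
  violator? D P with anySubset? (λ (S : Subset n) → all? (λ v → decBool (lookup S v) →-dec decBool (P v)) ×-dec (card (Nbr D (lookup S)) <? card (lookup S)))
  ... | yes (S , sub , lt) = inj₁ (lookup S , (λ {v} → sub v) , lt)
  ... | no none = inj₂ holds
    where
    holds : HallCondition D P
    holds X sub with card (Nbr D X) <? card X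
    ... | no nlt = ≮⇒≥ nlt
    ... | yes lt = ⊥-elim (none (tabulate X , (λ v p → sub (to p)) , ≤-trans (s≤s (card-mono {X = Nbr D X'} {Nbr D X} (Nbr-mono D {X'} {X} to))) (≤-trans lt (card-mono {X = X} {X'} from))))
      where
      X' = lookup (tabulate X)
      to : X' ⊆ X
      to {v} p = trans (sym (lookup∘tabulate X v)) p
      from : X ⊆ X'
      from {v} p = trans (lookup∘tabulate X v) p

  weight : Rel n → ℕ
  weight D = sum (λ x → card (D x))

  sum-strict : ∀ {k} {f g : Fin k → ℕ} → (∀ i → f i ≤ g i) → ∀ i → f i < g i → sum f < sum g
  sum-strict {f = f} {g} h i lt with sum g ≤? sum f
  ... | yes le = ⊥-elim (<-irrefl refl (≤-trans lt (sum-tight h le i)))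
  ... | no nle = ≰⇒> nle

  weight-without : ∀ {D : Rel n} {x y} → D x y ≡ true → weight (without D x y) < weight D
  weight-without {D} {x} {y} p = sum-strict (λ u → card-mono {X = without D x y u} {D u} λ {v} → without-sub {D = D} {x} {y} {u} {v}) x
    (≤-trans (s≤s (card-mono {X = without D x y x} {delete y (D x)} λ {v} q → delete-intro {X = D x} (without-sub {D = D} {x} {y} {x} {v} q) λ e → without-≢ {D = D} q (refl , e)))
      (≤-reflexive (sym (card-delete {X = D x} p))))

  -- If deleting either of two edges at x violates Hall's condition, uncrossing the two violators gives a violator already for D.
  keep-one : ∀ {D P x y y'} → HallCondition D P → y ≢ y' → Violator (without D x y) P → Violator (without D x y') P → ⊥
  keep-one {D} {P} {x} {y} {y'} hc ne (X₁ , sub₁ , lt₁) (X₂ , sub₂ , lt₂) = <-irrefl refl total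
    where
    N₁ = Nbr (without D x y) X₁
    N₂ = Nbr (without D x y') X₂
    contains : ∀ {X z} → X ⊆ P → card (Nbr (without D x z) X) < card X → x ∊ X
    contains {X} {z} sub lt = ¬∉⇒∊ λ x∉ → <-irrefl refl (≤-trans lt (≤-trans (hc X sub) (card-mono {X = Nbr D X} {Nbr (without D x z) X} λ p → case Nbr-elim D {X} p of λ { (u , q , r) → Nbr-intro (without D x z) {X} q (without-intro {D = D} r λ { (refl , _) → ∊∉ {X = X} q x∉ }) })))
    x∊₁ = contains {X₁} {y} sub₁ lt₁
    x∊₂ = contains {X₂} {y'} sub₂ lt₂
    W = delete x (X₁ ∩ X₂)
    union : Nbr D (X₁ ∪ X₂) ⊆ N₁ ∪ N₂
    union {v} p with Nbr-elim D {X₁ ∪ X₂} p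
    ... | u , q , r with u ≟ x | v ≟ y
    -- The pair of `x` and `y` is missing from the first relation only; as `y ≢ y'`, the second one
    -- still has it.
    ... | yes refl | yes refl = ∨-introʳ {N₁ y} (Nbr-intro (without D x y') {X₂} x∊₂ (without-intro {D = D} r λ e → ne (proj₂ e)))
    ... | yes refl | no v≢y = ∨-introˡ (Nbr-intro (without D x y) {X₁} x∊₁ (without-intro {D = D} r λ e → v≢y (proj₂ e)))
    ... | no u≢x | _ with ∨-elim {X₁ u} q
    ... | inj₁ s = ∨-introˡ (Nbr-intro (without D x y) {X₁} s (without-intro {D = D} r λ e → u≢x (proj₁ e)))
    ... | inj₂ s = ∨-introʳ {N₁ v} (Nbr-intro (without D x y') {X₂} s (without-intro {D = D} r λ e → u≢x (proj₁ e)))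
    inter : Nbr D W ⊆ N₁ ∩ N₂
    inter {v} p with Nbr-elim D {W} p
    ... | u , q , r = ∧-intro (Nbr-intro (without D x y) {X₁} (∧-elimˡ {X₁ u} u∊) (without-intro {D = D} r λ e → u≢x (proj₁ e)))
                              (Nbr-intro (without D x y') {X₂} (∧-elimʳ {X₁ u} u∊) (without-intro {D = D} r λ e → u≢x (proj₁ e)))
      where
      u∊ = delete-sub {a = x} {X₁ ∩ X₂} q
      u≢x = delete-≢ {X = X₁ ∩ X₂} q
    total : suc (card X₁ + card X₂) ≤ card X₁ + card X₂
    -- On the intersection without `x` both relations agree with `D`. Taking out `x` costs one
    -- element, while the two violations are worth two.
    total = linear (card X₁ ∷ card X₂ ∷ card N₁ ∷ card N₂ ∷ card (N₁ ∪ N₂) ∷ card (N₁ ∩ N₂) ∷ card (Nbr D (X₁ ∪ X₂)) ∷ card (Nbr D W) ∷ card (X₁ ∪ X₂) ∷ card (X₁ ∩ X₂) ∷ card W ∷ [])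
      ((♯ 1 ⊕ ′ # 2 ≼ ′ # 0) ∷ (♯ 1 ⊕ ′ # 3 ≼ ′ # 1) ∷ (′ # 4 ⊕ ′ # 5 ≼ ′ # 2 ⊕ ′ # 3) ∷ (′ # 6 ≼ ′ # 4) ∷ (′ # 7 ≼ ′ # 5) ∷ (′ # 8 ≼ ′ # 6) ∷ (′ # 10 ≼ ′ # 7) ∷ (′ # 0 ⊕ ′ # 1 ≼ ′ # 8 ⊕ ′ # 9) ∷ (′ # 9 ≼ ♯ 1 ⊕ ′ # 10) ∷ [])
      (♯ 1 ⊕ (′ # 0 ⊕ ′ # 1) ≼ ′ # 0 ⊕ ′ # 1)
      (lt₁ ∷ lt₂ ∷ ≤-reflexive (card-∪-∩ N₁ N₂) ∷ card-mono {X = Nbr D (X₁ ∪ X₂)} {N₁ ∪ N₂} union ∷ card-mono {X = Nbr D W} {N₁ ∩ N₂} inter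
       ∷ hc (X₁ ∪ X₂) (λ {v} p → case ∨-elim {X₁ v} p of λ { (inj₁ q) → sub₁ q ; (inj₂ q) → sub₂ q })
       ∷ hc W (λ {v} p → sub₁ (∧-elimˡ {X₁ v} (delete-sub {a = x} {X₁ ∩ X₂} p)))
       ∷ ≤-reflexive (sym (card-∪-∩ X₁ X₂)) ∷ ≤-reflexive (card-delete {X = X₁ ∩ X₂} (∧-intro x∊₁ x∊₂)) ∷ [])

  weaken : ∀ {D P a b} → Matching (without D a b) P → Matching D P
  weaken {D} {P} {a} {b} M = record { mate = mate ; edge = λ p → without-sub {D = D} {a} {b} (edge p) ; inj = inj }
    where open Matching M

  -- With at most one neighbour per vertex, Hall's condition on singletons gives existence, and on
  -- pairs it gives injectivity.
  hall-functional : ∀ {D P} → HallCondition D P → (∀ x y y' → x ∊ P → D x y ≡ true → D x y' ≡ true → y ≡ y') → Matching D P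
  hall-functional {D} {P} hc fun = record { mate = mate ; edge = edge ; inj = inj }
    where
    pick : ∀ x → (∃ λ y → y ∊ D x) ⊎ (∀ y → y ∉ D x) → Fin n
    pick x (inj₁ (y , _)) = y
    pick x (inj₂ _) = x
    mate : Fin n → Fin n
    mate x = pick x (find (D x))
    edge : ∀ {x} → x ∊ P → D x (mate x) ≡ true
    edge {x} p with find (D x)
    ... | inj₁ (y , q) = q
    ... | inj₂ none = ⊥-elim (<-irrefl refl (≤-trans (≤-reflexive (sym (card-⁅⁆ x))) (≤-trans (hc ⁅ x ⁆ λ q → subst (_∊ P) (sym (∊⁅⁆⇒≡ q)) p)
        (≤-reflexive (card-∅ {X = Nbr D ⁅ x ⁆} λ y → Nbr-∉ D {⁅ x ⁆} λ u q r → ∊∉ {X = D x} (subst (λ w → D w y ≡ true) (∊⁅⁆⇒≡ q) r) (none y))))))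
    inj : ∀ {x x'} → x ∊ P → x' ∊ P → mate x ≡ mate x' → x ≡ x'
    inj {x} {x'} p p' e with x ≟ x'
    ... | yes q = q
    ... | no ne = ⊥-elim (<-irrefl refl (≤-trans (card-pair {X = Z} ne (insert-self x ⁅ x' ⁆) (insert-old x ⁅ x' ⁆ (∊⁅⁆ x')))
        (≤-trans (hc Z (λ q → case insert-elim {a = x} {X = ⁅ x' ⁆} q of λ { (inj₁ refl) → p ; (inj₂ r) → subst (_∊ P) (sym (∊⁅⁆⇒≡ r)) p' }))
          (≤-trans (card-mono {X = Nbr D Z} {⁅ mate x ⁆} small) (≤-reflexive (card-⁅⁆ (mate x)))))))
      where
      Z = insert x ⁅ x' ⁆
      small : Nbr D Z ⊆ ⁅ mate x ⁆
      small {v} q with Nbr-elim D {Z} q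
      ... | u , r , s with insert-elim {a = x} {X = ⁅ x' ⁆} r
      ... | inj₁ refl = ≡⇒∊⁅⁆ (fun x v (mate x) p s (edge p))
      ... | inj₂ t with ∊⁅⁆⇒≡ t
      ... | refl = ≡⇒∊⁅⁆ (trans (fun x' v (mate x') p' s (edge p')) (sym e))

  -- Induction on the number of pairs: while some `x` has two neighbours, `keep-one` allows one of
  -- these pairs to be deleted, until the relation is functional.
  hall : ∀ k {D P} → weight D < k → HallCondition D P → Matching D P
  hall (suc k) {D} {P} (s≤s le) hc with any? (λ x → any? (λ y → any? (λ y' → decBool (P x) ×-dec decBool (D x y) ×-dec decBool (D x y') ×-dec ¬? (y ≟ y'))))
  ... | no none = hall-functional hc fun
    where
    fun : ∀ x y y' → x ∊ P → D x y ≡ true → D x y' ≡ true → y ≡ y'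
    fun x y y' p q r with y ≟ y'
    ... | yes e = e
    ... | no ne = ⊥-elim (none (x , y , y' , p , q , r , ne))
  ... | yes (x , y , y' , p , q , r , ne) with violator? (without D x y) P | violator? (without D x y') P
  ... | inj₂ h | _ = weaken {D} (hall k (≤-trans (weight-without {D} q) le) h)
  ... | inj₁ _ | inj₂ h = weaken {D} (hall k (≤-trans (weight-without {D} r) le) h)
  ... | inj₁ v | inj₁ v' = ⊥-elim (keep-one hc ne v v')

  opaque
    hall? : ∀ D P → Matching D P ⊎ Violator D P
    hall? D P with violator? D P
    ... | inj₁ v = inj₂ v
    ... | inj₂ h = inj₁ (hall _ ≤-refl h)

-- Near-bipartite structures

card-delete-≤ : ∀ {n} (a : Fin n) (X : FSet n) → card X ≤ suc (card (delete a X))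
card-delete-≤ a X with ∊? X a
... | inj₁ p = ≤-reflexive (card-delete {X = X} p)
... | inj₂ p = ≤-trans (card-mono {X = X} {delete a X} λ q → delete-intro {X = X} q λ { refl → ∊∉ {X = X} q p }) (n≤1+n _)

card-nonempty : ∀ {n} (X : FSet n) → 1 ≤ card X → ∃ λ v → v ∊ X
card-nonempty X h with find X
... | inj₁ p = p
... | inj₂ e = ⊥-elim (<-irrefl refl (≤-trans h (≤-reflexive (card-∅ {X = X} e))))

opaque
  into : ∀ {n} → Rel n → FSet n → Rel n
  into D Q u v = D u v ∧ Q v

  into-intro : ∀ {n} {D : Rel n} {Q u v} → D u v ≡ true → v ∊ Q → into D Q u v ≡ true
  into-intro = ∧-intro

  into-edge : ∀ {n} {D : Rel n} {Q u v} → into D Q u v ≡ true → D u v ≡ true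
  into-edge {D = D} {Q} {u} {v} p = ∧-elimˡ {D u v} p

  into-∊ : ∀ {n} {D : Rel n} {Q u v} → into D Q u v ≡ true → v ∊ Q
  into-∊ {D = D} {Q} {u} {v} p = ∧-elimʳ {D u v} p

module _ {n : ℕ} {D : Rel n} {P : FSet n} {x y : Fin n} where

  extend : D x y ≡ true → Matching (into D (∁ ⁅ y ⁆)) (delete x P) → Σ (Matching D P) λ M → Matching.mate M x ≡ y
  extend Dxy M = record { mate = mate' ; edge = edge' ; inj = inj' } , mate'-x
    where
    open Matching M
    mate' : Fin n → Fin n
    mate' u = if ⌊ u ≟ x ⌋ then y else mate u
    mate'-x : mate' x ≡ y
    mate'-x rewrite ⌊⌋-intro (x ≟ x) refl = refl
    mate'-old : ∀ {u} → u ≢ x → mate' u ≡ mate u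
    mate'-old {u} ne rewrite ⌊⌋-false (u ≟ x) ne = refl
    misses : ∀ {u} → u ∊ P → u ≢ x → mate' u ≢ y
    misses {u} p ne e = true≢false (∊⁅⁆ y) (subst (λ w → ⁅ y ⁆ w ≡ false) (trans (sym (mate'-old ne)) e) (not-true (into-∊ {D = D} {∁ ⁅ y ⁆} (edge (delete-intro {X = P} p ne)))))
    edge' : ∀ {u} → u ∊ P → D u (mate' u) ≡ true
    edge' {u} p with u ≟ x
    ... | yes refl = Dxy
    ... | no ne = into-edge {D = D} {∁ ⁅ y ⁆} (edge (delete-intro {X = P} p ne))
    inj' : ∀ {u v} → u ∊ P → v ∊ P → mate' u ≡ mate' v → u ≡ v
    inj' {u} {v} p q e = case (u ≟ x) of λ where
      (yes refl) → case (v ≟ x) of λ where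
        (yes refl) → refl
        (no ne) → ⊥-elim (misses q ne (trans (sym e) mate'-x))
      (no ne) → case (v ≟ x) of λ where
        (yes refl) → ⊥-elim (misses p ne (trans e mate'-x))
        (no ne') → inj (delete-intro {X = P} p ne) (delete-intro {X = P} q ne') (trans (sym (mate'-old ne)) (trans e (mate'-old ne')))

  -- Hall's theorem with `x` removed from the sources and `y` from the targets: the violator is a
  -- set whose neighbourhood becomes too small once `y` is reserved for `x`.
  unextendable : D x y ≡ true → ¬ (Σ (Matching D P) λ M → Matching.mate M x ≡ y) →
    ∃ λ Z → Z ⊆ P × x ∉ Z × card (delete y (Nbr D Z)) < card Z
  unextendable Dxy none with hall? (into D (∁ ⁅ y ⁆)) (delete x P)
  ... | inj₁ M = ⊥-elim (none (extend Dxy M))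
  ... | inj₂ (Z , sub , lt) = Z , (λ p → delete-sub {a = x} {P} (sub p)) , ¬∊⇒∉ (λ p → delete-≢ {X = P} (sub p) refl) ,
      ≤-trans (s≤s (card-mono {X = delete y (Nbr D Z)} {Nbr (into D (∁ ⁅ y ⁆)) Z} shrink)) lt
    where
    shrink : delete y (Nbr D Z) ⊆ Nbr (into D (∁ ⁅ y ⁆)) Z
    shrink {v} p with Nbr-elim D {Z} (delete-sub {a = y} {Nbr D Z} p)
    ... | u , q , r = Nbr-intro (into D (∁ ⁅ y ⁆)) {Z} q (into-intro {D = D} r (not-false (≢⇒∉⁅⁆ (delete-≢ {X = Nbr D Z} p))))

opaque
  Col : ∀ {n} → (Fin n → Bool) → Bool → FSet n
  Col c true v = c v
  Col c false v = not (c v)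

  Col-intro : ∀ {n} {c : Fin n → Bool} {s v} → c v ≡ s → v ∊ Col c s
  Col-intro {s = true} p = p
  Col-intro {s = false} p = not-false p

  Col-elim : ∀ {n} {c : Fin n → Bool} {s v} → v ∊ Col c s → c v ≡ s
  Col-elim {s = true} p = p
  Col-elim {s = false} p = not-true p

not≢ : ∀ {s : Bool} → s ≡ not s → ⊥
not≢ {true} ()
not≢ {false} ()

bool-split : ∀ {i j : Bool} → i ≢ j → ∀ k → k ≡ i ⊎ k ≡ j
bool-split {true} {true} ne k = ⊥-elim (ne refl)
bool-split {false} {false} ne k = ⊥-elim (ne refl)
bool-split {true} {false} ne true = inj₁ refl
bool-split {true} {false} ne false = inj₂ refl
bool-split {false} {true} ne true = inj₂ refl
bool-split {false} {true} ne false = inj₁ refl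

-- H = G - {e₁, e₂} with colour classes Col c true and Col c false; sp s i are the ends of the
-- deleted edge inside class s, and μ is a perfect matching of G through both deleted edges.
-- The field brick says that otherwise X ∪ N(X) would be the shore of a nontrivial tight cut.
record NearBip (n : ℕ) : Set where
  field
    E        : Rel n
    c        : Fin n → Bool
    E-sym    : ∀ {u v} → E u v ≡ true → E v u ≡ true
    E-col    : ∀ {u v} → E u v ≡ true → c v ≡ not (c u)
    sp       : Bool → Bool → Fin n
    sp-col   : ∀ s i → c (sp s i) ≡ s
    sp-dist  : ∀ s → sp s true ≢ sp s false
    μ        : Fin n → Fin n
    μμ       : ∀ v → μ (μ v) ≡ v
    μ-sp     : ∀ s i → μ (sp s i) ≡ sp s (not i)
    μ-E      : ∀ v → (∀ i → v ≢ sp (c v) i) → E v (μ v) ≡ true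
    balanced : ∀ s → card (Col c s) ≡ card (Col c (not s))
    third    : ∀ s → ∃ λ v → c v ≡ s × (∀ i → v ≢ sp s i)
    expand   : ∀ s X {x u} → (∀ {v} → v ∊ X → c v ≡ s) → x ∊ X → u ∉ X → c u ≡ s → card X < card (Nbr E X)
    brick    : ∀ s X {x u v} → (∀ {v} → v ∊ X → c v ≡ s) → x ∊ X → u ∉ X → c u ≡ s → v ∉ X → c v ≡ s → u ≢ v →
               card (Nbr E X) ≤ suc (card X) → (∃ λ i → sp s i ∊ X) × ¬ (∀ i → sp (not s) i ∊ Nbr E X)

module NearBipTheory {n : ℕ} (B : NearBip n) where

  open NearBip B public

  N : FSet n → FSet n
  N = Nbr E

  N-in : ∀ {X u v} → u ∊ X → E u v ≡ true → v ∊ N X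
  N-in {X} = Nbr-intro E {X}

  N-out : ∀ {X v} → v ∊ N X → ∃ λ u → u ∊ X × E u v ≡ true
  N-out {X} = Nbr-elim E {X}

  Normal : Fin n → Set
  Normal v = ∀ i → v ≢ sp (c v) i

  sp-dist' : ∀ s i → sp s i ≢ sp s (not i)
  sp-dist' s true = sp-dist s
  sp-dist' s false = sp-dist s ∘ sym

  -- Supplies a second vertex of the same colour, so that `expand` applies to singletons.
  other-special : ∀ v → ∃ λ u → u ≢ v × c u ≡ c v
  other-special v with sp (c v) true ≟ v
  ... | no ne = sp (c v) true , ne , sp-col (c v) true
  ... | yes e = sp (c v) false , (λ e' → sp-dist (c v) (trans e (sym e'))) , sp-col (c v) false

  has-neighbour : ∀ v → ∃ λ u → E v u ≡ true
  has-neighbour v with other-special v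
  ... | w , ne , cw with card-nonempty (N ⁅ v ⁆) (≤-trans (s≤s z≤n) (expand (c v) ⁅ v ⁆ (λ p → cong c (∊⁅⁆⇒≡ p)) (∊⁅⁆ v) (≢⇒∉⁅⁆ ne) cw))
  ... | u , p with N-out {⁅ v ⁆} p
  ... | v' , q , r = u , subst (λ w → E w u ≡ true) (∊⁅⁆⇒≡ q) r

  -- With fewer neighbours, `brick` applies to the singleton, the two special vertices of its colour
  -- being outside, and would place a special vertex in it.
  normal-degree : ∀ v → Normal v → 3 ≤ card (N ⁅ v ⁆)
  normal-degree v nv with 3 ≤? card (N ⁅ v ⁆)
  ... | yes p = p
  ... | no p with brick (c v) ⁅ v ⁆ (λ p → cong c (∊⁅⁆⇒≡ p)) (∊⁅⁆ v) (≢⇒∉⁅⁆ (nv true ∘ sym)) (sp-col (c v) true) (≢⇒∉⁅⁆ (nv false ∘ sym)) (sp-col (c v) false) (sp-dist (c v))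
                (≤-trans (s≤s⁻¹ (≰⇒> p)) (≤-reflexive (cong suc (sym (card-⁅⁆ v)))))
  ... | (i , q) , _ = ⊥-elim (nv i (sym (∊⁅⁆⇒≡ q)))

  μ-normal : ∀ v → Normal v → Normal (μ v)
  μ-normal v nv i e = not≢ {c v} (trans (sym col≡) (E-col (μ-E v nv)))
    where
    v≡ : v ≡ sp (c (μ v)) (not i)
    v≡ = trans (sym (μμ v)) (trans (cong μ e) (μ-sp _ i))
    col≡ : c (μ v) ≡ c v
    col≡ = sym (trans (cong c v≡) (sp-col _ _))

-- The two types of obstacle to removability

module Side {n : ℕ} (B : NearBip n) (s : Bool) where

  open NearBipTheory B

  t : Bool
  t = not s

  E-to-t : ∀ {u v} → E u v ≡ true → c u ≡ s → c v ≡ t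
  E-to-t e p = trans (E-col e) (cong not p)

  E-to-s : ∀ {u v} → E u v ≡ true → c u ≡ t → c v ≡ s
  E-to-s e p = trans (E-col e) (trans (cong not p) (not-involutive s))

  N-t : ∀ {X} → (∀ {v} → v ∊ X → c v ≡ s) → ∀ {v} → v ∊ N X → c v ≡ t
  N-t {X} h p with N-out {X} p
  ... | u , q , r = E-to-t r (h q)

  -- A perfect matching of `G` through both deleted edges consists of these edges and a perfect
  -- matching between `Plain` and `PlainT`.
  Plain : FSet n
  Plain v = Col c s v ∧ not (⁅ sp s true ⁆ v ∨ ⁅ sp s false ⁆ v)

  PlainT : FSet n
  PlainT v = Col c t v ∧ not (⁅ sp t true ⁆ v ∨ ⁅ sp t false ⁆ v)

  plain-intro : ∀ {r v} → c v ≡ r → (∀ i → v ≢ sp r i) → (Col c r v ∧ not (⁅ sp r true ⁆ v ∨ ⁅ sp r false ⁆ v)) ≡ true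
  plain-intro p q = ∧-intro (Col-intro p) (not-false (∨-false (≢⇒∉⁅⁆ (q true)) (≢⇒∉⁅⁆ (q false))))

  plain-col : ∀ {r v} → (Col c r v ∧ not (⁅ sp r true ⁆ v ∨ ⁅ sp r false ⁆ v)) ≡ true → c v ≡ r
  plain-col {r} {v} p = Col-elim (∧-elimˡ {Col c r v} p)

  plain-≢ : ∀ {r v} → (Col c r v ∧ not (⁅ sp r true ⁆ v ∨ ⁅ sp r false ⁆ v)) ≡ true → ∀ i → v ≢ sp r i
  plain-≢ {r} {v} p true refl = true≢false (∨-introˡ (∊⁅⁆ v)) (not-true (∧-elimʳ {Col c r v} p))
  plain-≢ {r} {v} p false refl = true≢false (∨-introʳ {⁅ sp r true ⁆ v} (∊⁅⁆ v)) (not-true (∧-elimʳ {Col c r v} p))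

  Eβ : Rel n
  Eβ = into E PlainT

  record Shore (X : FSet n) : Set where
    field
      col : ∀ {v} → v ∊ X → c v ≡ s
      plain : ∀ {v} → v ∊ X → ∀ i → v ≢ sp s i

    plain-∉ : ∀ i → sp s i ∉ X
    plain-∉ i = ¬∊⇒∉ λ p → plain p i refl

    normal : ∀ {v} → v ∊ X → Normal v
    normal p i = subst (λ r → _ ≢ sp r i) (sym (col p)) (plain p i)

  open Shore

  -- A smaller neighbourhood would let `brick` find a special vertex inside the shore; the two
  -- special vertices of the class are the two outside vertices that it asks for.
  shore-lower : ∀ {X x} → Shore X → x ∊ X → suc (suc (card X)) ≤ card (N X)
  shore-lower {X} S p with suc (suc (card X)) ≤? card (N X)
  ... | yes q = q
  ... | no q with brick s X (col S) p (plain-∉ S true) (sp-col s true) (plain-∉ S false) (sp-col s false) (sp-dist s) (s≤s⁻¹ (≰⇒> q))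
  ... | (i , r) , _ = ⊥-elim (plain S r i refl)

  μ-plainT : ∀ {v} → c v ≡ s → (∀ i → v ≢ sp s i) → μ v ∊ PlainT
  μ-plainT {v} p q = plain-intro cμ λ i e → μ-normal v nv i (trans e (cong (λ r → sp r i) (sym cμ)))
    where
    nv : Normal v
    nv i = subst (λ r → v ≢ sp r i) (sym p) (q i)
    cμ : c (μ v) ≡ t
    cμ = E-to-t (μ-E v nv) p

  -- Closure under alternating paths for `μ`: out along an edge to a nonspecial vertex, back along
  -- the matching.
  ClosedUnder : Rel n → FSet n → Set
  ClosedUnder D Z = ∀ {z v} → z ∊ Z → D z v ≡ true → (∀ i → v ≢ sp t i) → μ v ∊ Z

  μ-inj : ∀ {u v} → μ u ≡ μ v → u ≡ v
  μ-inj {u} {v} e = trans (sym (μμ u)) (trans (cong μ e) (μμ v))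

  -- The injection `μ` sends the nonspecial neighbours into `Z`, and at most two neighbours are
  -- special.
  closed-upper : ∀ {Z} → ClosedUnder E Z → card (N Z) ≤ suc (suc (card Z))
  closed-upper {Z} cl = ≤-trans (card-delete-≤ (sp t true) (N Z)) (s≤s (≤-trans (card-delete-≤ (sp t false) D₁) (s≤s
      (card-injection μ (delete (sp t false) D₁) Z inside (λ _ _ → μ-inj)))))
    where
    D₁ = delete (sp t true) (N Z)
    inside : ∀ {v} → v ∊ delete (sp t false) D₁ → μ v ∊ Z
    inside {v} p with N-out {Z} (delete-sub {a = sp t true} {N Z} (delete-sub {a = sp t false} {D₁} p))
    ... | u , q , r = cl q r λ { true e → delete-≢ {X = N Z} (delete-sub {a = sp t false} {D₁} p) e ; false e → delete-≢ {X = D₁} p e }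

  -- If one special vertex were unseen, the injection behind `closed-upper` would bound the excess
  -- by one, against `shore-lower`.
  closed-special : ∀ {Z z} → Shore Z → ClosedUnder E Z → z ∊ Z → ∀ i → sp t i ∊ N Z
  closed-special {Z} {z} S cl p i = ¬∉⇒∊ λ q → <-irrefl refl (≤-trans (shore-lower S p)
      (≤-trans (card-delete-≤ (sp t (not i)) (N Z)) (s≤s (card-injection μ (delete (sp t (not i)) (N Z)) Z (inside q) (λ _ _ → μ-inj)))))
    where
    split : ∀ j → j ≡ i ⊎ j ≡ not i
    split = bool-split not≢
    inside : sp t i ∉ N Z → ∀ {v} → v ∊ delete (sp t (not i)) (N Z) → μ v ∊ Z
    inside q {v} r with N-out {Z} (delete-sub {a = sp t (not i)} {N Z} r)
    ... | u , q' , r' = cl q' r' λ j e → case split j of λ where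
        (inj₁ refl) → ∊∉ {X = N Z} (delete-sub {a = sp t (not i)} {N Z} r) (subst (_∉ N Z) (sym e) q)
        (inj₂ refl) → delete-≢ {X = N Z} r e

  -- Without the edge `ab` the set `X` loses the neighbour `b`, and a matching of `H` containing
  -- `xy` takes away `y` as well, so by `upper` too few neighbours remain for `X`. Hence `xy` is
  -- lost in `H`; `no-β` records that it is lost in matchings of the other kind too.
  record AlphaSet (a b : Fin n) : Set where
    field
      X     : FSet n
      col-X : ∀ {v} → v ∊ X → c v ≡ s
      a∊    : a ∊ X
      only  : ∀ {u} → u ∊ X → E u b ≡ true → u ≡ a
      upper : card (N X) ≤ suc (card X)
      x y   : Fin n
      cx    : c x ≡ s
      x∉    : x ∉ X
      Exy   : E x y ≡ true
      y∊    : y ∊ N X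
      y≢b   : y ≢ b
      no-β  : x ∊ Plain → y ∊ PlainT → ¬ (Σ (Matching (without Eβ a b) Plain) λ M → Matching.mate M x ≡ y)

  -- By `closed⁻` no alternating path from elsewhere in `Z` leads to `a`. So within `Z` only `a`
  -- sees `b`, and without the edge `ab` the nonspecial neighbours of `Z` are one too few.
  record BetaSet (a b : Fin n) : Set where
    field
      Z       : FSet n
      shore   : Shore Z
      a∊      : a ∊ Z
      μa      : μ a ≡ b
      closed  : ClosedUnder E Z
      closed⁻ : ClosedUnder E (delete a Z)

    -- An edge to `b` from another vertex of `Z` would lead by `closed⁻` to the partner of `b`,
    -- which is `a`.
    b-only : ∀ {z} → z ∊ Z → E z b ≡ true → z ≡ a
    b-only {z} p e with z ≟ a
    ... | yes q = q
    ... | no ne = ⊥-elim (delete-≢ {X = Z} (closed⁻ (delete-intro {X = Z} p ne) e plain-b) (trans (cong μ (sym μa)) (μμ a)))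
      where
      plain-b : ∀ i → b ≢ sp t i
      plain-b i = subst (_≢ sp t i) μa (plain-≢ (μ-plainT (col shore a∊) (plain shore a∊)) i)

  -- Nonremovability in terms of Hall problems: either no matching through both deleted edges avoids
  -- `ab`, or some other edge `xy` survives in neither kind of matching.
  Uncovered : Fin n → Fin n → Set
  Uncovered a b = ¬ Matching (without Eβ a b) Plain
    ⊎ ∃₂ λ x y → c x ≡ s × E x y ≡ true × ¬ (x ≡ a × y ≡ b)
        × ¬ (Σ (Matching (without E a b) (Col c s)) λ M → Matching.mate M x ≡ y)
        × (x ∊ Plain → y ∊ PlainT → ¬ (Σ (Matching (without Eβ a b) Plain) λ M → Matching.mate M x ≡ y))

  -- `μ` maps the Hall violator without `a` injectively into its neighbourhood. Their sizes force a
  -- bijection, and its inverse yields both closures.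
  beta-set : ∀ {a b} → ¬ Matching (without Eβ a b) Plain → BetaSet a b
  beta-set {a} {b} none with hall? (without Eβ a b) Plain
  ... | inj₁ M = ⊥-elim (none M)
  ... | inj₂ (Z , sub , lt) = record { Z = Z ; shore = sh ; a∊ = a∊ ; μa = μa ; closed = cl ; closed⁻ = cl⁻ }
    where
    D = without Eβ a b
    sh : Shore Z
    sh = record { col = λ p → plain-col (sub p) ; plain = λ p → plain-≢ (sub p) }
    forward : ∀ {z} → z ∊ Z → ¬ (z ≡ a × μ z ≡ b) → μ z ∊ Nbr D Z
    forward {z} p ne = Nbr-intro D {Z} p (without-intro {D = Eβ} (into-intro {D = E} (μ-E z (normal sh p)) (μ-plainT (col sh p) (plain sh p))) ne)
    used : Σ (a ∊ Z) λ _ → μ a ≡ b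
    used with ∊? Z a | μ a ≟ b
    ... | inj₁ p | yes q = p , q
    ... | inj₂ p | _ = ⊥-elim (<-irrefl refl (≤-trans lt (card-injection μ Z (Nbr D Z) (λ q → forward q λ { (refl , _) → ∊∉ {X = Z} q p }) (λ _ _ → μ-inj))))
    ... | inj₁ _ | no q = ⊥-elim (<-irrefl refl (≤-trans lt (card-injection μ Z (Nbr D Z) (λ p → forward p λ { (refl , e) → q e }) (λ _ _ → μ-inj))))
    a∊ = proj₁ used
    μa = proj₂ used
    forward⁻ : ∀ {z} → z ∊ delete a Z → μ z ∊ Nbr D Z
    forward⁻ p = forward (delete-sub {a = a} {Z} p) λ e → delete-≢ {X = Z} p (proj₁ e)
    back : ∀ {v} → v ∊ Nbr D Z → μ v ∊ delete a Z
    back p with card-surjection μ (delete a Z) (Nbr D Z) forward⁻ (λ _ _ → μ-inj) (s≤s⁻¹ (≤-trans lt (≤-reflexive (card-delete {X = Z} a∊)))) p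
    ... | z , q , refl = subst (_∊ delete a Z) (sym (μμ z)) q
    reach : ∀ {z v} → z ∊ Z → E z v ≡ true → (∀ i → v ≢ sp t i) → ¬ (z ≡ a × v ≡ b) → μ v ∊ delete a Z
    reach p e nv ne = back (Nbr-intro D {Z} p (without-intro {D = Eβ} (into-intro {D = E} e (plain-intro (E-to-t e (col sh p)) nv)) ne))
    cl⁻ : ClosedUnder E (delete a Z)
    cl⁻ p e nv = reach (delete-sub {a = a} {Z} p) e nv λ { (q , _) → delete-≢ {X = Z} p q }
    cl : ClosedUnder E Z
    cl {z} {v} p e nv with v ≟ b
    ... | yes refl = subst (_∊ Z) (sym (trans (cong μ (sym μa)) (μμ a))) a∊
    ... | no ne = delete-sub {a = a} {Z} (reach p e nv λ e → ne (proj₂ e))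

  -- In `H` a proper nonempty subset has excess at least one, so a violator is only possible if
  -- deleting `ab` really costs the neighbour `b` and reserving `xy` really costs `y`. All fields
  -- follow from this tightness.
  alpha-set : ∀ {a b x y} → c x ≡ s → E x y ≡ true → ¬ (x ≡ a × y ≡ b)
    → ¬ (Σ (Matching (without E a b) (Col c s)) λ M → Matching.mate M x ≡ y)
    → (x ∊ Plain → y ∊ PlainT → ¬ (Σ (Matching (without Eβ a b) Plain) λ M → Matching.mate M x ≡ y)) → AlphaSet a b
  alpha-set {a} {b} {x} {y} cx Exy ne no-α no-β with unextendable {D = without E a b} {P = Col c s} {x} {y} (without-intro {D = E} Exy ne) no-α
  ... | X , sub , x∉ , lt = record { X = X ; col-X = col-X ; a∊ = a∊ ; only = only ; upper = upper ; x = x ; y = y ; cx = cx ; x∉ = x∉ ; Exy = Exy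
        ; y∊ = Nbr-mono' y∊' ; y≢b = λ { refl → ∊∉ {X = N'} y∊' b∉ } ; no-β = no-β }
    where
    D = without E a b
    N' = Nbr D X
    col-X : ∀ {v} → v ∊ X → c v ≡ s
    col-X p = Col-elim (sub p)
    N'≤ : card N' ≤ card X
    N'≤ = ≤-trans (card-delete-≤ y N') lt
    Nbr-mono' : N' ⊆ N X
    Nbr-mono' p with Nbr-elim D {X} p
    ... | u , q , r = N-in {X} q (without-sub {D = E} r)
    big : card X < card (N X)
    big = expand s X col-X (proj₂ (card-nonempty X (≤-trans (s≤s z≤n) lt))) x∉ cx
    a∊ : a ∊ X
    a∊ = ¬∉⇒∊ λ q → <-irrefl refl (≤-trans big (≤-trans (card-mono {X = N X} {N'} λ p → case N-out {X} p of λ { (u , r , e) → Nbr-intro D {X} r (without-intro {D = E} e λ { (refl , _) → ∊∉ {X = X} r q }) }) N'≤))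
    grow : N X ⊆ insert b N'
    grow {v} p with v ≟ b | N-out {X} p
    ... | yes refl | _ = insert-self v N'
    ... | no ne | u , q , r = insert-old b N' (Nbr-intro D {X} q (without-intro {D = E} r λ e → ne (proj₂ e)))
    b∉ : b ∉ N'
    b∉ = ¬∊⇒∉ λ p → <-irrefl refl (≤-trans big (≤-trans (card-mono {X = N X} {N'} λ q → case insert-elim {a = b} {X = N'} (grow q) of λ { (inj₁ refl) → p ; (inj₂ r) → r }) N'≤))
    only : ∀ {u} → u ∊ X → E u b ≡ true → u ≡ a
    only {u} p e with u ≟ a
    ... | yes q = q
    ... | no q = ⊥-elim (∊∉ {X = N'} (Nbr-intro D {X} p (without-intro {D = E} e λ r → q (proj₁ r))) b∉)
    upper' : card (N X) ≤ suc (card N')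
    upper' = ≤-trans (card-mono {X = N X} {insert b N'} grow) (≤-reflexive (card-insert {X = N'} b∉))
    upper : card (N X) ≤ suc (card X)
    upper = ≤-trans upper' (s≤s N'≤)
    y∊' : y ∊ N'
    y∊' = ¬∉⇒∊ λ p → <-irrefl refl (≤-trans big (≤-trans upper' (≤-trans (s≤s (card-mono {X = N'} {delete y N'} λ q → delete-intro {X = N'} q λ { refl → ∊∉ {X = N'} q p })) lt)))

  classify : ∀ {a b} → Uncovered a b → AlphaSet a b ⊎ BetaSet a b
  classify (inj₁ none) = inj₂ (beta-set none)
  classify (inj₂ (x , y , cx , Exy , ne , no-α , no-β)) = inj₁ (alpha-set cx Exy ne no-α no-β)

-- Uncrossing the obstacles at a vertex

module Obstacles {n : ℕ} (B : NearBip n) (s : Bool) where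

  open NearBipTheory B
  open Side B s
  open Shore

  card-meet : ∀ {a} (X Y : FSet n) → a ∊ X → a ∊ Y → card X + card Y ≡ suc (card (X ∪ Y) + card (delete a (X ∩ Y)))
  card-meet {a} X Y p q = trans (sym (card-∪-∩ X Y)) (trans (cong (card (X ∪ Y) +_) (card-delete {X = X ∩ Y} (∧-intro p q))) (+-suc _ _))

  meetˡ : ∀ {a} (X Y : FSet n) → delete a (X ∩ Y) ⊆ X
  meetˡ {a} X Y {v} p = ∧-elimˡ {X v} (delete-sub {a = a} {X ∩ Y} p)

  meetʳ : ∀ {a} (X Y : FSet n) → delete a (X ∩ Y) ⊆ Y
  meetʳ {a} X Y {v} p = ∧-elimʳ {X v} (delete-sub {a = a} {X ∩ Y} p)

  meet-≢ : ∀ {a v} (X Y : FSet n) → v ∊ delete a (X ∩ Y) → v ≢ a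
  meet-≢ X Y p = delete-≢ {X = X ∩ Y} p

  ∪-col : ∀ {X Y : FSet n} → (∀ {v} → v ∊ X → c v ≡ s) → (∀ {v} → v ∊ Y → c v ≡ s) → ∀ {v} → v ∊ X ∪ Y → c v ≡ s
  ∪-col {X} p q {v} r with ∨-elim {X v} r
  ... | inj₁ u = p u
  ... | inj₂ u = q u

  insert-⊆ : ∀ {a} {X Y : FSet n} → a ∊ Y → X ⊆ Y → insert a X ⊆ Y
  insert-⊆ {a} {X} p q r with insert-elim {a = a} {X = X} r
  ... | inj₁ refl = p
  ... | inj₂ u = q u

  ⁅⁆-⊆ : ∀ {a} {Y : FSet n} → a ∊ Y → ⁅ a ⁆ ⊆ Y
  ⁅⁆-⊆ {Y = Y} p q = subst (_∊ Y) (sym (∊⁅⁆⇒≡ q)) p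

  -- b and b' have a as their only neighbour in X ∩ Y, so removing a costs N(X ∩ Y) two vertices.
  uncross-at : ∀ {a b b'} (X Y : FSet n) → a ∊ X → a ∊ Y → E a b ≡ true → E a b' ≡ true → b ≢ b'
    → (∀ {u} → u ∊ X → u ∊ Y → E u b ≡ true → u ≡ a) → (∀ {u} → u ∊ X → u ∊ Y → E u b' ≡ true → u ≡ a)
    → suc (suc (card (N (delete a (X ∩ Y))) + card (N (X ∪ Y)))) ≤ card (N X) + card (N Y)
  uncross-at {a} {b} {b'} X Y aX aY Eb Eb' ne only only' = ≤-trans (≤-reflexive (cong (_+ card (N (X ∪ Y))) (sym size)))
      (uncross E {X} {Y} {S} (insert-⊆ {X = insert b' (N W)} (N-in {X} aX Eb) (insert-⊆ {X = N W} (N-in {X} aX Eb') (Nbr-mono E {W} {X} (meetˡ X Y))))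
                             (insert-⊆ {X = insert b' (N W)} (N-in {Y} aY Eb) (insert-⊆ {X = N W} (N-in {Y} aY Eb') (Nbr-mono E {W} {Y} (meetʳ X Y)))))
    where
    W = delete a (X ∩ Y)
    S = insert b (insert b' (N W))
    outW : ∀ {b} → (∀ {u} → u ∊ X → u ∊ Y → E u b ≡ true → u ≡ a) → b ∉ N W
    outW on = Nbr-∉ E {W} λ u p e → meet-≢ X Y p (on (meetˡ X Y p) (meetʳ X Y p) e)
    size : card S ≡ suc (suc (card (N W)))
    size = trans (card-insert {X = insert b' (N W)} (insert-∉ {X = N W} ne (outW only))) (cong suc (card-insert {X = N W} (outW only')))

  card-three : ∀ {x y z : Fin n} → x ≢ y → x ≢ z → y ≢ z → card (insert x (insert y ⁅ z ⁆)) ≡ 3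
  card-three {x} {y} {z} p q r = trans (card-insert {X = insert y ⁅ z ⁆} (insert-∉ {X = ⁅ z ⁆} p (≢⇒∉⁅⁆ q))) (cong suc (trans (card-insert {X = ⁅ z ⁆} (≢⇒∉⁅⁆ r)) (cong suc (card-⁅⁆ z))))

  -- A vertex left out by both sets gives their union an excess. Uncrossing then leaves the
  -- intersection without `a` none, so it is empty; but in that case three common neighbours `b`,
  -- `b'`, `d` are more than submodularity allows.
  alpha-cover : ∀ {a b b' d} → E a b ≡ true → E a b' ≡ true → E a d ≡ true → b ≢ b' → b ≢ d → b' ≢ d
    → (S₁ : AlphaSet a b) (S₂ : AlphaSet a b') → ∀ {v} → c v ≡ s → v ∊ AlphaSet.X S₁ ⊎ v ∊ AlphaSet.X S₂
  alpha-cover {a} {b} {b'} {d} Eb Eb' Ed bb' bd b'd S₁ S₂ {v} cv with ∊? (AlphaSet.X S₁ ∪ AlphaSet.X S₂) v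
  ... | inj₁ p = ∨-elim {AlphaSet.X S₁ v} p
  ... | inj₂ v∉ = ⊥-elim contra
    where
    open AlphaSet S₁ renaming (X to X₁)
    open AlphaSet S₂ renaming (X to X₂; a∊ to a∊₂; only to only₂; upper to upper₂; col-X to col₂)
    W = delete a (X₁ ∩ X₂)
    big : card (X₁ ∪ X₂) < card (N (X₁ ∪ X₂))
    big = expand s (X₁ ∪ X₂) (∪-col {X₁} {X₂} col-X col₂) (∨-introˡ a∊) v∉ cv
    small : card (N W) ≤ card W
    small = linear (card X₁ ∷ card X₂ ∷ card (N X₁) ∷ card (N X₂) ∷ card (X₁ ∪ X₂) ∷ card (N (X₁ ∪ X₂)) ∷ card W ∷ card (N W) ∷ [])
      ((♯ 1 ⊕ ′ # 4 ≼ ′ # 5) ∷ (♯ 2 ⊕ (′ # 7 ⊕ ′ # 5) ≼ ′ # 2 ⊕ ′ # 3) ∷ (′ # 2 ≼ ♯ 1 ⊕ ′ # 0) ∷ (′ # 3 ≼ ♯ 1 ⊕ ′ # 1) ∷ (′ # 0 ⊕ ′ # 1 ≼ ♯ 1 ⊕ (′ # 4 ⊕ ′ # 6)) ∷ [])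
      (′ # 7 ≼ ′ # 6)
      (big ∷ uncross-at X₁ X₂ a∊ a∊₂ Eb Eb' bb' (λ p _ → only p) (λ _ → only₂) ∷ upper ∷ upper₂ ∷ ≤-reflexive (card-meet X₁ X₂ a∊ a∊₂) ∷ [])
    contra : ⊥
    contra with find W
    ... | inj₁ (w , p) = <-irrefl refl (≤-trans (expand s W (λ q → col-X (meetˡ X₁ X₂ q)) p (delete-∉ {a = a} {X₁ ∩ X₂}) (col-X a∊)) small)
    ... | inj₂ empty = <-irrefl refl (linear (card X₁ ∷ card X₂ ∷ card (N X₁) ∷ card (N X₂) ∷ card (X₁ ∪ X₂) ∷ card (N (X₁ ∪ X₂)) ∷ card W ∷ card S ∷ [])
        ((♯ 1 ⊕ ′ # 4 ≼ ′ # 5) ∷ (′ # 7 ⊕ ′ # 5 ≼ ′ # 2 ⊕ ′ # 3) ∷ (′ # 2 ≼ ♯ 1 ⊕ ′ # 0) ∷ (′ # 3 ≼ ♯ 1 ⊕ ′ # 1) ∷ (′ # 0 ⊕ ′ # 1 ≼ ♯ 1 ⊕ (′ # 4 ⊕ ′ # 6)) ∷ (♯ 3 ≼ ′ # 7) ∷ (′ # 6 ≼ ♯ 0) ∷ [])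
        (♯ 1 ≼ ♯ 0)
        (big ∷ uncross E {X₁} {X₂} {S} (nbrs X₁ a∊) (nbrs X₂ a∊₂) ∷ upper ∷ upper₂ ∷ ≤-reflexive (card-meet X₁ X₂ a∊ a∊₂) ∷ ≤-reflexive (sym (card-three bb' bd b'd)) ∷ ≤-reflexive (card-∅ {X = W} empty) ∷ []))
      where
      S = insert b (insert b' ⁅ d ⁆)
      nbrs : ∀ X → a ∊ X → S ⊆ N X
      nbrs X p = insert-⊆ {X = insert b' ⁅ d ⁆} (N-in {X} p Eb) (insert-⊆ {X = ⁅ d ⁆} (N-in {X} p Eb') (⁅⁆-⊆ {Y = N X} (N-in {X} p Ed)))

  -- On the other colour class this is the complementary shore: what `X` does not see, together with
  -- `b`, which `X` sees from `a` alone.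
  Missed : ∀ {a b} → AlphaSet a b → Fin n → Set
  Missed {a} {b} S v = v ∉ N (AlphaSet.X S) ⊎ v ≡ b

  module _ {a b} (S : AlphaSet a b) where
    open AlphaSet S

    card-s : card (Col c s) ≡ card X + card (Col c s ∩ ∁ X)
    card-s = trans (sym (card-partition (Col c s) X)) (cong (_+ card (Col c s ∩ ∁ X)) (card-cong {X = Col c s ∩ X} {X} (λ {v} p → ∧-elimʳ {Col c s v} p) (λ p → ∧-intro (Col-intro (col-X p)) p)))

    card-t : card (Col c t) ≡ card (N X) + card (Col c t ∩ ∁ (N X))
    card-t = trans (sym (card-partition (Col c t) (N X))) (cong (_+ card (Col c t ∩ ∁ (N X))) (card-cong {X = Col c t ∩ N X} {N X} (λ {v} p → ∧-elimʳ {Col c t v} p) (λ p → ∧-intro (Col-intro (N-t {X} col-X p)) p)))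

    -- The complementary shore B ∖ N(X) + b also has a single excess neighbour, so brick applies to it.
    alpha-special : ∀ {b' d} → E a b ≡ true → E a b' ≡ true → E a d ≡ true → b ≢ b' → b ≢ d → b' ≢ d → ∃ λ i → Missed S (sp t i)
    alpha-special {b'} {d} Eb Eb' Ed bb' bd b'd = case proj₁ (brick t Y col-Y (insert-self b Y₀) (out Eb' bb') (E-to-t Eb' (col-X a∊)) (out Ed bd) (E-to-t Ed (col-X a∊)) b'd bound) of λ where
        (i , p) → i , (case insert-elim {a = b} {X = Y₀} p of λ { (inj₁ e) → inj₂ e ; (inj₂ q) → inj₁ (not-true (∧-elimʳ {Col c t (sp t i)} q)) })
      where
      Y₀ = Col c t ∩ ∁ (N X)
      X₀ = Col c s ∩ ∁ X
      Y = insert b Y₀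
      b∉Y₀ : b ∉ Y₀
      b∉Y₀ = ¬∊⇒∉ λ p → ∊∉ {X = N X} (N-in {X} a∊ Eb) (not-true (∧-elimʳ {Col c t b} p))
      col-Y : ∀ {v} → v ∊ Y → c v ≡ t
      col-Y {v} p with insert-elim {a = b} {X = Y₀} p
      ... | inj₁ refl = E-to-t Eb (col-X a∊)
      ... | inj₂ q = Col-elim (∧-elimˡ {Col c t v} q)
      out : ∀ {v} → E a v ≡ true → b ≢ v → v ∉ Y
      out {v} e ne = insert-∉ {X = Y₀} (ne ∘ sym) (¬∊⇒∉ λ p → ∊∉ {X = N X} (N-in {X} a∊ e) (not-true (∧-elimʳ {Col c t v} p)))
      sub : N Y ⊆ insert a X₀
      sub {v} p with N-out {Y} p
      ... | u , q , r with ∊? X v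
      ... | inj₂ v∉ = insert-old a X₀ (∧-intro (Col-intro (E-to-s r (col-Y q))) (not-false v∉))
      ... | inj₁ v∊ with insert-elim {a = b} {X = Y₀} q
      ... | inj₁ refl = subst (_∊ insert a X₀) (sym (only v∊ (E-sym r))) (insert-self a X₀)
      ... | inj₂ u∊ = ⊥-elim (∊∉ {X = N X} (N-in {X} v∊ (E-sym r)) (not-true (∧-elimʳ {Col c t u} u∊)))
      a∉X₀ : a ∉ X₀
      a∉X₀ = ¬∊⇒∉ λ p → ∊∉ {X = X} a∊ (not-true (∧-elimʳ {Col c s a} p))
      bound : card (N Y) ≤ suc (card Y)
      bound = linear (card (N Y) ∷ card Y ∷ card X ∷ card (N X) ∷ card X₀ ∷ card Y₀ ∷ card (Col c s) ∷ card (Col c t) ∷ [])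
        ((′ # 0 ≼ ♯ 1 ⊕ ′ # 4) ∷ (♯ 1 ⊕ ′ # 5 ≼ ′ # 1) ∷ (′ # 2 ⊕ ′ # 4 ≼ ′ # 6) ∷ (′ # 7 ≼ ′ # 3 ⊕ ′ # 5) ∷ (′ # 3 ≼ ♯ 1 ⊕ ′ # 2) ∷ (′ # 6 ≼ ′ # 7) ∷ [])
        (′ # 0 ≼ ♯ 1 ⊕ ′ # 1)
        (≤-trans (card-mono {X = N Y} {insert a X₀} sub) (≤-reflexive (card-insert {X = X₀} a∉X₀)) ∷ ≤-reflexive (sym (card-insert {X = Y₀} b∉Y₀)) ∷ ≤-reflexive (sym card-s) ∷ ≤-reflexive card-t ∷ upper ∷ ≤-reflexive (balanced s) ∷ [])

  module Pair {a b b' d} (Eb : E a b ≡ true) (Eb' : E a b' ≡ true) (Ed : E a d ≡ true) (bb' : b ≢ b') (bd : b ≢ d) (b'd : b' ≢ d)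
              (S₁ : AlphaSet a b) (S₂ : AlphaSet a b') where
    open AlphaSet S₁ renaming (X to X₁)
    open AlphaSet S₂ renaming (X to X₂; a∊ to a∊₂; only to only₂)

    cover : ∀ {v} → c v ≡ s → v ∊ X₁ ⊎ v ∊ X₂
    cover = alpha-cover Eb Eb' Ed bb' bd b'd S₁ S₂

    missed-b : ∀ {v} → Missed S₂ v → v ≢ b
    missed-b (inj₁ p) refl = ∊∉ {X = N X₂} (N-in {X₂} a∊₂ Eb) p
    missed-b (inj₂ refl) e = bb' (sym e)

    missed-adj : ∀ {u v} → Missed S₁ v → E u v ≡ true → u ∊ X₁ → u ≡ a
    missed-adj (inj₁ p) e q = ⊥-elim (∊∉ {X = N X₁} (N-in {X₁} q e) p)
    missed-adj (inj₂ refl) e q = only q e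

    -- `v` has a neighbour, and by `cover` one of the two sets contains it. A missed vertex seen
    -- from its own set is the end of that α-edge, and the other set sees this end through `a`.
    missed-apart : ∀ {v} → c v ≡ t → Missed S₁ v → Missed S₂ v → ⊥
    missed-apart {v} cv p q with has-neighbour v
    ... | u , e with cover (E-to-s e cv)
    missed-apart {v} cv (inj₁ p) q | u , e | inj₁ r = ∊∉ {X = N X₁} (N-in {X₁} r (E-sym e)) p
    missed-apart {v} cv (inj₂ p) q | u , e | inj₁ r = missed-b q p
    missed-apart {v} cv p (inj₁ q) | u , e | inj₂ r = ∊∉ {X = N X₂} (N-in {X₂} r (E-sym e)) q
    missed-apart {v} cv (inj₁ p) (inj₂ refl) | u , e | inj₂ r = ∊∉ {X = N X₁} (N-in {X₁} a∊ Eb') p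
    missed-apart {v} cv (inj₂ p) (inj₂ q) | u , e | inj₂ r = bb' (trans (sym p) q)

  -- Each α-set misses a special vertex of the other class, no two miss the same one, and there are
  -- only two.
  no-three-alpha : ∀ {a b b' b''} → E a b ≡ true → E a b' ≡ true → E a b'' ≡ true → b ≢ b' → b ≢ b'' → b' ≢ b''
    → AlphaSet a b → AlphaSet a b' → AlphaSet a b'' → ⊥
  no-three-alpha {a} {b} {b'} {b''} e e' e'' p q r S S' S'' =
    clash (alpha-special S e e' e'' p q r) (alpha-special S' e' e e'' (p ∘ sym) r q) (alpha-special S'' e'' e e' (q ∘ sym) (r ∘ sym) p)
    where
    clash : (∃ λ i → Missed S (sp t i)) → (∃ λ i → Missed S' (sp t i)) → (∃ λ i → Missed S'' (sp t i)) → ⊥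
    clash (i , m) (j , m') (k , m'') = choose (bool-split (λ i≡j → Pair.missed-apart e e' e'' p q r S S' (sp-col t i) m (subst (λ j → Missed S' (sp t j)) (sym i≡j) m')) k)
      where
      choose : k ≡ i ⊎ k ≡ j → ⊥
      choose (inj₁ refl) = Pair.missed-apart e e'' e' q p (r ∘ sym) S S'' (sp-col t k) m m''
      choose (inj₂ refl) = Pair.missed-apart e' e'' e r (p ∘ sym) (q ∘ sym) S' S'' (sp-col t k) m' m''

  -- As `μ` does not use `ab`, it is still a perfect matching where the obstacle is sought. The Hall
  -- set is therefore tight, and `μ` leads from its neighbours back into it.
  blocked : ∀ {a b x y} → x ∊ Plain → y ∊ PlainT → E x y ≡ true → ¬ (x ≡ a × y ≡ b) → μ a ≢ b
    → ¬ (Σ (Matching (without Eβ a b) Plain) λ M → Matching.mate M x ≡ y)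
    → ∃ λ Z → x ∉ Z × μ y ∊ Z × ClosedUnder (without E a b) Z
  blocked {a} {b} {x} {y} px py Exy ne μa≢b none with unextendable {D = without Eβ a b} {P = Plain} {x} {y} (without-intro {D = Eβ} (into-intro {D = E} Exy py) ne) none
  ... | Z , sub , x∉ , lt = Z , x∉ , back y∊ , cl
    where
    D = without Eβ a b
    forward : ∀ {z} → z ∊ Z → μ z ∊ Nbr D Z
    forward {z} p = Nbr-intro D {Z} p (without-intro {D = Eβ} (into-intro {D = E} (μ-E z λ i → subst (λ r → z ≢ sp r i) (sym (plain-col (sub p))) (plain-≢ (sub p) i)) (μ-plainT (plain-col (sub p)) (plain-≢ (sub p)))) λ { (refl , e) → μa≢b e })
    back : ∀ {v} → v ∊ Nbr D Z → μ v ∊ Z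
    back p with card-surjection μ Z (Nbr D Z) forward (λ _ _ → μ-inj) (≤-trans (card-delete-≤ y (Nbr D Z)) lt) p
    ... | z , q , refl = subst (_∊ Z) (sym (μμ z)) q
    y∊ : y ∊ Nbr D Z
    y∊ = ¬∉⇒∊ λ q → <-irrefl refl (≤-trans lt (≤-trans (card-injection μ Z (Nbr D Z) forward (λ _ _ → μ-inj)) (card-mono {X = Nbr D Z} {delete y (Nbr D Z)} λ r → delete-intro {X = Nbr D Z} r λ { refl → ∊∉ {X = Nbr D Z} r q })))
    cl : ClosedUnder (without E a b) Z
    cl p e nv = back (Nbr-intro D {Z} p (without-intro {D = Eβ} (into-intro {D = E} (without-sub {D = E} e) (plain-intro (E-to-t (without-sub {D = E} e) (plain-col (sub p))) nv)) (without-≢ {D = E} e)))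

  module Triple {a b b' d} (Eb : E a b ≡ true) (Eb' : E a b' ≡ true) (Ed : E a d ≡ true) (bb' : b ≢ b') (bd : b ≢ d) (b'd : b' ≢ d)
                (S₁ : AlphaSet a b) (S₂ : AlphaSet a b') (T : BetaSet a d)
                {i₁ i₂ : Bool} (m₁ : Missed S₁ (sp t i₁)) (m₂ : Missed S₂ (sp t i₂)) where
    open AlphaSet S₁ renaming (X to X₁)
    open AlphaSet S₂ renaming (X to X₂; a∊ to a∊₂; only to only₂) using ()
    open BetaSet T renaming (a∊ to a∊Z)
    open Pair Eb Eb' Ed bb' bd b'd S₁ S₂

    i₁≢i₂ : i₁ ≢ i₂
    i₁≢i₂ e = missed-apart (sp-col t i₁) m₁ (subst (λ i → Missed S₂ (sp t i)) (sym e) m₂)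

    W : FSet n
    W = delete a (Z ∩ X₁)

    plain-d : ∀ i → d ≢ sp t i
    plain-d i = subst (_≢ sp t i) μa (plain-≢ (μ-plainT (col shore a∊Z) (plain shore a∊Z)) i)

    ZX-col : ∀ {v} → v ∊ Z ∪ X₁ → c v ≡ s
    ZX-col = ∪-col {Z} {X₁} (col shore) col-X

    -- The vertex left out gives the union an excess, so uncrossing allows the intersection without
    -- `a` an excess of at most one. Containing no special vertex, it is empty. Four common
    -- neighbours would now be too many, which identifies the special vertex missed by `X₂` with
    -- `b'`.
    partial : ∀ {x₀} → c x₀ ≡ s → x₀ ∉ Z ∪ X₁ → sp t i₂ ≡ b' × (∀ {v} → v ∊ Z → v ∊ X₁ → v ≡ a)
    partial {x₀} cx₀ x₀∉ = special , meet
      where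
      big : card (Z ∪ X₁) < card (N (Z ∪ X₁))
      big = expand s (Z ∪ X₁) ZX-col (∨-introˡ a∊Z) x₀∉ cx₀
      small : card (N W) ≤ suc (card W)
      small = linear (card Z ∷ card X₁ ∷ card (N Z) ∷ card (N X₁) ∷ card (Z ∪ X₁) ∷ card (N (Z ∪ X₁)) ∷ card W ∷ card (N W) ∷ [])
        ((♯ 1 ⊕ ′ # 4 ≼ ′ # 5) ∷ (♯ 2 ⊕ (′ # 7 ⊕ ′ # 5) ≼ ′ # 2 ⊕ ′ # 3) ∷ (′ # 2 ≼ ♯ 2 ⊕ ′ # 0) ∷ (′ # 3 ≼ ♯ 1 ⊕ ′ # 1) ∷ (′ # 0 ⊕ ′ # 1 ≼ ♯ 1 ⊕ (′ # 4 ⊕ ′ # 6)) ∷ [])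
        (′ # 7 ≼ ♯ 1 ⊕ ′ # 6)
        (big ∷ uncross-at Z X₁ a∊Z a∊ Eb Ed bd (λ _ → only) (λ p _ → b-only p) ∷ closed-upper closed ∷ upper ∷ ≤-reflexive (card-meet Z X₁ a∊Z a∊) ∷ [])
      empty : ∀ v → v ∉ W
      empty v = ¬∊⇒∉ λ p → <-irrefl refl (≤-trans (shore-lower {W} (record { col = λ q → col shore (meetˡ Z X₁ q) ; plain = λ q → plain shore (meetˡ Z X₁ q) }) p) small)
      meet : ∀ {v} → v ∊ Z → v ∊ X₁ → v ≡ a
      meet {v} p q with v ≟ a
      ... | yes e = e
      ... | no ne = ⊥-elim (∊∉ {X = W} (delete-intro {X = Z ∩ X₁} (∧-intro p q) ne) (empty v))
      special : sp t i₂ ≡ b'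
      special with sp t i₂ ≟ b'
      ... | yes e = e
      ... | no ne = ⊥-elim (<-irrefl refl (linear (card Z ∷ card X₁ ∷ card (N Z) ∷ card (N X₁) ∷ card (Z ∪ X₁) ∷ card (N (Z ∪ X₁)) ∷ card W ∷ card S ∷ [])
          ((♯ 1 ⊕ ′ # 4 ≼ ′ # 5) ∷ (′ # 7 ⊕ ′ # 5 ≼ ′ # 2 ⊕ ′ # 3) ∷ (′ # 2 ≼ ♯ 2 ⊕ ′ # 0) ∷ (′ # 3 ≼ ♯ 1 ⊕ ′ # 1) ∷ (′ # 0 ⊕ ′ # 1 ≼ ♯ 1 ⊕ (′ # 4 ⊕ ′ # 6)) ∷ (♯ 4 ≼ ′ # 7) ∷ (′ # 6 ≼ ♯ 0) ∷ [])
          (♯ 1 ≼ ♯ 0)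
          (big ∷ uncross E {Z} {X₁} {S} (nbrs Z a∊Z (closed-special shore closed a∊Z i₂)) (nbrs X₁ a∊ q∊X₁) ∷ closed-upper closed ∷ upper ∷ ≤-reflexive (card-meet Z X₁ a∊Z a∊)
            ∷ ≤-reflexive (sym size) ∷ ≤-reflexive (card-∅ {X = W} empty) ∷ [])))
        where
        q = sp t i₂
        S = insert q (insert b (insert b' ⁅ d ⁆))
        size : card S ≡ 4
        size = trans (card-insert {X = insert b (insert b' ⁅ d ⁆)} (insert-∉ {X = insert b' ⁅ d ⁆} (missed-b m₂) (insert-∉ {X = ⁅ d ⁆} ne (≢⇒∉⁅⁆ (plain-d i₂ ∘ sym))))) (cong suc (card-three bb' bd b'd))
        nbrs : ∀ X → a ∊ X → q ∊ N X → S ⊆ N X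
        nbrs X p r = insert-⊆ {X = insert b (insert b' ⁅ d ⁆)} r (insert-⊆ {X = insert b' ⁅ d ⁆} (N-in {X} p Eb) (insert-⊆ {X = ⁅ d ⁆} (N-in {X} p Eb') (⁅⁆-⊆ {Y = N X} (N-in {X} p Ed))))
        q∊X₁ : q ∊ N X₁
        q∊X₁ with has-neighbour q
        ... | u , e = go (cover (E-to-s e (sp-col t i₂))) m₂
          where
          go : u ∊ X₁ ⊎ u ∊ X₂ → Missed S₂ q → q ∊ N X₁
          go (inj₁ r) _ = N-in {X₁} r (E-sym e)
          go (inj₂ r) (inj₁ q∉) = ⊥-elim (∊∉ {X = N X₂} (N-in {X₂} r (E-sym e)) q∉)
          go (inj₂ r) (inj₂ e') = ⊥-elim (ne e')

    x∊X₂ : x ∊ X₂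
    x∊X₂ with cover cx
    ... | inj₁ p = ⊥-elim (∊∉ {X = X₁} p x∉)
    ... | inj₂ p = p

    -- Vertices of A ∖ X₁ lie in X₂ and differ from a, hence do not see the special vertex missed by X₂.
    not-adjacent : ∀ {v} → c v ≡ s → v ∉ X₁ → E v (sp t i₂) ≡ true → ⊥
    not-adjacent {v} cv v∉ e = go (cover cv) m₂
      where
      go : v ∊ X₁ ⊎ v ∊ X₂ → Missed S₂ (sp t i₂) → ⊥
      go (inj₁ p) _ = ∊∉ {X = X₁} p v∉
      go (inj₂ p) (inj₁ q) = ∊∉ {X = N X₂} (N-in {X₂} p e) q
      go (inj₂ p) (inj₂ q) = ∊∉ {X = X₁} (subst (_∊ X₁) (sym (only₂ p (subst (λ w → E v w ≡ true) q e))) a∊) v∉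

    -- Here the lost edge `xy` of the first α-set enters. If the special vertex missed by `X₁` were
    -- not `b`, then `b` would be nonspecial, and `no-β` would give a closed set whose uncrossing
    -- with `X₁` leaves `b` only the neighbours `a` and `x`.
    total : (∀ {v} → c v ≡ s → v ∊ Z ⊎ v ∊ X₁) → sp t i₁ ≡ b
    total cov = go m₁
      where
      go : Missed S₁ (sp t i₁) → sp t i₁ ≡ b
      go (inj₂ e) = e
      go (inj₁ q∉) with sp t i₁ ≟ b
      ... | yes e = e
      ... | no q≢b = ⊥-elim (case find (delete x (Col c s ∩ ∁ X₁)) of λ { (inj₁ (x' , p)) → several p ; (inj₂ none) → single none })
       where
       q = sp t i₁
       single : (∀ v → v ∉ delete x (Col c s ∩ ∁ X₁)) → ⊥
       -- If only `x` lies outside `X₁`, the other class is too large: it has at least one vertex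
       -- more than `X₁` in the neighbourhood, and `q` besides.
       single none = <-irrefl refl (linear (card X₁ ∷ card (N X₁) ∷ card (Col c s) ∷ card (Col c t) ∷ card (Col c s ∩ ∁ X₁) ∷ card (Col c t ∩ ∁ (N X₁)) ∷ [])
         ((♯ 1 ⊕ ′ # 0 ≼ ′ # 1) ∷ (′ # 2 ≼ ′ # 0 ⊕ ′ # 4) ∷ (′ # 1 ⊕ ′ # 5 ≼ ′ # 3) ∷ (′ # 3 ≼ ′ # 2) ∷ (′ # 4 ≼ ♯ 1) ∷ (♯ 1 ≼ ′ # 5) ∷ [])
         (♯ 1 ≼ ♯ 0)
         (expand s X₁ col-X a∊ x∉ cx ∷ ≤-reflexive (card-s S₁) ∷ ≤-reflexive (sym (card-t S₁)) ∷ ≤-reflexive (sym (balanced s))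
           ∷ ≤-trans (card-delete-≤ x (Col c s ∩ ∁ X₁)) (s≤s (≤-reflexive (card-∅ {X = delete x (Col c s ∩ ∁ X₁)} none)))
           ∷ card-pos {X = Col c t ∩ ∁ (N X₁)} {q} (∧-intro (Col-intro (sp-col t i₁)) (not-false q∉)) ∷ []))
       several : ∀ {x'} → x' ∊ delete x (Col c s ∩ ∁ X₁) → ⊥
       several {x'} p = cut block
         where
         a≢x : a ≢ x
         a≢x refl = ∊∉ {X = X₁} a∊ x∉
         cb : c b ≡ t
         cb = E-to-t Eb (col-X a∊)
         x∊Z : x ∊ Z
         x∊Z = case cov cx of λ { (inj₁ r) → r ; (inj₂ r) → ⊥-elim (∊∉ {X = X₁} r x∉) }
         normal-b : Normal b
         normal-b i rewrite cb = λ e → case bool-split i₁≢i₂ i of λ { (inj₁ refl) → q≢b (sym e) ; (inj₂ refl) → missed-b m₂ (sym e) }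
         plain-y : ∀ i → y ≢ sp t i
         plain-y i e with bool-split i₁≢i₂ i
         ... | inj₁ refl = ∊∉ {X = N X₁} (subst (_∊ N X₁) e y∊) q∉
         ... | inj₂ refl = not-adjacent cx x∉ (subst (λ w → E x w ≡ true) e Exy)
         y∊PlainT : y ∊ PlainT
         y∊PlainT = plain-intro (E-to-t Exy cx) plain-y
         x∊Plain : x ∊ Plain
         x∊Plain = plain-intro cx (plain shore x∊Z)
         block = blocked {a} {b} x∊Plain y∊PlainT Exy (λ e → a≢x (sym (proj₁ e))) (λ e → bd (trans (sym e) μa)) (no-β x∊Plain y∊PlainT)
         cut : (∃ λ Z₃ → x ∉ Z₃ × μ y ∊ Z₃ × ClosedUnder (without E a b) Z₃) → ⊥
         cut (Z₃ , x∉₃ , μy∊₃ , cl₃) = <-irrefl refl (≤-trans (normal-degree b normal-b) (≤-trans (card-mono {X = N ⁅ b ⁆} {insert a ⁅ x ⁆} Nb) (≤-reflexive (trans (card-insert {X = ⁅ x ⁆} (≢⇒∉⁅⁆ a≢x)) (cong suc (card-⁅⁆ x))))))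
          where
           -- `Z` stays closed without `a`, and away from `a` the deletion of `ab` has no effect on
           -- `Z₃`, so `U` is closed in `H`.
           U = delete a (Z ∩ Z₃)
           U-shore : Shore U
           U-shore = record { col = λ r → col shore (meetˡ Z Z₃ r) ; plain = λ r → plain shore (meetˡ Z Z₃ r) }
           U-closed : ClosedUnder E U
           U-closed {z} {v} r e nv = delete-intro {X = Z ∩ Z₃} (∧-intro (closed (meetˡ Z Z₃ r) e nv) (cl₃ (meetʳ Z Z₃ r) (without-intro {D = E} e λ { (refl , _) → meet-≢ Z Z₃ r refl }) nv))
             (delete-≢ {X = Z} (closed⁻ (delete-intro {X = Z} (meetˡ Z Z₃ r) (meet-≢ Z Z₃ r)) e nv))
           μy∊U : μ y ∊ U
           μy∊U = delete-intro {X = Z ∩ Z₃} (∧-intro (closed x∊Z Exy plain-y) (μy∊₃)) λ e → a≢x (sym (b-only x∊Z (subst (λ w → E x w ≡ true) (trans (sym (μμ y)) (trans (cong μ e) μa)) Exy)))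
           x∉U : x ∉ U
           x∉U = ¬∊⇒∉ λ r → ∊∉ {X = Z₃} (meetʳ Z Z₃ r) (x∉₃)
           a∉U : a ∉ U
           a∉U = delete-∉ {a = a} {Z ∩ Z₃}
           seen : ∀ i → sp t i ∊ N U
           seen = closed-special U-shore U-closed μy∊U
           UX-shore : Shore (U ∩ X₁)
           UX-shore = record { col = λ {v} r → col U-shore (∧-elimˡ {U v} r) ; plain = λ {v} r → plain U-shore (∧-elimˡ {U v} r) }
           -- `U` sees both special vertices. The one missed by `X₂` can only be seen from inside
           -- `X₁`, by `not-adjacent`.
           crossing : ∃ λ u → u ∊ U ∩ X₁
           crossing with N-out {U} (seen i₂)
           ... | u , r , e with ∊? X₁ u
           ... | inj₁ u∊ = u , ∧-intro r u∊
           ... | inj₂ u∉ = ⊥-elim (not-adjacent (col U-shore r) u∉ e)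
           UX-col : ∀ {v} → v ∊ U ∪ X₁ → c v ≡ s
           UX-col = ∪-col {U} {X₁} (col U-shore) col-X
           upperUX : card (N (U ∪ X₁)) ≤ suc (card (U ∪ X₁))
           upperUX = linear (card U ∷ card X₁ ∷ card (N U) ∷ card (N X₁) ∷ card (U ∪ X₁) ∷ card (N (U ∪ X₁)) ∷ card (U ∩ X₁) ∷ card (N (U ∩ X₁)) ∷ [])
             ((♯ 2 ⊕ ′ # 6 ≼ ′ # 7) ∷ (′ # 7 ⊕ ′ # 5 ≼ ′ # 2 ⊕ ′ # 3) ∷ (′ # 2 ≼ ♯ 2 ⊕ ′ # 0) ∷ (′ # 3 ≼ ♯ 1 ⊕ ′ # 1) ∷ (′ # 0 ⊕ ′ # 1 ≼ ′ # 4 ⊕ ′ # 6) ∷ [])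
             (′ # 5 ≼ ♯ 1 ⊕ ′ # 4)
             (shore-lower UX-shore (proj₂ crossing) ∷ uncross E {U} {X₁} {N (U ∩ X₁)} (Nbr-mono E {U ∩ X₁} {U} λ {v} r → ∧-elimˡ {U v} r) (Nbr-mono E {U ∩ X₁} {X₁} λ {v} r → ∧-elimʳ {U v} r)
               ∷ closed-upper U-closed ∷ upper ∷ ≤-reflexive (sym (card-∪-∩ U X₁)) ∷ [])
           x∉UX : x ∉ U ∪ X₁
           x∉UX = ∨-false x∉U x∉
           -- The union sees both special vertices of the other class, so `brick` tolerates no
           -- second vertex outside it besides `x`.
           rest : ∀ {v} → c v ≡ s → v ∉ X₁ → v ≢ x → v ∊ U
           rest {v} cv v∉ ne = ¬∉⇒∊ λ v∉U → proj₂ (brick s (U ∪ X₁) UX-col (∨-introˡ μy∊U) x∉UX cx (∨-false v∉U v∉) cv (ne ∘ sym) upperUX)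
             λ i → Nbr-mono E {U} {U ∪ X₁} ∨-introˡ (seen i)
           b∉NUX : b ∉ N (U ∩ X₁)
           b∉NUX = Nbr-∉ E {U ∩ X₁} λ u r e → ∊∉ {X = U} (subst (_∊ U) (only (∧-elimʳ {U u} r) e) (∧-elimˡ {U u} r)) a∉U
           -- Seen from `U`, the vertex `b` would be one more common neighbour of `U` and `X₁`, and
           -- the union would lose its excess.
           b∉NU : b ∉ N U
           b∉NU = ¬∊⇒∉ λ b∊ → <-irrefl refl (linear (card U ∷ card X₁ ∷ card (N U) ∷ card (N X₁) ∷ card (U ∪ X₁) ∷ card (N (U ∪ X₁)) ∷ card (U ∩ X₁) ∷ card (N (U ∩ X₁)) ∷ card (insert b (N (U ∩ X₁))) ∷ [])
             ((♯ 2 ⊕ ′ # 6 ≼ ′ # 7) ∷ (′ # 8 ⊕ ′ # 5 ≼ ′ # 2 ⊕ ′ # 3) ∷ (′ # 2 ≼ ♯ 2 ⊕ ′ # 0) ∷ (′ # 3 ≼ ♯ 1 ⊕ ′ # 1) ∷ (′ # 0 ⊕ ′ # 1 ≼ ′ # 4 ⊕ ′ # 6) ∷ (♯ 1 ⊕ ′ # 7 ≼ ′ # 8) ∷ (♯ 1 ⊕ ′ # 4 ≼ ′ # 5) ∷ [])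
             (♯ 1 ≼ ♯ 0)
             (shore-lower UX-shore (proj₂ crossing)
               ∷ uncross E {U} {X₁} {insert b (N (U ∩ X₁))} (insert-⊆ {X = N (U ∩ X₁)} b∊ (Nbr-mono E {U ∩ X₁} {U} λ {v} r → ∧-elimˡ {U v} r)) (insert-⊆ {X = N (U ∩ X₁)} (N-in {X₁} a∊ Eb) (Nbr-mono E {U ∩ X₁} {X₁} λ {v} r → ∧-elimʳ {U v} r))
               ∷ closed-upper U-closed ∷ upper ∷ ≤-reflexive (sym (card-∪-∩ U X₁)) ∷ ≤-reflexive (sym (card-insert {X = N (U ∩ X₁)} b∉NUX))
               ∷ expand s (U ∪ X₁) UX-col (∨-introˡ μy∊U) x∉UX cx ∷ []))
           Nb : N ⁅ b ⁆ ⊆ insert a ⁅ x ⁆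
           Nb {v} r with N-out {⁅ b ⁆} r
           ... | u , u∊ , e with ∊⁅⁆⇒≡ u∊
           ... | refl with ∊? X₁ v | v ≟ x
           ... | inj₁ v∊ | _ = subst (_∊ insert a ⁅ x ⁆) (sym (only v∊ (E-sym e))) (insert-self a ⁅ x ⁆)
           ... | inj₂ v∉ | yes refl = insert-old a ⁅ x ⁆ (∊⁅⁆ x)
           ... | inj₂ v∉ | no ne = ⊥-elim (∊∉ {X = N U} (N-in {U} (rest (E-to-s e cb) v∉ ne) (E-sym e)) b∉NU)

  -- `partial` and `total` are applied to both orders of the two α-edges. When the same one applies
  -- twice, the two missed special vertices are `b` and `b'`. In the mixed cases it would identify
  -- one of them twice, so these are excluded: the lost vertex `x` of one α-set would lie in `Z` and
  -- in the other α-set, hence equal `a`.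
  triple⇒star : ∀ {a b b' d} → E a b ≡ true → E a b' ≡ true → E a d ≡ true → b ≢ b' → b ≢ d → b' ≢ d
    → AlphaSet a b → AlphaSet a b' → BetaSet a d → ∀ i → E a (sp t i) ≡ true
  triple⇒star {a} {b} {b'} {d} e e' e'' p q r S S' T = main (alpha-special S e e' e'' p q r) (alpha-special S' e' e e'' (p ∘ sym) r q)
   where
   main : (∃ λ i → Missed S (sp t i)) → (∃ λ i → Missed S' (sp t i)) → ∀ i → E a (sp t i) ≡ true
   main (i₁ , m) (i₂ , m') = result (outside X₁) (outside X₂)
    where
    module T₁ = Triple e e' e'' p q r S S' T m m'
    module T₂ = Triple e' e e'' (p ∘ sym) r q S' S T m' m
    open BetaSet T using (Z)
    X₁ = AlphaSet.X S
    X₂ = AlphaSet.X S'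
    conclude : sp t i₁ ≡ b → sp t i₂ ≡ b' → ∀ i → E a (sp t i) ≡ true
    conclude h h' i with bool-split T₁.i₁≢i₂ i
    ... | inj₁ refl = subst (λ w → E a w ≡ true) (sym h) e
    ... | inj₂ refl = subst (λ w → E a w ≡ true) (sym h') e'
    outside : ∀ X → (∃ λ v → c v ≡ s × v ∉ Z ∪ X) ⊎ (∀ {v} → c v ≡ s → v ∊ Z ⊎ v ∊ X)
    outside X with find (Col c s ∩ ∁ (Z ∪ X))
    ... | inj₁ (v , h) = inj₁ (v , Col-elim (∧-elimˡ {Col c s v} h) , not-true (∧-elimʳ {Col c s v} h))
    ... | inj₂ none = inj₂ λ {v} cv → case ∊? (Z ∪ X) v of λ { (inj₁ h) → ∨-elim {Z v} h ; (inj₂ h) → ⊥-elim (true≢false (∧-intro (Col-intro cv) (not-false h)) (none v)) }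
    Outside : FSet n → Set
    Outside X = (∃ λ v → c v ≡ s × v ∉ Z ∪ X) ⊎ (∀ {v} → c v ≡ s → v ∊ Z ⊎ v ∊ X)
    result : Outside X₁ → Outside X₂ → ∀ i → E a (sp t i) ≡ true
    result (inj₁ (_ , cv , v∉)) (inj₁ (_ , cv' , v∉')) = conclude (proj₁ (T₂.partial cv' v∉')) (proj₁ (T₁.partial cv v∉))
    result (inj₂ h) (inj₂ h') = conclude (T₁.total h) (T₂.total h')
    result (inj₁ (_ , cv , v∉)) (inj₂ h') = case h' (AlphaSet.cx S') of λ where
      (inj₁ x∊Z) → ⊥-elim (∊∉ {X = X₂} (subst (_∊ X₂) (sym (proj₂ (T₁.partial cv v∉) x∊Z T₂.x∊X₂)) (AlphaSet.a∊ S')) (AlphaSet.x∉ S'))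
      (inj₂ x∊) → ⊥-elim (∊∉ {X = X₂} x∊ (AlphaSet.x∉ S'))
    result (inj₂ h) (inj₁ (_ , cv' , v∉')) = case h (AlphaSet.cx S) of λ where
      (inj₁ x∊Z) → ⊥-elim (∊∉ {X = X₁} (subst (_∊ X₁) (sym (proj₂ (T₂.partial cv' v∉') x∊Z T₁.x∊X₂)) (AlphaSet.a∊ S)) (AlphaSet.x∉ S))
      (inj₂ x∊) → ⊥-elim (∊∉ {X = X₁} x∊ (AlphaSet.x∉ S))

  -- Each α-set at `a` leaves out `a'`, and through `a` it sees both special vertices, so by `brick`
  -- nothing else is outside. The two special vertices would then have only `a` and `a'` as
  -- neighbours, against expansion.
  star-unique : ∀ {a a'} → (∀ i → AlphaSet a (sp t i)) → (∀ i → E a (sp t i) ≡ true) → c a' ≡ s → (∀ i → E a' (sp t i) ≡ true) → a' ≡ a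
  star-unique {a} {a'} S e ca' e' with a' ≟ a
  ... | yes q = q
  ... | no ne = ⊥-elim (<-irrefl refl (≤-trans (s≤s (≤-reflexive (sym size))) (≤-trans big (≤-trans (card-mono {X = N Y} {insert a ⁅ a' ⁆} NY) (≤-reflexive (trans (card-insert {X = ⁅ a' ⁆} (≢⇒∉⁅⁆ (ne ∘ sym))) (cong suc (card-⁅⁆ a'))))))))
    where
    Y = insert (sp t true) ⁅ sp t false ⁆
    size : card Y ≡ 2
    size = trans (card-insert {X = ⁅ sp t false ⁆} (≢⇒∉⁅⁆ (sp-dist t))) (cong suc (card-⁅⁆ (sp t false)))
    Y-elim : ∀ {v} → v ∊ Y → ∃ λ i → v ≡ sp t i
    Y-elim p with insert-elim {a = sp t true} {X = ⁅ sp t false ⁆} p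
    ... | inj₁ q = true , q
    ... | inj₂ q = false , ∊⁅⁆⇒≡ q
    big : card Y < card (N Y)
    big = expand t Y (λ p → trans (cong c (proj₂ (Y-elim p))) (sp-col t (proj₁ (Y-elim p)))) (insert-self (sp t true) ⁅ sp t false ⁆)
      (insert-∉ {X = ⁅ sp t false ⁆} (proj₂ (proj₂ (third t)) true) (≢⇒∉⁅⁆ (proj₂ (proj₂ (third t)) false))) (proj₁ (proj₂ (third t)))
    few : ∀ i {v} → E v (sp t i) ≡ true → v ≡ a ⊎ v ≡ a'
    few i {v} h with v ≟ a'
    ... | yes q = inj₂ q
    ... | no v≢a' with ∊? (AlphaSet.X (S i)) v
    ... | inj₁ p = inj₁ (AlphaSet.only (S i) p h)
    ... | inj₂ v∉ = ⊥-elim (proj₂ (brick s X col-X a∊ v∉ (E-to-s (E-sym h) (sp-col t i)) a'∉ ca' v≢a' upper) λ j → N-in {X} a∊ (e j))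
      where
      open AlphaSet (S i)
      a'∉ : a' ∉ X
      a'∉ = ¬∊⇒∉ λ p → ne (only p (e' i))
    NY : N Y ⊆ insert a ⁅ a' ⁆
    NY {v} p with N-out {Y} p
    ... | u , q , r with Y-elim q
    ... | i , refl with few i (E-sym r)
    ... | inj₁ refl = insert-self v ⁅ a' ⁆
    ... | inj₂ refl = insert-old a ⁅ v ⁆ (∊⁅⁆ v)

  -- By `cover` the vertex `a'` lies in one of the α-sets. It sees the special vertex which that set
  -- misses, and inside the set only `a` can do so.
  two-alpha⇒star : ∀ {a b b' d a'} → E a b ≡ true → E a b' ≡ true → E a d ≡ true → b ≢ b' → b ≢ d → b' ≢ d
    → AlphaSet a b → AlphaSet a b' → c a' ≡ s → (∀ i → E a' (sp t i) ≡ true) → a' ≡ a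
  two-alpha⇒star {a' = a'} e e' e'' p q r S S' ca' h = main (alpha-special S e e' e'' p q r) (alpha-special S' e' e e'' (p ∘ sym) r q)
    where
    main : (∃ λ i → Missed S (sp t i)) → (∃ λ i → Missed S' (sp t i)) → a' ≡ _
    main (i₁ , m) (i₂ , m') = case Pair.cover e e' e'' p q r S S' ca' of λ where
      (inj₁ a'∊) → Pair.missed-adj e e' e'' p q r S S' m (h i₁) a'∊
      (inj₂ a'∊) → Pair.missed-adj e' e e'' (p ∘ sym) r q S' S m' (h i₂) a'∊

-- Matchings in graphs

∈-tabulate : ∀ {k} {X : FSet k} {v} → v ∊ X → v ∈ tabulate X
∈-tabulate {X = X} {v} p = lookup⇒[]= v (tabulate X) (trans (lookup∘tabulate X v) p)

tabulate-∈ : ∀ {k} {X : FSet k} {v} → v ∈ tabulate X → v ∊ X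
tabulate-∈ {X = X} {v} p = trans (sym (lookup∘tabulate X v)) ([]=⇒lookup p)

module _ {G : Graph} where

  joins-sym : ∀ {e u v} → Joins G e u v → Joins G e v u
  joins-sym (inj₁ (p , q)) = inj₂ (p , q)
  joins-sym (inj₂ (p , q)) = inj₁ (p , q)

  joins-inc : ∀ {e u v} → Joins G e u v → Inc G e u
  joins-inc (inj₁ (p , q)) = inj₁ p
  joins-inc (inj₂ (p , q)) = inj₂ q

  joins-ends : ∀ e → Joins G e (end₁ G e) (end₂ G e)
  joins-ends e = inj₁ (refl , refl)

  joins-≢ : ∀ {e u v} → Joins G e u v → u ≢ v
  joins-≢ {e} (inj₁ (refl , refl)) q = loopless G e q
  joins-≢ {e} (inj₂ (refl , refl)) q = loopless G e (sym q)

  joins-cases : ∀ {e u v x y} → Joins G e u v → Joins G e x y → (u ≡ x × v ≡ y) ⊎ (u ≡ y × v ≡ x)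
  joins-cases (inj₁ (refl , refl)) (inj₁ (refl , refl)) = inj₁ (refl , refl)
  joins-cases (inj₁ (refl , refl)) (inj₂ (refl , refl)) = inj₂ (refl , refl)
  joins-cases (inj₂ (refl , refl)) (inj₁ (refl , refl)) = inj₂ (refl , refl)
  joins-cases (inj₂ (refl , refl)) (inj₂ (refl , refl)) = inj₁ (refl , refl)

  joins-unique : ∀ {e u v w} → Joins G e u v → Joins G e u w → v ≡ w
  joins-unique j j' with joins-cases j j'
  ... | inj₁ (_ , q) = q
  ... | inj₂ (p , q) = ⊥-elim (joins-≢ j (sym q))

  inc-joins : ∀ {e v} → Inc G e v → ∃ λ u → Joins G e v u
  inc-joins {e} (inj₁ p) = end₂ G e , inj₁ (p , refl)
  inc-joins {e} (inj₂ p) = end₁ G e , inj₂ (refl , p)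

  inc? : ∀ e v → Dec (Inc G e v)
  inc? e v = (end₁ G e ≟ v) ⊎-dec (end₂ G e ≟ v)

  joins? : ∀ e u v → Dec (Joins G e u v)
  joins? e u v = ((end₁ G e ≟ u) ×-dec (end₂ G e ≟ v)) ⊎-dec ((end₁ G e ≟ v) ×-dec (end₂ G e ≟ u))

  inc-cases : ∀ {e u v w} → Joins G e u v → Inc G e w → w ≡ u ⊎ w ≡ v
  inc-cases (inj₁ (refl , refl)) (inj₁ p) = inj₁ (sym p)
  inc-cases (inj₁ (refl , refl)) (inj₂ p) = inj₂ (sym p)
  inc-cases (inj₂ (refl , refl)) (inj₁ p) = inj₂ (sym p)
  inc-cases (inj₂ (refl , refl)) (inj₂ p) = inj₁ (sym p)

  -- A perfect matching as an involution without fixed points. The edges are kept alongside, because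
  -- with parallel edges the partner does not determine the edge.
  record Partner (M : Subset (m G)) : Set where
    field
      p         : Fin (n G) → Fin (n G)
      pe        : Fin (n G) → Fin (m G)
      pe∈       : ∀ v → pe v ∈ M
      pe-joins  : ∀ v → Joins G (pe v) v (p v)
      pe-unique : ∀ {e v} → e ∈ M → Inc G e v → e ≡ pe v

    p-edge : ∀ {e u v} → e ∈ M → Joins G e u v → p u ≡ v
    p-edge {e} {u} {v} e∈ j = joins-unique (pe-joins u) (subst (λ g → Joins G g u v) (pe-unique e∈ (joins-inc j)) j)

    p-inv : ∀ v → p (p v) ≡ v
    p-inv v = p-edge (pe∈ v) (joins-sym (pe-joins v))

    p-inj : ∀ {u v} → p u ≡ p v → u ≡ v
    p-inj {u} {v} e = trans (sym (p-inv u)) (trans (cong p e) (p-inv v))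

    p-≢ : ∀ v → p v ≢ v
    p-≢ v e = joins-≢ (pe-joins v) (sym e)

  partner : ∀ {S M} → PerfectMatching G S M → Partner M
  partner {S} {M} (_ , cov , uniq) = record
    { p = λ v → proj₁ (inc-joins (proj₂ (proj₂ (cov v)))) ; pe = λ v → proj₁ (cov v) ; pe∈ = λ v → proj₁ (proj₂ (cov v))
    ; pe-joins = λ v → proj₂ (inc-joins (proj₂ (proj₂ (cov v)))) ; pe-unique = λ {e} {v} e∈ i → uniq v e (proj₁ (cov v)) e∈ (proj₁ (proj₂ (cov v))) i (proj₂ (proj₂ (cov v))) }

  pm-mono : ∀ {S S' : EdgeSet G} {M} → (∀ e → S e → S' e) → PerfectMatching G S M → PerfectMatching G S' M
  pm-mono h (sub , cov , uniq) = (λ e p → h e (sub e p)) , cov , uniq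

  reach-trans : ∀ {S u v w} → Reach G S u v → Reach G S v w → Reach G S u w
  reach-trans here r = r
  reach-trans (step e s j r) r' = step e s j (reach-trans r r')

  reach-sym : ∀ {S u v} → Reach G S u v → Reach G S v u
  reach-sym here = here
  reach-sym (step e s j r) = reach-trans (reach-sym r) (step e s (joins-sym j) here)

  reach-closed : ∀ {S u v} (C : FSet (n G)) → (∀ {e x y} → S e → Joins G e x y → x ∊ C → y ∊ C) → u ∊ C → Reach G S u v → v ∊ C
  reach-closed C h p here = p
  reach-closed C h p (step e s j r) = reach-closed C h (h s j p) r

  -- The component of `u` is grown one vertex at a time until no edge leaves it; the bound `k` on
  -- the vertices outside makes this terminate.
  reachable : ∀ {S : EdgeSet G} → (∀ e → Dec (S e)) → ∀ u →
    ∃ λ (C : FSet (n G)) → u ∊ C × (∀ {v} → v ∊ C → Reach G S u v) × (∀ {e x y} → S e → Joins G e x y → x ∊ C → y ∊ C)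
  reachable {S} S? u = grow _ ⁅ u ⁆ ≤-refl (∊⁅⁆ u) λ q → subst (Reach G S u) (sym (∊⁅⁆⇒≡ q)) here
    where
    grow : ∀ k (C : FSet (n G)) → card (∁ C) ≤ k → u ∊ C → (∀ {v} → v ∊ C → Reach G S u v) →
      ∃ λ (C : FSet (n G)) → u ∊ C × (∀ {v} → v ∊ C → Reach G S u v) × (∀ {e x y} → S e → Joins G e x y → x ∊ C → y ∊ C)
    grow k C le u∊ r with any? (λ e → any? (λ x → any? (λ y → S? e ×-dec joins? e x y ×-dec decBool (C x) ×-dec decBool (not (C y)))))
    ... | no none = C , u∊ , r , λ {e} {x} {y} se j p → ¬∉⇒∊ λ q → none (e , x , y , se , j , p , not-false q)
    grow zero C le u∊ r | yes (e , x , y , se , j , p , q) = ⊥-elim (<-irrefl refl (≤-trans (card-pos {X = ∁ C} q) le))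
    grow (suc k) C le u∊ r | yes (e , x , y , se , j , p , q) =
      grow k (insert y C) (s≤s⁻¹ (≤-trans shrink le)) (insert-old y C u∊) λ {v} h → case insert-elim {a = y} {X = C} h of λ where
        (inj₁ refl) → reach-trans (r p) (step e se j here)
        (inj₂ h') → r h'
      where
      shrink : suc (card (∁ (insert y C))) ≤ card (∁ C)
      shrink = ≤-trans (s≤s (card-mono {X = ∁ (insert y C)} {delete y (∁ C)} λ {v} h → delete-intro {X = ∁ C} (not-false (¬∊⇒∉ λ h' → true≢false (insert-old y C h') (not-true h)))
          λ { refl → true≢false (insert-self v C) (not-true h) })) (≤-reflexive (sym (card-delete {X = ∁ C} q)))

-- A two-colouring of H = G - {e₁, e₂} in which the deleted edge se s lies inside class s.
record Setup (G : Graph) : Set where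
  field
    c       : Fin (n G) → Bool
    se      : Bool → Fin (m G)
    se-col₁ : ∀ s → c (end₁ G (se s)) ≡ s
    se-col₂ : ∀ s → c (end₂ G (se s)) ≡ s
    bip     : ∀ e → (∀ s → e ≢ se s) → c (end₁ G e) ≢ c (end₂ G e)
    mcH     : MatchingCoveredOn G (λ e → ∀ s → e ≢ se s)

module Balance (G : Graph) (c : Fin (n G) → Bool) (e₁ e₂ : Fin (m G))
  (bip : ∀ e → Minus2 G e₁ e₂ e → c (end₁ G e) ≢ c (end₂ G e)) (mc : MatchingCoveredOn G (Minus2 G e₁ e₂)) where

  opposite : ∀ {x y : Bool} → x ≢ y → y ≡ not x
  opposite {true} {true} h = ⊥-elim (h refl)
  opposite {true} {false} h = refl
  opposite {false} {true} h = refl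
  opposite {false} {false} h = ⊥-elim (h refl)

  bip-joins : ∀ {e u v} → Minus2 G e₁ e₂ e → Joins G e u v → c v ≡ not (c u)
  bip-joins {e} s (inj₁ (refl , refl)) = opposite (bip e s)
  bip-joins {e} s (inj₂ (refl , refl)) = opposite (bip e s ∘ sym)

  some-edge : ∀ {u v} → u ≢ v → Reach G (Minus2 G e₁ e₂) u v → ∃ λ e → Minus2 G e₁ e₂ e
  some-edge ne here = ⊥-elim (ne refl)
  some-edge ne (step e s _ _) = e , s

  -- Connectivity gives `H` an edge, hence a perfect matching, and this matching pairs the two
  -- colours.
  balance : ∀ s → card (Col c s) ≤ card (Col c (not s))
  balance s with some-edge (loopless G e₁) (proj₁ (proj₂ mc) (end₁ G e₁) (end₂ G e₁))
  ... | e , se with proj₂ (proj₂ mc) e se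
  ... | M , pm , _ = card-injection p (Col c s) (Col c (not s)) (λ {v} q → Col-intro (trans (bip-joins (proj₁ pm (pe v) (pe∈ v)) (pe-joins v)) (cong not (Col-elim q)))) (λ _ _ → p-inj)
    where open Partner (partner {G} pm)

  balance≡ : ∀ s → card (Col c s) ≡ card (Col c (not s))
  balance≡ s = ≤-antisym (balance s) (≤-trans (balance (not s)) (≤-reflexive (cong (λ r → card (Col c r)) (not-involutive s))))

  -- Otherwise the partner map injects class not s into class s minus an end of e.
  mono-partner : ∀ {s e e'} → (∀ g → g ≢ e → g ≢ e' → Minus2 G e₁ e₂ g) → c (end₁ G e) ≡ s → c (end₂ G e) ≡ s →
    ∀ {S M} → PerfectMatching G S M → e ∈ M → e' ∈ M × c (end₁ G e') ≡ not s × c (end₂ G e') ≡ not s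
  mono-partner {s} {e} {e'} min h₁ h₂ {S} {M} pm e∈ with (e' ∈? M) ×-dec ((c (end₁ G e') ≟ᵇ not s) ×-dec (c (end₂ G e') ≟ᵇ not s))
  ... | yes r = r
  ... | no none = ⊥-elim (<-irrefl refl (≤-trans (≤-trans (≤-reflexive (sym (card-delete {X = Col c s} (Col-intro h₁)))) (≤-reflexive (balance≡ s)))
        (card-injection p (Col c (not s)) (delete (end₁ G e) (Col c s)) inside (λ _ _ → p-inj))))
    where
    open Partner (partner {G} pm)
    col : ∀ {v} → c v ≡ not s → c (p v) ≡ s
    col {v} q with pe v ≟ e | pe v ≟ e'
    ... | yes r | _ = ⊥-elim (not≢ {s} (trans (mono (subst (λ g → Joins G g v (p v)) r (pe-joins v))) q))
      where
      mono : ∀ {u w} → Joins G e u w → s ≡ c u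
      mono (inj₁ (refl , _)) = sym h₁
      mono (inj₂ (_ , refl)) = sym h₂
    ... | no r | no r' = trans (bip-joins (min (pe v) r r') (pe-joins v)) (trans (cong not q) (not-involutive s))
    ... | no r | yes r' with c (p v) ≟ᵇ s
    ... | yes h = h
    ... | no h = ⊥-elim (none (subst (_∈ M) r' (pe∈ v) , ends (subst (λ g → Joins G g v (p v)) r' (pe-joins v))))
      where
      cp : c (p v) ≡ not s
      cp = opposite (h ∘ sym)
      ends : Joins G e' v (p v) → c (end₁ G e') ≡ not s × c (end₂ G e') ≡ not s
      ends (inj₁ (h , h')) = trans (cong c h) q , trans (cong c h') cp
      ends (inj₂ (h , h')) = trans (cong c h) cp , trans (cong c h') q
    inside : ∀ {v} → v ∊ Col c (not s) → p v ∊ delete (end₁ G e) (Col c s)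
    inside {v} q = delete-intro {X = Col c s} (Col-intro (col (Col-elim q))) λ r → not≢ {s} (trans (sym h₂) (trans (cong c (trans (sym (p-edge e∈ (joins-ends {G} e))) (trans (cong p (sym r)) (p-inv v)))) (Col-elim q)))

reach-mono : ∀ {G S S' u v} → (∀ e → S e → S' e) → Reach G S u v → Reach G S' u v
reach-mono h here = here
reach-mono h (step e s j r) = step e (h e s) j (reach-mono h r)

mc-cong : ∀ {G} {S S' : EdgeSet G} → (∀ e → S e → S' e) → (∀ e → S' e → S e) → MatchingCoveredOn G S → MatchingCoveredOn G S'
mc-cong {G} h h' (two , con , cov) = two , (λ u v → reach-mono h (con u v)) , λ e s → case cov e (h' e s) of λ { (M , pm , e∈) → M , pm-mono {G} h pm , e∈ }

-- If `e₁` joined different colours, then so would `e₂`, by `mono-partner` with the roles exchanged,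
-- and `G` would be bipartite. So `e₁` lies inside a class, and `mono-partner` puts `e₂` into the
-- other one.
setup : ∀ G → NearBipartite G → Setup G
setup G (mcG , nonbip , e₁ , e₂ , e₁≢e₂ , (c , bip) , mc) = build (c (end₁ G e₁) ≟ᵇ c (end₂ G e₁))
  where
  open Balance G c e₁ e₂ bip mc
  make : ∀ {s} → c (end₁ G e₁) ≡ s → c (end₂ G e₁) ≡ s → c (end₁ G e₂) ≡ not s → c (end₂ G e₂) ≡ not s → Setup G
  make {true} h₁ h₂ h₃ h₄ = record { c = c ; se = λ b → if b then e₁ else e₂ ; se-col₁ = λ { true → h₁ ; false → h₃ } ; se-col₂ = λ { true → h₂ ; false → h₄ }
    ; bip = λ e h → bip e (h true , h false) ; mcH = mc-cong (λ { e h true → proj₁ h ; e h false → proj₂ h }) (λ e h → h true , h false) mc }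
  make {false} h₁ h₂ h₃ h₄ = record { c = c ; se = λ b → if b then e₂ else e₁ ; se-col₁ = λ { true → h₃ ; false → h₁ } ; se-col₂ = λ { true → h₄ ; false → h₂ }
    ; bip = λ e h → bip e (h false , h true) ; mcH = mc-cong (λ { e h true → proj₂ h ; e h false → proj₁ h }) (λ e h → h false , h true) mc }
  build : Dec (c (end₁ G e₁) ≡ c (end₂ G e₁)) → Setup G
  build (yes h) with proj₂ (proj₂ mcG) e₁ tt
  ... | M , pm , e∈ with mono-partner (λ g p q → p , q) refl (sym h) pm e∈
  ... | _ , h₃ , h₄ = make refl (sym h) h₃ h₄
  build (no h) = ⊥-elim (nonbip (c , λ e _ → check e))
    where
    mono₂ : c (end₁ G e₂) ≢ c (end₂ G e₂)
    mono₂ h' with proj₂ (proj₂ mcG) e₂ tt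
    ... | M , pm , e∈ with mono-partner (λ g p q → q , p) refl (sym h') pm e∈
    ... | _ , h₃ , h₄ = h (trans h₃ (sym h₄))
    check : ∀ e → c (end₁ G e) ≢ c (end₂ G e)
    check e with e ≟ e₁ | e ≟ e₂
    ... | yes refl | _ = h
    ... | no _ | yes refl = mono₂
    ... | no p | no q = bip e (p , q)

∣tabulate∣ : ∀ {k} (X : FSet k) → ∣ tabulate X ∣ ≡ card X
∣tabulate∣ X = trans (go X) (sym (card-sum X))
  where
  go : ∀ {k} (X : FSet k) → ∣ tabulate X ∣ ≡ sum (λ v → ind (X v))
  go {zero} X = refl
  go {suc k} X with X zero
  ... | true = cong suc (go (X ∘ suc))
  ... | false = go (X ∘ suc)

∣∁tabulate∣ : ∀ {k} (X : FSet k) → ∣ ∁ˢ (tabulate X) ∣ ≡ card (∁ X)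
∣∁tabulate∣ X = trans (cong ∣_∣ (sym (tabulate-∘ not X))) (∣tabulate∣ (∁ X))

card-full : ∀ {k} → card {k} (λ _ → true) ≡ k
card-full {k} = trans (card-sum {k} (λ _ → true)) (go k)
  where
  go : ∀ k → sum {k} (λ _ → 1) ≡ k
  go zero = refl
  go (suc k) = cong suc (go k)

-- The near-bipartite structure of a brick

module FromGraph (G : Graph) (mcG : MatchingCovered G)
  (no-tight : ∀ (X : Subset (n G)) → 2 ≤ ∣ X ∣ → 2 ≤ ∣ ∁ˢ X ∣ → ¬ TightCut G X)
  (St : Setup G) (six : 6 ≤ n G) where

  open Setup St public

  PlainEdge : EdgeSet G
  PlainEdge e = ∀ s → e ≢ se s

  plain? : ∀ e → Dec (PlainEdge e)
  plain? e with e ≟ se true | e ≟ se false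
  ... | yes p | _ = no λ h → h true p
  ... | no _ | yes q = no λ h → h false q
  ... | no p | no q = yes λ { true → p ; false → q }

  special-edge : ∀ {e} → ¬ PlainEdge e → ∃ λ s → e ≡ se s
  special-edge {e} h with e ≟ se true | e ≟ se false
  ... | yes p | _ = true , p
  ... | no _ | yes q = false , q
  ... | no p | no q = ⊥-elim (h λ { true → p ; false → q })

  private
    bip₂ : ∀ e → Minus2 G (se true) (se false) e → c (end₁ G e) ≢ c (end₂ G e)
    bip₂ e (p , q) = bip e λ { true → p ; false → q }
    mc₂ : MatchingCoveredOn G (Minus2 G (se true) (se false))
    mc₂ = mc-cong {G} (λ e h → h true , h false) (λ { e (p , q) true → p ; e (p , q) false → q }) mcH

  open Balance G c (se true) (se false) bip₂ mc₂ using (opposite; balance≡; mono-partner; bip-joins)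

  plain-joins : ∀ {e u v} → PlainEdge e → Joins G e u v → c v ≡ not (c u)
  plain-joins p j = bip-joins (p true , p false) j

  sp : Bool → Bool → Fin (n G)
  sp s true = end₁ G (se s)
  sp s false = end₂ G (se s)

  sp-col : ∀ s i → c (sp s i) ≡ s
  sp-col s true = se-col₁ s
  sp-col s false = se-col₂ s

  sp-joins : ∀ s i → Joins G (se s) (sp s i) (sp s (not i))
  sp-joins s true = inj₁ (refl , refl)
  sp-joins s false = inj₂ (refl , refl)

  sp-inc : ∀ {s v} → Inc G (se s) v → ∃ λ i → v ≡ sp s i
  sp-inc (inj₁ p) = true , sym p
  sp-inc (inj₂ p) = false , sym p

  kind : ∀ {S M} → PerfectMatching G S M → (∀ s → se s ∈ M) ⊎ (∀ s → ¬ se s ∈ M)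
  kind {S} {M} pm with se true ∈? M | se false ∈? M
  ... | yes p | yes q = inj₁ λ { true → p ; false → q }
  ... | no p | no q = inj₂ λ { true → p ; false → q }
  ... | yes p | no q = ⊥-elim (q (proj₁ (mono-partner {e = se true} {se false} (λ g h h' → h , h') refl (trans (se-col₂ true) (sym (se-col₁ true))) pm p)))
  ... | no p | yes q = ⊥-elim (p (proj₁ (mono-partner {e = se false} {se true} (λ g h h' → h' , h) refl (trans (se-col₂ false) (sym (se-col₁ false))) pm q)))

  opaque
    E : Rel (n G)
    E u v = ⌊ any? (λ e → plain? e ×-dec joins? {G} e u v) ⌋

    E-intro : ∀ {e u v} → PlainEdge e → Joins G e u v → E u v ≡ true
    E-intro {e} {u} {v} p j = ⌊⌋-intro (any? (λ e → plain? e ×-dec joins? {G} e u v)) (e , p , j)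

    E-elim : ∀ {u v} → E u v ≡ true → ∃ λ e → PlainEdge e × Joins G e u v
    E-elim {u} {v} h = ⌊⌋-elim (any? (λ e → plain? e ×-dec joins? {G} e u v)) h

  E-sym : ∀ {u v} → E u v ≡ true → E v u ≡ true
  E-sym h with E-elim h
  ... | e , p , j = E-intro p (joins-sym {G} j)

  E-col : ∀ {u v} → E u v ≡ true → c v ≡ not (c u)
  E-col h with E-elim h
  ... | e , p , j = plain-joins p j

  -- Were `Nbr E X` no larger than `X`, every perfect matching of `H` would match `X` onto it. No
  -- edge of `H` could then leave their union, against connectivity.
  expand : ∀ s X {x u} → (∀ {v} → v ∊ X → c v ≡ s) → x ∊ X → u ∉ X → c u ≡ s → card X < card (Nbr E X)
  expand s X {x} {u} sub x∊ u∉ cu with card (Nbr E X) ≤? card X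
  ... | no h = ≰⇒> h
  ... | yes le = ⊥-elim (out (reach-closed C stays (∨-introˡ x∊) (proj₁ (proj₂ mcH) x u)))
    where
    C = X ∪ Nbr E X
    out : u ∊ C → ⊥
    out h with ∨-elim {X u} h
    ... | inj₁ p = ∊∉ {X = X} p u∉
    ... | inj₂ p with Nbr-elim E {X} p
    ... | w , q , r = not≢ {s} (trans (sym cu) (trans (E-col r) (cong not (sub q))))
    stays : ∀ {e v w} → PlainEdge e → Joins G e v w → v ∊ C → w ∊ C
    stays {e} {v} {w} pe' j h with ∨-elim {X v} h
    ... | inj₁ p = ∨-introʳ {X w} (Nbr-intro E {X} p (E-intro pe' j))
    ... | inj₂ p with proj₂ (proj₂ mcH) e pe'
    ... | M , pm , e∈ = ∨-introˡ (back (card-surjection q X (Nbr E X) (λ {z} r → Nbr-intro E {X} r (E-intro (proj₁ pm _ (pe∈ z)) (pe-joins z))) (λ _ _ → p-inj) le p))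
      where
      open Partner (partner {G} pm) renaming (p to q)
      back : (∃ λ z → z ∊ X × q z ≡ v) → w ∊ X
      back (z , z∊ , e) = subst (_∊ X) (trans (sym (p-inv z)) (trans (cong q e) (p-edge e∈ j))) z∊

  module Crossing (s : Bool) (X : FSet (n G)) (sub : ∀ {v} → v ∊ X → c v ≡ s) (size : card (Nbr E X) ≡ suc (card X))
                  {M : Subset (m G)} (pm : PerfectMatching G (All G) M) where
    open Partner (partner {G} pm)
    t = not s
    NX = Nbr E X
    Z = X ∪ NX
    pre : FSet (n G) → FSet (n G)
    pre Y v = Y (p v)
    -- `P'` and `Q'` are the vertices of `X` and `NX` not matched to the other of the two sets.
    -- Index 2 means that the partner lies in the same set, index 3 that the matching edge leaves
    -- `Z`.
    P' = X ∩ ∁ (pre NX)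
    P₂ = P' ∩ pre X
    P₃ = P' ∩ ∁ (pre X)
    Q' = NX ∩ ∁ (pre X)
    Q₂ = Q' ∩ pre NX
    Q₃ = Q' ∩ ∁ (pre NX)
    K : FSet (n G)
    K v = Z v ∧ not (Z (p v))

    NX-col : ∀ {v} → v ∊ NX → c v ≡ t
    NX-col h with Nbr-elim E {X} h
    ... | u , q , r = trans (E-col r) (cong not (sub q))

    X-not-NX : ∀ {v} → v ∊ X → v ∉ NX
    X-not-NX h = ¬∊⇒∉ λ h' → not≢ {s} (trans (sym (sub h)) (NX-col h'))

    plain-p : ∀ {v} → PlainEdge (pe v) → v ∊ X → p v ∊ NX
    plain-p h q = Nbr-intro E {X} q (E-intro h (pe-joins _))

    P₁≤Q₁ : card (X ∩ pre NX) ≤ card (NX ∩ pre X)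
    P₁≤Q₁ = card-injection p (X ∩ pre NX) (NX ∩ pre X) (λ {v} h → ∧-intro (∧-elimʳ {X v} h) (subst (_∊ X) (sym (p-inv v)) (∧-elimˡ {X v} h))) (λ _ _ → p-inj)

    Q₁≤P₁ : card (NX ∩ pre X) ≤ card (X ∩ pre NX)
    Q₁≤P₁ = card-injection p (NX ∩ pre X) (X ∩ pre NX) (λ {v} h → ∧-intro (∧-elimʳ {NX v} h) (subst (_∊ NX) (sym (p-inv v)) (∧-elimˡ {NX v} h))) (λ _ _ → p-inj)

    ρ : Vec ℕ 10
    ρ = card X ∷ card NX ∷ card (X ∩ pre NX) ∷ card P' ∷ card P₂ ∷ card P₃ ∷ card (NX ∩ pre X) ∷ card Q' ∷ card Q₂ ∷ card Q₃ ∷ []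

    -- The pairs matched between `X` and `NX` cancel, which leaves the one vertex by which `NX` is
    -- larger.
    count≤ : card Q₂ + card Q₃ ≤ suc (card P₂ + card P₃)
    count≤ = linear ρ ((′ # 1 ≼ ♯ 1 ⊕ ′ # 0) ∷ (′ # 0 ≼ ′ # 2 ⊕ ′ # 3) ∷ (′ # 3 ≼ ′ # 4 ⊕ ′ # 5) ∷ (′ # 6 ⊕ ′ # 7 ≼ ′ # 1) ∷ (′ # 8 ⊕ ′ # 9 ≼ ′ # 7) ∷ (′ # 2 ≼ ′ # 6) ∷ [])
      (′ # 8 ⊕ ′ # 9 ≼ ♯ 1 ⊕ (′ # 4 ⊕ ′ # 5))
      (≤-reflexive size ∷ ≤-reflexive (sym (card-partition X (pre NX))) ∷ ≤-reflexive (sym (card-partition P' (pre X))) ∷ ≤-reflexive (card-partition NX (pre X)) ∷ ≤-reflexive (card-partition Q' (pre NX)) ∷ P₁≤Q₁ ∷ [])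

    count≥ : suc (card P₂ + card P₃) ≤ card Q₂ + card Q₃
    count≥ = linear ρ ((♯ 1 ⊕ ′ # 0 ≼ ′ # 1) ∷ (′ # 2 ⊕ ′ # 3 ≼ ′ # 0) ∷ (′ # 4 ⊕ ′ # 5 ≼ ′ # 3) ∷ (′ # 1 ≼ ′ # 6 ⊕ ′ # 7) ∷ (′ # 7 ≼ ′ # 8 ⊕ ′ # 9) ∷ (′ # 6 ≼ ′ # 2) ∷ [])
      (♯ 1 ⊕ (′ # 4 ⊕ ′ # 5) ≼ ′ # 8 ⊕ ′ # 9)
      (≤-reflexive (sym size) ∷ ≤-reflexive (card-partition X (pre NX)) ∷ ≤-reflexive (card-partition P' (pre X)) ∷ ≤-reflexive (sym (card-partition NX (pre X))) ∷ ≤-reflexive (sym (card-partition Q' (pre NX))) ∷ Q₁≤P₁ ∷ [])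

    P₂-stable : ∀ {v} → v ∊ P₂ → p v ∊ P₂
    P₂-stable {v} h = ∧-intro (∧-intro pv∊ (not-false (subst (_∉ NX) (sym (p-inv v)) (X-not-NX v∊)))) (subst (_∊ X) (sym (p-inv v)) v∊)
      where
      v∊ = ∧-elimˡ {X v} (∧-elimˡ {P' v} h)
      pv∊ = ∧-elimʳ {P' v} h

    Q₂-stable : ∀ {v} → v ∊ Q₂ → p v ∊ Q₂
    Q₂-stable {v} h = ∧-intro (∧-intro pv∊ (not-false (subst (_∉ X) (sym (p-inv v)) (¬∊⇒∉ λ h' → ∊∉ {X = NX} v∊ (X-not-NX h'))))) (subst (_∊ NX) (sym (p-inv v)) v∊)
      where
      v∊ = ∧-elimˡ {NX v} (∧-elimˡ {Q' v} h)
      pv∊ = ∧-elimʳ {Q' v} h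

    -- All that is used of parity: a set stable under an involution without fixed points cannot be a
    -- singleton.
    even : ∀ (Y : FSet (n G)) → (∀ {v} → v ∊ Y → p v ∊ Y) → card Y ≡ 0 ⊎ 2 ≤ card Y
    even Y st with find Y
    ... | inj₁ (v , h) = inj₂ (card-pair {X = Y} (p-≢ v ∘ sym) h (st h))
    ... | inj₂ h = inj₁ (card-∅ {X = Y} h)

    Crossed : Set
    Crossed = card P₃ + card Q₃ ≡ 1

    no-P' : (∀ v → v ∉ P') → Crossed
    no-P' h = decide (even Q₂ Q₂-stable)
      where
      P₂0 : card P₂ ≡ 0
      P₂0 = card-∅ {X = P₂} λ v → ¬∊⇒∉ λ q → ∊∉ {X = P'} (∧-elimˡ {P' v} q) (h v)
      P₃0 : card P₃ ≡ 0
      P₃0 = card-∅ {X = P₃} λ v → ¬∊⇒∉ λ q → ∊∉ {X = P'} (∧-elimˡ {P' v} q) (h v)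
      arith : ∀ {p₂ p₃ q₂ q₃} → p₂ ≡ 0 → p₃ ≡ 0 → q₂ ≡ 0 ⊎ 2 ≤ q₂ → q₂ + q₃ ≤ suc (p₂ + p₃) → suc (p₂ + p₃) ≤ q₂ + q₃ → p₃ + q₃ ≡ 1
      arith refl refl (inj₁ refl) le ge = ≤-antisym le ge
      arith refl refl (inj₂ (s≤s (s≤s _))) (s≤s ()) ge
      decide : card Q₂ ≡ 0 ⊎ 2 ≤ card Q₂ → Crossed
      decide d = arith P₂0 P₃0 d count≤ count≥

    crossed-plain : (∀ s → ¬ se s ∈ M) → Crossed
    crossed-plain h = no-P' λ v → ¬∊⇒∉ λ q → true≢false (plain-p (λ r e → h r (subst (_∈ M) e (pe∈ v))) (∧-elimˡ {X v} q)) (not-true (∧-elimʳ {X v} q))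

    P'-special : ∀ {v} → v ∊ P' → ∃ λ i → v ≡ sp s i
    P'-special {v} h with plain? (pe v)
    ... | yes q = ⊥-elim (true≢false (plain-p q (∧-elimˡ {X v} h)) (not-true (∧-elimʳ {X v} h)))
    ... | no q with special-edge q
    ... | r , e with sp-inc (subst (λ g → Inc G g v) e (joins-inc {G} (pe-joins v)))
    ... | i , refl with trans (sym (sp-col r i)) (sub (∧-elimˡ {X v} h))
    ... | refl = i , refl

    crossed-outside : (∀ i → sp s i ∉ X) → Crossed
    crossed-outside h = no-P' λ v → ¬∊⇒∉ λ q → case P'-special q of λ { (i , refl) → ∊∉ {X = X} (∧-elimˡ {X v} q) (h i) }

    pair-card : ∀ r → card (insert (sp r true) ⁅ sp r false ⁆) ≡ 2
    pair-card r = trans (card-insert {X = ⁅ sp r false ⁆} (≢⇒∉⁅⁆ (loopless G (se r)))) (cong suc (card-⁅⁆ (sp r false)))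

    in-pair : ∀ {r v} → (∃ λ i → v ≡ sp r i) → v ∊ insert (sp r true) ⁅ sp r false ⁆
    in-pair {r} (true , refl) = insert-self (sp r true) ⁅ sp r false ⁆
    in-pair {r} (false , refl) = insert-old (sp r true) ⁅ sp r false ⁆ (∊⁅⁆ (sp r false))

    -- `Q₂` consists of exactly the two ends of the deleted edge of the other class. In `P'` at most
    -- two vertices remain; either both are partners of each other, or at most one of them leaves
    -- `Z`. In each case one crossing is left.
    crossed-both : (∀ s → se s ∈ M) → (∀ i → sp t i ∊ NX) → Crossed
    crossed-both h g = decide (even P₂ P₂-stable)
      where
      p-sp : ∀ r i → p (sp r i) ≡ sp r (not i)
      p-sp r i = p-edge (h r) (sp-joins r i)
      Q₂-sp : ∀ i → sp t i ∊ Q₂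
      Q₂-sp i = ∧-intro (∧-intro (g i) (not-false (subst (_∉ X) (sym (p-sp t i)) (¬∊⇒∉ λ h' → ∊∉ {X = NX} (g (not i)) (X-not-NX h'))))) (subst (_∊ NX) (sym (p-sp t i)) (g (not i)))
      Q₂≥ : 2 ≤ card Q₂
      Q₂≥ = card-pair {X = Q₂} (loopless G (se t)) (Q₂-sp true) (Q₂-sp false)
      Q₂-special : ∀ {v} → v ∊ Q₂ → ∃ λ i → v ≡ sp t i
      Q₂-special {v} q with plain? (pe v)
      ... | yes r = ⊥-elim (not≢ {t} (trans (sym (NX-col (∧-elimʳ {Q' v} q))) (trans (plain-joins r (pe-joins v)) (cong not (NX-col (∧-elimˡ {NX v} (∧-elimˡ {Q' v} q)))))))
      ... | no r with special-edge r
      ... | r' , e with sp-inc (subst (λ g → Inc G g v) e (joins-inc {G} (pe-joins v)))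
      ... | i , refl with trans (sym (sp-col r' i)) (NX-col (∧-elimˡ {NX v} (∧-elimˡ {Q' v} q)))
      ... | refl = i , refl
      Q₂≤ : card Q₂ ≤ 2
      Q₂≤ = ≤-trans (card-mono {X = Q₂} {insert (sp t true) ⁅ sp t false ⁆} (λ q → in-pair (Q₂-special q))) (≤-reflexive (pair-card t))
      P'≤ : card P₂ + card P₃ ≤ 2
      P'≤ = ≤-trans (≤-reflexive (card-partition P' (pre X))) (≤-trans (card-mono {X = P'} {insert (sp s true) ⁅ sp s false ⁆} (λ q → in-pair (P'-special q))) (≤-reflexive (pair-card s)))
      P₃-unique : ∀ u v → u ∊ P₃ → v ∊ P₃ → u ≡ v
      P₃-unique u v hu hv with P'-special (∧-elimˡ {P' u} hu) | P'-special (∧-elimˡ {P' v} hv)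
      ... | i , refl | j , refl with bool-split {i} {not i} not≢ j
      ... | inj₁ refl = refl
      ... | inj₂ refl = ⊥-elim (true≢false (∧-elimˡ {X (sp s (not i))} (∧-elimˡ {P' (sp s (not i))} hv)) (subst (_∉ X) (p-sp s i) (not-true (∧-elimʳ {P' (sp s i)} hu))))
      P₃≤ : card P₃ ≤ 1
      P₃≤ = card≤1 {X = P₃} P₃-unique
      arith : ∀ {p₂ p₃ q₂ q₃} → p₂ ≡ 0 ⊎ 2 ≤ p₂ → 2 ≤ q₂ → q₂ ≤ 2 → p₂ + p₃ ≤ 2 → p₃ ≤ 1 → q₂ + q₃ ≤ suc (p₂ + p₃) → suc (p₂ + p₃) ≤ q₂ + q₃ → p₃ + q₃ ≡ 1
      arith {p₂} {p₃} {q₂} {q₃} (inj₁ refl) a b _ d e f = ≤-antisym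
        (linear (p₃ ∷ q₂ ∷ q₃ ∷ []) ((♯ 2 ≼ ′ # 1) ∷ (′ # 0 ≼ ♯ 1) ∷ (′ # 0 ≼ ♯ 1) ∷ (′ # 1 ⊕ ′ # 2 ≼ ♯ 1 ⊕ ′ # 0) ∷ []) (′ # 0 ⊕ ′ # 2 ≼ ♯ 1) (a ∷ d ∷ d ∷ e ∷ []))
        (linear (p₃ ∷ q₂ ∷ q₃ ∷ []) ((♯ 2 ≼ ′ # 1) ∷ (′ # 1 ⊕ ′ # 2 ≼ ♯ 1 ⊕ ′ # 0) ∷ []) (♯ 1 ≼ ′ # 0 ⊕ ′ # 2) (a ∷ e ∷ []))
      arith {p₂} {p₃} {q₂} {q₃} (inj₂ z) a b c' d e f = ≤-antisym
        (linear (p₂ ∷ p₃ ∷ q₂ ∷ q₃ ∷ []) ((♯ 2 ≼ ′ # 2) ∷ (♯ 2 ≼ ′ # 0) ∷ (′ # 0 ⊕ ′ # 1 ≼ ♯ 2) ∷ (′ # 0 ⊕ ′ # 1 ≼ ♯ 2) ∷ (′ # 2 ⊕ ′ # 3 ≼ ♯ 1 ⊕ (′ # 0 ⊕ ′ # 1)) ∷ []) (′ # 1 ⊕ ′ # 3 ≼ ♯ 1) (a ∷ z ∷ c' ∷ c' ∷ e ∷ []))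
        (linear (p₂ ∷ p₃ ∷ q₂ ∷ q₃ ∷ []) ((′ # 2 ≼ ♯ 2) ∷ (♯ 2 ≼ ′ # 0) ∷ (♯ 1 ⊕ (′ # 0 ⊕ ′ # 1) ≼ ′ # 2 ⊕ ′ # 3) ∷ []) (♯ 1 ≼ ′ # 1 ⊕ ′ # 3) (b ∷ z ∷ f ∷ []))
      decide : card P₂ ≡ 0 ⊎ 2 ≤ card P₂ → Crossed
      decide d = arith d Q₂≥ Q₂≤ P'≤ P₃≤ count≤ count≥

    P₃⊆K : P₃ ⊆ K
    P₃⊆K {v} h = ∧-intro (∨-introˡ (∧-elimˡ {X v} (∧-elimˡ {P' v} h))) (not-false (∨-false (not-true (∧-elimʳ {P' v} h)) (not-true (∧-elimʳ {X v} (∧-elimˡ {P' v} h)))))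

    Q₃⊆K : Q₃ ⊆ K
    Q₃⊆K {v} h = ∧-intro (∨-introʳ {X v} (∧-elimˡ {NX v} (∧-elimˡ {Q' v} h))) (not-false (∨-false (not-true (∧-elimʳ {NX v} (∧-elimˡ {Q' v} h))) (not-true (∧-elimʳ {Q' v} h))))

    ∨-falseˡ : ∀ {a b} → a ∨ b ≡ false → a ≡ false
    ∨-falseˡ {false} h = refl

    ∨-falseʳ : ∀ {a b} → a ∨ b ≡ false → b ≡ false
    ∨-falseʳ {false} h = h

    K⊆ : K ⊆ P₃ ∪ Q₃
    K⊆ {v} h with ∨-elim {X v} (∧-elimˡ {Z v} h) | not-true (∧-elimʳ {Z v} h)
    ... | inj₁ q | r = ∨-introˡ (∧-intro (∧-intro q (not-false (∨-falseʳ {X (p v)} r))) (not-false (∨-falseˡ r)))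
    ... | inj₂ q | r = ∨-introʳ {P₃ v} (∧-intro (∧-intro q (not-false (∨-falseˡ r))) (not-false (∨-falseʳ {X (p v)} r)))

    tight : Crossed → (∃ λ e → e ∈ M × InCut G (tabulate Z) e) × (∀ e e' → e ∈ M → InCut G (tabulate Z) e → e' ∈ M → InCut G (tabulate Z) e' → e ≡ e')
    tight cr = witness (card-nonempty (P₃ ∪ Q₃) (≤-trans (s≤s z≤n) (≤-trans (≤-reflexive (sym cr)) (≤-reflexive (sym (card-disjoint-∪ P₃ Q₃ λ v h → ¬∊⇒∉ λ h' → ∊∉ {X = NX} (∧-elimˡ {NX v} (∧-elimˡ {Q' v} h')) (X-not-NX (∧-elimˡ {X v} (∧-elimˡ {P' v} h))))))))) , unique
      where
      K≤1 : card K ≤ 1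
      K≤1 = ≤-trans (card-mono {X = K} {P₃ ∪ Q₃} K⊆) (≤-trans (≤-trans (m≤m+n _ _) (≤-reflexive (card-∪-∩ P₃ Q₃))) (≤-reflexive cr))
      incut : ∀ {e u v} → Joins G e u v → u ∊ Z → v ∉ Z → InCut G (tabulate Z) e
      incut (inj₁ (refl , refl)) h h' = inj₁ (∈-tabulate h , λ q → true≢false (tabulate-∈ {X = Z} q) h')
      incut (inj₂ (refl , refl)) h h' = inj₂ ((λ q → true≢false (tabulate-∈ {X = Z} q) h') , ∈-tabulate h)
      witness : (∃ λ v → v ∊ P₃ ∪ Q₃) → ∃ λ e → e ∈ M × InCut G (tabulate Z) e
      witness (v , h) = pe v , pe∈ v , incut (pe-joins v) (∧-elimˡ {Z v} hK) (not-true (∧-elimʳ {Z v} hK))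
        where
        hK : v ∊ K
        hK = case ∨-elim {P₃ v} h of λ { (inj₁ q) → P₃⊆K q ; (inj₂ q) → Q₃⊆K q }
      cut-end : ∀ {e} → e ∈ M → InCut G (tabulate Z) e → ∃ λ v → v ∊ K × e ≡ pe v
      cut-end {e} e∈ (inj₁ (h , h')) = end₁ G e , ∧-intro (tabulate-∈ h) (not-false (subst (_∉ Z) (sym (p-edge e∈ (joins-ends {G} e))) (¬∊⇒∉ λ q → h' (∈-tabulate q)))) , pe-unique e∈ (inj₁ refl)
      cut-end {e} e∈ (inj₂ (h' , h)) = end₂ G e , ∧-intro (tabulate-∈ h) (not-false (subst (_∉ Z) (sym (p-edge e∈ (joins-sym {G} (joins-ends {G} e)))) (¬∊⇒∉ λ q → h' (∈-tabulate q)))) , pe-unique e∈ (inj₂ refl)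
      unique : ∀ e e' → e ∈ M → InCut G (tabulate Z) e → e' ∈ M → InCut G (tabulate Z) e' → e ≡ e'
      unique e e' e∈ h e'∈ h' with cut-end e∈ h | cut-end e'∈ h'
      ... | v , q , r | v' , q' , r' = trans r (trans (cong pe (card≡1⇒unique {X = K} K≤1 q q')) (sym r'))

  -- If either conclusion failed, perfect matchings of both kinds would cross `X ∪ Nbr E X` exactly
  -- once, and this tight cut would be nontrivial: `x` and a neighbour are inside, `u` and `v`
  -- outside.
  brick : ∀ s X {x u v} → (∀ {v} → v ∊ X → c v ≡ s) → x ∊ X → u ∉ X → c u ≡ s → v ∉ X → c v ≡ s → u ≢ v →
    card (Nbr E X) ≤ suc (card X) → (∃ λ i → sp s i ∊ X) × ¬ (∀ i → sp (not s) i ∊ Nbr E X)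
  brick s X {x} {u} {v} sub x∊ u∉ cu v∉ cv u≢v le = some , λ all → not-tight (inj₂ all)
    where
    NX = Nbr E X
    Z = X ∪ NX
    size : card NX ≡ suc (card X)
    size = ≤-antisym le (expand s X sub x∊ u∉ cu)
    outside : ∀ {w} → w ∉ X → c w ≡ s → w ∊ ∁ Z
    outside h cw = not-false (∨-false h (Nbr-∉ E {X} λ z q r → not≢ {s} (trans (sym cw) (trans (E-col r) (cong not (sub q))))))
    y = card-nonempty NX (≤-trans (s≤s z≤n) (≤-reflexive (sym size)))
    x≢y : x ≢ proj₁ y
    x≢y e = case Nbr-elim E {X} (subst (_∊ NX) (sym e) (proj₂ y)) of λ { (z , q , r) → not≢ {s} (trans (sym (sub x∊)) (trans (E-col r) (cong not (sub q)))) }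
    not-tight : (∀ i → sp s i ∉ X) ⊎ (∀ i → sp (not s) i ∊ NX) → ⊥
    not-tight h = no-tight (tabulate Z) (≤-trans (card-pair {X = Z} x≢y (∨-introˡ x∊) (∨-introʳ {X (proj₁ y)} (proj₂ y))) (≤-reflexive (sym (∣tabulate∣ Z))))
      (≤-trans (card-pair {X = ∁ Z} u≢v (outside u∉ cu) (outside v∉ cv)) (≤-reflexive (sym (∣∁tabulate∣ Z))))
      λ M pm → Crossing.tight s X sub size pm (cross pm (kind pm) h)
      where
      cross : ∀ {M} (pm : PerfectMatching G (All G) M) → (∀ s → se s ∈ M) ⊎ (∀ s → ¬ se s ∈ M) → (∀ i → sp s i ∉ X) ⊎ (∀ i → sp (not s) i ∊ NX) → Crossing.Crossed s X sub size pm
      cross pm (inj₂ k) _ = Crossing.crossed-plain s X sub size pm k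
      cross pm (inj₁ k) (inj₁ h) = Crossing.crossed-outside s X sub size pm h
      cross pm (inj₁ k) (inj₂ h) = Crossing.crossed-both s X sub size pm k h
    some : ∃ λ i → sp s i ∊ X
    some with ∊? X (sp s true) | ∊? X (sp s false)
    ... | inj₁ h | _ = true , h
    ... | inj₂ _ | inj₁ h = false , h
    ... | inj₂ h | inj₂ h' = ⊥-elim (not-tight (inj₁ λ { true → h ; false → h' }))

  -- The classes have equal size, so six vertices give each at least three.
  third : ∀ s → ∃ λ v → c v ≡ s × (∀ i → v ≢ sp s i)
  third s = conclude (card-nonempty D₂ (s≤s⁻¹ (s≤s⁻¹ (≤-trans three (≤-trans (card-delete-≤ (sp s true) (Col c s)) (s≤s (card-delete-≤ (sp s false) D₁)))))))
    where
    D₁ = delete (sp s true) (Col c s)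
    D₂ = delete (sp s false) D₁
    all : (λ _ → true) ⊆ Col c s ∪ Col c (not s)
    all {v} _ with c v ≟ᵇ s
    ... | yes h = ∨-introˡ (Col-intro h)
    ... | no h = ∨-introʳ {Col c s v} (Col-intro (opposite (h ∘ sym)))
    double : ∀ {k} → 6 ≤ k + k → 3 ≤ k
    double {suc (suc (suc k))} h = s≤s (s≤s (s≤s z≤n))
    double {zero} ()
    double {suc zero} (s≤s (s≤s ()))
    double {suc (suc zero)} (s≤s (s≤s (s≤s (s≤s ()))))
    three : 3 ≤ card (Col c s)
    three = double (≤-trans six (≤-trans (≤-reflexive (sym card-full)) (≤-trans (card-mono {X = λ _ → true} {Col c s ∪ Col c (not s)} all)
      (≤-trans (≤-trans (m≤m+n _ _) (≤-reflexive (card-∪-∩ (Col c s) (Col c (not s))))) (≤-reflexive (cong (card (Col c s) +_) (sym (balance≡ s))))))))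
    conclude : (∃ λ v → v ∊ D₂) → ∃ λ v → c v ≡ s × (∀ i → v ≢ sp s i)
    conclude (v , h) = v , Col-elim (delete-sub {a = sp s true} {Col c s} (delete-sub {a = sp s false} {D₁} h)) ,
      λ { true → delete-≢ {X = Col c s} (delete-sub {a = sp s false} {D₁} h) ; false → delete-≢ {X = D₁} h }

  βpm : ∃ λ M → PerfectMatching G (All G) M × se true ∈ M
  βpm = proj₂ (proj₂ mcG) (se true) tt

  β-all : ∀ s → se s ∈ proj₁ βpm
  β-all = go (kind (proj₁ (proj₂ βpm)))
    where
    go : (∀ s → se s ∈ proj₁ βpm) ⊎ (∀ s → ¬ se s ∈ proj₁ βpm) → ∀ s → se s ∈ proj₁ βpm
    go (inj₁ h) = h
    go (inj₂ h) = ⊥-elim (h true (proj₂ (proj₂ βpm)))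

  module βP = Partner (partner {G} (proj₁ (proj₂ βpm)))

  nearBip : NearBip (n G)
  nearBip = record
    { E = E ; c = c ; E-sym = E-sym ; E-col = E-col ; sp = sp ; sp-col = sp-col ; sp-dist = λ s → loopless G (se s)
    ; μ = βP.p ; μμ = βP.p-inv ; μ-sp = λ s i → βP.p-edge (β-all s) (sp-joins s i) ; μ-E = μ-E
    ; balanced = balance≡ ; third = third ; expand = expand ; brick = brick }
    where
    μ-E : ∀ v → (∀ i → v ≢ sp (c v) i) → E v (βP.p v) ≡ true
    μ-E v h with plain? (βP.pe v)
    ... | yes q = E-intro q (βP.pe-joins v)
    ... | no q with special-edge q
    ... | r , e with sp-inc (subst (λ g → Inc G g v) e (joins-inc {G} (βP.pe-joins v)))
    ... | i , refl = ⊥-elim (h i (cong (λ r → sp r i) (sym (sp-col r i))))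

-- Nonremovable edges are uncovered

≢⇒≡not : ∀ {x y : Bool} → x ≢ y → x ≡ not y
≢⇒≡not {true} {true} h = ⊥-elim (h refl)
≢⇒≡not {true} {false} h = refl
≢⇒≡not {false} {true} h = refl
≢⇒≡not {false} {false} h = ⊥-elim (h refl)

module Removability (G : Graph) (mcG : MatchingCovered G)
  (no-tight : ∀ (X : Subset (n G)) → 2 ≤ ∣ X ∣ → 2 ≤ ∣ ∁ˢ X ∣ → ¬ TightCut G X)
  (St : Setup G) (six : 6 ≤ n G) where

  open FromGraph G mcG no-tight St six public

  Covers : Fin (m G) → Fin (m G) → Set
  Covers e f = ∃ λ M → PerfectMatching G (Minus1 G e) M × f ∈ M

  opaque
    covers? : ∀ e f → Dec (Covers e f)
    covers? e f = anySubset? λ M →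
      (all? (λ g → (g ∈? M) →-dec ¬? (g ≟ e)) ×-dec all? (λ v → any? λ g → (g ∈? M) ×-dec inc? {G} g v)
        ×-dec all? (λ v → all? λ g → all? λ g' → (g ∈? M) →-dec ((g' ∈? M) →-dec (inc? {G} g v →-dec (inc? {G} g' v →-dec (g ≟ g'))))))
      ×-dec (f ∈? M)

  joins-plain-ends : ∀ {e a b x y} → Joins G e a b → Joins G e x y → c a ≡ c x → PlainEdge e → a ≡ x × b ≡ y
  joins-plain-ends {e} j j' h pl with joins-cases {G} j j'
  ... | inj₁ r = r
  ... | inj₂ (refl , refl) = ⊥-elim (not≢ (trans h (plain-joins pl j)))

  -- The path around e: with b unreachable from a, both a's side and its complement would have to expand.
  detour : ∀ {e a b} → PlainEdge e → Joins G e a b → Reach G (Minus1 G e) a b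
  detour {e} {a} {b} pl j = go (reachable {G} {Minus1 G e} (λ f → ¬? (f ≟ e)) a)
    where
    s = c a
    t = not s
    cb : c b ≡ t
    cb = plain-joins pl j
    go : (∃ λ (C : FSet (n G)) → a ∊ C × (∀ {v} → v ∊ C → Reach G (Minus1 G e) a v) × (∀ {f x y} → Minus1 G e f → Joins G f x y → x ∊ C → y ∊ C)) → Reach G (Minus1 G e) a b
    go (C , a∊ , r , cl) with ∊? C b
    ... | inj₁ h = r h
    ... | inj₂ b∉ = ⊥-elim (contra (find Q))
      where
      P = Col c s ∩ C
      Q = Col c s ∩ ∁ C
      P-col : ∀ {v} → v ∊ P → c v ≡ s
      P-col {v} h = Col-elim (∧-elimˡ {Col c s v} h)
      Q-col : ∀ {v} → v ∊ Q → c v ≡ s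
      Q-col {v} h = Col-elim (∧-elimˡ {Col c s v} h)
      NP : Nbr E P ⊆ insert b (Col c t ∩ C)
      NP {v} h with Nbr-elim E {P} h
      ... | u , q , q' with E-elim q'
      ... | f , plf , jf with f ≟ e
      ... | yes refl = subst (_∊ insert b (Col c t ∩ C)) (proj₂ (joins-plain-ends j jf (sym (P-col q)) pl)) (insert-self b (Col c t ∩ C))
      ... | no ne = insert-old b (Col c t ∩ C) (∧-intro (Col-intro (trans (plain-joins plf jf) (cong not (P-col q)))) (cl ne jf (∧-elimʳ {Col c s u} q)))
      NQ : Nbr E Q ⊆ Col c t ∩ ∁ C
      NQ {v} h with Nbr-elim E {Q} h
      ... | u , q , q' with E-elim q'
      ... | f , plf , jf = ∧-intro (Col-intro (trans (plain-joins plf jf) (cong not (Q-col q)))) (not-false (¬∊⇒∉ λ v∊ → ∊∉ {X = C} (cl ne (joins-sym {G} jf) v∊) u∉))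
        where
        u∉ : u ∉ C
        u∉ = not-true (∧-elimʳ {Col c s u} q)
        ne : f ≢ e
        ne refl = ∊∉ {X = C} (subst (_∊ C) (proj₁ (joins-plain-ends j jf (sym (Q-col q)) pl)) a∊) u∉
      a∊P : a ∊ P
      a∊P = ∧-intro (Col-intro refl) a∊
      contra : (∃ λ v → v ∊ Q) ⊎ (∀ v → v ∉ Q) → ⊥
      contra (inj₁ (q , q∊)) = <-irrefl refl (linear (card P ∷ card Q ∷ card (Nbr E P) ∷ card (Nbr E Q) ∷ card (Col c t ∩ C) ∷ card (Col c t ∩ ∁ C) ∷ card (Col c s) ∷ card (Col c t) ∷ [])
        ((♯ 1 ⊕ ′ # 0 ≼ ′ # 2) ∷ (♯ 1 ⊕ ′ # 1 ≼ ′ # 3) ∷ (′ # 2 ≼ ♯ 1 ⊕ ′ # 4) ∷ (′ # 3 ≼ ′ # 5) ∷ (′ # 6 ≼ ′ # 0 ⊕ ′ # 1) ∷ (′ # 4 ⊕ ′ # 5 ≼ ′ # 7) ∷ (′ # 7 ≼ ′ # 6) ∷ [])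
        (♯ 1 ≼ ♯ 0)
        (expand s P P-col a∊P (¬∊⇒∉ λ h → ∊∉ {X = C} (∧-elimʳ {Col c s q} h) (not-true (∧-elimʳ {Col c s q} q∊))) (Q-col q∊)
          ∷ expand s Q Q-col q∊ (¬∊⇒∉ λ h → ∊∉ {X = C} a∊ (not-true (∧-elimʳ {Col c s a} h))) refl
          ∷ ≤-trans (card-mono {X = Nbr E P} {insert b (Col c t ∩ C)} NP) (≤-reflexive (card-insert {X = Col c t ∩ C} (¬∊⇒∉ λ h → ∊∉ {X = C} (∧-elimʳ {Col c t b} h) b∉)))
          ∷ card-mono {X = Nbr E Q} {Col c t ∩ ∁ C} NQ ∷ ≤-reflexive (sym (card-partition (Col c s) C)) ∷ ≤-reflexive (card-partition (Col c t) C)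
          ∷ ≤-reflexive (sym (NearBip.balanced nearBip s)) ∷ []))
      -- Now the whole class of `a` is reachable from `a`. Expansion gives `b` a second neighbour
      -- there, and `b` is reached through it.
      contra (inj₂ none) = another (card-nonempty (delete a (Nbr E ⁅ b ⁆)) (s≤s⁻¹ (≤-trans two (card-delete-≤ a (Nbr E ⁅ b ⁆)))))
        where
        two : 2 ≤ card (Nbr E ⁅ b ⁆)
        two with NearBipTheory.other-special nearBip b
        ... | w , ne , cw = ≤-trans (≤-reflexive (cong suc (sym (card-⁅⁆ b)))) (expand (c b) ⁅ b ⁆ (λ h → cong c (∊⁅⁆⇒≡ h)) (∊⁅⁆ b) (≢⇒∉⁅⁆ ne) cw)
        another : (∃ λ u → u ∊ delete a (Nbr E ⁅ b ⁆)) → ⊥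
        another (u , h) with Nbr-elim E {⁅ b ⁆} (delete-sub {a = a} {Nbr E ⁅ b ⁆} h)
        ... | b' , q , q' with ∊⁅⁆⇒≡ q
        ... | refl with E-elim q'
        ... | f , plf , jf = ∊∉ {X = C} (cl ne (joins-sym {G} jf) u∊) b∉
          where
          cu : c u ≡ s
          cu = trans (plain-joins plf jf) (trans (cong not cb) (not-involutive s))
          ne : f ≢ e
          ne refl = delete-≢ {X = Nbr E ⁅ b ⁆} h (joins-unique {G} jf (joins-sym {G} j))
          u∊ : u ∊ C
          u∊ = ¬∉⇒∊ λ u∉ → true≢false (∧-intro (Col-intro cu) (not-false u∉)) (none u)

  connected : ∀ {e} → PlainEdge e → Connected G (Minus1 G e)
  connected {e} pl u v = reroute (proj₁ (proj₂ mcG) u v)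
    where
    reroute : ∀ {u v} → Reach G (All G) u v → Reach G (Minus1 G e) u v
    reroute here = here
    reroute (step f _ j r) with f ≟ e
    ... | yes refl = reach-trans (detour pl j) (reroute r)
    ... | no ne = step f ne j (reroute r)

  -- A Hall matching fixes only pairs of vertices. Because of parallel edges an edge must be chosen
  -- for each pair, and at `x` it has to be the prescribed `f`. The edges in `extra` cover the
  -- vertices outside `P` and `Q`: none for a matching of `H`, the two deleted edges for the other
  -- kind.
  module Assemble {s : Bool} {a b : Fin (n G)} {e : Fin (m G)} (ple : PlainEdge e) (je : Joins G e a b) (ca : c a ≡ s)
    (P Q : FSet (n G)) (P-col : ∀ {v} → v ∊ P → c v ≡ s) (mate : Fin (n G) → Fin (n G))
    (edge : ∀ {u} → u ∊ P → E u (mate u) ≡ true) (avoid : ∀ {u} → u ∊ P → ¬ (u ≡ a × mate u ≡ b))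
    (inj : ∀ {u v} → u ∊ P → v ∊ P → mate u ≡ mate v → u ≡ v) (into-Q : ∀ {u} → u ∊ P → mate u ∊ Q) (Q≤P : card Q ≤ card P)
    (extra : FSet (m G)) (extra-≢ : ∀ {g} → g ∊ extra → g ≢ e)
    (cover-s : ∀ {v} → c v ≡ s → v ∊ P ⊎ (∃ λ g → g ∊ extra × Inc G g v)) (cover-t : ∀ {v} → c v ≡ not s → v ∊ Q ⊎ (∃ λ g → g ∊ extra × Inc G g v))
    (extra-unique : ∀ {g g' v} → g ∊ extra → g' ∊ extra → Inc G g v → Inc G g' v → g ≡ g')
    (extra-apart : ∀ {g v} → g ∊ extra → Inc G g v → v ∉ P × v ∉ Q)
    {x : Fin (n G)} {f : Fin (m G)} (x∊ : x ∊ P) (jf : Joins G f x (mate x)) (f≢e : f ≢ e) where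

    pick : ∀ u → u ∊ P ⊎ u ∉ P → Dec (u ≡ x) → Fin (m G)
    pick u _ (yes _) = f
    pick u (inj₁ h) (no _) = proj₁ (E-elim (edge h))
    pick u (inj₂ h) (no _) = f

    pick-joins : ∀ u (h : u ∊ P) d d' → Joins G (pick u d d') u (mate u)
    pick-joins u h _ (yes refl) = jf
    pick-joins u h (inj₁ h') (no _) = proj₂ (proj₂ (E-elim (edge h')))
    pick-joins u h (inj₂ h') (no _) = ⊥-elim (∊∉ {X = P} h h')

    ch : Fin (n G) → Fin (m G)
    ch u = pick u (∊? P u) (u ≟ x)

    ch-x : ch x ≡ f
    ch-x with x ≟ x
    ... | yes _ = refl
    ... | no h = ⊥-elim (h refl)

    ch-joins : ∀ {u} → u ∊ P → Joins G (ch u) u (mate u)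
    ch-joins {u} h = pick-joins u h (∊? P u) (u ≟ x)

    ch-≢ : ∀ {u} → u ∊ P → ch u ≢ e
    ch-≢ {u} h q = avoid h (joins-plain-ends (subst (λ g → Joins G g u (mate u)) q (ch-joins h)) je (trans (P-col h) (sym ca)) ple)

    mate-col : ∀ {u} → u ∊ P → c (mate u) ≡ not s
    mate-col h = trans (E-col (edge h)) (cong not (P-col h))

    chosen? : ∀ g → Dec (∃ λ u → u ∊ P × ch u ≡ g)
    chosen? g = any? λ u → decBool (P u) ×-dec (ch u ≟ g)

    edges : FSet (m G)
    edges g = extra g ∨ ⌊ chosen? g ⌋

    Member : Fin (m G) → Set
    Member g = g ∊ extra ⊎ (∃ λ u → u ∊ P × ch u ≡ g)

    member : ∀ {g} → g ∈ tabulate edges → Member g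
    member {g} h with ∨-elim {extra g} (tabulate-∈ {X = edges} h)
    ... | inj₁ q = inj₁ q
    ... | inj₂ q = inj₂ (⌊⌋-elim (chosen? g) q)

    extra∈ : ∀ {g} → g ∊ extra → g ∈ tabulate edges
    extra∈ h = ∈-tabulate {X = edges} (∨-introˡ h)

    ch∈ : ∀ {u} → u ∊ P → ch u ∈ tabulate edges
    ch∈ {u} h = ∈-tabulate {X = edges} (∨-introʳ {extra (ch u)} (⌊⌋-intro (chosen? (ch u)) (u , h , refl)))

    unique : ∀ v g g' → Member g → Member g' → Inc G g v → Inc G g' v → g ≡ g'
    unique v g g' (inj₁ h) (inj₁ h') i i' = extra-unique h h' i i'
    unique v g g' (inj₁ h) (inj₂ (u , u∊ , refl)) i i' with inc-cases {G} (ch-joins u∊) i'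
    ... | inj₁ refl = ⊥-elim (∊∉ {X = P} u∊ (proj₁ (extra-apart h i)))
    ... | inj₂ refl = ⊥-elim (∊∉ {X = Q} (into-Q u∊) (proj₂ (extra-apart h i)))
    unique v g g' (inj₂ (u , u∊ , refl)) (inj₁ h') i i' with inc-cases {G} (ch-joins u∊) i
    ... | inj₁ refl = ⊥-elim (∊∉ {X = P} u∊ (proj₁ (extra-apart h' i')))
    ... | inj₂ refl = ⊥-elim (∊∉ {X = Q} (into-Q u∊) (proj₂ (extra-apart h' i')))
    unique v g g' (inj₂ (u , u∊ , refl)) (inj₂ (u' , u'∊ , refl)) i i' with inc-cases {G} (ch-joins u∊) i | inc-cases {G} (ch-joins u'∊) i'
    ... | inj₁ q | inj₁ q' = cong ch (trans (sym q) q')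
    ... | inj₁ q | inj₂ q' = ⊥-elim (not≢ {s} (trans (sym (P-col u∊)) (trans (cong c (trans (sym q) q')) (mate-col u'∊))))
    ... | inj₂ q | inj₁ q' = ⊥-elim (not≢ {s} (trans (sym (P-col u'∊)) (trans (cong c (trans (sym q') q)) (mate-col u∊))))
    ... | inj₂ q | inj₂ q' = cong ch (inj u∊ u'∊ (trans (sym q) q'))

    cover : ∀ v → ∃ λ g → g ∈ tabulate edges × Inc G g v
    cover v with c v ≟ᵇ s
    ... | yes h = case cover-s h of λ where
      (inj₁ q) → ch v , ch∈ q , joins-inc {G} (ch-joins q)
      (inj₂ (g , q , i)) → g , extra∈ q , i
    ... | no h = case cover-t (≢⇒≡not h) of λ where
      (inj₁ q) → case card-surjection mate P Q into-Q inj Q≤P q of λ { (u , u∊ , e') → ch u , ch∈ u∊ , subst (Inc G (ch u)) e' (joins-inc {G} (joins-sym {G} (ch-joins u∊))) }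
      (inj₂ (g , q , i)) → g , extra∈ q , i

    result : ∃ λ M → PerfectMatching G (Minus1 G e) M × f ∈ M × (∀ {g} → g ∊ extra → g ∈ M)
    result = tabulate edges , ((λ g h → avoid-e (member h)) , cover , λ v g g' h h' → unique v g g' (member h) (member h')) ,
        subst (_∈ tabulate edges) ch-x (ch∈ x∊) , extra∈
      where
      avoid-e : ∀ {g} → Member g → g ≢ e
      avoid-e (inj₁ h) = extra-≢ h
      avoid-e (inj₂ (u , u∊ , refl)) = ch-≢ u∊

  module _ {s : Bool} {a b : Fin (n G)} {e : Fin (m G)} (ple : PlainEdge e) (je : Joins G e a b) (ca : c a ≡ s) where
    open Side nearBip s hiding (E-to-t; E-to-s)

    α-covers : ∀ {x f} (Mt : Matching (without E a b) (Col c s)) → c x ≡ s → Joins G f x (Matching.mate Mt x) → f ≢ e → Covers e f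
    α-covers Mt cx jf f≢e = case Assemble.result ple je ca (Col c s) (Col c t) Col-elim mate
        (λ h → without-sub {D = E} (edge h)) (λ h → without-≢ {D = E} (edge h)) inj
        (λ h → Col-intro (trans (E-col (without-sub {D = E} (edge h))) (cong not (Col-elim h)))) (≤-reflexive (sym (NearBip.balanced nearBip s)))
        ∅ (λ ()) (λ h → inj₁ (Col-intro h)) (λ h → inj₁ (Col-intro h)) (λ ()) (λ ()) (Col-intro cx) jf f≢e of λ { (M , pm , f∈ , _) → M , pm , f∈ }
      where open Matching Mt

    specials : FSet (m G)
    specials g = ⁅ se true ⁆ g ∨ ⁅ se false ⁆ g

    special∊ : ∀ r → se r ∊ specials
    special∊ true = ∨-introˡ (∊⁅⁆ (se true))
    special∊ false = ∨-introʳ {⁅ se true ⁆ (se false)} (∊⁅⁆ (se false))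

    specials-elim : ∀ {g} → g ∊ specials → ∃ λ r → g ≡ se r
    specials-elim {g} h with ∨-elim {⁅ se true ⁆ g} h
    ... | inj₁ q = true , ∊⁅⁆⇒≡ q
    ... | inj₂ q = false , ∊⁅⁆⇒≡ q

    special-or-plain : ∀ {r v} → c v ≡ r → (Col c r v ∧ not (⁅ sp r true ⁆ v ∨ ⁅ sp r false ⁆ v)) ≡ true ⊎ (∃ λ g → g ∊ specials × Inc G g v)
    special-or-plain {r} {v} h with v ≟ sp r true | v ≟ sp r false
    ... | yes refl | _ = inj₂ (se r , special∊ r , inj₁ refl)
    ... | no _ | yes refl = inj₂ (se r , special∊ r , inj₂ refl)
    ... | no p | no q = inj₁ (plain-intro h λ { true → p ; false → q })

    special-not-plain : ∀ {r r' v} → Inc G (se r) v → v ∉ (λ v → Col c r' v ∧ not (⁅ sp r' true ⁆ v ∨ ⁅ sp r' false ⁆ v))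
    special-not-plain {r} {r'} {v} i = ¬∊⇒∉ λ h → case sp-inc i of λ { (k , refl) → plain-≢ {r'} h k (cong (λ z → sp z k) (trans (sym (sp-col r k)) (plain-col {r'} h))) }

    μ-back : ∀ {v} → v ∊ PlainT → NearBip.μ nearBip v ∊ Plain
    μ-back {v} h = plain-intro cμ λ k q → NearBipTheory.μ-normal nearBip v nv k (trans q (cong (λ z → sp z k) (sym cμ)))
      where
      nv : ∀ k → v ≢ sp (c v) k
      nv k = subst (λ z → v ≢ sp z k) (sym (plain-col h)) (plain-≢ h k)
      cμ : c (NearBip.μ nearBip v) ≡ s
      cμ = trans (E-col (NearBip.μ-E nearBip v nv)) (trans (cong not (plain-col h)) (not-involutive s))

    β-covers : ∀ {x f} (Mt : Matching (without Eβ a b) Plain) → x ∊ Plain → Joins G f x (Matching.mate Mt x) → f ≢ e →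
      ∃ λ M → PerfectMatching G (Minus1 G e) M × f ∈ M × (∀ {g} → g ∊ specials → g ∈ M)
    β-covers Mt x∊ jf f≢e = Assemble.result ple je ca Plain PlainT plain-col mate
        (λ h → into-edge {D = E} (without-sub {D = Eβ} (edge h))) (λ h → without-≢ {D = Eβ} (edge h)) inj (λ h → into-∊ {D = E} (without-sub {D = Eβ} (edge h)))
        (card-injection (NearBip.μ nearBip) PlainT Plain μ-back (λ _ _ → μ-inj))
        specials (λ h q → case specials-elim h of λ { (r , refl) → ple r (sym q) }) special-or-plain special-or-plain
        (λ h h' i i' → specials-unique (specials-elim h) (specials-elim h') i i') (λ h i → case specials-elim h of λ { (r , refl) → special-not-plain {r} {s} i , special-not-plain {r} {t} i }) x∊ jf f≢e
      where
      open Matching Mt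
      specials-unique : ∀ {g g' v} → (∃ λ r → g ≡ se r) → (∃ λ r → g' ≡ se r) → Inc G g v → Inc G g' v → g ≡ g'
      specials-unique (r , refl) (r' , refl) i i' with sp-inc i | sp-inc i'
      ... | k , refl | k' , q = cong se (trans (sym (sp-col r k)) (trans (cong c q) (sp-col r' k')))

    β-covers-special : Matching (without Eβ a b) Plain → ∀ r → Covers e (se r)
    β-covers-special Mt r = from-vertex (third s)
      where
      from-edge : ∀ {x} → x ∊ Plain → (∃ λ f → PlainEdge f × Joins G f x (Matching.mate Mt x)) → Covers e (se r)
      from-edge x∊ (f , _ , jf) = case β-covers Mt x∊ jf (λ { refl → without-≢ {D = Eβ} (Matching.edge Mt x∊) (joins-plain-ends jf je (trans (plain-col x∊) (sym ca)) ple) }) of λ { (M , pm , _ , h) → M , pm , h (special∊ r) }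
      from-vertex : (∃ λ x → c x ≡ s × (∀ i → x ≢ sp s i)) → Covers e (se r)
      from-vertex (x , cx , nx) = from-edge (plain-intro cx nx) (E-elim (into-edge {D = E} (without-sub {D = Eβ} (Matching.edge Mt (plain-intro cx nx)))))

    -- Matchings of the second kind all contain both deleted edges, so if `f` is one of these, no
    -- such matching avoids `e`. Any other `f` becomes the lost edge `xy`.
    uncovered-by : ∀ {f} → f ≢ e → ¬ Covers e f → Uncovered a b
    uncovered-by {f} f≢e none with plain? f
    ... | no h with special-edge h
    ... | r , refl = inj₁ λ Mt → none (β-covers-special Mt r)
    uncovered-by {f} f≢e none | yes plf = inj₂ (x , y , cx , E-intro plf jf , not-ab
        , (λ { (Mt , q) → none (α-covers Mt cx (subst (Joins G f x) (sym q) jf) f≢e) })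
        , (λ px _ → λ { (Mt , q) → none (case β-covers Mt px (subst (Joins G f x) (sym q) jf) f≢e of λ { (M , pm , f∈ , _) → M , pm , f∈ }) }))
      where
      s-end : ∃₂ λ x y → c x ≡ s × Joins G f x y
      s-end with c (end₁ G f) ≟ᵇ s
      ... | yes h = _ , _ , h , joins-ends {G} f
      ... | no h = end₂ G f , end₁ G f , trans (plain-joins plf (joins-ends {G} f)) (trans (cong not (≢⇒≡not h)) (not-involutive s)) , joins-sym {G} (joins-ends {G} f)
      x = proj₁ s-end
      y = proj₁ (proj₂ s-end)
      cx : c x ≡ s
      cx = proj₁ (proj₂ (proj₂ s-end))
      jf : Joins G f x y
      jf = proj₂ (proj₂ (proj₂ s-end))
      -- An `f` parallel to `e` would be covered: a perfect matching of `H` through `f` cannot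
      -- contain `e` as well.
      not-ab : ¬ (x ≡ a × y ≡ b)
      not-ab (p , q) with proj₂ (proj₂ mcH) f plf
      ... | M , pm , f∈ = none (M , ((λ g g∈ g≡e → f≢e (proj₂ (proj₂ pm) a f e f∈ (subst (_∈ M) g≡e g∈) (subst (Inc G f) p (joins-inc {G} jf)) (joins-inc {G} je))) , proj₂ pm) , f∈)

    uncovered : ¬ Removable G e → Uncovered a b
    uncovered h with any? (λ f → ¬? (f ≟ e) ×-dec ¬? (covers? e f))
    ... | yes (f , f≢e , none) = uncovered-by f≢e none
    ... | no all = ⊥-elim (h (proj₁ mcG , connected ple , λ f f≢e → cov f f≢e (covers? e f)))
      where
      cov : ∀ f → f ≢ e → Dec (Covers e f) → Covers e f
      cov f f≢e (yes q) = q
      cov f f≢e (no q) = ⊥-elim (all (f , f≢e , q))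

  se-inj : ∀ {r r'} → se r ≡ se r' → r ≡ r'
  se-inj {r} {r'} q = trans (sym (se-col₁ r)) (trans (cong (λ e → c (end₁ G e)) q) (se-col₁ r'))

  -- The deleted edges occur in perfect matchings only together, so without one of them the other is
  -- in none.
  special-nonremovable : ∀ r → ¬ Removable G (se r)
  special-nonremovable r (_ , _ , cov) with cov (se (not r)) (λ q → not≢ {r} (sym (se-inj q)))
  ... | M , pm , h = go (kind pm)
    where
    go : (∀ s → se s ∈ M) ⊎ (∀ s → ¬ se s ∈ M) → ⊥
    go (inj₁ k) = proj₁ pm (se r) (k r) refl
    go (inj₂ k) = k (not r) h

  removable? : ∀ e → Dec (Removable G e)
  removable? e with plain? e
  ... | no h with special-edge h
  ... | r , refl = no (special-nonremovable r)
  removable? e | yes ple with all? (λ f → ¬? (f ≟ e) →-dec covers? e f)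
  ... | yes h = yes (proj₁ mcG , connected ple , h)
  ... | no h = no λ { (_ , _ , cov) → h cov }

  -- In any perfect matching `e` can be exchanged for `e'`.
  parallel⇒removable : ∀ {e e' u v} → e' ≢ e → PlainEdge e → Joins G e u v → Joins G e' u v → Removable G e
  parallel⇒removable {e} {e'} {u} {v} ne ple j j' = proj₁ mcG , connected ple , λ f f≢e → avoid f f≢e (proj₂ (proj₂ mcG) f tt)
    where
    same-inc : ∀ {w} → Inc G e w → Inc G e' w
    same-inc i with inc-cases {G} j i
    ... | inj₁ refl = joins-inc {G} j'
    ... | inj₂ refl = joins-inc {G} (joins-sym {G} j')
    same-inc' : ∀ {w} → Inc G e' w → Inc G e w
    same-inc' i with inc-cases {G} j' i
    ... | inj₁ refl = joins-inc {G} j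
    ... | inj₂ refl = joins-inc {G} (joins-sym {G} j)
    avoid : ∀ f → f ≢ e → (∃ λ M → PerfectMatching G (All G) M × f ∈ M) → Covers e f
    avoid f f≢e (M , pm , f∈) with e ∈? M
    ... | no h = M , ((λ { g g∈ refl → h g∈ }) , proj₂ pm) , f∈
    ... | yes e∈ = tabulate M' , ((λ g g∈ → proj₁ (out g∈)) , cover , λ w g g' h h' → uniq w g g' (out h) (out h')) , ∈-tabulate {X = M'} (∨-introˡ (∧-intro (⌊⌋-intro (f ∈? M) f∈) (not-false (≢⇒∉⁅⁆ f≢e))))
      where
      M' : FSet (m G)
      M' g = (⌊ g ∈? M ⌋ ∧ not (⁅ e ⁆ g)) ∨ ⁅ e' ⁆ g
      out : ∀ {g} → g ∈ tabulate M' → g ≢ e × (g ∈ M ⊎ g ≡ e')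
      out {g} h with ∨-elim {⌊ g ∈? M ⌋ ∧ not (⁅ e ⁆ g)} (tabulate-∈ {X = M'} h)
      ... | inj₁ q = (λ { refl → true≢false (∊⁅⁆ e) (not-true (∧-elimʳ {⌊ g ∈? M ⌋} q)) }) , inj₁ (⌊⌋-elim (g ∈? M) (∧-elimˡ {⌊ g ∈? M ⌋} q))
      ... | inj₂ q with ∊⁅⁆⇒≡ q
      ... | refl = ne , inj₂ refl
      uniq : ∀ w g g' → g ≢ e × (g ∈ M ⊎ g ≡ e') → g' ≢ e × (g' ∈ M ⊎ g' ≡ e') → Inc G g w → Inc G g' w → g ≡ g'
      uniq w g g' (g≢e , h) (g'≢e , h') i i' = go h h'
        where
        clash : ∀ {k} → k ∈ M → Inc G k w → Inc G e' w → k ≡ e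
        clash k∈ ik i' = proj₂ (proj₂ pm) w _ e k∈ e∈ ik (same-inc' i')
        go : (g ∈ M ⊎ g ≡ e') → (g' ∈ M ⊎ g' ≡ e') → g ≡ g'
        go (inj₁ q) (inj₁ q') = proj₂ (proj₂ pm) w g g' q q' i i'
        go (inj₂ q) (inj₂ q') = trans q (sym q')
        go (inj₁ q) (inj₂ refl) = ⊥-elim (g≢e (clash q i i'))
        go (inj₂ refl) (inj₁ q') = ⊥-elim (g'≢e (clash q' i' i))
      cover : ∀ w → ∃ λ g → g ∈ tabulate M' × Inc G g w
      cover w with proj₁ (proj₂ pm) w
      ... | g , g∈ , i with g ≟ e
      ... | no q = g , ∈-tabulate {X = M'} (∨-introˡ (∧-intro (⌊⌋-intro (g ∈? M) g∈) (not-false (≢⇒∉⁅⁆ q)))) , i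
      ... | yes refl = e' , ∈-tabulate {X = M'} (∨-introʳ {⌊ e' ∈? M ⌋ ∧ not (⁅ e ⁆ e')} (∊⁅⁆ e')) , same-inc i

-- Counting vertices without removable edges

card-three⁻ : ∀ {k} (X : FSet k) → 3 ≤ card X → ∃ λ x → ∃₂ λ y z → x ∊ X × y ∊ X × z ∊ X × x ≢ y × x ≢ z × y ≢ z
card-three⁻ X h = step₁ (card-nonempty X (≤-trans (s≤s z≤n) h))
  where
  step₁ : (∃ λ x → x ∊ X) → _
  step₁ (x , x∊) = step₂ (card-nonempty X₁ (≤-trans (s≤s z≤n) h₁))
    where
    X₁ = delete x X
    h₁ : 2 ≤ card X₁
    h₁ = s≤s⁻¹ (≤-trans h (card-delete-≤ x X))
    step₂ : (∃ λ y → y ∊ X₁) → _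
    step₂ (y , y∊) = step₃ (card-nonempty X₂ (s≤s⁻¹ (≤-trans h₁ (card-delete-≤ y X₁))))
      where
      X₂ = delete y X₁
      step₃ : (∃ λ z → z ∊ X₂) → ∃ λ x → ∃₂ λ y z → x ∊ X × y ∊ X × z ∊ X × x ≢ y × x ≢ z × y ≢ z
      step₃ (z , z∊) = x , y , z , x∊ , delete-sub {a = x} {X} y∊ , delete-sub {a = x} {X} z∊₁ , (delete-≢ {X = X} y∊ ∘ sym) , (delete-≢ {X = X} z∊₁ ∘ sym) , (delete-≢ {X = X₁} z∊ ∘ sym)
        where z∊₁ = delete-sub {a = y} {X₁} z∊

module Stars {k : ℕ} (B : NearBip k) (s : Bool) where

  open NearBipTheory B
  open Side B s
  open Obstacles B s

  beta-unique : ∀ {a b b'} → b ≢ b' → BetaSet a b → BetaSet a b' → ⊥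
  beta-unique ne T T' = ne (trans (sym (BetaSet.μa T)) (BetaSet.μa T'))

  -- Three edges of type α are excluded, and β-edges at `a` all end in `μ a`, so the pattern is two
  -- and one.
  three-uncovered : ∀ {a b b' b''} → E a b ≡ true → E a b' ≡ true → E a b'' ≡ true → b ≢ b' → b ≢ b'' → b' ≢ b'' →
    Uncovered a b → Uncovered a b' → Uncovered a b'' → (∀ i → E a (sp t i) ≡ true) × ∃ (BetaSet a)
  three-uncovered {a} {b} {b'} {b''} e e' e'' p q r u u' u'' = go (classify u) (classify u') (classify u'')
    where
    go : AlphaSet a b ⊎ BetaSet a b → AlphaSet a b' ⊎ BetaSet a b' → AlphaSet a b'' ⊎ BetaSet a b'' → (∀ i → E a (sp t i) ≡ true) × ∃ (BetaSet a)
    go (inj₁ S) (inj₁ S') (inj₁ S'') = ⊥-elim (no-three-alpha e e' e'' p q r S S' S'')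
    go (inj₁ S) (inj₁ S') (inj₂ T) = triple⇒star e e' e'' p q r S S' T , _ , T
    go (inj₁ S) (inj₂ T) (inj₁ S') = triple⇒star e e'' e' q p (r ∘ sym) S S' T , _ , T
    go (inj₂ T) (inj₁ S) (inj₁ S') = triple⇒star e' e'' e r (p ∘ sym) (q ∘ sym) S S' T , _ , T
    go _ (inj₂ T) (inj₂ T') = ⊥-elim (beta-unique r T T')
    go (inj₂ T) _ (inj₂ T') = ⊥-elim (beta-unique q T T')
    go (inj₂ T) (inj₂ T') _ = ⊥-elim (beta-unique p T T')

  beta-normal : ∀ {a b} → BetaSet a b → ∀ i → b ≢ sp t i
  beta-normal T i = subst (_≢ sp t i) (BetaSet.μa T) (plain-≢ (μ-plainT (Shore.col (BetaSet.shore T) (BetaSet.a∊ T)) (Shore.plain (BetaSet.shore T) (BetaSet.a∊ T))) i)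

  -- A β-edge ends in the vertex `μ a`, which is never special.
  star-alpha : ∀ {a} → (∀ i → Uncovered a (sp t i)) → ∀ i → AlphaSet a (sp t i)
  star-alpha u i with classify (u i)
  ... | inj₁ S = S
  ... | inj₂ T = ⊥-elim (beta-normal T i refl)

module Count (G : Graph) (mcG : MatchingCovered G)
  (no-tight : ∀ (X : Subset (n G)) → 2 ≤ ∣ X ∣ → 2 ≤ ∣ ∁ˢ X ∣ → ¬ TightCut G X)
  (St : Setup G) (six : 6 ≤ n G) where

  open Removability G mcG no-tight St six public
  open NearBipTheory nearBip using (N; N-in; N-out; Normal; normal-degree; μ-normal) public

  opaque
    R : FSet (m G)
    R e = ⌊ removable? e ⌋

    R-elim : ∀ {e} → e ∊ R → Removable G e
    R-elim {e} = ⌊⌋-elim (removable? e)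

    R-intro : ∀ {e} → Removable G e → e ∊ R
    R-intro {e} = ⌊⌋-intro (removable? e)

    At : Fin (n G) → FSet (m G)
    At v e = R e ∧ ⌊ inc? {G} e v ⌋

    At-intro : ∀ {v e} → e ∊ R → Inc G e v → e ∊ At v
    At-intro {v} {e} p i = ∧-intro p (⌊⌋-intro (inc? {G} e v) i)

    handshake : sum (λ v → card (At v)) ≡ card R + card R
    handshake = trans (sum-cong-≗ λ v → card-sum (At v)) (trans (∑-comm (λ v e → ind (At v e)))
        (trans (sum-cong-≗ row) (trans (∑-distrib-+ (λ e → ind (R e)) (λ e → ind (R e))) (cong₂ _+_ (sym (card-sum R)) (sym (card-sum R))))))
      where
      row : ∀ e → sum (λ v → ind (R e ∧ ⌊ inc? {G} e v ⌋)) ≡ ind (R e) + ind (R e)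
      row e with R e
      ... | false = sum-zero {n G} λ _ → refl
      ... | true = trans (sym (card-sum (λ v → ⌊ inc? {G} e v ⌋))) (trans (card-cong {X = λ v → ⌊ inc? {G} e v ⌋} {insert (end₁ G e) ⁅ end₂ G e ⁆} to from)
          (trans (card-insert {X = ⁅ end₂ G e ⁆} (≢⇒∉⁅⁆ (loopless G e))) (cong suc (card-⁅⁆ (end₂ G e)))))
        where
        to : (λ v → ⌊ inc? {G} e v ⌋) ⊆ insert (end₁ G e) ⁅ end₂ G e ⁆
        to {v} h with ⌊⌋-elim (inc? {G} e v) h
        ... | inj₁ refl = insert-self (end₁ G e) ⁅ end₂ G e ⁆
        ... | inj₂ refl = insert-old (end₁ G e) ⁅ end₂ G e ⁆ (∊⁅⁆ (end₂ G e))
        from : insert (end₁ G e) ⁅ end₂ G e ⁆ ⊆ (λ v → ⌊ inc? {G} e v ⌋)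
        from {v} h = ⌊⌋-intro (inc? {G} e v) (case insert-elim {a = end₁ G e} {X = ⁅ end₂ G e ⁆} h of λ { (inj₁ q) → inj₁ (sym q) ; (inj₂ q) → inj₂ (sym (∊⁅⁆⇒≡ q)) })

  Zero : Fin (n G) → Set
  Zero v = ∀ e → Inc G e v → e ∉ R

  edge-uncovered : ∀ {s a b e} → c a ≡ s → PlainEdge e → Joins G e a b → e ∉ R → Side.Uncovered nearBip s a b
  edge-uncovered ca pl j h = uncovered pl j ca λ r → true≢false (R-intro r) h

  zero-uncovered : ∀ {s a b} → c a ≡ s → Zero a → E a b ≡ true → Side.Uncovered nearBip s a b
  zero-uncovered {s} {a} {b} ca z h with E-elim h
  ... | e , pl , j = edge-uncovered ca pl j (z e (joins-inc {G} j))

  three-neighbours : ∀ v → Normal v → ∃ λ x → ∃₂ λ y z → E v x ≡ true × E v y ≡ true × E v z ≡ true × x ≢ y × x ≢ z × y ≢ z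
  three-neighbours v nv with card-three⁻ (N ⁅ v ⁆) (normal-degree v nv)
  ... | x , y , z , p , q , r , ne = x , y , z , adj p , adj q , adj r , ne
    where
    adj : ∀ {w} → w ∊ N ⁅ v ⁆ → E v w ≡ true
    adj h with N-out {⁅ v ⁆} h
    ... | u , u∊ , e = subst (λ u → E u _ ≡ true) (∊⁅⁆⇒≡ u∊) e

  zero-star : ∀ {s v} → c v ≡ s → Normal v → Zero v → ∀ i → E v (sp (not s) i) ≡ true
  zero-star {s} {v} cv nv z with three-neighbours v nv
  ... | x , y , w , ex , ey , ew , p , q , r = proj₁ (Stars.three-uncovered nearBip s ex ey ew p q r (zero-uncovered cv z ex) (zero-uncovered cv z ey) (zero-uncovered cv z ew))

  zero-unique : ∀ {s u v} → c u ≡ s → Normal u → Zero u → c v ≡ s → (∀ i → E v (sp (not s) i) ≡ true) → v ≡ u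
  zero-unique {s} {u} {v} cu nu zu cv sv = Obstacles.star-unique nearBip s (Stars.star-alpha nearBip s λ i → zero-uncovered cu zu (zero-star cu nu zu i)) (zero-star cu nu zu) cv sv

  opaque
    Star : Bool → FSet (n G)
    Star s v = ⌊ (c v ≟ᵇ s) ×-dec (¬? (v ≟ sp s true) ×-dec (¬? (v ≟ sp s false) ×-dec all? (λ e → inc? {G} e v →-dec ¬? (decBool (R e))))) ⌋

    Star-intro : ∀ {s v} → c v ≡ s → Normal v → Zero v → v ∊ Star s
    Star-intro {s} {v} refl nv z = ⌊⌋-intro ((c v ≟ᵇ c v) ×-dec (¬? (v ≟ sp (c v) true) ×-dec (¬? (v ≟ sp (c v) false) ×-dec all? (λ e → inc? {G} e v →-dec ¬? (decBool (R e))))))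
      (refl , nv true , nv false , λ e i h → true≢false h (z e i))

    Star-elim : ∀ {s v} → v ∊ Star s → c v ≡ s × Normal v × Zero v
    Star-elim {s} {v} h with ⌊⌋-elim ((c v ≟ᵇ s) ×-dec (¬? (v ≟ sp s true) ×-dec (¬? (v ≟ sp s false) ×-dec all? (λ e → inc? {G} e v →-dec ¬? (decBool (R e)))))) h
    ... | refl , p , q , z = refl , (λ { true → p ; false → q }) , λ e i → ¬∊⇒∉ (z e i)

  star≤1 : ∀ s → card (Star s) ≤ 1
  star≤1 s = card≤1 {X = Star s} λ u v hu hv → case Star-elim hu of λ { (cu , nu , zu) → case Star-elim hv of λ { (cv , nv , zv) → zero-unique cv nv zv cu (zero-star cu nu zu) } }

  -- Four separate indicators instead of one disjunction, so that the total over all vertices is 4.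
  spind : Fin (n G) → ℕ
  spind v = (ind (⁅ sp true true ⁆ v) + ind (⁅ sp true false ⁆ v)) + (ind (⁅ sp false true ⁆ v) + ind (⁅ sp false false ⁆ v))

  -- The charge of a vertex: its removable edges, plus one for each excuse for having none. Every
  -- vertex has charge at least one, and the excuses amount to at most 4 + 1 + 1.
  weight-at : Fin (n G) → ℕ
  weight-at v = card (At v) + (spind v + (ind (Star true v) + ind (Star false v)))

  ind-∊ : ∀ {b} → b ≡ true → 1 ≤ ind b
  ind-∊ refl = s≤s z≤n

  spind-sp : ∀ s i → 1 ≤ spind (sp s i)
  spind-sp true true = ≤-trans (≤-trans (ind-∊ (∊⁅⁆ _)) (m≤m+n _ _)) (m≤m+n _ _)
  spind-sp true false = ≤-trans (≤-trans (ind-∊ (∊⁅⁆ (sp true false))) (m≤n+m _ (ind (⁅ sp true true ⁆ (sp true false))))) (m≤m+n _ _)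
  spind-sp false true = ≤-trans (≤-trans (ind-∊ (∊⁅⁆ _)) (m≤m+n _ _)) (m≤n+m _ (ind (⁅ sp true true ⁆ (sp false true)) + ind (⁅ sp true false ⁆ (sp false true))))
  spind-sp false false = ≤-trans (≤-trans (ind-∊ (∊⁅⁆ _)) (m≤n+m _ (ind (⁅ sp false true ⁆ (sp false false))))) (m≤n+m _ (ind (⁅ sp true true ⁆ (sp false false)) + ind (⁅ sp true false ⁆ (sp false false))))

  star-ind : ∀ s v → v ∊ Star s → 1 ≤ ind (Star true v) + ind (Star false v)
  star-ind true v h = ≤-trans (ind-∊ h) (m≤m+n _ _)
  star-ind false v h = ≤-trans (ind-∊ h) (m≤n+m _ _)

  weight≥1 : ∀ v → 1 ≤ weight-at v
  weight≥1 v with find (At v)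
  ... | inj₁ (e , h) = ≤-trans (card-pos {X = At v} h) (m≤m+n _ _)
  ... | inj₂ none with v ≟ sp (c v) true | v ≟ sp (c v) false
  ... | yes q | _ = ≤-trans (≤-trans (subst (λ w → 1 ≤ spind w) (sym q) (spind-sp (c v) true)) (m≤m+n _ _)) (m≤n+m _ (card (At v)))
  ... | no _ | yes q = ≤-trans (≤-trans (subst (λ w → 1 ≤ spind w) (sym q) (spind-sp (c v) false)) (m≤m+n _ _)) (m≤n+m _ (card (At v)))
  ... | no p | no q = ≤-trans (≤-trans (star-ind (c v) v (Star-intro refl (λ { true → p ; false → q }) λ e i → ¬∊⇒∉ λ h → ∊∉ {X = At v} (At-intro h i) (none e))) (m≤n+m _ (spind v))) (m≤n+m _ (card (At v)))

  sum-ind : ∀ (X : FSet (n G)) → sum (λ v → ind (X v)) ≡ card X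
  sum-ind X = sym (card-sum X)

  sum-spind : sum spind ≡ 4
  sum-spind = trans (∑-distrib-+ (λ v → ind (⁅ sp true true ⁆ v) + ind (⁅ sp true false ⁆ v)) (λ v → ind (⁅ sp false true ⁆ v) + ind (⁅ sp false false ⁆ v)))
      (cong₂ _+_ (two true) (two false))
    where
    two : ∀ s → sum (λ v → ind (⁅ sp s true ⁆ v) + ind (⁅ sp s false ⁆ v)) ≡ 2
    two s = trans (∑-distrib-+ (λ v → ind (⁅ sp s true ⁆ v)) (λ v → ind (⁅ sp s false ⁆ v))) (cong₂ _+_ (trans (sum-ind ⁅ sp s true ⁆) (card-⁅⁆ (sp s true))) (trans (sum-ind ⁅ sp s false ⁆) (card-⁅⁆ (sp s false))))

  sum-weight : sum weight-at ≡ (card R + card R) + (4 + (card (Star true) + card (Star false)))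
  sum-weight = trans (∑-distrib-+ (λ v → card (At v)) (λ v → spind v + (ind (Star true v) + ind (Star false v)))) (cong₂ _+_ handshake
    (trans (∑-distrib-+ spind (λ v → ind (Star true v) + ind (Star false v))) (cong₂ _+_ sum-spind
      (trans (∑-distrib-+ (λ v → ind (Star true v)) (λ v → ind (Star false v))) (cong₂ _+_ (sum-ind (Star true)) (sum-ind (Star false)))))))

  sum-ones : sum {n G} (λ _ → 1) ≡ n G
  sum-ones = trans (sym (card-sum {n G} (λ _ → true))) card-full

  n≤weight : n G ≤ (card R + card R) + (4 + (card (Star true) + card (Star false)))
  n≤weight = ≤-trans (≤-reflexive (sym sum-ones)) (≤-trans (sum-mono weight≥1) (≤-reflexive sum-weight))

  lower : n G ≤ (card R + card R) + 6
  lower = linear (n G ∷ card R ∷ card (Star true) ∷ card (Star false) ∷ [])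
    ((′ # 0 ≼ (′ # 1 ⊕ ′ # 1) ⊕ (♯ 4 ⊕ (′ # 2 ⊕ ′ # 3))) ∷ (′ # 2 ≼ ♯ 1) ∷ (′ # 3 ≼ ♯ 1) ∷ []) (′ # 0 ≼ (′ # 1 ⊕ ′ # 1) ⊕ ♯ 6) (n≤weight ∷ star≤1 true ∷ star≤1 false ∷ [])

  module Equality (eq : (card R + card R) + 6 ≡ n G) where

    star : ∀ s → ∃ λ v → v ∊ Star s
    star s = card-nonempty (Star s) (count s)
      where
      count : ∀ s → 1 ≤ card (Star s)
      count true = linear (n G ∷ card R ∷ card (Star true) ∷ card (Star false) ∷ [])
        ((′ # 0 ≼ (′ # 1 ⊕ ′ # 1) ⊕ (♯ 4 ⊕ (′ # 2 ⊕ ′ # 3))) ∷ ((′ # 1 ⊕ ′ # 1) ⊕ ♯ 6 ≼ ′ # 0) ∷ (′ # 3 ≼ ♯ 1) ∷ []) (♯ 1 ≼ ′ # 2) (n≤weight ∷ ≤-reflexive eq ∷ star≤1 false ∷ [])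
      count false = linear (n G ∷ card R ∷ card (Star true) ∷ card (Star false) ∷ [])
        ((′ # 0 ≼ (′ # 1 ⊕ ′ # 1) ⊕ (♯ 4 ⊕ (′ # 2 ⊕ ′ # 3))) ∷ ((′ # 1 ⊕ ′ # 1) ⊕ ♯ 6 ≼ ′ # 0) ∷ (′ # 2 ≼ ♯ 1) ∷ []) (♯ 1 ≼ ′ # 3) (n≤weight ∷ ≤-reflexive eq ∷ star≤1 true ∷ [])

    -- In the extremal case the charges, each at least one, add up to no more than the number of
    -- vertices.
    weight≤1 : ∀ v → weight-at v ≤ 1
    weight≤1 = sum-tight {f = λ _ → 1} {weight-at} weight≥1 (≤-trans (≤-reflexive sum-weight) (≤-trans
      (linear (card R ∷ card (Star true) ∷ card (Star false) ∷ []) ((′ # 1 ≼ ♯ 1) ∷ (′ # 2 ≼ ♯ 1) ∷ []) ((′ # 0 ⊕ ′ # 0) ⊕ (♯ 4 ⊕ (′ # 1 ⊕ ′ # 2)) ≼ (′ # 0 ⊕ ′ # 0) ⊕ ♯ 6) (star≤1 true ∷ star≤1 false ∷ []))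
      (≤-trans (≤-reflexive eq) (≤-reflexive (sym sum-ones)))))

    one-removable : ∀ {v e e'} → e ∊ R → e' ∊ R → Inc G e v → Inc G e' v → e ≡ e'
    one-removable {v} p q i i' = card≡1⇒unique {X = At v} (≤-trans (m≤m+n _ _) (weight≤1 v)) (At-intro p i) (At-intro q i')

    special-zero : ∀ s i → Zero (sp s i)
    special-zero s i e inc = ¬∊⇒∉ λ h → <-irrefl refl (≤-trans (+-mono-≤ (card-pos {X = At (sp s i)} (At-intro h inc)) (≤-trans (spind-sp s i) (m≤m+n _ _))) (weight≤1 (sp s i)))

-- Splicing K₄ at a cubic vertex

Simple : Graph → Set
Simple G = ∀ {e e' u v} → Joins G e u v → Joins G e' u v → e ≡ e'

-- `β` is blown up into a triangle: `f₁` moves to the new corner `t₁`, `f₂` moves to `t₂`, and `f₃`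
-- stays at `β`, which is kept as the third corner.
module Extension (L : Graph) (β : Fin (n L)) (f₁ f₂ f₃ : Fin (m L)) (v₁ v₂ v₃ : Fin (n L))
  (j₁ : Joins L f₁ β v₁) (j₂ : Joins L f₂ β v₂) (j₃ : Joins L f₃ β v₃) (f₁≢f₂ : f₁ ≢ f₂) (f₁≢f₃ : f₁ ≢ f₃) (f₂≢f₃ : f₂ ≢ f₃)
  (exact : ∀ {e} → Inc L e β → e ≡ f₁ ⊎ e ≡ f₂ ⊎ e ≡ f₃) where

  pattern t₁ = zero
  pattern t₂ = suc zero
  pattern up v = suc (suc v)
  pattern upe e = suc (suc (suc e))

  -- Only an end at `β` moves, and only for `f₁` and `f₂`; the last clause is the case of `f₃`.
  re : (v : Fin (n L)) → ∀ {P Q R : Set} → Dec P → Dec Q → Dec R → Fin (2 + n L)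
  re v (no _) _ _ = up v
  re v (yes _) (yes _) _ = t₁
  re v (yes _) (no _) (yes _) = t₂
  re v (yes _) (no _) (no _) = up v

  image : Fin (m L) → Fin (n L) → Fin (2 + n L)
  image e v = re v (v ≟ β) (e ≟ f₁) (e ≟ f₂)

  -- The contraction of the triangle back to `β`.
  ρ : Fin (2 + n L) → Fin (n L)
  ρ t₁ = β
  ρ t₂ = β
  ρ (up v) = v

  ρ-image : ∀ e v → ρ (image e v) ≡ v
  ρ-image e v with v ≟ β | e ≟ f₁ | e ≟ f₂
  ... | no _ | _ | _ = refl
  ... | yes q | yes _ | _ = sym q
  ... | yes q | no _ | yes _ = sym q
  ... | yes _ | no _ | no _ = refl

  image-other : ∀ e {v} → v ≢ β → image e v ≡ up v
  image-other e {v} h with v ≟ β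
  ... | no _ = refl
  ... | yes q = ⊥-elim (h q)

  image-f₁ : image f₁ β ≡ t₁
  image-f₁ with β ≟ β | f₁ ≟ f₁
  ... | yes _ | yes _ = refl
  ... | no h | _ = ⊥-elim (h refl)
  ... | yes _ | no h = ⊥-elim (h refl)

  image-f₂ : image f₂ β ≡ t₂
  image-f₂ with β ≟ β | f₂ ≟ f₁ | f₂ ≟ f₂
  ... | yes _ | no _ | yes _ = refl
  ... | no h | _ | _ = ⊥-elim (h refl)
  ... | yes _ | yes h | _ = ⊥-elim (f₁≢f₂ (sym h))
  ... | yes _ | no _ | no h = ⊥-elim (h refl)

  image-f₃ : image f₃ β ≡ up β
  image-f₃ with β ≟ β | f₃ ≟ f₁ | f₃ ≟ f₂
  ... | yes _ | no _ | no _ = refl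
  ... | no h | _ | _ = ⊥-elim (h refl)
  ... | yes _ | yes h | _ = ⊥-elim (f₁≢f₃ (sym h))
  ... | yes _ | no _ | yes h = ⊥-elim (f₂≢f₃ (sym h))

  e₁' e₂' : Fin (3 + m L) → Fin (2 + n L)
  e₁' zero = t₁
  e₁' (suc zero) = t₁
  e₁' (suc (suc zero)) = t₂
  e₁' (upe e) = image e (end₁ L e)
  e₂' zero = t₂
  e₂' (suc zero) = up β
  e₂' (suc (suc zero)) = up β
  e₂' (upe e) = image e (end₂ L e)

  L' : Graph
  L' = record { n = 2 + n L ; m = 3 + m L ; end₁ = e₁' ; end₂ = e₂' ; loopless = ll }
    where
    ll : ∀ e → e₁' e ≢ e₂' e
    ll zero ()
    ll (suc zero) ()
    ll (suc (suc zero)) ()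
    ll (upe e) q = loopless L e (trans (sym (ρ-image e (end₁ L e))) (trans (cong ρ q) (ρ-image e (end₂ L e))))

  joins-up : ∀ {e u v} → Joins L e u v → Joins L' (upe e) (image e u) (image e v)
  joins-up (inj₁ (refl , refl)) = inj₁ (refl , refl)
  joins-up (inj₂ (refl , refl)) = inj₂ (refl , refl)

  joins-down : ∀ {e x y} → Joins L' (upe e) x y → Joins L e (ρ x) (ρ y)
  joins-down {e} (inj₁ (refl , refl)) = inj₁ (sym (ρ-image e (end₁ L e)) , sym (ρ-image e (end₂ L e)))
  joins-down {e} (inj₂ (refl , refl)) = inj₂ (sym (ρ-image e (end₁ L e)) , sym (ρ-image e (end₂ L e)))

  inc-down : ∀ {e x} → Inc L' (upe e) x → Inc L e (ρ x)
  inc-down {e} (inj₁ refl) = inj₁ (sym (ρ-image e (end₁ L e)))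
  inc-down {e} (inj₂ refl) = inj₂ (sym (ρ-image e (end₂ L e)))

  inc-up : ∀ {e v} → Inc L e v → Inc L' (upe e) (image e v)
  inc-up (inj₁ refl) = inj₁ refl
  inc-up (inj₂ refl) = inj₂ refl

  joins-at-f₁ : Joins L' (upe f₁) t₁ (up v₁)
  joins-at-f₁ = subst₂ (Joins L' (upe f₁)) image-f₁ (image-other f₁ (joins-≢ {L} j₁ ∘ sym)) (joins-up j₁)

  joins-at-f₂ : Joins L' (upe f₂) t₂ (up v₂)
  joins-at-f₂ = subst₂ (Joins L' (upe f₂)) image-f₂ (image-other f₂ (joins-≢ {L} j₂ ∘ sym)) (joins-up j₂)

  joins-at-f₃ : Joins L' (upe f₃) (up β) (up v₃)
  joins-at-f₃ = subst₂ (Joins L' (upe f₃)) image-f₃ (image-other f₃ (joins-≢ {L} j₃ ∘ sym)) (joins-up j₃)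

  upe-inj : ∀ {e e' : Fin (m L)} → _≡_ {A = Fin (3 + m L)} (upe e) (upe e') → e ≡ e'
  upe-inj refl = refl

  near : ∀ {e x y z} → ρ x ≡ β → Joins L' (upe e) y (up z) → β ≢ z → Inc L' (upe e) x → x ≡ y
  near {e} h j ne i with inc-cases {L'} {upe e} j i
  ... | inj₁ q = q
  ... | inj₂ q = ⊥-elim (ne (trans (sym h) (cong ρ q)))

  old-at : ∀ {e x} → ρ x ≡ β → Inc L' (upe e) x → (e ≡ f₁ × x ≡ t₁) ⊎ (e ≡ f₂ × x ≡ t₂) ⊎ (e ≡ f₃ × x ≡ up β)
  old-at {e} {x} h i with exact (subst (Inc L e) h (inc-down i))
  ... | inj₁ refl = inj₁ (refl , near {f₁} h joins-at-f₁ (joins-≢ {L} j₁) i)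
  ... | inj₂ (inj₁ refl) = inj₂ (inj₁ (refl , near {f₂} h joins-at-f₂ (joins-≢ {L} j₂) i))
  ... | inj₂ (inj₂ refl) = inj₂ (inj₂ (refl , near {f₃} h joins-at-f₃ (joins-≢ {L} j₃) i))

  share : ∀ {g g' w u v} → Inc L' g w → Joins L' g u v → Joins L' g' u v → Inc L' g' w
  share {g} {g'} i j j' with inc-cases {L'} {g} j i
  ... | inj₁ refl = joins-inc {L'} {g'} j'
  ... | inj₂ refl = joins-inc {L'} {g'} (joins-sym {L'} {g'} j')

  simple' : Simple L → Simple L'
  simple' sm {upe e} {upe e'} j j' = cong (λ e → upe e) (sm (joins-down j) (joins-down j'))
  simple' sm {upe e} {zero} j (inj₁ (refl , refl)) = ⊥-elim (joins-≢ {L} (joins-down j) refl)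
  simple' sm {upe e} {zero} j (inj₂ (refl , refl)) = ⊥-elim (joins-≢ {L} (joins-down j) refl)
  simple' sm {upe e} {suc zero} j (inj₁ (refl , refl)) = ⊥-elim (joins-≢ {L} (joins-down j) refl)
  simple' sm {upe e} {suc zero} j (inj₂ (refl , refl)) = ⊥-elim (joins-≢ {L} (joins-down j) refl)
  simple' sm {upe e} {suc (suc zero)} j (inj₁ (refl , refl)) = ⊥-elim (joins-≢ {L} (joins-down j) refl)
  simple' sm {upe e} {suc (suc zero)} j (inj₂ (refl , refl)) = ⊥-elim (joins-≢ {L} (joins-down j) refl)
  simple' sm {zero} {upe e} (inj₁ (refl , refl)) j = ⊥-elim (joins-≢ {L} (joins-down j) refl)
  simple' sm {zero} {upe e} (inj₂ (refl , refl)) j = ⊥-elim (joins-≢ {L} (joins-down j) refl)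
  simple' sm {suc zero} {upe e} (inj₁ (refl , refl)) j = ⊥-elim (joins-≢ {L} (joins-down j) refl)
  simple' sm {suc zero} {upe e} (inj₂ (refl , refl)) j = ⊥-elim (joins-≢ {L} (joins-down j) refl)
  simple' sm {suc (suc zero)} {upe e} (inj₁ (refl , refl)) j = ⊥-elim (joins-≢ {L} (joins-down j) refl)
  simple' sm {suc (suc zero)} {upe e} (inj₂ (refl , refl)) j = ⊥-elim (joins-≢ {L} (joins-down j) refl)
  simple' sm {zero} {zero} _ _ = refl
  simple' sm {suc zero} {suc zero} _ _ = refl
  simple' sm {suc (suc zero)} {suc (suc zero)} _ _ = refl
  simple' sm {zero} {suc zero} j j' = case share {zero} {suc zero} {t₂} (inj₂ refl) j j' of λ { (inj₁ ()) ; (inj₂ ()) }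
  simple' sm {zero} {suc (suc zero)} j j' = case share {zero} {suc (suc zero)} {t₁} (inj₁ refl) j j' of λ { (inj₁ ()) ; (inj₂ ()) }
  simple' sm {suc zero} {zero} j j' = case share {suc zero} {zero} {up β} (inj₂ refl) j j' of λ { (inj₁ ()) ; (inj₂ ()) }
  simple' sm {suc zero} {suc (suc zero)} j j' = case share {suc zero} {suc (suc zero)} {t₁} (inj₁ refl) j j' of λ { (inj₁ ()) ; (inj₂ ()) }
  simple' sm {suc (suc zero)} {zero} j j' = case share {suc (suc zero)} {zero} {up β} (inj₂ refl) j j' of λ { (inj₁ ()) ; (inj₂ ()) }
  simple' sm {suc (suc zero)} {suc zero} j j' = case share {suc (suc zero)} {suc zero} {t₂} (inj₁ refl) j j' of λ { (inj₁ ()) ; (inj₂ ()) }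

  EdgeOf : Set
  EdgeOf = Fin (m L) ⊎ (Fin 6 ⊎ (Fin (m L) × Fin 6))

  vcls : (v : Fin (n L)) → Dec (v ≡ β) → Fin (n L) ⊎ Fin 4
  vcls v (yes _) = inj₂ (# 3)
  vcls v (no _) = inj₁ v

  vmap : Fin (2 + n L) → Fin (n L) ⊎ Fin 4
  vmap t₁ = inj₂ (# 1)
  vmap t₂ = inj₂ (# 2)
  vmap (up v) = vcls v (v ≟ β)

  ecls : (e : Fin (m L)) → Dec (e ≡ f₁) → Dec (e ≡ f₂) → Dec (e ≡ f₃) → EdgeOf
  ecls e (yes _) _ _ = inj₂ (inj₂ (e , # 0))
  ecls e (no _) (yes _) _ = inj₂ (inj₂ (e , # 1))
  ecls e (no _) (no _) (yes _) = inj₂ (inj₂ (e , # 2))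
  ecls e (no _) (no _) (no _) = inj₁ e

  emap : Fin (3 + m L) → EdgeOf
  emap zero = inj₂ (inj₁ (# 3))
  emap (suc zero) = inj₂ (inj₁ (# 4))
  emap (suc (suc zero)) = inj₂ (inj₁ (# 5))
  emap (upe e) = ecls e (e ≟ f₁) (e ≟ f₂) (e ≟ f₃)

  vmap-β : vmap (up β) ≡ inj₂ (# 3)
  vmap-β with β ≟ β
  ... | yes _ = refl
  ... | no h = ⊥-elim (h refl)

  vmap-other : ∀ {v} → v ≢ β → vmap (up v) ≡ inj₁ v
  vmap-other {v} h with v ≟ β
  ... | yes q = ⊥-elim (h q)
  ... | no _ = refl

  data View : Fin (m L) → Set where
    is₁ : View f₁
    is₂ : View f₂
    is₃ : View f₃
    old : ∀ {e} → ¬ Inc L e β → emap (upe e) ≡ inj₁ e → View e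

  emap₁ : emap (upe f₁) ≡ inj₂ (inj₂ (f₁ , # 0))
  emap₁ with f₁ ≟ f₁
  ... | yes _ = refl
  ... | no h = ⊥-elim (h refl)

  emap₂ : emap (upe f₂) ≡ inj₂ (inj₂ (f₂ , # 1))
  emap₂ with f₂ ≟ f₁ | f₂ ≟ f₂
  ... | no _ | yes _ = refl
  ... | yes h | _ = ⊥-elim (f₁≢f₂ (sym h))
  ... | no _ | no h = ⊥-elim (h refl)

  emap₃ : emap (upe f₃) ≡ inj₂ (inj₂ (f₃ , # 2))
  emap₃ with f₃ ≟ f₁ | f₃ ≟ f₂ | f₃ ≟ f₃
  ... | no _ | no _ | yes _ = refl
  ... | yes h | _ | _ = ⊥-elim (f₁≢f₃ (sym h))
  ... | no _ | yes h | _ = ⊥-elim (f₂≢f₃ (sym h))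
  ... | no _ | no _ | no h = ⊥-elim (h refl)

  view : ∀ e → View e
  view e = go (e ≟ f₁) (e ≟ f₂) (e ≟ f₃)
    where
    go : Dec (e ≡ f₁) → Dec (e ≡ f₂) → Dec (e ≡ f₃) → View e
    go (yes refl) _ _ = is₁
    go (no _) (yes refl) _ = is₂
    go (no _) (no _) (yes refl) = is₃
    go (no p) (no q) (no r) = old (λ i → case exact i of λ { (inj₁ h) → p h ; (inj₂ (inj₁ h)) → q h ; (inj₂ (inj₂ h)) → r h }) unfold
      where
      unfold : emap (upe e) ≡ inj₁ e
      unfold with e ≟ f₁ | e ≟ f₂ | e ≟ f₃
      ... | yes h | _ | _ = ⊥-elim (p h)
      ... | no _ | yes h | _ = ⊥-elim (q h)
      ... | no _ | no _ | yes h = ⊥-elim (r h)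
      ... | no _ | no _ | no _ = refl

  -- A left inverse of `emap` on old edges, from which injectivity follows. The value `f₁` on the
  -- new triangle is arbitrary.
  first : EdgeOf → Fin (m L)
  first (inj₁ e) = e
  first (inj₂ (inj₁ _)) = f₁
  first (inj₂ (inj₂ (e , _))) = e

  emap-first : ∀ e → first (emap (upe e)) ≡ e
  emap-first e with view e
  ... | is₁ = cong first emap₁
  ... | is₂ = cong first emap₂
  ... | is₃ = cong first emap₃
  ... | old _ h = cong first h

  ρ-vmap : Fin (n L) ⊎ Fin 4 → Fin (2 + n L)
  ρ-vmap (inj₁ v) = up v
  ρ-vmap (inj₂ zero) = t₁
  ρ-vmap (inj₂ (suc zero)) = t₁
  ρ-vmap (inj₂ (suc (suc zero))) = t₂
  ρ-vmap (inj₂ (suc (suc (suc zero)))) = up β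

  vmap-section : ∀ x → ρ-vmap (vmap x) ≡ x
  vmap-section t₁ = refl
  vmap-section t₂ = refl
  vmap-section (up v) with v ≟ β
  ... | yes q = cong (λ v → up v) (sym q)
  ... | no _ = refl

  not-new : ∀ e k → emap (upe e) ≢ inj₂ (inj₁ k)
  not-new e k h with view e
  ... | is₁ = case trans (sym emap₁) h of λ ()
  ... | is₂ = case trans (sym emap₂) h of λ ()
  ... | is₃ = case trans (sym emap₃) h of λ ()
  ... | old _ q = case trans (sym q) h of λ ()

  same : ∀ {g x y x' y'} → Joins L' g x y → vmap x ≡ x' → vmap y ≡ y' → SamePair (vmap (end₁ L' g)) (vmap (end₂ L' g)) x' y'
  same (inj₁ (refl , refl)) refl refl = inj₁ (refl , refl)
  same (inj₂ (refl , refl)) refl refl = inj₂ (refl , refl)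

  -- Vertex 0 of `K4` is the one that disappears; vertices 1, 2, 3 become `t₁`, `t₂` and `up β`.
  splicing : Splicing L' L β K4 (# 0)
  splicing = record
    { vmap = vmap
    ; vmap-inj = λ x y h → trans (sym (vmap-section x)) (trans (cong ρ-vmap h) (vmap-section y))
    ; vmap-no₁ = no₁ ; vmap-no₂ = no₂
    ; vmap-on₁ = λ v h → up v , vmap-other h
    ; vmap-on₂ = on₂
    ; emap = emap ; emap-inj = einj
    ; old₁ = o₁ ; old₁-on = o₁-on ; old₂ = o₂ ; old₂-on = o₂-on
    ; new = nw ; new-on₁ = nw₁ ; new-on₂ = nw₂
    ; new-fun₁ = λ g h a b b' p q → fun₁ g h p q ; new-fun₂ = fun₂ }
    where
    no₁ : ∀ x → vmap x ≢ inj₁ β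
    no₁ t₁ ()
    no₁ t₂ ()
    no₁ (up v) h with v ≟ β
    no₁ (up v) () | yes _
    no₁ (up v) refl | no q = q refl
    no₂ : ∀ x → vmap x ≢ inj₂ (# 0)
    no₂ t₁ ()
    no₂ t₂ ()
    no₂ (up v) h with v ≟ β
    no₂ (up v) () | yes _
    no₂ (up v) () | no _
    on₂ : ∀ v → v ≢ # 0 → ∃ λ x → vmap x ≡ inj₂ v
    on₂ zero h = ⊥-elim (h refl)
    on₂ (suc zero) h = t₁ , refl
    on₂ (suc (suc zero)) h = t₂ , refl
    on₂ (suc (suc (suc zero))) h = up β , vmap-β
    einj : ∀ g h → emap g ≡ emap h → g ≡ h
    einj (upe e) (upe e') q = cong (λ e → upe e) (trans (sym (emap-first e)) (trans (cong first q) (emap-first e')))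
    einj (upe e) zero q = ⊥-elim (not-new e _ q)
    einj (upe e) (suc zero) q = ⊥-elim (not-new e _ q)
    einj (upe e) (suc (suc zero)) q = ⊥-elim (not-new e _ q)
    einj zero (upe e) q = ⊥-elim (not-new e _ (sym q))
    einj (suc zero) (upe e) q = ⊥-elim (not-new e _ (sym q))
    einj (suc (suc zero)) (upe e) q = ⊥-elim (not-new e _ (sym q))
    einj zero zero q = refl
    einj (suc zero) (suc zero) q = refl
    einj (suc (suc zero)) (suc (suc zero)) q = refl
    einj zero (suc zero) ()
    einj zero (suc (suc zero)) ()
    einj (suc zero) zero ()
    einj (suc zero) (suc (suc zero)) ()
    einj (suc (suc zero)) zero ()
    einj (suc (suc zero)) (suc zero) ()
    o₁ : ∀ g f → emap g ≡ inj₁ f → ¬ Inc L f β × SamePair (vmap (e₁' g)) (vmap (e₂' g)) (inj₁ (end₁ L f)) (inj₁ (end₂ L f))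
    o₁ zero f ()
    o₁ (suc zero) f ()
    o₁ (suc (suc zero)) f ()
    o₁ (upe e) f h with view e
    ... | is₁ = case trans (sym emap₁) h of λ ()
    ... | is₂ = case trans (sym emap₂) h of λ ()
    ... | is₃ = case trans (sym emap₃) h of λ ()
    ... | old ni q with trans (sym q) h
    ... | refl = ni , inj₁ (trans (cong vmap (image-other e (ni ∘ inj₁))) (vmap-other (ni ∘ inj₁)) , trans (cong vmap (image-other e (ni ∘ inj₂))) (vmap-other (ni ∘ inj₂)))
    o₁-on : ∀ f → ¬ Inc L f β → ∃ λ g → emap g ≡ inj₁ f
    o₁-on f ni with view f
    ... | is₁ = ⊥-elim (ni (joins-inc {L} j₁))
    ... | is₂ = ⊥-elim (ni (joins-inc {L} j₂))
    ... | is₃ = ⊥-elim (ni (joins-inc {L} j₃))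
    ... | old _ q = upe f , q
    o₂ : ∀ g f → emap g ≡ inj₂ (inj₁ f) → ¬ Inc K4 f (# 0) × SamePair (vmap (e₁' g)) (vmap (e₂' g)) (inj₂ (end₁ K4 f)) (inj₂ (end₂ K4 f))
    o₂ zero f refl = (λ { (inj₁ ()) ; (inj₂ ()) }) , inj₁ (refl , refl)
    o₂ (suc zero) f refl = (λ { (inj₁ ()) ; (inj₂ ()) }) , inj₁ (refl , vmap-β)
    o₂ (suc (suc zero)) f refl = (λ { (inj₁ ()) ; (inj₂ ()) }) , inj₁ (refl , vmap-β)
    o₂ (upe e) f h = ⊥-elim (not-new e f h)
    o₂-on : ∀ f → ¬ Inc K4 f (# 0) → ∃ λ g → emap g ≡ inj₂ (inj₁ f)
    o₂-on zero h = ⊥-elim (h (inj₁ refl))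
    o₂-on (suc zero) h = ⊥-elim (h (inj₁ refl))
    o₂-on (suc (suc zero)) h = ⊥-elim (h (inj₁ refl))
    o₂-on (suc (suc (suc zero))) h = zero , refl
    o₂-on (suc (suc (suc (suc zero)))) h = suc zero , refl
    o₂-on (suc (suc (suc (suc (suc zero))))) h = suc (suc zero) , refl
    nw : ∀ g a b → emap g ≡ inj₂ (inj₂ (a , b)) → ∃₂ λ x y → Joins L a β x × Joins K4 b (# 0) y × SamePair (vmap (e₁' g)) (vmap (e₂' g)) (inj₁ x) (inj₂ y)
    nw zero a b ()
    nw (suc zero) a b ()
    nw (suc (suc zero)) a b ()
    nw (upe e) a b h with view e
    ... | is₁ with trans (sym emap₁) h
    ... | refl = v₁ , # 1 , j₁ , inj₁ (refl , refl) , same (joins-sym {L'} joins-at-f₁) (vmap-other (joins-≢ {L} j₁ ∘ sym)) refl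
    nw (upe e) a b h | is₂ with trans (sym emap₂) h
    ... | refl = v₂ , # 2 , j₂ , inj₁ (refl , refl) , same (joins-sym {L'} joins-at-f₂) (vmap-other (joins-≢ {L} j₂ ∘ sym)) refl
    nw (upe e) a b h | is₃ with trans (sym emap₃) h
    ... | refl = v₃ , # 3 , j₃ , inj₁ (refl , refl) , same (joins-sym {L'} joins-at-f₃) (vmap-other (joins-≢ {L} j₃ ∘ sym)) vmap-β
    nw (upe e) a b h | old _ q = case trans (sym q) h of λ ()
    nw₁ : ∀ a → Inc L a β → ∃₂ λ g b → emap g ≡ inj₂ (inj₂ (a , b))
    nw₁ a i with exact i
    ... | inj₁ refl = upe a , _ , emap₁
    ... | inj₂ (inj₁ refl) = upe a , _ , emap₂
    ... | inj₂ (inj₂ refl) = upe a , _ , emap₃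
    nw₂ : ∀ b → Inc K4 b (# 0) → ∃₂ λ g a → emap g ≡ inj₂ (inj₂ (a , b))
    nw₂ zero i = upe f₁ , f₁ , emap₁
    nw₂ (suc zero) i = upe f₂ , f₂ , emap₂
    nw₂ (suc (suc zero)) i = upe f₃ , f₃ , emap₃
    nw₂ (suc (suc (suc zero))) (inj₁ ())
    nw₂ (suc (suc (suc zero))) (inj₂ ())
    nw₂ (suc (suc (suc (suc zero)))) (inj₁ ())
    nw₂ (suc (suc (suc (suc zero)))) (inj₂ ())
    nw₂ (suc (suc (suc (suc (suc zero))))) (inj₁ ())
    nw₂ (suc (suc (suc (suc (suc zero))))) (inj₂ ())
    fun₁ : ∀ g h {a b b'} → emap g ≡ inj₂ (inj₂ (a , b)) → emap h ≡ inj₂ (inj₂ (a , b')) → g ≡ h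
    fun₁ zero h ()
    fun₁ (suc zero) h ()
    fun₁ (suc (suc zero)) h ()
    fun₁ (upe e) zero p ()
    fun₁ (upe e) (suc zero) p ()
    fun₁ (upe e) (suc (suc zero)) p ()
    fun₁ (upe e) (upe e') p q = cong (λ e → upe e) (trans (sym (emap-first e)) (trans (cong first p) (trans (sym (cong first q)) (emap-first e'))))
    second : ∀ e {a b} → emap (upe e) ≡ inj₂ (inj₂ (a , b)) → (e ≡ f₁ × b ≡ # 0) ⊎ (e ≡ f₂ × b ≡ # 1) ⊎ (e ≡ f₃ × b ≡ # 2)
    second e h with view e
    ... | is₁ = case trans (sym emap₁) h of λ { refl → inj₁ (refl , refl) }
    ... | is₂ = case trans (sym emap₂) h of λ { refl → inj₂ (inj₁ (refl , refl)) }
    ... | is₃ = case trans (sym emap₃) h of λ { refl → inj₂ (inj₂ (refl , refl)) }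
    ... | old _ q = case trans (sym q) h of λ ()
    fun₂ : ∀ g h a a' b → emap g ≡ inj₂ (inj₂ (a , b)) → emap h ≡ inj₂ (inj₂ (a' , b)) → g ≡ h
    fun₂ zero h a a' b ()
    fun₂ (suc zero) h a a' b ()
    fun₂ (suc (suc zero)) h a a' b ()
    fun₂ (upe e) zero a a' b p ()
    fun₂ (upe e) (suc zero) a a' b p ()
    fun₂ (upe e) (suc (suc zero)) a a' b p ()
    fun₂ (upe e) (upe e') a a' b p q with second e p | second e' q
    ... | inj₁ (refl , _) | inj₁ (refl , _) = refl
    ... | inj₂ (inj₁ (refl , _)) | inj₂ (inj₁ (refl , _)) = refl
    ... | inj₂ (inj₂ (refl , _)) | inj₂ (inj₂ (refl , _)) = refl
    ... | inj₁ (_ , refl) | inj₂ (inj₁ (_ , ()))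
    ... | inj₁ (_ , refl) | inj₂ (inj₂ (_ , ()))
    ... | inj₂ (inj₁ (_ , refl)) | inj₁ (_ , ())
    ... | inj₂ (inj₁ (_ , refl)) | inj₂ (inj₂ (_ , ()))
    ... | inj₂ (inj₂ (_ , refl)) | inj₁ (_ , ())
    ... | inj₂ (inj₂ (_ , refl)) | inj₂ (inj₁ (_ , ()))

-- Isomorphisms, and ladders with a distinguished triangle

module _ {G H : Graph} (i : Iso G H) where
  open Iso i
  open Inverse

  iso-same : ∀ {A : Set} (f : Fin (n H) → A) {x y} g → SamePair (f (end₁ H (to ebij g))) (f (end₂ H (to ebij g))) x y →
    SamePair (f (to vbij (end₁ G g))) (f (to vbij (end₂ G g))) x y
  iso-same f g h with ends g
  iso-same f g (inj₁ (p , q)) | inj₁ (a , b) = inj₁ (trans (cong f a) p , trans (cong f b) q)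
  iso-same f g (inj₂ (p , q)) | inj₁ (a , b) = inj₂ (trans (cong f a) p , trans (cong f b) q)
  iso-same f g (inj₁ (p , q)) | inj₂ (a , b) = inj₂ (trans (cong f a) q , trans (cong f b) p)
  iso-same f g (inj₂ (p , q)) | inj₂ (a , b) = inj₁ (trans (cong f a) q , trans (cong f b) p)

  to-inj : ∀ {A B : Set} (b : A ↔ B) {x y} → to b x ≡ to b y → x ≡ y
  to-inj b {x} {y} h = trans (sym (strictlyInverseʳ b x)) (trans (cong (from b) h) (strictlyInverseʳ b y))

  pull : ∀ {A B : Set} (b : A ↔ B) {P : B → Set} → ∃ P → ∃ λ x → P (to b x)
  pull b {P} (y , p) = from b y , subst P (sym (strictlyInverseˡ b y)) p

  splicing-iso : ∀ {K u w} → Splicing H K u K4 w → Splicing G K u K4 w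
  splicing-iso S = record
    { vmap = λ x → vmap (to vbij x) ; vmap-inj = λ x y h → to-inj vbij (vmap-inj _ _ h)
    ; vmap-no₁ = λ x → vmap-no₁ _ ; vmap-no₂ = λ x → vmap-no₂ _
    ; vmap-on₁ = λ v h → pull vbij (vmap-on₁ v h) ; vmap-on₂ = λ v h → pull vbij (vmap-on₂ v h)
    ; emap = λ g → emap (to ebij g) ; emap-inj = λ g h q → to-inj ebij (emap-inj _ _ q)
    ; old₁ = λ g f h → proj₁ (old₁ _ f h) , iso-same vmap g (proj₂ (old₁ _ f h))
    ; old₁-on = λ f h → pull ebij (old₁-on f h)
    ; old₂ = λ g f h → proj₁ (old₂ _ f h) , iso-same vmap g (proj₂ (old₂ _ f h))
    ; old₂-on = λ f h → pull ebij (old₂-on f h)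
    ; new = λ g f₁ f₂ h → case new _ f₁ f₂ h of λ { (a , b , p , q , r) → a , b , p , q , iso-same vmap g r }
    ; new-on₁ = λ f h → pull ebij (new-on₁ f h) ; new-on₂ = λ f h → pull ebij (new-on₂ f h)
    ; new-fun₁ = λ g h a b b' p q → to-inj ebij (new-fun₁ _ _ a b b' p q) ; new-fun₂ = λ g h a a' b p q → to-inj ebij (new-fun₂ _ _ a a' b p q) }
    where open Splicing S

  iso-trans : ∀ {K} → Iso H K → Iso G K
  iso-trans k = record { vbij = compose vbij (Iso.vbij k) ; ebij = compose ebij (Iso.ebij k) ; ends = λ e → iso-same (to (Iso.vbij k)) e (Iso.ends k (to ebij e)) }
    where
    compose : ∀ {A B C : Set} → A ↔ B → B ↔ C → A ↔ C
    compose f g = mk↔ₛ′ (λ x → to g (to f x)) (λ y → from f (from g y))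
      (λ y → trans (cong (to g) (strictlyInverseˡ f (from g y))) (strictlyInverseˡ g y)) (λ x → trans (cong (from f) (strictlyInverseʳ g (to f x))) (strictlyInverseʳ f x))

triLadder-iso : ∀ {G H} → Iso G H → TriLadder H → TriLadder G
triLadder-iso i (base j) = base (iso-trans i j)
triLadder-iso i (splice tl u tri w S) = splice tl u tri w (splicing-iso i S)

ThreeEdges : Graph → Set
ThreeEdges G = ∀ v → ∃ λ e → ∃₂ λ e' e'' → Inc G e v × Inc G e' v × Inc G e'' v × e ≢ e' × e ≢ e'' × e' ≢ e''

-- Simplicity of `L` makes the induced edge map injective. The images of three edges at a vertex
-- exhaust the edges of `G` there, since four are impossible, so the map is onto.
embedding⇒iso : ∀ {G L : Graph} → Simple L → ThreeEdges L
  → (∀ {v e₁ e₂ e₃ e₄} → Inc G e₁ v → Inc G e₂ v → Inc G e₃ v → Inc G e₄ v → e₁ ≢ e₂ → e₁ ≢ e₃ → e₁ ≢ e₄ → e₂ ≢ e₃ → e₂ ≢ e₄ → e₃ ≢ e₄ → ⊥)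
  → (φ : Fin (n L) → Fin (n G)) → (∀ {u v} → φ u ≡ φ v → u ≡ v) → (∀ x → ∃ λ v → φ v ≡ x)
  → (∀ e → Adj G (φ (end₁ L e)) (φ (end₂ L e))) → Iso G L
embedding⇒iso {G} {L} sm three deg φ φ-inj φ-surj adj = record
  { vbij = mk↔ₛ′ (λ x → proj₁ (φ-surj x)) φ (λ v → φ-inj (proj₂ (φ-surj (φ v)))) (λ x → proj₂ (φ-surj x))
  ; ebij = mk↔ₛ′ (λ g → proj₁ (ψ-surj g)) ψ (λ e → ψ-inj (proj₂ (ψ-surj (ψ e)))) (λ g → proj₂ (ψ-surj g))
  ; ends = λ g → ends g (proj₁ (ψ-surj g)) (proj₂ (ψ-surj g)) }
  where
  ψ : Fin (m L) → Fin (m G)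
  ψ e = proj₁ (adj e)
  ψ-joins : ∀ {e u v} → Joins L e u v → Joins G (ψ e) (φ u) (φ v)
  ψ-joins {e} (inj₁ (refl , refl)) = proj₂ (adj e)
  ψ-joins {e} (inj₂ (refl , refl)) = joins-sym {G} (proj₂ (adj e))
  ψ-inj : ∀ {e e'} → ψ e ≡ ψ e' → e ≡ e'
  ψ-inj {e} {e'} h with joins-cases {G} (subst (λ g → Joins G g _ _) h (ψ-joins (joins-ends {L} e))) (ψ-joins (joins-ends {L} e'))
  ... | inj₁ (p , q) = sm (joins-ends {L} e) (subst₂ (Joins L e') (φ-inj (sym p)) (φ-inj (sym q)) (joins-ends {L} e'))
  ... | inj₂ (p , q) = sm (joins-ends {L} e) (subst₂ (Joins L e') (φ-inj (sym p)) (φ-inj (sym q)) (joins-sym {L} (joins-ends {L} e')))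
  ψ-inc : ∀ {e u} → Inc L e u → Inc G (ψ e) (φ u)
  ψ-inc i with inc-joins {L} i
  ... | w , j = joins-inc {G} (ψ-joins j)
  ψ-surj : ∀ g → ∃ λ e → ψ e ≡ g
  ψ-surj g with φ-surj (end₁ G g)
  ... | u , q with three u
  ... | e₁ , e₂ , e₃ , i₁ , i₂ , i₃ , p₁₂ , p₁₃ , p₂₃ with ψ e₁ ≟ g | ψ e₂ ≟ g | ψ e₃ ≟ g
  ... | yes r | _ | _ = e₁ , r
  ... | no _ | yes r | _ = e₂ , r
  ... | no _ | no _ | yes r = e₃ , r
  ... | no r₁ | no r₂ | no r₃ = ⊥-elim (deg (ψ-inc i₁) (ψ-inc i₂) (ψ-inc i₃) (inj₁ (sym q)) (p₁₂ ∘ ψ-inj) (p₁₃ ∘ ψ-inj) r₁ (p₂₃ ∘ ψ-inj) r₂ r₃)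
  ends : ∀ g e → ψ e ≡ g → SamePair (proj₁ (φ-surj (end₁ G g))) (proj₁ (φ-surj (end₂ G g))) (end₁ L e) (end₂ L e)
  ends g e refl with ψ-joins (joins-ends {L} e)
  ... | inj₁ (p , q) = inj₁ (φ-inj (trans (proj₂ (φ-surj _)) p) , φ-inj (trans (proj₂ (φ-surj _)) q))
  ... | inj₂ (p , q) = inj₂ (φ-inj (trans (proj₂ (φ-surj _)) p) , φ-inj (trans (proj₂ (φ-surj _)) q))

-- A tri-ladder seen from one of its triangles {ξ, β₁, β₂}, whose vertices β₁ and β₂ continue to π and κ.
record Ladder : Set where
  field
    L : Graph
    triLadder : TriLadder L
    simple : Simple L
    three : ThreeEdges L
    β₁ β₂ ξ π κ : Fin (n L)
    e₁ξ e₁π e₂ξ e₂κ eββ : Fin (m L)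
    j₁ξ : Joins L e₁ξ β₁ ξ
    j₁π : Joins L e₁π β₁ π
    j₂ξ : Joins L e₂ξ β₂ ξ
    j₂κ : Joins L e₂κ β₂ κ
    jββ : Joins L eββ β₁ β₂
    exact₁ : ∀ {e} → Inc L e β₁ → e ≡ e₁ξ ⊎ e ≡ eββ ⊎ e ≡ e₁π
    exact₂ : ∀ {e} → Inc L e β₂ → e ≡ e₂ξ ⊎ e ≡ eββ ⊎ e ≡ e₂κ
    π≢β₂ : π ≢ β₂
    κ≢β₁ : κ ≢ β₁
    ξ≢π : ξ ≢ π
    ξ≢κ : ξ ≢ κ

swapLadder : Ladder → Ladder
swapLadder Λ = record { L = L ; triLadder = triLadder ; simple = simple ; three = three ; β₁ = β₂ ; β₂ = β₁ ; ξ = ξ ; π = κ ; κ = π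
  ; e₁ξ = e₂ξ ; e₁π = e₂κ ; e₂ξ = e₁ξ ; e₂κ = e₁π ; eββ = eββ ; j₁ξ = j₂ξ ; j₁π = j₂κ ; j₂ξ = j₁ξ ; j₂κ = j₁π ; jββ = joins-sym {L} jββ
  ; exact₁ = exact₂ ; exact₂ = exact₁ ; π≢β₂ = κ≢β₁ ; κ≢β₁ = π≢β₂ ; ξ≢π = ξ≢κ ; ξ≢κ = ξ≢π }
  where open Ladder Λ

-- The blown-up vertex is `β₂`, and the new triangle becomes the distinguished one. Its corner `t₂`,
-- attached to the old `β₁`, is the new `ξ`; the old `ξ`, attached to `t₁`, takes over the part of
-- `π`.
module Extend (Λ : Ladder) where
  open Ladder Λ

  e₂ξ≢eββ : e₂ξ ≢ eββ
  e₂ξ≢eββ refl = joins-≢ {L} j₁ξ (sym (joins-unique {L} j₂ξ (joins-sym {L} jββ)))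

  e₂ξ≢e₂κ : e₂ξ ≢ e₂κ
  e₂ξ≢e₂κ refl = ξ≢κ (joins-unique {L} j₂ξ j₂κ)

  eββ≢e₂κ : eββ ≢ e₂κ
  eββ≢e₂κ refl = κ≢β₁ (joins-unique {L} j₂κ (joins-sym {L} jββ))

  open Extension L β₂ e₂ξ eββ e₂κ ξ β₁ κ j₂ξ (joins-sym {L} jββ) j₂κ e₂ξ≢eββ e₂ξ≢e₂κ eββ≢e₂κ exact₂ public

  three' : ThreeEdges L'
  three' t₁ = zero , suc zero , upe e₂ξ , inj₁ refl , inj₁ refl , joins-inc {L'} {upe e₂ξ} joins-at-f₁ , (λ ()) , (λ ()) , λ ()
  three' t₂ = zero , suc (suc zero) , upe eββ , inj₂ refl , inj₁ refl , joins-inc {L'} {upe eββ} joins-at-f₂ , (λ ()) , (λ ()) , λ ()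
  three' (up v) with v ≟ β₂
  ... | yes refl = suc zero , suc (suc zero) , upe e₂κ , inj₂ refl , inj₂ refl , joins-inc {L'} {upe e₂κ} joins-at-f₃ , (λ ()) , (λ ()) , λ ()
  ... | no ne with three v
  ... | e , e' , e'' , i , i' , i'' , p , q , r = upe e , upe e' , upe e'' , lift i , lift i' , lift i'' , p ∘ upe-inj , q ∘ upe-inj , r ∘ upe-inj
    where
    lift : ∀ {e} → Inc L e v → Inc L' (upe e) (up v)
    lift {e} i = subst (Inc L' (upe e)) (image-other e ne) (inc-up i)

  extended : Ladder
  extended = record
    { L = L' ; triLadder = splice triLadder β₂ (β₁ , ξ , (eββ , joins-sym {L} jββ) , (e₁ξ , j₁ξ) , (e₂ξ , j₂ξ)) (# 0) splicing ; simple = λ {e} {e'} → simple' simple {e} {e'} ; three = three'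
    ; β₁ = t₁ ; β₂ = up β₂ ; ξ = t₂ ; π = up ξ ; κ = up κ
    ; e₁ξ = zero ; e₁π = upe e₂ξ ; e₂ξ = suc (suc zero) ; e₂κ = upe e₂κ ; eββ = suc zero
    ; j₁ξ = inj₁ (refl , refl) ; j₁π = joins-at-f₁ ; j₂ξ = inj₂ (refl , refl) ; j₂κ = joins-at-f₃ ; jββ = inj₁ (refl , refl)
    ; exact₁ = λ {e} → ex₁ e ; exact₂ = λ {e} → ex₂ e
    ; π≢β₂ = λ { refl → joins-≢ {L} j₂ξ refl } ; κ≢β₁ = λ () ; ξ≢π = λ () ; ξ≢κ = λ () }
    where
    ex₁ : ∀ e → Inc L' e t₁ → e ≡ zero ⊎ e ≡ suc zero ⊎ e ≡ upe e₂ξ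
    ex₁ zero i = inj₁ refl
    ex₁ (suc zero) i = inj₂ (inj₁ refl)
    ex₁ (suc (suc zero)) (inj₁ ())
    ex₁ (suc (suc zero)) (inj₂ ())
    ex₁ (upe e) i with old-at {e} {t₁} refl i
    ... | inj₁ (refl , _) = inj₂ (inj₂ refl)
    ... | inj₂ (inj₁ (_ , ()))
    ... | inj₂ (inj₂ (_ , ()))
    ex₂ : ∀ e → Inc L' e (up β₂) → e ≡ suc (suc zero) ⊎ e ≡ suc zero ⊎ e ≡ upe e₂κ
    ex₂ zero (inj₁ ())
    ex₂ zero (inj₂ ())
    ex₂ (suc zero) i = inj₂ (inj₁ refl)
    ex₂ (suc (suc zero)) i = inj₁ refl
    ex₂ (upe e) i with old-at {e} {up β₂} refl i
    ... | inj₁ (_ , ())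
    ... | inj₂ (inj₁ (_ , ()))
    ... | inj₂ (inj₂ (refl , _)) = inj₂ (inj₂ refl)

decided : ∀ {P : Set} (d : Dec P) {_ : True d} → P
decided d {w} = toWitness w

prism-simple : Simple C6bar
prism-simple {e} {e'} j j' = decided (all? λ e → all? λ e' → joins? {C6bar} e' (end₁ C6bar e) (end₂ C6bar e) →-dec (e ≟ e')) e e' (go j j')
  where
  go : ∀ {u v} → Joins C6bar e u v → Joins C6bar e' u v → Joins C6bar e' (end₁ C6bar e) (end₂ C6bar e)
  go (inj₁ (refl , refl)) j' = j'
  go (inj₂ (refl , refl)) j' = joins-sym {C6bar} {e'} j'

prism-three : ThreeEdges C6bar
prism-three zero = # 0 , # 1 , # 2 , inj₁ refl , inj₁ refl , inj₁ refl , (λ ()) , (λ ()) , λ ()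
prism-three (suc zero) = # 3 , # 4 , # 5 , inj₁ refl , inj₁ refl , inj₁ refl , (λ ()) , (λ ()) , λ ()
prism-three (suc (suc zero)) = # 0 , # 6 , # 7 , inj₂ refl , inj₁ refl , inj₁ refl , (λ ()) , (λ ()) , λ ()
prism-three (suc (suc (suc zero))) = # 1 , # 3 , # 8 , inj₂ refl , inj₂ refl , inj₁ refl , (λ ()) , (λ ()) , λ ()
prism-three (suc (suc (suc (suc zero)))) = # 2 , # 4 , # 6 , inj₂ refl , inj₂ refl , inj₂ refl , (λ ()) , (λ ()) , λ ()
prism-three (suc (suc (suc (suc (suc zero))))) = # 5 , # 7 , # 8 , inj₂ refl , inj₂ refl , inj₂ refl , (λ ()) , (λ ()) , λ ()

prismLadder : Ladder
prismLadder = record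
  { L = C6bar ; triLadder = base (record { vbij = mk↔ₛ′ id id (λ _ → refl) (λ _ → refl) ; ebij = mk↔ₛ′ id id (λ _ → refl) (λ _ → refl) ; ends = λ e → inj₁ (refl , refl) })
  ; simple = λ {e} {e'} → prism-simple {e} {e'} ; three = prism-three
  ; β₁ = # 3 ; β₂ = # 5 ; ξ = # 1 ; π = # 0 ; κ = # 2 ; e₁ξ = # 3 ; e₁π = # 1 ; e₂ξ = # 5 ; e₂κ = # 7 ; eββ = # 8
  ; j₁ξ = inj₂ (refl , refl) ; j₁π = inj₂ (refl , refl) ; j₂ξ = inj₂ (refl , refl) ; j₂κ = inj₂ (refl , refl) ; jββ = inj₁ (refl , refl)
  ; exact₁ = λ {e} → decided (all? λ e → inc? {C6bar} e (# 3) →-dec ((e ≟ # 3) ⊎-dec ((e ≟ # 8) ⊎-dec (e ≟ # 1)))) e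
  ; exact₂ = λ {e} → decided (all? λ e → inc? {C6bar} e (# 5) →-dec ((e ≟ # 5) ⊎-dec ((e ≟ # 8) ⊎-dec (e ≟ # 7)))) e
  ; π≢β₂ = λ () ; κ≢β₁ = λ () ; ξ≢π = λ () ; ξ≢κ = λ () }

-- The extremal graphs

module _ {k : ℕ} (B : NearBip k) (s : Bool) where
  open NearBipTheory B
  open Side B s
  open Obstacles B s
  open Stars B s

  no-four-uncovered : ∀ {a b₁ b₂ b₃ b₄} → E a b₁ ≡ true → E a b₂ ≡ true → E a b₃ ≡ true → E a b₄ ≡ true
    → b₁ ≢ b₂ → b₁ ≢ b₃ → b₁ ≢ b₄ → b₂ ≢ b₃ → b₂ ≢ b₄ → b₃ ≢ b₄ → Uncovered a b₁ → Uncovered a b₂ → Uncovered a b₃ → Uncovered a b₄ → ⊥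
  no-four-uncovered {a} {b₁} {b₂} {b₃} {b₄} x₁ x₂ x₃ x₄ p₁₂ p₁₃ p₁₄ p₂₃ p₂₄ p₃₄ u₁ u₂ u₃ u₄ = go (classify u₁) (classify u₂) (classify u₃) (classify u₄)
    where
    go : AlphaSet a b₁ ⊎ BetaSet a b₁ → AlphaSet a b₂ ⊎ BetaSet a b₂ → AlphaSet a b₃ ⊎ BetaSet a b₃ → AlphaSet a b₄ ⊎ BetaSet a b₄ → ⊥
    go (inj₁ S) (inj₁ S') (inj₁ S'') _ = no-three-alpha x₁ x₂ x₃ p₁₂ p₁₃ p₂₃ S S' S''
    go (inj₁ S) (inj₁ S') (inj₂ _) (inj₁ S'') = no-three-alpha x₁ x₂ x₄ p₁₂ p₁₄ p₂₄ S S' S''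
    go (inj₁ _) (inj₁ _) (inj₂ T) (inj₂ T') = beta-unique p₃₄ T T'
    go (inj₁ S) (inj₂ _) (inj₁ S') (inj₁ S'') = no-three-alpha x₁ x₃ x₄ p₁₃ p₁₄ p₃₄ S S' S''
    go (inj₁ _) (inj₂ T) (inj₁ _) (inj₂ T') = beta-unique p₂₄ T T'
    go (inj₁ _) (inj₂ T) (inj₂ T') _ = beta-unique p₂₃ T T'
    go (inj₂ _) (inj₁ S) (inj₁ S') (inj₁ S'') = no-three-alpha x₂ x₃ x₄ p₂₃ p₂₄ p₃₄ S S' S''
    go (inj₂ T) (inj₁ _) (inj₁ _) (inj₂ T') = beta-unique p₁₄ T T'
    go (inj₂ T) (inj₁ _) (inj₂ T') _ = beta-unique p₁₃ T T'
    go (inj₂ T) (inj₂ T') _ _ = beta-unique p₁₂ T T'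

  module Peel (beta : ∀ {a} → c a ≡ s → Normal a → ∃ (BetaSet a)) where

    Top : FSet k → Fin k → Set
    Top Z a = a ∊ Z × ClosedUnder E (delete a Z)

    -- As every vertex has a β-edge, alternating paths for `μ` never return to their start. So a
    -- closed set contains a vertex to which none of its other vertices leads.
    top : ∀ {Z z} → Shore Z → ClosedUnder E Z → z ∊ Z → ∃ (Top Z)
    top {Z} {z} sh cl z∊ = start (beta (Shore.col sh z∊) (Shore.normal sh z∊))
      where
      -- Invariant: `U` is closed, with and without `a`. While a vertex `v` of `Z` lies outside `U`,
      -- its β-set is added; nothing in the old `U` leads to `v`, so `v` is the next candidate.
      climb : ∀ i (U : FSet k) a → card (Z ∩ ∁ U) ≤ i → a ∊ Z → ClosedUnder E U → ClosedUnder E (delete a U) → a ∊ U → ∃ (Top Z)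
      climb i U a le a∊Z clU clU⁻ a∊U = go i le (find (Z ∩ ∁ U))
        where
        go : ∀ i → card (Z ∩ ∁ U) ≤ i → (∃ λ v → v ∊ Z ∩ ∁ U) ⊎ (∀ v → v ∉ Z ∩ ∁ U) → ∃ (Top Z)
        go i le (inj₂ none) = a , a∊Z , λ {w} p e nv → delete-intro {X = Z} (cl (delete-sub {a = a} {Z} p) e nv)
            (delete-≢ {X = U} (clU⁻ (delete-intro {X = U} (¬∉⇒∊ λ q → true≢false (∧-intro (delete-sub {a = a} {Z} p) (not-false q)) (none w)) (delete-≢ {X = Z} p)) e nv))
        go zero le (inj₁ (v , h)) = ⊥-elim (<-irrefl refl (≤-trans (card-pos {X = Z ∩ ∁ U} h) le))
        go (suc i) le (inj₁ (v , h)) = next (beta (Shore.col sh v∊Z) (Shore.normal sh v∊Z))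
          where
          v∊Z = ∧-elimˡ {Z v} h
          v∉U : v ∉ U
          v∉U = not-true (∧-elimʳ {Z v} h)
          next : ∃ (BetaSet v) → ∃ (Top Z)
          next (_ , T) = climb i (U ∪ Zᵥ) v (s≤s⁻¹ (≤-trans shrink le)) v∊Z clU' clU'⁻ (∨-introʳ {U v} (BetaSet.a∊ T))
            where
            Zᵥ = BetaSet.Z T
            clU' : ClosedUnder E (U ∪ Zᵥ)
            clU' {w} {y} p e nv = case ∨-elim {U w} p of λ { (inj₁ q) → ∨-introˡ (clU q e nv) ; (inj₂ q) → ∨-introʳ {U (μ y)} (BetaSet.closed T q e nv) }
            clU'⁻ : ClosedUnder E (delete v (U ∪ Zᵥ))
            clU'⁻ {w} {y} p e nv with ∨-elim {U w} (delete-sub {a = v} {U ∪ Zᵥ} p)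
            ... | inj₁ q = delete-intro {X = U ∪ Zᵥ} (∨-introˡ (clU q e nv)) λ r → ∊∉ {X = U} (subst (_∊ U) r (clU q e nv)) v∉U
            ... | inj₂ q = delete-intro {X = U ∪ Zᵥ} (∨-introʳ {U (μ y)} (delete-sub {a = v} {Zᵥ} r)) (delete-≢ {X = Zᵥ} r)
              where r = BetaSet.closed⁻ T (delete-intro {X = Zᵥ} q (delete-≢ {X = U ∪ Zᵥ} p)) e nv
            shrink : suc (card (Z ∩ ∁ (U ∪ Zᵥ))) ≤ card (Z ∩ ∁ U)
            shrink = ≤-trans (s≤s (card-mono {X = Z ∩ ∁ (U ∪ Zᵥ)} {delete v (Z ∩ ∁ U)} λ {w} p → delete-intro {X = Z ∩ ∁ U}
                (∧-intro (∧-elimˡ {Z w} p) (not-false (¬∊⇒∉ λ q → true≢false (∨-introˡ {U w} {Zᵥ w} q) (not-true (∧-elimʳ {Z w} p)))))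
                λ { refl → true≢false (∨-introʳ {U w} (BetaSet.a∊ T)) (not-true (∧-elimʳ {Z w} p)) })) (≤-reflexive (sym (card-delete {X = Z ∩ ∁ U} h)))
      start : ∃ (BetaSet z) → ∃ (Top Z)
      start (_ , T) = climb _ (BetaSet.Z T) z ≤-refl z∊ (BetaSet.closed T) (BetaSet.closed⁻ T) (BetaSet.a∊ T)

module Extremal (G : Graph) (mcG : MatchingCovered G)
  (no-tight : ∀ (X : Subset (n G)) → 2 ≤ ∣ X ∣ → 2 ≤ ∣ ∁ˢ X ∣ → ¬ TightCut G X)
  (St : Setup G) (six : 6 ≤ n G) where

  open Count G mcG no-tight St six

  module Degrees (eq : (card R + card R) + 6 ≡ n G) where
    open Equality eq

    -- Parallel edges would both be removable, but they share a vertex, which allows only one.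
    simple-plain : ∀ {e e' u v} → PlainEdge e → PlainEdge e' → Joins G e u v → Joins G e' u v → e ≡ e'
    simple-plain {e} {e'} pl pl' j j' with e ≟ e'
    ... | yes q = q
    ... | no ne = one-removable (R-intro (parallel⇒removable (ne ∘ sym) pl j j')) (R-intro (parallel⇒removable ne pl' j' j)) (joins-inc {G} j) (joins-inc {G} j')

    starv : Bool → Fin (n G)
    starv s = proj₁ (star s)

    three⇒zero : ∀ {s v b₁ b₂ b₃} → c v ≡ s → E v b₁ ≡ true → E v b₂ ≡ true → E v b₃ ≡ true → b₁ ≢ b₂ → b₁ ≢ b₃ → b₂ ≢ b₃ →
      Side.Uncovered nearBip s v b₁ → Side.Uncovered nearBip s v b₂ → Side.Uncovered nearBip s v b₃ → v ≡ starv s × Zero v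
    three⇒zero {s} {v} cv x₁ x₂ x₃ p q r u₁ u₂ u₃ = v≡ , subst Zero (sym v≡) (proj₂ (proj₂ (Star-elim (proj₂ (star s)))))
      where
      st = Star-elim (proj₂ (star s))
      v≡ : v ≡ starv s
      v≡ = zero-unique (proj₁ st) (proj₁ (proj₂ st)) (proj₂ (proj₂ st)) cv (proj₁ (Stars.three-uncovered nearBip s x₁ x₂ x₃ p q r u₁ u₂ u₃))

    module Edges {s v} (cv : c v ≡ s) {b : Fin (n G)} (x : E v b ≡ true) where
      e : Fin (m G)
      e = proj₁ (E-elim x)
      e-plain : PlainEdge e
      e-plain = proj₁ (proj₂ (E-elim x))
      e-joins : Joins G e v b
      e-joins = proj₂ (proj₂ (E-elim x))
      status : e ∊ R ⊎ Side.Uncovered nearBip s v b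
      status with ∊? R e
      ... | inj₁ h = inj₁ h
      ... | inj₂ h = inj₂ (edge-uncovered cv e-plain e-joins h)

    not-both : ∀ {s v b b'} (cv : c v ≡ s) (x : E v b ≡ true) (x' : E v b' ≡ true) → b ≢ b' → Edges.e cv x ∊ R → Edges.e cv x' ∊ R → ⊥
    not-both cv x x' ne h h' = ne (joins-unique {G} (Edges.e-joins cv x) (subst (λ g → Joins G g _ _) (sym (one-removable h h' (joins-inc {G} (Edges.e-joins cv x)) (joins-inc {G} (Edges.e-joins cv x')))) (Edges.e-joins cv x')))

    -- At most one of the four edges is removable. Three nonremovable ones make `v` the exceptional
    -- vertex of its class, which has no removable edge; but four nonremovable ones are impossible.
    no-four : ∀ {v b₁ b₂ b₃ b₄} → E v b₁ ≡ true → E v b₂ ≡ true → E v b₃ ≡ true → E v b₄ ≡ true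
      → b₁ ≢ b₂ → b₁ ≢ b₃ → b₁ ≢ b₄ → b₂ ≢ b₃ → b₂ ≢ b₄ → b₃ ≢ b₄ → ⊥
    no-four {v} {b₁} {b₂} {b₃} {b₄} x₁ x₂ x₃ x₄ p₁₂ p₁₃ p₁₄ p₂₃ p₂₄ p₃₄ = go (status x₁) (status x₂) (status x₃) (status x₄)
      where
      open Edges {c v} {v} refl using (status)
      U = Side.Uncovered nearBip (c v) v
      finish : Zero v → ⊥
      finish z = no-four-uncovered nearBip (c v) x₁ x₂ x₃ x₄ p₁₂ p₁₃ p₁₄ p₂₃ p₂₄ p₃₄ (zero-uncovered refl z x₁) (zero-uncovered refl z x₂) (zero-uncovered refl z x₃) (zero-uncovered refl z x₄)
      go : Edges.e refl x₁ ∊ R ⊎ U b₁ → Edges.e refl x₂ ∊ R ⊎ U b₂ → Edges.e refl x₃ ∊ R ⊎ U b₃ → Edges.e refl x₄ ∊ R ⊎ U b₄ → ⊥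
      go (inj₁ h) (inj₁ h') _ _ = not-both refl x₁ x₂ p₁₂ h h'
      go (inj₁ h) _ (inj₁ h') _ = not-both refl x₁ x₃ p₁₃ h h'
      go (inj₁ h) _ _ (inj₁ h') = not-both refl x₁ x₄ p₁₄ h h'
      go (inj₁ _) (inj₂ u) (inj₂ u') (inj₂ u'') = finish (proj₂ (three⇒zero refl x₂ x₃ x₄ p₂₃ p₂₄ p₃₄ u u' u''))
      go (inj₂ u) (inj₂ u') (inj₂ u'') _ = finish (proj₂ (three⇒zero refl x₁ x₂ x₃ p₁₂ p₁₃ p₂₃ u u' u''))
      go (inj₂ u) (inj₂ u') (inj₁ _) (inj₂ u'') = finish (proj₂ (three⇒zero refl x₁ x₂ x₄ p₁₂ p₁₄ p₂₄ u u' u''))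
      go _ _ (inj₁ h) (inj₁ h') = not-both refl x₃ x₄ p₃₄ h h'
      go _ (inj₁ h) (inj₁ h') _ = not-both refl x₂ x₃ p₂₃ h h'
      go _ (inj₁ h) _ (inj₁ h') = not-both refl x₂ x₄ p₂₄ h h'
      go (inj₂ u) (inj₁ _) (inj₂ u') (inj₂ u'') = finish (proj₂ (three⇒zero refl x₁ x₃ x₄ p₁₃ p₁₄ p₃₄ u u' u''))

    -- Special vertices meet no removable edge, so one of the three would be a β-edge, and a β-set
    -- contains no special vertex.
    no-three-special : ∀ s i {b₁ b₂ b₃} → E (sp s i) b₁ ≡ true → E (sp s i) b₂ ≡ true → E (sp s i) b₃ ≡ true → b₁ ≢ b₂ → b₁ ≢ b₃ → b₂ ≢ b₃ → ⊥
    no-three-special s i x₁ x₂ x₃ p q r = Side.Shore.plain (Side.BetaSet.shore T) (Side.BetaSet.a∊ T) i refl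
      where
      u : ∀ {b} → E (sp s i) b ≡ true → Side.Uncovered nearBip s (sp s i) b
      u = zero-uncovered (sp-col s i) (special-zero s i)
      T = proj₂ (proj₂ (Stars.three-uncovered nearBip s x₁ x₂ x₃ p q r (u x₁) (u x₂) (u x₃)))

    inc-plain : ∀ {e v} → Normal v → Inc G e v → PlainEdge e
    inc-plain nv i r refl with sp-inc i
    ... | k , refl = nv k (cong (λ z → sp z k) (sym (sp-col r k)))

    special-or-plain-edge : ∀ {e r k} → Inc G e (sp r k) → e ≢ se r → PlainEdge e
    special-or-plain-edge {e} {r} {k} i ne r' refl with sp-inc i
    ... | k' , q = ne (cong se (trans (sym (sp-col r' k')) (trans (cong c (sym q)) (sp-col r k))))

    no-four-edges : ∀ {v e₁ e₂ e₃ e₄} → Inc G e₁ v → Inc G e₂ v → Inc G e₃ v → Inc G e₄ v → e₁ ≢ e₂ → e₁ ≢ e₃ → e₁ ≢ e₄ → e₂ ≢ e₃ → e₂ ≢ e₄ → e₃ ≢ e₄ → ⊥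
    no-four-edges {v} {e₁} {e₂} {e₃} {e₄} i₁ i₂ i₃ i₄ p₁₂ p₁₃ p₁₄ p₂₃ p₂₄ p₃₄ = go (v ≟ sp (c v) true) (v ≟ sp (c v) false)
      where
      far : ∀ {e} → Inc G e v → Fin (n G)
      far i = proj₁ (inc-joins {G} i)
      adj : ∀ {e} (i : Inc G e v) → PlainEdge e → E v (far i) ≡ true
      adj i pl = E-intro pl (proj₂ (inc-joins {G} i))
      far-≢ : ∀ {e e'} (i : Inc G e v) (i' : Inc G e' v) → PlainEdge e → PlainEdge e' → e ≢ e' → far i ≢ far i'
      far-≢ {e} {e'} i i' pl pl' ne q = ne (simple-plain pl pl' (proj₂ (inc-joins {G} i)) (subst (Joins G e' v) (sym q) (proj₂ (inc-joins {G} i'))))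
      three : ∀ {k e e' e''} → v ≡ sp (c v) k → (i : Inc G e v) (i' : Inc G e' v) (i'' : Inc G e'' v) → e ≢ e' → e ≢ e'' → e' ≢ e'' → e ≢ se (c v) → e' ≢ se (c v) → e'' ≢ se (c v) → ⊥
      three {k} {e} {e'} {e''} q i i' i'' p p' p'' h h' h'' = no-three-special (c v) k (sub (adj i pl)) (sub (adj i' pl')) (sub (adj i'' pl'')) (far-≢ i i' pl pl' p) (far-≢ i i'' pl pl'' p') (far-≢ i' i'' pl' pl'' p'')
        where
        pl = special-or-plain-edge {e} {c v} {k} (subst (Inc G e) q i) h
        pl' = special-or-plain-edge {e'} {c v} {k} (subst (Inc G e') q i') h'
        pl'' = special-or-plain-edge {e''} {c v} {k} (subst (Inc G e'') q i'') h''
        sub : ∀ {w} → E v w ≡ true → E (sp (c v) k) w ≡ true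
        sub {w} = subst (λ z → E z w ≡ true) q
      special : ∀ k → v ≡ sp (c v) k → ⊥
      special k q with e₁ ≟ se (c v) | e₂ ≟ se (c v) | e₃ ≟ se (c v)
      ... | yes refl | _ | _ = three {k} q i₂ i₃ i₄ p₂₃ p₂₄ p₃₄ (p₁₂ ∘ sym) (p₁₃ ∘ sym) (p₁₄ ∘ sym)
      ... | no h | yes refl | _ = three {k} q i₁ i₃ i₄ p₁₃ p₁₄ p₃₄ h (p₂₃ ∘ sym) (p₂₄ ∘ sym)
      ... | no h | no h' | yes refl = three {k} q i₁ i₂ i₄ p₁₂ p₁₄ p₂₄ h h' (p₃₄ ∘ sym)
      ... | no h | no h' | no h'' = three {k} q i₁ i₂ i₃ p₁₂ p₁₃ p₂₃ h h' h''
      go : Dec (v ≡ sp (c v) true) → Dec (v ≡ sp (c v) false) → ⊥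
      go (yes q) _ = special true q
      go (no _) (yes q) = special false q
      go (no p) (no q) = no-four (adj i₁ l₁) (adj i₂ l₂) (adj i₃ l₃) (adj i₄ l₄) (far-≢ i₁ i₂ l₁ l₂ p₁₂) (far-≢ i₁ i₃ l₁ l₃ p₁₃) (far-≢ i₁ i₄ l₁ l₄ p₁₄) (far-≢ i₂ i₃ l₂ l₃ p₂₃) (far-≢ i₂ i₄ l₂ l₄ p₂₄) (far-≢ i₃ i₄ l₃ l₄ p₃₄)
        where
        nv : Normal v
        nv true = p
        nv false = q
        l₁ = inc-plain nv i₁
        l₂ = inc-plain nv i₂
        l₃ = inc-plain nv i₃
        l₄ = inc-plain nv i₄

    beta : ∀ {s a} → c a ≡ s → Normal a → ∃ (Side.BetaSet nearBip s a)
    beta {s} {a} ca na = go₃ (three-neighbours a na)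
      where
      open Side nearBip s using (Uncovered; AlphaSet; BetaSet; classify)
      star-facts = Star-elim (proj₂ (star s))
      star-edges : ∀ i → E (starv s) (sp (not s) i) ≡ true
      star-edges = zero-star (proj₁ star-facts) (proj₁ (proj₂ star-facts)) (proj₂ (proj₂ star-facts))
      go₃ : (∃ λ x → ∃₂ λ y z → E a x ≡ true × E a y ≡ true × E a z ≡ true × x ≢ y × x ≢ z × y ≢ z) → ∃ (BetaSet a)
      go₃ (x , y , z , ex , ey , ez , p , q , r) = split (a ≟ starv s)
        where
        two : ∀ {b b' d} → a ≢ starv s → E a b ≡ true → E a b' ≡ true → E a d ≡ true → b ≢ b' → b ≢ d → b' ≢ d → Uncovered a b → Uncovered a b' → ∃ (BetaSet a)
        two {b} {b'} {d} ne e e' e'' p q r u u' = decide (classify u) (classify u')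
          where
          decide : AlphaSet a b ⊎ BetaSet a b → AlphaSet a b' ⊎ BetaSet a b' → ∃ (BetaSet a)
          decide (inj₂ T) _ = _ , T
          decide _ (inj₂ T) = _ , T
          decide (inj₁ S) (inj₁ S') = ⊥-elim (ne (sym (Obstacles.two-alpha⇒star nearBip s e e' e'' p q r S S' (proj₁ star-facts) star-edges)))
        pick : a ≢ starv s → Edges.e ca ex ∊ R ⊎ Uncovered a x → Edges.e ca ey ∊ R ⊎ Uncovered a y → Edges.e ca ez ∊ R ⊎ Uncovered a z → ∃ (BetaSet a)
        pick ne (inj₂ u) (inj₂ u') _ = two ne ex ey ez p q r u u'
        pick ne (inj₂ u) _ (inj₂ u') = two ne ex ez ey q p (r ∘ sym) u u'
        pick ne _ (inj₂ u) (inj₂ u') = two ne ey ez ex r (p ∘ sym) (q ∘ sym) u u'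
        pick ne (inj₁ h) (inj₁ h') _ = ⊥-elim (not-both ca ex ey p h h')
        pick ne (inj₁ h) _ (inj₁ h') = ⊥-elim (not-both ca ex ez q h h')
        pick ne _ (inj₁ h) (inj₁ h') = ⊥-elim (not-both ca ey ez r h h')
        split : Dec (a ≡ starv s) → ∃ (BetaSet a)
        split (no ne) = pick ne (Edges.status ca ex) (Edges.status ca ey) (Edges.status ca ez)
        split (yes h) = proj₂ (Stars.three-uncovered nearBip s ex ey ez p q r (zu ex) (zu ey) (zu ez))
          where
          zu : ∀ {b} → E a b ≡ true → Uncovered a b
          zu = zero-uncovered ca (subst Zero (sym h) (proj₂ (proj₂ star-facts)))

-- Peeling the extremal graph into a ladder

module Climb (G : Graph) (mcG : MatchingCovered G)
  (no-tight : ∀ (X : Subset (n G)) → 2 ≤ ∣ X ∣ → 2 ≤ ∣ ∁ˢ X ∣ → ¬ TightCut G X)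
  (St : Setup G) (six : 6 ≤ n G)
  (eq : (card (Count.R G mcG no-tight St six) + card (Count.R G mcG no-tight St six)) + 6 ≡ n G) where

  open Count G mcG no-tight St six
  open Extremal G mcG no-tight St six
  open Degrees eq
  open NearBipTheory nearBip using (μ; μμ; μ-E; sp-dist')
  open Side nearBip true using (Shore; Plain; PlainT; plain-intro; plain-col; plain-≢; ClosedUnder; E-to-t; E-to-s; μ-plainT)
  open Peel nearBip true beta using (top)

  A B : FSet (n G)
  A = Col c true
  B = Col c false

  Adj-E : ∀ {u v} → E u v ≡ true → Adj G u v
  Adj-E h with E-elim h
  ... | e , _ , j = e , j

  Adj-sym : ∀ {u v} → Adj G u v → Adj G v u
  Adj-sym (e , j) = e , joins-sym {G} j

  -- The vertices of W have been matched with a ladder; only the images of ξ, π, κ still have neighbours outside W.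
  record Stage : Set where
    field
      Λ : Ladder
    open Ladder Λ public
    Inner : Fin (n L) → Set
    Inner v = v ≢ β₁ × v ≢ β₂
    field
      φ : Fin (n L) → Fin (n G)
      W : FSet (n G)
      φ-in : ∀ {v} → Inner v → φ v ∊ W
      φ-inj : ∀ {u v} → Inner u → Inner v → φ u ≡ φ v → u ≡ v
      φ-surj : ∀ {g} → g ∊ W → ∃ λ v → Inner v × φ v ≡ g
      φ-adj : ∀ {e u v} → Joins L e u v → Inner u → Inner v → Adj G (φ u) (φ v)
      rest-closed : ClosedUnder E (Plain ∩ ∁ W)
      sp-in : ∀ i → sp true i ∊ W
      sp-out : ∀ i → sp false i ∉ W
      ξ-col : c (φ ξ) ≡ true
      ξ-normal : Normal (φ ξ)
      ξ-μ : μ (φ ξ) ∊ W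
      ξ-only : ∀ {y} → y ∊ W → E (φ ξ) y ≡ true → y ≡ μ (φ ξ)
      B-inside : ∀ {y a} → y ∊ W → c y ≡ false → E y a ≡ true → a ∊ W
      A-outside : ∀ {a y} → a ∊ W → c a ≡ true → E a y ≡ true → y ∉ W → a ≡ φ ξ ⊎ a ≡ φ π ⊎ a ≡ φ κ
      π-once : ∀ {y y'} → E (φ π) y ≡ true → E (φ π) y' ≡ true → y ∉ W → y' ∉ W → y ≡ y'
      κ-once : ∀ {y y'} → E (φ κ) y ≡ true → E (φ κ) y' ≡ true → y ∉ W → y' ∉ W → y ≡ y'
      π-col : c (φ π) ≡ true
      κ-col : c (φ κ) ≡ true
      -- `W` has the special vertices of `A` and none of those of `B`; otherwise it consists of
      -- pairs matched by `μ`.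
      balance : card (W ∩ A) ≡ 2 + card (W ∩ B)

    ξ-inner : Inner ξ
    ξ-inner = (joins-≢ {L} j₁ξ ∘ sym) , (joins-≢ {L} j₂ξ ∘ sym)

    π-inner : Inner π
    π-inner = (joins-≢ {L} j₁π ∘ sym) , π≢β₂

    κ-inner : Inner κ
    κ-inner = κ≢β₁ , (joins-≢ {L} j₂κ ∘ sym)

    A-covered : ∀ {a} → c a ≡ true → a ∉ W → a ∊ Plain
    A-covered ca a∉ = plain-intro ca λ { i refl → ∊∉ {X = W} (sp-in i) a∉ }

  swapStage : Stage → Stage
  swapStage S = record
    { Λ = swapLadder Λ ; φ = φ ; W = W ; φ-in = λ h → φ-in (flip h) ; φ-inj = λ h h' → φ-inj (flip h) (flip h')
    ; φ-surj = λ h → case φ-surj h of λ { (v , i , q) → v , flip i , q } ; φ-adj = λ j h h' → φ-adj j (flip h) (flip h')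
    ; rest-closed = λ {z} {v} → rest-closed {z} {v} ; sp-in = sp-in ; sp-out = sp-out ; ξ-col = ξ-col ; ξ-normal = ξ-normal ; ξ-μ = ξ-μ ; ξ-only = ξ-only
    ; B-inside = B-inside ; A-outside = λ h h' e y → case A-outside h h' e y of λ { (inj₁ q) → inj₁ q ; (inj₂ (inj₁ q)) → inj₂ (inj₂ q) ; (inj₂ (inj₂ q)) → inj₂ (inj₁ q) }
    ; π-once = κ-once ; κ-once = π-once ; π-col = κ-col ; κ-col = π-col ; balance = balance }
    where
    open Stage S
    flip : ∀ {P Q : Set} → P × Q → Q × P
    flip (p , q) = q , p

  shore-rest : ∀ W → Shore (Plain ∩ ∁ W)
  shore-rest W = record { col = λ {v} h → plain-col (∧-elimˡ {Plain v} h) ; plain = λ {v} h → plain-≢ (∧-elimˡ {Plain v} h) }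

  degree-bound : ∀ {y u v} → Normal y → (∀ {w} → E y w ≡ true → w ≡ u ⊎ w ≡ v) → ⊥
  degree-bound {y} {u} {v} ny h = <-irrefl refl (≤-trans (normal-degree y ny) (≤-trans (card-mono {X = N ⁅ y ⁆} {⁅ u ⁆ ∪ ⁅ v ⁆} sub)
      (≤-trans (m≤m+n _ _) (≤-reflexive (trans (card-∪-∩ ⁅ u ⁆ ⁅ v ⁆) (cong₂ _+_ (card-⁅⁆ u) (card-⁅⁆ v)))))))
    where
    sub : N ⁅ y ⁆ ⊆ ⁅ u ⁆ ∪ ⁅ v ⁆
    sub {w} p with N-out {⁅ y ⁆} p
    ... | z , q , r with h (subst (λ z → E z w ≡ true) (∊⁅⁆⇒≡ q) r)
    ... | inj₁ e = ∨-introˡ (≡⇒∊⁅⁆ e)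
    ... | inj₂ e = ∨-introʳ {⁅ u ⁆ w} (≡⇒∊⁅⁆ e)

  E? : ∀ u v → Dec (E u v ≡ true)
  E? u v = decBool (E u v)

  module Next (W : FSet (n G)) (sp-in : ∀ i → sp true i ∊ W) {x' : Fin (n G)} (x'∊ : x' ∊ Plain ∩ ∁ W) (cl : ClosedUnder E (delete x' (Plain ∩ ∁ W))) where
    y : Fin (n G)
    y = μ x'
    x'-plain : x' ∊ Plain
    x'-plain = ∧-elimˡ {Plain x'} x'∊
    x'-col : c x' ≡ true
    x'-col = plain-col x'-plain
    x'∉ : x' ∉ W
    x'∉ = not-true (∧-elimʳ {Plain x'} x'∊)
    x'-normal : Normal x'
    x'-normal = Side.Shore.normal (shore-rest W) x'∊
    Ex'y : E x' y ≡ true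
    Ex'y = μ-E x' x'-normal
    y-plain : y ∊ PlainT
    y-plain = μ-plainT x'-col (plain-≢ x'-plain)
    y-col : c y ≡ false
    y-col = plain-col y-plain
    y-normal : Normal y
    y-normal = μ-normal x' x'-normal
    -- A further neighbour would be a remaining vertex of `A` other than `x'`; as what remains is
    -- closed without `x'`, the partner of `y` would differ from `x'`.
    y-near : ∀ {u} → E y u ≡ true → u ≡ x' ⊎ u ∊ W
    y-near {u} e with u ≟ x' | ∊? W u
    ... | yes q | _ = inj₁ q
    ... | no _ | inj₁ h = inj₂ h
    ... | no ne | inj₂ h = ⊥-elim (delete-≢ {X = Z} (cl (delete-intro {X = Z} (∧-intro (plain-intro (E-to-s e y-col) (λ { i refl → ∊∉ {X = W} (sp-in i) h })) (not-false h)) ne) (E-sym e) (plain-≢ y-plain)) (μμ x'))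
      where Z = Plain ∩ ∁ W
    W' : FSet (n G)
    W' = insert y (insert x' W)
    y∊W' : y ∊ W'
    y∊W' = insert-self y (insert x' W)
    x'∊W' : x' ∊ W'
    x'∊W' = insert-old y (insert x' W) (insert-self x' W)
    old∊W' : W ⊆ W'
    old∊W' h = insert-old y (insert x' W) (insert-old x' W h)
    W'-elim : ∀ {v} → v ∊ W' → v ≡ y ⊎ v ≡ x' ⊎ v ∊ W
    W'-elim h with insert-elim {a = y} {X = insert x' W} h
    ... | inj₁ q = inj₁ q
    ... | inj₂ q = inj₂ (insert-elim {a = x'} {X = W} q)
    ∉W'⇒∉W : ∀ {v} → v ∉ W' → v ∉ W
    ∉W'⇒∉W h = ¬∊⇒∉ λ q → ∊∉ {X = W'} (old∊W' q) h
    ∉W'⇒≢y : ∀ {v} → v ∉ W' → v ≢ y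
    ∉W'⇒≢y h refl = ∊∉ {X = W'} y∊W' h
    rest-closed' : ClosedUnder E (Plain ∩ ∁ W')
    rest-closed' {z} {v} h e nv = ∧-intro (∧-elimˡ {Plain (μ v)} r) (not-false (¬∊⇒∉ λ q → case W'-elim q of λ where
        (inj₁ q) → not≢ {true} (trans (sym (plain-col (∧-elimˡ {Plain (μ v)} r))) (trans (cong c q) y-col))
        (inj₂ (inj₁ q)) → delete-≢ {X = Z} (cl z∊ e nv) q
        (inj₂ (inj₂ q)) → ∊∉ {X = W} q (not-true (∧-elimʳ {Plain (μ v)} r))))
      where
      Z = Plain ∩ ∁ W
      z∊ : z ∊ delete x' Z
      z∊ = delete-intro {X = Z} (∧-intro (∧-elimˡ {Plain z} h) (not-false (∉W'⇒∉W (not-true (∧-elimʳ {Plain z} h))))) λ { refl → ∊∉ {X = W'} x'∊W' (not-true (∧-elimʳ {Plain z} h)) }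
      r = delete-sub {a = x'} {Z} (cl z∊ e nv)
    y≢x' : y ≢ x'
    y≢x' h = not≢ {true} (trans (sym x'-col) (trans (cong c (sym h)) y-col))
    grow-A : card (W' ∩ A) ≡ suc (card (W ∩ A))
    grow-A = trans (card-cong {X = W' ∩ A} {insert x' (W ∩ A)} to from) (card-insert {X = W ∩ A} (¬∊⇒∉ λ h → ∊∉ {X = W} (∧-elimˡ {W x'} h) x'∉))
      where
      to : W' ∩ A ⊆ insert x' (W ∩ A)
      to {v} h with W'-elim (∧-elimˡ {W' v} h)
      ... | inj₁ refl = ⊥-elim (not≢ {true} (trans (sym (Col-elim {c = c} {true} (∧-elimʳ {W' y} h))) y-col))
      ... | inj₂ (inj₁ refl) = insert-self x' (W ∩ A)
      ... | inj₂ (inj₂ q) = insert-old x' (W ∩ A) (∧-intro q (∧-elimʳ {W' v} h))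
      from : insert x' (W ∩ A) ⊆ W' ∩ A
      from {v} h with insert-elim {a = x'} {X = W ∩ A} h
      ... | inj₁ refl = ∧-intro x'∊W' (Col-intro x'-col)
      ... | inj₂ q = ∧-intro (old∊W' (∧-elimˡ {W v} q)) (∧-elimʳ {W v} q)
    grow-B : y ∉ W → card (W' ∩ B) ≡ suc (card (W ∩ B))
    grow-B y∉ = trans (card-cong {X = W' ∩ B} {insert y (W ∩ B)} to from) (card-insert {X = W ∩ B} (¬∊⇒∉ λ h → ∊∉ {X = W} (∧-elimˡ {W y} h) y∉))
      where
      to : W' ∩ B ⊆ insert y (W ∩ B)
      to {v} h with W'-elim (∧-elimˡ {W' v} h)
      ... | inj₁ refl = insert-self y (W ∩ B)
      ... | inj₂ (inj₁ refl) = ⊥-elim (not≢ {true} (trans (sym x'-col) (Col-elim {c = c} {false} (∧-elimʳ {W' x'} h))))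
      ... | inj₂ (inj₂ q) = insert-old y (W ∩ B) (∧-intro q (∧-elimʳ {W' v} h))
      from : insert y (W ∩ B) ⊆ W' ∩ B
      from {v} h with insert-elim {a = y} {X = W ∩ B} h
      ... | inj₁ refl = ∧-intro y∊W' (Col-intro y-col)
      ... | inj₂ q = ∧-intro (old∊W' (∧-elimˡ {W v} q)) (∧-elimʳ {W v} q)

  false≢true : ∀ {v} → c v ≡ true → c v ≡ false → ⊥
  false≢true p q = not≢ {true} (trans (sym p) q)

  module Advance (S : Stage) {x' : Fin (n G)} (x'∊ : x' ∊ Plain ∩ ∁ (Stage.W S)) (cl : ClosedUnder E (delete x' (Plain ∩ ∁ (Stage.W S)))) where
    open Stage S
    open Next W sp-in x'∊ cl

    y∉ : y ∉ W
    y∉ = ¬∊⇒∉ λ h → ∊∉ {X = W} (B-inside h y-col (E-sym Ex'y)) x'∉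

    y-cases : ∀ {u} → E y u ≡ true → u ≡ x' ⊎ u ≡ φ ξ ⊎ u ≡ φ π ⊎ u ≡ φ κ
    y-cases e with y-near e
    ... | inj₁ q = inj₁ q
    ... | inj₂ q = inj₂ (A-outside q (E-to-s e y-col) (E-sym e) y∉)

    -- Otherwise y would absorb the free ends of both π and κ, and W ∩ A without φ ξ would not expand.
    y-ξ : E y (φ ξ) ≡ true
    y-ξ with E? y (φ ξ)
    ... | yes h = h
    ... | no h = ⊥-elim (<-irrefl refl (linear (card X ∷ card (N X) ∷ card (W ∩ A) ∷ card (W ∩ B) ∷ [])
        ((♯ 1 ⊕ ′ # 0 ≼ ′ # 1) ∷ (′ # 1 ≼ ♯ 1 ⊕ ′ # 3) ∷ (♯ 2 ⊕ ′ # 3 ≼ ′ # 2) ∷ (′ # 2 ≼ ♯ 1 ⊕ ′ # 0) ∷ []) (♯ 1 ≼ ♯ 0)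
        (expand true X X-col π∊X (delete-∉ {a = φ ξ} {W ∩ A}) ξ-col ∷ NX≤ ∷ ≤-reflexive (sym balance) ∷ ≤-reflexive (card-delete {X = W ∩ A} (∧-intro (φ-in ξ-inner) (Col-intro ξ-col))) ∷ [])))
      where
      X = delete (φ ξ) (W ∩ A)
      X-col : ∀ {v} → v ∊ X → c v ≡ true
      X-col {v} q = Col-elim (∧-elimʳ {W v} (delete-sub {a = φ ξ} {W ∩ A} q))
      π∊X : φ π ∊ X
      π∊X = delete-intro {X = W ∩ A} (∧-intro (φ-in π-inner) (Col-intro π-col)) λ q → ξ≢π (sym (φ-inj π-inner ξ-inner q))
      yπ : E y (φ π) ≡ true
      yπ with E? y (φ π)
      ... | yes r = r
      ... | no r = ⊥-elim (degree-bound {u = x'} {φ κ} y-normal λ e → case y-cases e of λ where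
          (inj₁ q) → inj₁ q
          (inj₂ (inj₁ refl)) → ⊥-elim (h e)
          (inj₂ (inj₂ (inj₁ refl))) → ⊥-elim (r e)
          (inj₂ (inj₂ (inj₂ q))) → inj₂ q)
      yκ : E y (φ κ) ≡ true
      yκ with E? y (φ κ)
      ... | yes r = r
      ... | no r = ⊥-elim (degree-bound {u = x'} {φ π} y-normal λ e → case y-cases e of λ where
          (inj₁ q) → inj₁ q
          (inj₂ (inj₁ refl)) → ⊥-elim (h e)
          (inj₂ (inj₂ (inj₁ q))) → inj₂ q
          (inj₂ (inj₂ (inj₂ refl))) → ⊥-elim (r e))
      sub : N X ⊆ insert y (W ∩ B)
      sub {v} q with N-out {X} q
      ... | u , u∊ , e with ∊? W v
      ... | inj₁ v∊ = insert-old y (W ∩ B) (∧-intro v∊ (Col-intro (E-to-t e (X-col u∊))))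
      ... | inj₂ v∉ with A-outside (∧-elimˡ {W u} (delete-sub {a = φ ξ} {W ∩ A} u∊)) (X-col u∊) e v∉
      ... | inj₁ r = ⊥-elim (delete-≢ {X = W ∩ A} u∊ r)
      ... | inj₂ (inj₁ refl) = subst (_∊ insert y (W ∩ B)) (π-once (E-sym yπ) e y∉ v∉) (insert-self y (W ∩ B))
      ... | inj₂ (inj₂ refl) = subst (_∊ insert y (W ∩ B)) (κ-once (E-sym yκ) e y∉ v∉) (insert-self y (W ∩ B))
      NX≤ : card (N X) ≤ suc (card (W ∩ B))
      NX≤ = ≤-trans (card-mono {X = N X} {insert y (W ∩ B)} sub) (≤-reflexive (card-insert {X = W ∩ B} (¬∊⇒∉ λ q → ∊∉ {X = W} (∧-elimˡ {W y} q) y∉)))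

    y-πκ : E y (φ π) ≡ true ⊎ E y (φ κ) ≡ true
    y-πκ with E? y (φ π) | E? y (φ κ)
    ... | yes h | _ = inj₁ h
    ... | no _ | yes h = inj₂ h
    ... | no h | no h' = ⊥-elim (degree-bound {u = x'} {φ ξ} y-normal λ e → case y-cases e of λ where
        (inj₁ q) → inj₁ q
        (inj₂ (inj₁ q)) → inj₂ q
        (inj₂ (inj₂ (inj₁ refl))) → ⊥-elim (h e)
        (inj₂ (inj₂ (inj₂ refl))) → ⊥-elim (h' e))

    -- In the extended ladder the old `β₁` is adjacent to `t₂`, `ξ` and `π`. Hence it receives `y`,
    -- and `t₂` receives `x'`. The corners `t₁` and `up β₂` are not inner yet, so their values are
    -- placeholders.
    module Glue (yπ : E y (φ π) ≡ true) where
      open Extend Λ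

      φv : (v : Fin (n L)) → Dec (v ≡ β₁) → Fin (n G)
      φv v (yes _) = y
      φv v (no _) = φ v

      φ' : Fin (n L') → Fin (n G)
      φ' t₁ = y
      φ' t₂ = x'
      φ' (up v) = φv v (v ≟ β₁)

      φ'-β₁ : φ' (up β₁) ≡ y
      φ'-β₁ with β₁ ≟ β₁
      ... | yes _ = refl
      ... | no h = ⊥-elim (h refl)

      φ'-old : ∀ {v} → v ≢ β₁ → φ' (up v) ≡ φ v
      φ'-old {v} h with v ≟ β₁
      ... | yes q = ⊥-elim (h q)
      ... | no _ = refl

      Inner' : Fin (n L') → Set
      Inner' v = v ≢ t₁ × v ≢ up β₂

      data Kind : Fin (n L') → Set where
        tip : Kind t₂
        bot : Kind (up β₁)
        old : ∀ {v} → Inner v → Kind (up v)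

      kind-of : ∀ v → Inner' v → Kind v
      kind-of t₁ (h , _) = ⊥-elim (h refl)
      kind-of t₂ _ = tip
      kind-of (up v) (_ , h) with v ≟ β₁
      ... | yes refl = bot
      ... | no q = old (q , λ { refl → h refl })

      φ'-in : ∀ {v} → Inner' v → φ' v ∊ W'
      φ'-in {v} h with kind-of v h
      ... | tip = x'∊W'
      ... | bot = subst (_∊ W') (sym φ'-β₁) y∊W'
      ... | old i = subst (_∊ W') (sym (φ'-old (proj₁ i))) (old∊W' (φ-in i))

      φ'-inj : ∀ {u v} → Inner' u → Inner' v → φ' u ≡ φ' v → u ≡ v
      φ'-inj {u} {v} hu hv e with kind-of u hu | kind-of v hv
      ... | tip | tip = refl
      ... | bot | bot = refl
      ... | old i | old i' = cong (λ v → up v) (φ-inj i i' (trans (sym (φ'-old (proj₁ i))) (trans e (φ'-old (proj₁ i')))))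
      ... | tip | bot = ⊥-elim (y≢x' (sym (trans e φ'-β₁)))
      ... | bot | tip = ⊥-elim (y≢x' (trans (sym φ'-β₁) e))
      ... | tip | old i = ⊥-elim (∊∉ {X = W} (subst (_∊ W) (sym (trans e (φ'-old (proj₁ i)))) (φ-in i)) x'∉)
      ... | old i | tip = ⊥-elim (∊∉ {X = W} (subst (_∊ W) (trans (sym (φ'-old (proj₁ i))) e) (φ-in i)) x'∉)
      ... | bot | old i = ⊥-elim (∊∉ {X = W} (subst (_∊ W) (sym (trans (sym φ'-β₁) (trans e (φ'-old (proj₁ i))))) (φ-in i)) y∉)
      ... | old i | bot = ⊥-elim (∊∉ {X = W} (subst (_∊ W) (trans (sym (φ'-old (proj₁ i))) (trans e φ'-β₁)) (φ-in i)) y∉)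

      β₁≢β₂ : β₁ ≢ β₂
      β₁≢β₂ = joins-≢ {L} jββ

      φ'-surj : ∀ {g} → g ∊ W' → ∃ λ v → Inner' v × φ' v ≡ g
      φ'-surj h with W'-elim h
      ... | inj₁ refl = up β₁ , ((λ ()) , λ { refl → β₁≢β₂ refl }) , φ'-β₁
      ... | inj₂ (inj₁ refl) = t₂ , ((λ ()) , λ ()) , refl
      ... | inj₂ (inj₂ q) with φ-surj q
      ... | v , i , r = up v , ((λ ()) , λ { refl → proj₂ i refl }) , trans (φ'-old (proj₁ i)) r

      adj-bot : ∀ {e w} → Joins L e β₁ w → w ≢ β₂ → Adj G y (φ' (up w))
      adj-bot {e} {w} j h with exact₁ (joins-inc {L} j)
      ... | inj₁ refl = subst (Adj G y) (sym (trans (cong (λ w → φ' (up w)) (joins-unique {L} j j₁ξ)) (φ'-old (proj₁ ξ-inner)))) (Adj-E y-ξ)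
      ... | inj₂ (inj₁ refl) = ⊥-elim (h (joins-unique {L} j jββ))
      ... | inj₂ (inj₂ refl) = subst (Adj G y) (sym (trans (cong (λ w → φ' (up w)) (joins-unique {L} j j₁π)) (φ'-old (proj₁ π-inner)))) (Adj-E yπ)

      adj-β₁ : ∀ {e w} → Joins L e β₁ w → w ≢ β₂ → Adj G (φ' (up β₁)) (φ' (up w))
      adj-β₁ {w = w} j h = subst (λ z → Adj G z (φ' (up w))) (sym φ'-β₁) (adj-bot j h)

      tip-edge : ∀ {e v} → Joins L' (upe e) t₂ (up v) → v ≡ β₁
      tip-edge {e} {v} j with old-at {e} {t₂} refl (joins-inc {L'} {upe e} j)
      ... | inj₁ (_ , ())
      ... | inj₂ (inj₂ (_ , ()))
      ... | inj₂ (inj₁ (refl , _)) = joins-unique {L} (joins-down j) (joins-sym {L} jββ)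

      φ'-adj : ∀ {e u v} → Joins L' e u v → Inner' u → Inner' v → Adj G (φ' u) (φ' v)
      φ'-adj {zero} (inj₁ (refl , _)) hu hv = ⊥-elim (proj₁ hu refl)
      φ'-adj {zero} (inj₂ (refl , _)) hu hv = ⊥-elim (proj₁ hv refl)
      φ'-adj {suc zero} (inj₁ (refl , _)) hu hv = ⊥-elim (proj₁ hu refl)
      φ'-adj {suc zero} (inj₂ (refl , _)) hu hv = ⊥-elim (proj₁ hv refl)
      φ'-adj {suc (suc zero)} (inj₁ (_ , refl)) hu hv = ⊥-elim (proj₂ hv refl)
      φ'-adj {suc (suc zero)} (inj₂ (_ , refl)) hu hv = ⊥-elim (proj₂ hu refl)
      φ'-adj {upe e} {u} {v} j hu hv with kind-of u hu | kind-of v hv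
      ... | tip | tip = ⊥-elim (joins-≢ {L} (joins-down j) refl)
      ... | bot | bot = ⊥-elim (joins-≢ {L} (joins-down j) refl)
      ... | tip | bot = subst (Adj G x') (sym φ'-β₁) (Adj-E Ex'y)
      ... | bot | tip = subst (λ z → Adj G z x') (sym φ'-β₁) (Adj-E (E-sym Ex'y))
      ... | tip | old i = ⊥-elim (proj₁ i (tip-edge j))
      ... | old i | tip = ⊥-elim (proj₁ i (tip-edge (joins-sym {L'} {upe e} j)))
      ... | bot | old i = adj-β₁ (joins-down j) (proj₂ i)
      ... | old i | bot = Adj-sym (adj-β₁ (joins-sym {L} (joins-down j)) (proj₂ i))
      ... | old i | old i' = subst₂ (Adj G) (sym (φ'-old (proj₁ i))) (sym (φ'-old (proj₁ i'))) (φ-adj (joins-down j) i i')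

      φ'ξ : φ' (up ξ) ≡ φ ξ
      φ'ξ = φ'-old (proj₁ ξ-inner)

      φ'κ : φ' (up κ) ≡ φ κ
      φ'κ = φ'-old κ≢β₁

      A-outside' : ∀ {a v} → a ∊ W' → c a ≡ true → E a v ≡ true → v ∉ W' → a ≡ x' ⊎ a ≡ φ' (up ξ) ⊎ a ≡ φ' (up κ)
      A-outside' {a} {v} a∊ ca e v∉ with W'-elim a∊
      ... | inj₁ refl = ⊥-elim (false≢true ca y-col)
      ... | inj₂ (inj₁ q) = inj₁ q
      ... | inj₂ (inj₂ q) with A-outside q ca e (∉W'⇒∉W v∉)
      ... | inj₁ r = inj₂ (inj₁ (trans r (sym φ'ξ)))
      ... | inj₂ (inj₂ r) = inj₂ (inj₂ (trans r (sym φ'κ)))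
      -- The one neighbour that `φ π` had outside `W` was `y`, which is inside now.
      ... | inj₂ (inj₁ refl) = ⊥-elim (∉W'⇒≢y v∉ (π-once e (E-sym yπ) (∉W'⇒∉W v∉) y∉))

      -- At most three neighbours are possible, and `μ (φ ξ)` and `y` are two of them.
      ξ-once : ∀ {u v} → E (φ ξ) u ≡ true → E (φ ξ) v ≡ true → u ∉ W' → v ∉ W' → u ≡ v
      ξ-once {u} {v} eu ev u∉ v∉ with u ≟ v
      ... | yes q = q
      ... | no ne = ⊥-elim (no-four (μ-E (φ ξ) ξ-normal) (E-sym y-ξ) eu ev (apart y∉) (apart (∉W'⇒∉W u∉)) (apart (∉W'⇒∉W v∉)) (∉W'⇒≢y u∉ ∘ sym) (∉W'⇒≢y v∉ ∘ sym) ne)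
        where
        apart : ∀ {w} → w ∉ W → μ (φ ξ) ≢ w
        apart h q = ∊∉ {X = W} (subst (_∊ W) q ξ-μ) h

      stage : Stage
      stage = record
        { Λ = extended ; φ = φ' ; W = W' ; φ-in = λ {v} → φ'-in {v} ; φ-inj = λ {u} {v} → φ'-inj {u} {v} ; φ-surj = φ'-surj ; φ-adj = λ {e} {u} {v} → φ'-adj {e} {u} {v} ; rest-closed = λ {z} {v} → rest-closed' {z} {v}
        ; sp-in = λ i → old∊W' (sp-in i)
        ; sp-out = λ i → ¬∊⇒∉ λ h → case W'-elim h of λ where
            (inj₁ q) → plain-≢ y-plain i (sym q)
            (inj₂ (inj₁ q)) → false≢true x'-col (trans (cong c (sym q)) (sp-col false i))
            (inj₂ (inj₂ q)) → ∊∉ {X = W} q (sp-out i)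
        ; ξ-col = x'-col ; ξ-normal = x'-normal ; ξ-μ = y∊W'
        ; ξ-only = λ {v} h e → case W'-elim h of λ where
            (inj₁ q) → q
            (inj₂ (inj₁ refl)) → ⊥-elim (false≢true x'-col (E-to-t e x'-col))
            (inj₂ (inj₂ q)) → ⊥-elim (∊∉ {X = W} (B-inside q (E-to-t e x'-col) (E-sym e)) x'∉)
        ; B-inside = λ {v} {a} h cv e → case W'-elim h of λ where
            (inj₁ refl) → case y-near e of λ { (inj₁ refl) → x'∊W' ; (inj₂ q) → old∊W' q }
            (inj₂ (inj₁ refl)) → ⊥-elim (false≢true x'-col cv)
            (inj₂ (inj₂ q)) → old∊W' (B-inside q cv e)
        ; A-outside = A-outside'
        ; π-once = λ {u} {v} eu ev u∉ v∉ → ξ-once (subst (λ z → E z u ≡ true) φ'ξ eu) (subst (λ z → E z v ≡ true) φ'ξ ev) u∉ v∉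
        ; κ-once = λ {u} {v} eu ev u∉ v∉ → κ-once (subst (λ z → E z u ≡ true) φ'κ eu) (subst (λ z → E z v ≡ true) φ'κ ev) (∉W'⇒∉W u∉) (∉W'⇒∉W v∉)
        ; π-col = trans (cong c φ'ξ) ξ-col ; κ-col = trans (cong c φ'κ) κ-col
        ; balance = trans grow-A (trans (cong suc balance) (cong (2 +_) (sym (grow-B y∉)))) }

  advance : (S : Stage) → (∃ λ v → v ∊ Plain ∩ ∁ (Stage.W S)) → Σ Stage λ S' → card (Plain ∩ ∁ (Stage.W S')) < card (Plain ∩ ∁ (Stage.W S))
  advance S (v , h) = go (top (shore-rest (Stage.W S)) (λ {z} {v} → Stage.rest-closed S {z} {v}) h)
    where
    smaller : ∀ W {x' y} → x' ∊ Plain ∩ ∁ W → card (Plain ∩ ∁ (insert y (insert x' W))) < card (Plain ∩ ∁ W)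
    smaller W {x'} {y} x'∊ = ≤-trans (s≤s (card-mono {X = Plain ∩ ∁ (insert y (insert x' W))} {delete x' (Plain ∩ ∁ W)} λ {w} q → delete-intro {X = Plain ∩ ∁ W}
        (∧-intro (∧-elimˡ {Plain w} q) (not-false (¬∊⇒∉ λ r → true≢false (insert-old y (insert x' W) (insert-old x' W r)) (not-true (∧-elimʳ {Plain w} q)))))
        λ { refl → true≢false (insert-old y (insert x' W) (insert-self x' W)) (not-true (∧-elimʳ {Plain w} q)) })) (≤-reflexive (sym (card-delete {X = Plain ∩ ∁ W} x'∊)))
    go : (∃ λ a → a ∊ Plain ∩ ∁ (Stage.W S) × ClosedUnder E (delete a (Plain ∩ ∁ (Stage.W S)))) → Σ Stage λ S' → card (Plain ∩ ∁ (Stage.W S')) < card (Plain ∩ ∁ (Stage.W S))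
    go (x' , x'∊ , cl) = choose (Advance.y-πκ S x'∊ cl)
      where
      choose : E (μ x') (Stage.φ S (Stage.π S)) ≡ true ⊎ E (μ x') (Stage.φ S (Stage.κ S)) ≡ true → Σ Stage λ S' → card (Plain ∩ ∁ (Stage.W S')) < card (Plain ∩ ∁ (Stage.W S))
      choose (inj₁ q) = Advance.Glue.stage S x'∊ cl q , smaller (Stage.W S) x'∊
      choose (inj₂ q) = Advance.Glue.stage (swapStage S) x'∊ cl q , smaller (Stage.W S) x'∊

  -- The partner of the first top vertex closes the triangle of the special vertices of A.
  initial : Stage
  initial = go (top sh cl (plain-intro (proj₁ (proj₂ (third true))) (proj₂ (proj₂ (third true)))))
    where
    sh : Shore Plain
    sh = record { col = plain-col ; plain = plain-≢ }
    cl : ClosedUnder E Plain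
    cl {z} {v} h e nv = plain-intro cμ λ i q → μ-normal v v-normal i (trans q (cong (λ r → sp r i) (sym cμ)))
      where
      cv : c v ≡ false
      cv = E-to-t e (plain-col h)
      v-normal : Normal v
      v-normal i = subst (λ r → v ≢ sp r i) (sym cv) (nv i)
      cμ : c (μ v) ≡ true
      cμ = E-to-s (μ-E v v-normal) cv
    go : (∃ λ a → a ∊ Plain × ClosedUnder E (delete a Plain)) → Stage
    go (x' , x'∊ , clx) = record
      { Λ = prismLadder ; φ = φ ; W = W' ; φ-in = λ {v} → φ-in v ; φ-inj = λ {u} {v} → φ-inj u v ; φ-surj = φ-surj ; φ-adj = λ {e} {u} {v} → φ-adj e u v ; rest-closed = λ {z} {v} → rest-closed' {z} {v}
      ; sp-in = λ i → old∊W' (sp-W₀ i)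
      ; sp-out = λ i → ¬∊⇒∉ λ h → case W'-elim h of λ where
          (inj₁ q) → plain-≢ y-plain i (sym q)
          (inj₂ (inj₁ q)) → false≢true x'-col (trans (cong c (sym q)) (sp-col false i))
          (inj₂ (inj₂ q)) → false≢true (W₀-col q) (sp-col false i)
      ; ξ-col = x'-col ; ξ-normal = x'-normal ; ξ-μ = y∊W'
      ; ξ-only = λ {v} h e → case W'-elim h of λ where
          (inj₁ q) → q
          (inj₂ (inj₁ refl)) → ⊥-elim (false≢true x'-col (E-to-t e x'-col))
          (inj₂ (inj₂ q)) → ⊥-elim (false≢true (W₀-col q) (E-to-t e x'-col))
      ; B-inside = λ {v} {a} h cv e → case W'-elim h of λ where
          (inj₁ refl) → case y-near e of λ { (inj₁ refl) → x'∊W' ; (inj₂ q) → old∊W' q }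
          (inj₂ (inj₁ refl)) → ⊥-elim (false≢true x'-col cv)
          (inj₂ (inj₂ q)) → ⊥-elim (false≢true (W₀-col q) cv)
      ; A-outside = λ {a} h ca e _ → case W'-elim h of λ where
          (inj₁ refl) → ⊥-elim (false≢true ca y-col)
          (inj₂ (inj₁ q)) → inj₁ q
          (inj₂ (inj₂ q)) → case W₀-elim q of λ { (true , r) → inj₂ (inj₁ r) ; (false , r) → inj₂ (inj₂ r) }
      ; π-once = once true ; κ-once = once false ; π-col = sp-col true true ; κ-col = sp-col true false
      ; balance = trans grow-A (trans (cong suc card-A) (cong (2 +_) (sym (trans (grow-B y∉) (cong suc card-B))))) }
      where
      W₀ : FSet (n G)
      W₀ = insert (sp true true) ⁅ sp true false ⁆
      sp-W₀ : ∀ i → sp true i ∊ W₀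
      sp-W₀ true = insert-self (sp true true) ⁅ sp true false ⁆
      sp-W₀ false = insert-old (sp true true) ⁅ sp true false ⁆ (∊⁅⁆ (sp true false))
      W₀-elim : ∀ {v} → v ∊ W₀ → ∃ λ i → v ≡ sp true i
      W₀-elim h with insert-elim {a = sp true true} {X = ⁅ sp true false ⁆} h
      ... | inj₁ q = true , q
      ... | inj₂ q = false , ∊⁅⁆⇒≡ q
      W₀-col : ∀ {v} → v ∊ W₀ → c v ≡ true
      W₀-col h with W₀-elim h
      ... | i , refl = sp-col true i
      fresh : ∀ {v} → v ∊ Plain → v ∊ Plain ∩ ∁ W₀
      fresh h = ∧-intro h (not-false (¬∊⇒∉ λ q → plain-≢ h (proj₁ (W₀-elim q)) (proj₂ (W₀-elim q))))
      cl₀ : ClosedUnder E (delete x' (Plain ∩ ∁ W₀))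
      cl₀ {z} {v} h e nv = delete-intro {X = Plain ∩ ∁ W₀} (fresh (delete-sub {a = x'} {Plain} r)) (delete-≢ {X = Plain} r)
        where r = clx (delete-intro {X = Plain} (∧-elimˡ {Plain z} (delete-sub {a = x'} {Plain ∩ ∁ W₀} h)) (delete-≢ {X = Plain ∩ ∁ W₀} h)) e nv
      open Next W₀ sp-W₀ (fresh x'∊) cl₀
      y∉ : y ∉ W₀
      y∉ = ¬∊⇒∉ λ h → false≢true (W₀-col h) y-col
      y-sp : ∀ i → E y (sp true i) ≡ true
      y-sp i with E? y (sp true i)
      ... | yes h = h
      ... | no h = ⊥-elim (degree-bound {u = x'} {sp true (not i)} y-normal λ e → case y-near e of λ where
          (inj₁ q) → inj₁ q
          (inj₂ q) → case W₀-elim q of λ { (j , refl) → case bool-split {i} {not i} not≢ j of λ { (inj₁ refl) → ⊥-elim (h e) ; (inj₂ refl) → inj₂ refl } })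
      once : ∀ i {u v} → E (sp true i) u ≡ true → E (sp true i) v ≡ true → u ∉ W' → v ∉ W' → u ≡ v
      once i {u} {v} eu ev u∉ v∉ with u ≟ v
      ... | yes q = q
      ... | no ne = ⊥-elim (no-three-special true i (E-sym (y-sp i)) eu ev (∉W'⇒≢y u∉ ∘ sym) (∉W'⇒≢y v∉ ∘ sym) ne)
      card-A : card (W₀ ∩ A) ≡ 2
      card-A = trans (card-cong {X = W₀ ∩ A} {W₀} (λ {v} h → ∧-elimˡ {W₀ v} h) (λ h → ∧-intro h (Col-intro (W₀-col h)))) (trans (card-insert {X = ⁅ sp true false ⁆} (≢⇒∉⁅⁆ (loopless G (se true)))) (cong suc (card-⁅⁆ (sp true false))))
      card-B : card (W₀ ∩ B) ≡ 0
      card-B = card-∅ {X = W₀ ∩ B} λ v → ¬∊⇒∉ λ h → false≢true (W₀-col (∧-elimˡ {W₀ v} h)) (Col-elim {c = c} {false} (∧-elimʳ {W₀ v} h))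
      -- Prism vertices 0, 2, 4 form the triangle of the two special vertices and `y`, and 1 is
      -- `x'`. Vertices 3 and 5 are `β₁` and `β₂`, still to be placed; their values are
      -- placeholders.
      φ : Fin 6 → Fin (n G)
      φ zero = sp true true
      φ (suc zero) = x'
      φ (suc (suc zero)) = sp true false
      φ (suc (suc (suc zero))) = x'
      φ (suc (suc (suc (suc zero)))) = y
      φ (suc (suc (suc (suc (suc zero))))) = x'
      φ-in : ∀ v → v ≢ # 3 × v ≢ # 5 → φ v ∊ W'
      φ-in zero h = old∊W' (sp-W₀ true)
      φ-in (suc zero) h = x'∊W'
      φ-in (suc (suc zero)) h = old∊W' (sp-W₀ false)
      φ-in (suc (suc (suc zero))) h = ⊥-elim (proj₁ h refl)
      φ-in (suc (suc (suc (suc zero)))) h = y∊W'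
      φ-in (suc (suc (suc (suc (suc zero))))) h = ⊥-elim (proj₂ h refl)
      x'≢sp : ∀ i → x' ≢ sp true i
      x'≢sp = plain-≢ x'-plain
      y≢sp : ∀ i → y ≢ sp true i
      y≢sp i q = false≢true (trans (cong c q) (sp-col true i)) y-col
      φ-inj : ∀ u v → u ≢ # 3 × u ≢ # 5 → v ≢ # 3 × v ≢ # 5 → φ u ≡ φ v → u ≡ v
      φ-inj (suc (suc (suc zero))) _ h _ _ = ⊥-elim (proj₁ h refl)
      φ-inj (suc (suc (suc (suc (suc zero))))) _ h _ _ = ⊥-elim (proj₂ h refl)
      φ-inj _ (suc (suc (suc zero))) _ h _ = ⊥-elim (proj₁ h refl)
      φ-inj _ (suc (suc (suc (suc (suc zero))))) _ h _ = ⊥-elim (proj₂ h refl)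
      φ-inj zero zero _ _ _ = refl
      φ-inj zero (suc zero) _ _ q = ⊥-elim (x'≢sp true (sym q))
      φ-inj zero (suc (suc zero)) _ _ q = ⊥-elim (loopless G (se true) q)
      φ-inj zero (suc (suc (suc (suc zero)))) _ _ q = ⊥-elim (y≢sp true (sym q))
      φ-inj (suc zero) zero _ _ q = ⊥-elim (x'≢sp true q)
      φ-inj (suc zero) (suc zero) _ _ _ = refl
      φ-inj (suc zero) (suc (suc zero)) _ _ q = ⊥-elim (x'≢sp false q)
      φ-inj (suc zero) (suc (suc (suc (suc zero)))) _ _ q = ⊥-elim (y≢x' (sym q))
      φ-inj (suc (suc zero)) zero _ _ q = ⊥-elim (loopless G (se true) (sym q))
      φ-inj (suc (suc zero)) (suc zero) _ _ q = ⊥-elim (x'≢sp false (sym q))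
      φ-inj (suc (suc zero)) (suc (suc zero)) _ _ _ = refl
      φ-inj (suc (suc zero)) (suc (suc (suc (suc zero)))) _ _ q = ⊥-elim (y≢sp false (sym q))
      φ-inj (suc (suc (suc (suc zero)))) zero _ _ q = ⊥-elim (y≢sp true q)
      φ-inj (suc (suc (suc (suc zero)))) (suc zero) _ _ q = ⊥-elim (y≢x' q)
      φ-inj (suc (suc (suc (suc zero)))) (suc (suc zero)) _ _ q = ⊥-elim (y≢sp false q)
      φ-inj (suc (suc (suc (suc zero)))) (suc (suc (suc (suc zero)))) _ _ _ = refl
      φ-surj : ∀ {g} → g ∊ W' → ∃ λ v → (v ≢ # 3 × v ≢ # 5) × φ v ≡ g
      φ-surj h with W'-elim h
      ... | inj₁ q = # 4 , ((λ ()) , λ ()) , sym q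
      ... | inj₂ (inj₁ q) = # 1 , ((λ ()) , λ ()) , sym q
      ... | inj₂ (inj₂ q) with W₀-elim q
      ... | true , r = # 0 , ((λ ()) , λ ()) , sym r
      ... | false , r = # 2 , ((λ ()) , λ ()) , sym r
      adj-ends : ∀ e → end₁ C6bar e ≢ # 3 × end₁ C6bar e ≢ # 5 → end₂ C6bar e ≢ # 3 × end₂ C6bar e ≢ # 5 → Adj G (φ (end₁ C6bar e)) (φ (end₂ C6bar e))
      adj-ends zero _ _ = se true , sp-joins true true
      adj-ends (suc zero) _ h = ⊥-elim (proj₁ h refl)
      adj-ends (suc (suc zero)) _ _ = Adj-E (E-sym (y-sp true))
      adj-ends (suc (suc (suc zero))) _ h = ⊥-elim (proj₁ h refl)
      adj-ends (suc (suc (suc (suc zero)))) _ _ = Adj-E Ex'y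
      adj-ends (suc (suc (suc (suc (suc zero))))) _ h = ⊥-elim (proj₂ h refl)
      adj-ends (suc (suc (suc (suc (suc (suc zero)))))) _ _ = Adj-E (E-sym (y-sp false))
      adj-ends (suc (suc (suc (suc (suc (suc (suc zero))))))) _ h = ⊥-elim (proj₂ h refl)
      adj-ends (suc (suc (suc (suc (suc (suc (suc (suc zero)))))))) h _ = ⊥-elim (proj₁ h refl)
      φ-adj : ∀ e u v → Joins C6bar e u v → u ≢ # 3 × u ≢ # 5 → v ≢ # 3 × v ≢ # 5 → Adj G (φ u) (φ v)
      φ-adj e u v (inj₁ (refl , refl)) hu hv = adj-ends e hu hv
      φ-adj e u v (inj₂ (refl , refl)) hu hv = Adj-sym (adj-ends e hv hu)

  module Finish (S : Stage) (done : ∀ v → v ∉ Plain ∩ ∁ (Stage.W S)) where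
    open Stage S

    A-in : ∀ {a} → c a ≡ true → a ∊ W
    A-in {a} ca = ¬∉⇒∊ λ h → true≢false (∧-intro (A-covered ca h) (not-false h)) (done a)

    -- `W` contains all of `A` and two vertices fewer of `B`, and the classes have equal size.
    outside-two : card (B ∩ ∁ W) ≤ 2
    outside-two = linear (card A ∷ card B ∷ card (W ∩ A) ∷ card (W ∩ B) ∷ card (B ∩ W) ∷ card (B ∩ ∁ W) ∷ [])
      ((′ # 4 ⊕ ′ # 5 ≼ ′ # 1) ∷ (′ # 1 ≼ ′ # 0) ∷ (′ # 0 ≼ ′ # 2) ∷ (′ # 2 ≼ ♯ 2 ⊕ ′ # 3) ∷ (′ # 3 ≼ ′ # 4) ∷ []) (′ # 5 ≼ ♯ 2)
      (≤-reflexive (card-partition B W) ∷ ≤-reflexive (sym (NearBip.balanced nearBip true)) ∷ card-mono {X = A} {W ∩ A} (λ h → ∧-intro (A-in (Col-elim h)) h)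
        ∷ ≤-reflexive balance ∷ card-mono {X = W ∩ B} {B ∩ W} (λ {v} h → ∧-intro (∧-elimʳ {W v} h) (∧-elimˡ {W v} h)) ∷ [])

    outside : ∀ {v} → v ∉ W → ∃ λ i → v ≡ sp false i
    outside {v} v∉ with v ≟ sp false true | v ≟ sp false false
    ... | yes q | _ = true , q
    ... | no _ | yes q = false , q
    ... | no p | no q = ⊥-elim (<-irrefl refl (≤-trans (≤-reflexive (sym (trans (card-insert {X = insert (sp false true) ⁅ sp false false ⁆} (insert-∉ {X = ⁅ sp false false ⁆} p (≢⇒∉⁅⁆ q)))
          (cong suc (trans (card-insert {X = ⁅ sp false false ⁆} (≢⇒∉⁅⁆ (loopless G (se false)))) (cong suc (card-⁅⁆ (sp false false)))))))) (≤-trans (card-mono {X = T} {B ∩ ∁ W} sub) outside-two)))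
      where
      T = insert v (insert (sp false true) ⁅ sp false false ⁆)
      cv : c v ≡ false
      cv = ¬∊⇒∉ λ h → ∊∉ {X = W} (A-in h) v∉
      sub : T ⊆ B ∩ ∁ W
      sub h with insert-elim {a = v} {X = insert (sp false true) ⁅ sp false false ⁆} h
      ... | inj₁ refl = ∧-intro (Col-intro cv) (not-false v∉)
      ... | inj₂ h' with insert-elim {a = sp false true} {X = ⁅ sp false false ⁆} h'
      ... | inj₁ refl = ∧-intro (Col-intro (sp-col false true)) (not-false (sp-out true))
      ... | inj₂ h'' with ∊⁅⁆⇒≡ h''
      ... | refl = ∧-intro (Col-intro (sp-col false false)) (not-false (sp-out false))

    ξ-sp : ∀ i → E (φ ξ) (sp false i) ≡ true
    ξ-sp i with E? (φ ξ) (sp false i)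
    ... | yes h = h
    ... | no h = ⊥-elim (degree-bound {u = μ (φ ξ)} {sp false (not i)} ξ-normal λ {w} e → case ∊? W w of λ where
        (inj₁ q) → inj₁ (ξ-only q e)
        (inj₂ q) → case outside q of λ { (j , refl) → case bool-split {i} {not i} not≢ j of λ { (inj₁ refl) → ⊥-elim (h e) ; (inj₂ refl) → inj₂ refl } })

    other : ∀ i → E (φ π) (sp false i) ≡ true ⊎ E (φ κ) (sp false i) ≡ true
    other i = go (card-nonempty (delete (φ ξ) (N ⁅ v ⁆)) (s≤s⁻¹ (≤-trans two (card-delete-≤ (φ ξ) (N ⁅ v ⁆)))))
      where
      v = sp false i
      two : 2 ≤ card (N ⁅ v ⁆)
      two = ≤-trans (≤-reflexive (cong suc (sym (card-⁅⁆ v)))) (expand false ⁅ v ⁆ (λ h → trans (cong c (∊⁅⁆⇒≡ h)) (sp-col false i)) (∊⁅⁆ v) (≢⇒∉⁅⁆ (sp-dist' false i ∘ sym)) (sp-col false (not i)))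
      go : (∃ λ u → u ∊ delete (φ ξ) (N ⁅ v ⁆)) → E (φ π) v ≡ true ⊎ E (φ κ) v ≡ true
      go (u , h) with N-out {⁅ v ⁆} (delete-sub {a = φ ξ} {N ⁅ v ⁆} h)
      ... | v' , q , e with ∊⁅⁆⇒≡ q
      ... | refl with A-outside (A-in (E-to-s e (sp-col false i))) (E-to-s e (sp-col false i)) (E-sym e) (sp-out i)
      ... | inj₁ r = ⊥-elim (delete-≢ {X = N ⁅ v ⁆} h r)
      ... | inj₂ (inj₁ refl) = inj₁ (E-sym e)
      ... | inj₂ (inj₂ refl) = inj₂ (E-sym e)

    -- Each special vertex of `B` has a neighbour besides `φ ξ`. As `φ π` and `φ κ` see at most one
    -- vertex outside `W` each, they divide the two between them.
    ends : ∃ λ i → E (φ π) (sp false i) ≡ true × E (φ κ) (sp false (not i)) ≡ true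
    ends with other true | other false
    ... | inj₁ h | inj₂ h' = true , h , h'
    ... | inj₂ h | inj₁ h' = false , h' , h
    ... | inj₁ h | inj₁ h' = ⊥-elim (loopless G (se false) (π-once h h' (sp-out true) (sp-out false)))
    ... | inj₂ h | inj₂ h' = ⊥-elim (loopless G (se false) (κ-once h h' (sp-out true) (sp-out false)))

    -- `β₁` and `β₂` at last receive the special vertices of `B`, in the order in which `φ π` and
    -- `φ κ` see them.
    finish : (∃ λ i → E (φ π) (sp false i) ≡ true × E (φ κ) (sp false (not i)) ≡ true) → TriLadder G
    finish (i , hπ , hκ) = triLadder-iso (embedding⇒iso {G} {L} simple three no-four-edges Φ (λ {u} {v} → Φ-inj u v) Φ-surj (λ e → Φ-adj (joins-ends {L} e))) triLadder
      where
      pick : (v : Fin (n L)) → Dec (v ≡ β₁) → Dec (v ≡ β₂) → Fin (n G)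
      pick v (yes _) _ = sp false i
      pick v (no _) (yes _) = sp false (not i)
      pick v (no _) (no _) = φ v
      Φ : Fin (n L) → Fin (n G)
      Φ v = pick v (v ≟ β₁) (v ≟ β₂)
      data Kind : Fin (n L) → Set where
        is₁ : Φ β₁ ≡ sp false i → Kind β₁
        is₂ : Φ β₂ ≡ sp false (not i) → Kind β₂
        old : ∀ {v} → Inner v → Φ v ≡ φ v → Kind v
      pick-old : ∀ {v} → Inner v → Φ v ≡ φ v
      pick-old {v} (p , q) with v ≟ β₁ | v ≟ β₂
      ... | yes h | _ = ⊥-elim (p h)
      ... | no _ | yes h = ⊥-elim (q h)
      ... | no _ | no _ = refl
      pick₁ : Φ β₁ ≡ sp false i
      pick₁ with β₁ ≟ β₁
      ... | yes _ = refl
      ... | no h = ⊥-elim (h refl)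
      pick₂ : Φ β₂ ≡ sp false (not i)
      pick₂ with β₂ ≟ β₁ | β₂ ≟ β₂
      ... | yes h | _ = ⊥-elim (joins-≢ {L} jββ (sym h))
      ... | no _ | yes _ = refl
      ... | no _ | no h = ⊥-elim (h refl)
      kind-of : ∀ v → Kind v
      kind-of v = go (v ≟ β₁) (v ≟ β₂)
        where
        go : Dec (v ≡ β₁) → Dec (v ≡ β₂) → Kind v
        go (yes refl) _ = is₁ pick₁
        go (no _) (yes refl) = is₂ pick₂
        go (no p) (no q) = old (p , q) (pick-old (p , q))
      clash : ∀ {v} j → Inner v → φ v ≡ sp false j → ⊥
      clash j h q = ∊∉ {X = W} (subst (_∊ W) q (φ-in h)) (sp-out j)
      Φ-inj : ∀ u v → Φ u ≡ Φ v → u ≡ v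
      Φ-inj u v e with kind-of u | kind-of v
      ... | is₁ _ | is₁ _ = refl
      ... | is₂ _ | is₂ _ = refl
      ... | is₁ p | is₂ q = ⊥-elim (sp-dist' false i (trans (sym p) (trans e q)))
      ... | is₂ p | is₁ q = ⊥-elim (sp-dist' false i (trans (sym q) (trans (sym e) p)))
      ... | old h p | old h' q = φ-inj h h' (trans (sym p) (trans e q))
      ... | old h p | is₁ q = ⊥-elim (clash i h (trans (sym p) (trans e q)))
      ... | old h p | is₂ q = ⊥-elim (clash (not i) h (trans (sym p) (trans e q)))
      ... | is₁ q | old h p = ⊥-elim (clash i h (trans (sym p) (trans (sym e) q)))
      ... | is₂ q | old h p = ⊥-elim (clash (not i) h (trans (sym p) (trans (sym e) q)))
      Φ-surj : ∀ x → ∃ λ v → Φ v ≡ x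
      Φ-surj x with ∊? W x
      ... | inj₁ h = case φ-surj h of λ { (v , inn , q) → v , trans (pick-old inn) q }
      ... | inj₂ h with outside h
      ... | j , refl with bool-split {i} {not i} not≢ j
      ... | inj₁ refl = β₁ , pick₁
      ... | inj₂ refl = β₂ , pick₂
      adj₁ : ∀ {e v} → Joins L e β₁ v → Adj G (sp false i) (Φ v)
      adj₁ {e} {v} j with exact₁ (joins-inc {L} j)
      ... | inj₁ refl = subst (Adj G (sp false i)) (sym (trans (cong Φ (joins-unique {L} j j₁ξ)) (pick-old ξ-inner))) (Adj-E (E-sym (ξ-sp i)))
      ... | inj₂ (inj₁ refl) = subst (Adj G (sp false i)) (sym (trans (cong Φ (joins-unique {L} j jββ)) pick₂)) (se false , sp-joins false i)
      ... | inj₂ (inj₂ refl) = subst (Adj G (sp false i)) (sym (trans (cong Φ (joins-unique {L} j j₁π)) (pick-old π-inner))) (Adj-E (E-sym hπ))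
      adj₂ : ∀ {e v} → Joins L e β₂ v → Adj G (sp false (not i)) (Φ v)
      adj₂ {e} {v} j with exact₂ (joins-inc {L} j)
      ... | inj₁ refl = subst (Adj G (sp false (not i))) (sym (trans (cong Φ (joins-unique {L} j j₂ξ)) (pick-old ξ-inner))) (Adj-E (E-sym (ξ-sp (not i))))
      ... | inj₂ (inj₁ refl) = subst (Adj G (sp false (not i))) (sym (trans (cong Φ (joins-unique {L} j (joins-sym {L} jββ))) pick₁)) (se false , joins-sym {G} (sp-joins false i))
      ... | inj₂ (inj₂ refl) = subst (Adj G (sp false (not i))) (sym (trans (cong Φ (joins-unique {L} j j₂κ)) (pick-old κ-inner))) (Adj-E (E-sym hκ))
      Φ-adj : ∀ {e u v} → Joins L e u v → Adj G (Φ u) (Φ v)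
      Φ-adj {e} {u} {v} j with kind-of u | kind-of v
      ... | is₁ p | _ = subst (λ z → Adj G z (Φ v)) (sym p) (adj₁ j)
      ... | is₂ p | _ = subst (λ z → Adj G z (Φ v)) (sym p) (adj₂ j)
      ... | old _ _ | is₁ q = Adj-sym (subst (λ z → Adj G z (Φ u)) (sym q) (adj₁ (joins-sym {L} j)))
      ... | old _ _ | is₂ q = Adj-sym (subst (λ z → Adj G z (Φ u)) (sym q) (adj₂ (joins-sym {L} j)))
      ... | old h p | old h' q = subst₂ (Adj G) (sym p) (sym q) (φ-adj j h h')

  run : ∀ k (S : Stage) → card (Plain ∩ ∁ (Stage.W S)) ≤ k → TriLadder G
  run k S le = go k le (find (Plain ∩ ∁ (Stage.W S)))
    where
    go : ∀ k → card (Plain ∩ ∁ (Stage.W S)) ≤ k → (∃ λ v → v ∊ Plain ∩ ∁ (Stage.W S)) ⊎ (∀ v → v ∉ Plain ∩ ∁ (Stage.W S)) → TriLadder G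
    go k le (inj₂ done) = Finish.finish S done (Finish.ends S done)
    go zero le (inj₁ (v , h)) = ⊥-elim (<-irrefl refl (≤-trans (card-pos {X = Plain ∩ ∁ (Stage.W S)} h) le))
    go (suc k) le (inj₁ h) = run k (proj₁ (advance S h)) (s≤s⁻¹ (≤-trans (proj₂ (advance S h)) le))

  extremal⇒triLadder : TriLadder G
  extremal⇒triLadder = run _ initial ≤-refl

-- Removable edges of tri-ladders

module _ {G : Graph} where

  Meet : Fin (m G) → Fin (m G) → Set
  Meet e f = e ≢ f × ∃ λ v → Inc G e v × Inc G f v

  depends⇒nonremovable : ∀ {e f} → f ≢ e → (∀ {S M} → PerfectMatching G S M → f ∈ M → e ∈ M) → ¬ Removable G e
  depends⇒nonremovable {e} {f} ne h (_ , _ , cov) with cov f ne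
  ... | M , pm , f∈ = proj₁ pm e (h pm f∈) refl

  meet-∉ : ∀ {e f S M} → PerfectMatching G S M → Meet e f → f ∈ M → ¬ e ∈ M
  meet-∉ pm (ne , v , i , i') f∈ e∈ = ne (proj₂ (proj₂ pm) v _ _ e∈ f∈ i i')

  -- A matching containing `f` can use neither `g` nor `h`, so only `e` is left to cover `t`.
  forced-at : ∀ {t e g h f} → f ≢ e → (∀ {x} → Inc G x t → x ≡ e ⊎ x ≡ g ⊎ x ≡ h) → Meet g f → Meet h f → ¬ Removable G e
  forced-at {t} {e} {g} {h} {f} ne exact mg mh = depends⇒nonremovable ne go
    where
    go : ∀ {S M} → PerfectMatching G S M → f ∈ M → e ∈ M
    go {M = M} pm f∈ with proj₁ (proj₂ pm) t
    ... | x , x∈ , i with exact i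
    ... | inj₁ refl = x∈
    ... | inj₂ (inj₁ refl) = ⊥-elim (meet-∉ pm mg f∈ x∈)
    ... | inj₂ (inj₂ refl) = ⊥-elim (meet-∉ pm mh f∈ x∈)

  -- If a matching contains `f` but not `e`, then `h` must cover `t` and `h'` must cover `t'`, but
  -- these two edges meet.
  forced-between : ∀ {t t' e g h g' h' f} → f ≢ e → (∀ {x} → Inc G x t → x ≡ e ⊎ x ≡ g ⊎ x ≡ h) → (∀ {x} → Inc G x t' → x ≡ e ⊎ x ≡ g' ⊎ x ≡ h') →
    Meet g f → Meet g' f → Meet h h' → ¬ Removable G e
  forced-between {t} {t'} {e} {g} {h} {g'} {h'} {f} ne exact exact' mg mg' mh = depends⇒nonremovable ne go
    where
    go : ∀ {S M} → PerfectMatching G S M → f ∈ M → e ∈ M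
    go {M = M} pm f∈ with proj₁ (proj₂ pm) t | proj₁ (proj₂ pm) t'
    ... | x , x∈ , i | x' , x'∈ , i' with exact i | exact' i'
    ... | inj₁ refl | _ = x∈
    ... | inj₂ _ | inj₁ refl = x'∈
    ... | inj₂ (inj₁ refl) | inj₂ _ = ⊥-elim (meet-∉ pm mg f∈ x∈)
    ... | inj₂ (inj₂ _) | inj₂ (inj₁ refl) = ⊥-elim (meet-∉ pm mg' f∈ x'∈)
    ... | inj₂ (inj₂ refl) | inj₂ (inj₂ refl) = ⊥-elim (meet-∉ pm mh x'∈ x∈)

Tri : (G : Graph) → Fin (n G) → Fin (n G) → Fin (n G) → Set
Tri G u v w = Adj G u v × Adj G v w × Adj G u w

-- The bound alone does not pass through a splicing: `tri-edges` makes the edges of the new triangle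
-- nonremovable, and `tri-unique` is needed to carry `tri-edges` along.
record TriBound (G : Graph) : Set where
  field
    simple     : Simple G
    tri-unique : ∀ {v u w p q} → Tri G v u w → Tri G v p q → p ≡ u ⊎ p ≡ w
    tri-edges  : ∀ {v e} → InTriangle G v → Inc G e v → ¬ Removable G e
    edges      : List (Fin (m G))
    complete   : ∀ {e} → Removable G e → e ∈ˡ edges
    bound      : 2 * length edges + 6 ≤ n G

-- G is H with the vertex u, on the triangle u a b, expanded into a triangle T;
-- opp i is the edge of T opposite to T i, and fu i the edge of H at u that becomes le (fu i) at T i.
record Expansion (G H : Graph) (u a b : Fin (n H)) : Set where
  field
    vm       : Fin (n G) → Fin (n H)
    vm-inj   : ∀ {x y} → vm x ≢ u → vm x ≡ vm y → x ≡ y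
    lift     : ∀ v → v ≢ u → ∃ λ x → vm x ≡ v
    T        : Fin 3 → Fin (n G)
    T-inj    : ∀ {i j} → T i ≡ T j → i ≡ j
    vm-T     : ∀ i → vm (T i) ≡ u
    T-cases  : ∀ {x} → vm x ≡ u → ∃ λ i → x ≡ T i
    le       : Fin (m H) → Fin (m G)
    le-inj   : ∀ {f f'} → le f ≡ le f' → f ≡ f'
    le-joins : ∀ {f x y} → Joins G (le f) x y → Joins H f (vm x) (vm y)
    opp      : Fin 3 → Fin (m G)
    opp-joins : ∀ {i j k} → i ≢ j → i ≢ k → j ≢ k → Joins G (opp i) (T j) (T k)
    e-cases  : ∀ g → (∃ λ f → g ≡ le f) ⊎ (∃ λ i → g ≡ opp i)
    fu       : Fin 3 → Fin (m H)
    fu-inc   : ∀ i → Inc H (fu i) u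
    fu-cases : ∀ {f} → Inc H f u → ∃ λ i → f ≡ fu i
    le-fu    : ∀ i → Inc G (le (fu i)) (T i)
    ja       : Joins H (fu (# 0)) u a
    jb       : Joins H (fu (# 1)) u b
    fab      : Fin (m H)
    jab      : Joins H fab a b

others : ∀ (i : Fin 3) → ∃₂ λ j k → i ≢ j × i ≢ k × j ≢ k
others zero = # 1 , # 2 , (λ ()) , (λ ()) , λ ()
others (suc zero) = # 0 , # 2 , (λ ()) , (λ ()) , λ ()
others (suc (suc zero)) = # 0 , # 1 , (λ ()) , (λ ()) , λ ()

opaque
  third₃ : ∀ (i j : Fin 3) → i ≢ j → ∃ λ k → i ≢ k × j ≢ k
  third₃ = decided (all? λ i → all? λ j → ¬? (i ≟ j) →-dec any? λ k → ¬? (i ≟ k) ×-dec ¬? (j ≟ k))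

  fin3 : ∀ (i j k l : Fin 3) → i ≢ j → i ≢ k → j ≢ k → i ≢ l → l ≡ j ⊎ l ≡ k
  fin3 = decided (all? λ i → all? λ j → all? λ k → all? λ l → ¬? (i ≟ j) →-dec (¬? (i ≟ k) →-dec (¬? (j ≟ k) →-dec (¬? (i ≟ l) →-dec ((l ≟ j) ⊎-dec (l ≟ k))))))

module Expanded {G H : Graph} {u a b : Fin (n H)} (X : Expansion G H u a b) where
  open Expansion X

  le-inc : ∀ {f x} → Inc G (le f) x → Inc H f (vm x)
  le-inc {f} i with inc-joins {G} i
  ... | y , j = joins-inc {H} (le-joins j)

  opp-inc : ∀ {i j} → i ≢ j → Inc G (opp i) (T j)
  opp-inc {i} {j} ne with third₃ i j ne
  ... | k , p , q = joins-inc {G} (opp-joins ne p q)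

  opp-vm : ∀ {i x} → Inc G (opp i) x → ∃ λ j → i ≢ j × x ≡ T j
  opp-vm {i} h with others i
  ... | j , k , p , q , r with inc-cases {G} (opp-joins p q r) h
  ... | inj₁ e = j , p , e
  ... | inj₂ e = k , q , e

  opp-inj : ∀ {i j} → opp i ≡ opp j → i ≡ j
  opp-inj {i} {j} e with i ≟ j
  ... | yes q = q
  ... | no ne with opp-vm {j} (subst (λ g → Inc G g (T j)) e (opp-inc ne))
  ... | k , p , q = ⊥-elim (p (T-inj q))

  le≢opp : ∀ {f i} → le f ≢ opp i
  le≢opp {f} {i} e with others i
  ... | j , k , p , q , r = joins-≢ {H} (le-joins (subst (λ g → Joins G g (T j) (T k)) (sym e) (opp-joins p q r))) (trans (vm-T j) (sym (vm-T k)))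

  le-at : ∀ {f i} → Inc G (le f) (T i) → f ≡ fu i
  le-at {f} {i} h with fu-cases (subst (Inc H f) (vm-T i) (le-inc h))
  ... | j , refl with i ≟ j
  ... | yes refl = refl
  ... | no ne with inc-joins {G} h
  ... | y , jy with inc-cases {G} jy (le-fu j)
  ... | inj₁ e = ⊥-elim (ne (sym (T-inj e)))
  ... | inj₂ e = ⊥-elim (joins-≢ {H} (le-joins jy) (trans (vm-T i) (sym (trans (cong vm (sym e)) (vm-T j)))))

  fu-inj : ∀ {i j} → fu i ≡ fu j → i ≡ j
  fu-inj {i} {j} e with inc-joins {G} (le-fu i)
  ... | y , jy with inc-cases {G} jy (subst (λ f → Inc G (le f) (T j)) (sym e) (le-fu j))
  ... | inj₁ q = sym (T-inj q)
  ... | inj₂ q = ⊥-elim (joins-≢ {H} (le-joins jy) (trans (vm-T i) (sym (trans (cong vm (sym q)) (vm-T j)))))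

  exact-T : ∀ {i j k} → i ≢ j → i ≢ k → j ≢ k → ∀ {g} → Inc G g (T i) → g ≡ le (fu i) ⊎ g ≡ opp j ⊎ g ≡ opp k
  exact-T {i} {j} {k} p q r {g} h with e-cases g
  ... | inj₁ (f , refl) = inj₁ (cong le (le-at h))
  ... | inj₂ (l , refl) with opp-vm h
  ... | l' , ne , e with fin3 i j k l p q r (λ { refl → ne (T-inj e) })
  ... | inj₁ refl = inj₂ (inj₁ refl)
  ... | inj₂ refl = inj₂ (inj₂ refl)

  -- A matching through `opp i` occupies the other two corners, so `T i` is left with its spoke.
  spoke-nonremovable : ∀ i → ¬ Removable G (le (fu i))
  spoke-nonremovable i with others i
  ... | j , k , p , q , r = forced-at {G} {T i} {f = opp i} (λ e → le≢opp (sym e)) (exact-T p q r) ((λ e → p (sym (opp-inj e))) , T k , opp-inc r , opp-inc q) ((λ e → q (sym (opp-inj e))) , T j , opp-inc (r ∘ sym) , opp-inc p)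

  inc-lift : ∀ {f x} → vm x ≢ u → Inc H f (vm x) → Inc G (le f) x
  inc-lift {f} {x} ne i with inc-cases {H} (le-joins (joins-ends {G} (le f))) i
  ... | inj₁ e = inj₁ (sym (vm-inj ne e))
  ... | inj₂ e = inj₂ (sym (vm-inj ne e))

  a≢u : a ≢ u
  a≢u e = joins-≢ {H} ja (sym e)

  b≢u : b ≢ u
  b≢u e = joins-≢ {H} jb (sym e)

  fab-not-u : ¬ Inc H fab u
  fab-not-u i with inc-cases {H} jab i
  ... | inj₁ e = a≢u (sym e)
  ... | inj₂ e = b≢u (sym e)

  fab≢fu : ∀ i → fab ≢ fu i
  fab≢fu i e = fab-not-u (subst (λ f → Inc H f u) (sym e) (fu-inc i))

  -- `le fab` occupies both far ends of the spokes at `T 0` and `T 1`; the other edges of the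
  -- triangle at these corners meet in `T 2`.
  base-nonremovable : ¬ Removable G (opp (# 2))
  base-nonremovable = forced-between {G} {T (# 0)} {T (# 1)} {f = le fab} le≢opp
      (λ h → case exact-T {# 0} {# 1} {# 2} (λ ()) (λ ()) (λ ()) h of λ { (inj₁ q) → inj₂ (inj₁ q) ; (inj₂ (inj₁ q)) → inj₂ (inj₂ q) ; (inj₂ (inj₂ q)) → inj₁ q })
      (λ h → case exact-T {# 1} {# 0} {# 2} (λ ()) (λ ()) (λ ()) h of λ { (inj₁ q) → inj₂ (inj₁ q) ; (inj₂ (inj₁ q)) → inj₂ (inj₂ q) ; (inj₂ (inj₂ q)) → inj₁ q })
      (meets (# 0) (joins-inc {H} jab) (joins-inc {H} (joins-sym {H} ja)) a≢u) (meets (# 1) (joins-inc {H} (joins-sym {H} jab)) (joins-inc {H} (joins-sym {H} jb)) b≢u)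
      ((λ e → case opp-inj e of λ ()) , T (# 2) , opp-inc (λ ()) , opp-inc (λ ()))
    where
    meets : ∀ i {v} → Inc H fab v → Inc H (fu i) v → v ≢ u → Meet {G} (le (fu i)) (le fab)
    meets i {v} h h' ne with lift v ne
    ... | x , refl = (λ e → fab≢fu i (sym (le-inj e))) , x , inc-lift ne h' , inc-lift ne h

  -- A matching using all three spokes is rerouted through fab.
  record Projection (M : Subset (m G)) : Set where
    field
      M'    : Subset (m H)
      pm'   : PerfectMatching H (All H) M'
      keeps : ∀ {f} → ¬ Inc H f u → le f ∈ M → f ∈ M'
      from-M : ∀ {f} → f ∈ M' → f ≢ fab → le f ∈ M
      at-u  : ∀ {i} → opp i ∈ M → fu i ∈ M'
      -- Index 2 is excluded because the rerouted matching keeps `fu 2` although `M` uses no `opp`.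
      from-u : ∀ {i} → i ≢ # 2 → fu i ∈ M' → opp i ∈ M

  module Project {S M} (pm : PerfectMatching G S M) where
    open Partner (partner {G} pm)

    same : ∀ {v g g'} → g ∈ M → g' ∈ M → Inc G g v → Inc G g' v → g ≡ g'
    same {v} {g} {g'} p q i i' = proj₂ (proj₂ pm) v g g' p q i i'

    opp-unique : ∀ {i j} → opp i ∈ M → opp j ∈ M → i ≡ j
    opp-unique {i} {j} p q with i ≟ j
    ... | yes e = e
    ... | no ne with third₃ i j ne
    ... | k , r , r' = opp-inj (same p q (opp-inc r) (opp-inc r'))

    spoke-clash : ∀ {i j} → i ≢ j → opp i ∈ M → ¬ le (fu j) ∈ M
    spoke-clash ne p q = le≢opp (same q p (le-fu _) (opp-inc ne))

    cover-T : ∀ i → le (fu i) ∈ M ⊎ (∃ λ j → i ≢ j × opp j ∈ M)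
    cover-T i with others i
    ... | j , k , p , q , r with exact-T p q r (joins-inc {G} (pe-joins (T i)))
    ... | inj₁ e = inj₁ (subst (_∈ M) e (pe∈ (T i)))
    ... | inj₂ (inj₁ e) = inj₂ (j , p , subst (_∈ M) e (pe∈ (T i)))
    ... | inj₂ (inj₂ e) = inj₂ (k , q , subst (_∈ M) e (pe∈ (T i)))

    spoke : ∀ {i} → opp i ∈ M → le (fu i) ∈ M
    spoke {i} p with cover-T i
    ... | inj₁ q = q
    ... | inj₂ (j , ne , q) = ⊥-elim (ne (opp-unique p q))

    cover-old : ∀ v → v ≢ u → ∃ λ f → le f ∈ M × Inc H f v
    cover-old v ne with lift v ne
    ... | x , refl with e-cases (pe x)
    ... | inj₁ (f , e) = f , subst (_∈ M) e (pe∈ x) , le-inc (subst (λ g → Inc G g x) e (joins-inc {G} (pe-joins x)))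
    ... | inj₂ (i , e) with opp-vm {i} (subst (λ g → Inc G g x) e (joins-inc {G} (pe-joins x)))
    ... | j , _ , refl = ⊥-elim (ne (vm-T j))

    unique-old : ∀ {v f f'} → v ≢ u → le f ∈ M → le f' ∈ M → Inc H f v → Inc H f' v → f ≡ f'
    unique-old {v} ne p q i i' with lift v ne
    ... | x , refl = le-inj (same p q (inc-lift ne i) (inc-lift ne i'))

    single : ∀ {i} → opp i ∈ M → Projection M
    single {i} oi = record
      { M' = tabulate K ; pm' = (λ _ _ → tt) , cover , (λ v f f' p q → unique v f f' (out p) (out q))
      ; keeps = λ _ p → ∈-tabulate {X = K} (⌊⌋-intro (le _ ∈? M) p) ; from-M = λ p _ → out p
      ; at-u = λ p → ∈-tabulate {X = K} (⌊⌋-intro (le _ ∈? M) (spoke p))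
      ; from-u = λ {j} _ p → subst (λ k → opp k ∈ M) (only (out p)) oi }
      where
      K : FSet (m H)
      K f = ⌊ le f ∈? M ⌋
      out : ∀ {f} → f ∈ tabulate K → le f ∈ M
      out {f} p = ⌊⌋-elim (le f ∈? M) (tabulate-∈ {X = K} p)
      only : ∀ {j} → le (fu j) ∈ M → i ≡ j
      only {j} p with i ≟ j
      ... | yes e = e
      ... | no ne = ⊥-elim (spoke-clash ne oi p)
      cover : ∀ v → ∃ λ f → f ∈ tabulate K × Inc H f v
      cover v with v ≟ u
      ... | yes refl = fu i , ∈-tabulate {X = K} (⌊⌋-intro (le (fu i) ∈? M) (spoke oi)) , fu-inc i
      ... | no ne with cover-old v ne
      ... | f , p , q = f , ∈-tabulate {X = K} (⌊⌋-intro (le f ∈? M) p) , q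
      unique : ∀ v f f' → le f ∈ M → le f' ∈ M → Inc H f v → Inc H f' v → f ≡ f'
      unique v f f' p q h h' with v ≟ u
      ... | no ne = unique-old ne p q h h'
      ... | yes refl with fu-cases h | fu-cases h'
      ... | j , refl | k , refl = cong fu (trans (sym (only p)) (only q))

    triple : (∀ i → ¬ opp i ∈ M) → Projection M
    triple none = record
      { M' = tabulate K ; pm' = (λ _ _ → tt) , cover , (λ v f f' p q → unique v f f' (out p) (out q))
      ; keeps = λ {f} h p → inn (inj₁ (p , (λ e → h (subst (λ f → Inc H f u) (sym e) (fu-inc (# 0)))) , λ e → h (subst (λ f → Inc H f u) (sym e) (fu-inc (# 1)))))
      ; from-M = λ p ne → case out p of λ { (inj₁ (q , _)) → q ; (inj₂ q) → ⊥-elim (ne q) }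
      ; at-u = λ {i} p → ⊥-elim (none i p)
      ; from-u = λ {i} ne p → ⊥-elim (not-u i ne (out p)) }
      where
      spokes : ∀ i → le (fu i) ∈ M
      spokes i with cover-T i
      ... | inj₁ p = p
      ... | inj₂ (j , _ , p) = ⊥-elim (none j p)
      Member : Fin (m H) → Set
      Member f = (le f ∈ M × f ≢ fu (# 0) × f ≢ fu (# 1)) ⊎ f ≡ fab
      member? : ∀ f → Dec (Member f)
      member? f = ((le f ∈? M) ×-dec (¬? (f ≟ fu (# 0)) ×-dec ¬? (f ≟ fu (# 1)))) ⊎-dec (f ≟ fab)
      K : FSet (m H)
      K f = ⌊ member? f ⌋
      out : ∀ {f} → f ∈ tabulate K → Member f
      out {f} p = ⌊⌋-elim (member? f) (tabulate-∈ {X = K} p)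
      inn : ∀ {f} → Member f → f ∈ tabulate K
      inn {f} p = ∈-tabulate {X = K} (⌊⌋-intro (member? f) p)
      not-u : ∀ i → i ≢ # 2 → ¬ Member (fu i)
      not-u zero _ (inj₁ (_ , p , _)) = p refl
      not-u (suc zero) _ (inj₁ (_ , _ , p)) = p refl
      not-u (suc (suc zero)) ne _ = ne refl
      not-u i _ (inj₂ p) = fab≢fu i (sym p)
      member-u : ∀ {f} → Member f → Inc H f u → f ≡ fu (# 2)
      member-u (inj₂ refl) h = ⊥-elim (fab-not-u h)
      member-u (inj₁ p) h with fu-cases h
      ... | zero , refl = ⊥-elim (proj₁ (proj₂ p) refl)
      ... | suc zero , refl = ⊥-elim (proj₂ (proj₂ p) refl)
      ... | suc (suc zero) , refl = refl
      far : ∀ {v f z} → v ≢ u → Joins H f u z → Inc H f v → v ≡ z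
      far ne j i = case inc-cases {H} j i of λ { (inj₁ e) → ⊥-elim (ne e) ; (inj₂ e) → e }
      cover : ∀ v → ∃ λ f → f ∈ tabulate K × Inc H f v
      cover v with v ≟ u
      ... | yes refl = fu (# 2) , inn (inj₁ (spokes (# 2) , (λ e → case fu-inj e of λ ()) , λ e → case fu-inj e of λ ())) , fu-inc (# 2)
      ... | no ne with cover-old v ne
      ... | f , p , h with f ≟ fu (# 0) | f ≟ fu (# 1)
      ... | no q | no q' = f , inn (inj₁ (p , q , q')) , h
      ... | yes refl | _ = fab , inn (inj₂ refl) , subst (Inc H fab) (sym (far ne ja h)) (joins-inc {H} jab)
      ... | no _ | yes refl = fab , inn (inj₂ refl) , subst (Inc H fab) (sym (far ne jb h)) (joins-inc {H} (joins-sym {H} jab))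
      clash : ∀ {v f} → v ≢ u → le f ∈ M → f ≢ fu (# 0) → f ≢ fu (# 1) → Inc H f v → ¬ Inc H fab v
      clash ne p q q' h h' with inc-cases {H} jab h'
      ... | inj₁ refl = q (unique-old ne p (spokes (# 0)) h (joins-inc {H} (joins-sym {H} ja)))
      ... | inj₂ refl = q' (unique-old ne p (spokes (# 1)) h (joins-inc {H} (joins-sym {H} jb)))
      unique : ∀ v f f' → Member f → Member f' → Inc H f v → Inc H f' v → f ≡ f'
      unique v f f' p q h h' with v ≟ u
      ... | yes refl = trans (member-u p h) (sym (member-u q h'))
      ... | no ne with p | q
      ... | inj₁ (x , _) | inj₁ (y , _) = unique-old ne x y h h'
      ... | inj₂ refl | inj₂ refl = refl
      ... | inj₁ (x , y , z) | inj₂ refl = ⊥-elim (clash ne x y z h h')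
      ... | inj₂ refl | inj₁ (x , y , z) = ⊥-elim (clash ne x y z h' h)

    projection : Projection M
    projection with opp (# 0) ∈? M | opp (# 1) ∈? M | opp (# 2) ∈? M
    ... | yes p | _ | _ = single p
    ... | no _ | yes p | _ = single p
    ... | no _ | no _ | yes p = single p
    ... | no p | no q | no r = triple λ { zero → p ; (suc zero) → q ; (suc (suc zero)) → r }

  two≤ : 2 ≤ n H
  two≤ = ≤-trans (card-pair {a = a} {u} {λ _ → true} a≢u refl refl) (≤-reflexive card-full)

  -- To cover an edge at `u`, a matching through `opp i` is projected, not one through the spoke:
  -- the latter may use all three spokes and be rerouted.
  transfer : ∀ {e e'} → Removable G e → (∀ {M} → (P : Projection M) → ¬ e ∈ M → ¬ e' ∈ Projection.M' P)
    → (∀ {f} → f ≢ e' → ¬ Inc H f u → le f ≢ e) → (∀ {i} → fu i ≢ e' → opp i ≢ e)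
    → (∀ {f v w} → le f ≢ e → Joins H f v w → Reach H (Minus1 H e') v w) → Removable H e'
  transfer {e} {e'} (_ , con , cov) avoid old at-u' edge = two≤ , connected' , λ f ne → go f ne (inc? {H} f u)
    where
    open Projection
    walk : ∀ {x y} → Reach G (Minus1 G e) x y → Reach H (Minus1 H e') (vm x) (vm y)
    walk here = here
    walk {x} {y} (step g s j r) with e-cases g
    ... | inj₁ (f , refl) = reach-trans {H} (edge s (le-joins j)) (walk r)
    ... | inj₂ (i , refl) with opp-vm {i} (joins-inc {G} j) | opp-vm {i} (joins-inc {G} (joins-sym {G} j))
    ... | k , _ , refl | k' , _ , refl = subst (λ z → Reach H (Minus1 H e') z (vm y)) (trans (vm-T k') (sym (vm-T k))) (walk r)
    vm-surj : ∀ v → ∃ λ x → vm x ≡ v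
    vm-surj v with v ≟ u
    ... | yes refl = T (# 0) , vm-T (# 0)
    ... | no ne = lift v ne
    connected' : Connected H (Minus1 H e')
    connected' v w with vm-surj v | vm-surj w
    ... | x , refl | y , refl = walk (con x y)
    restrict : ∀ {M f} → PerfectMatching G (Minus1 G e) M → (P : Projection M) → f ∈ M' P → ∃ λ N → PerfectMatching H (Minus1 H e') N × f ∈ N
    restrict pm P f∈ = M' P , ((λ { g g∈ refl → avoid P (λ e∈ → proj₁ pm e e∈ refl) g∈ }) , proj₂ (pm' P)) , f∈
    go : ∀ f → f ≢ e' → Dec (Inc H f u) → ∃ λ N → PerfectMatching H (Minus1 H e') N × f ∈ N
    go f ne (no h) with cov (le f) (old ne h)
    ... | M , pm , p = restrict pm (Project.projection pm) (keeps (Project.projection pm) h p)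
    go f ne (yes h) with fu-cases h
    ... | i , refl with cov (opp i) (at-u' ne)
    ... | M , pm , p = restrict pm (Project.projection pm) (at-u (Project.projection pm) p)

  -- `fab` is excluded since a projection can introduce it.
  transfer-old : ∀ {f} → ¬ Inc H f u → f ≢ fab → Removable G (le f) → Removable H f
  transfer-old {f} h ne r = transfer r (λ P e∉ f∈ → e∉ (Projection.from-M P f∈ ne)) (λ q _ e → q (le-inj e)) (λ _ e → le≢opp (sym e)) λ q j → step _ (λ e → q (cong le e)) j here

  -- For `i ≢ # 2` a matching contains `opp i` exactly when its projection contains `fu i`. For
  -- connectivity, the triangle `u a b` leads around `fu i`.
  transfer-side : ∀ {i} → i ≢ # 2 → Removable G (opp i) → Removable H (fu i)
  transfer-side {i} i≢2 r = transfer r (λ P e∉ f∈ → e∉ (Projection.from-u P i≢2 f∈)) (λ _ _ → le≢opp) (λ q e → q (cong fu (opp-inj e))) λ {f} _ j → route f j (f ≟ fu i)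
    where
    around : ∀ k → k ≢ # 2 → ∀ {v w} → Joins H (fu k) v w → Reach H (Minus1 H (fu k)) v w
    around zero _ j with joins-cases {H} j ja
    ... | inj₁ (refl , refl) = step (fu (# 1)) (λ e → case fu-inj e of λ ()) jb (step fab (fab≢fu _) (joins-sym {H} jab) here)
    ... | inj₂ (refl , refl) = step fab (fab≢fu _) jab (step (fu (# 1)) (λ e → case fu-inj e of λ ()) (joins-sym {H} jb) here)
    around (suc zero) _ j with joins-cases {H} j jb
    ... | inj₁ (refl , refl) = step (fu (# 0)) (λ e → case fu-inj e of λ ()) ja (step fab (fab≢fu _) jab here)
    ... | inj₂ (refl , refl) = step fab (fab≢fu _) (joins-sym {H} jab) (step (fu (# 0)) (λ e → case fu-inj e of λ ()) (joins-sym {H} ja) here)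
    around (suc (suc zero)) ne j = ⊥-elim (ne refl)
    route : ∀ f {v w} → Joins H f v w → Dec (f ≡ fu i) → Reach H (Minus1 H (fu i)) v w
    route f j (yes refl) = around i i≢2 j
    route f j (no ne) = step f ne j here

  module Bound (I : TriBound H) where
    open TriBound I

    u-tri : InTriangle H u
    u-tri = a , b , (fu (# 0) , ja) , (fab , jab) , (fu (# 1) , jb)

    opp-nonremovable : ∀ i → ¬ Removable G (opp i)
    opp-nonremovable zero r = tri-edges u-tri (fu-inc (# 0)) (transfer-side (λ ()) r)
    opp-nonremovable (suc zero) r = tri-edges u-tri (fu-inc (# 1)) (transfer-side (λ ()) r)
    opp-nonremovable (suc (suc zero)) = base-nonremovable

    adj-vm : ∀ {x y} → Adj G x y → (vm x ≡ u × vm y ≡ u) ⊎ (∃ λ f → Joins G (le f) x y)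
    adj-vm (g , j) with e-cases g
    ... | inj₁ (f , refl) = inj₂ (f , j)
    ... | inj₂ (i , refl) with opp-vm {i} (joins-inc {G} j) | opp-vm {i} (joins-inc {G} (joins-sym {G} j))
    ... | k , _ , refl | k' , _ , refl = inj₁ (vm-T k , vm-T k')

    adj-old : ∀ {x y} → vm x ≢ u → Adj G x y → ∃ λ f → Joins G (le f) x y
    adj-old ne h with adj-vm h
    ... | inj₁ (q , _) = ⊥-elim (ne q)
    ... | inj₂ q = q

    adj-≢ : ∀ {x y} → Adj G x y → x ≢ y
    adj-≢ (g , j) = joins-≢ {G} j

    adj-flip : ∀ {x y} → Adj G x y → Adj G y x
    adj-flip (g , j) = g , joins-sym {G} j

    not-parallel : ∀ {f i x y} → Joins G (le f) x y → Joins G (opp i) x y → ⊥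
    not-parallel {f} {i} j j' with opp-vm {i} (joins-inc {G} j') | opp-vm {i} (joins-inc {G} (joins-sym {G} j'))
    ... | k , _ , refl | k' , _ , refl = joins-≢ {H} (le-joins j) (trans (vm-T k) (sym (vm-T k')))

    simple' : Simple G
    simple' {g} {g'} {x} {y} j j' with e-cases g | e-cases g'
    ... | inj₁ (f , refl) | inj₁ (f' , refl) = cong le (simple (le-joins j) (le-joins j'))
    ... | inj₁ (f , refl) | inj₂ (i , refl) = ⊥-elim (not-parallel j j')
    ... | inj₂ (i , refl) | inj₁ (f , refl) = ⊥-elim (not-parallel j' j)
    ... | inj₂ (i , refl) | inj₂ (i' , refl) with i ≟ i'
    ... | yes refl = refl
    ... | no ne = ⊥-elim (apart (inc-cases {G} j (opp-inc ne)))
      where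
      apart : T i' ≡ x ⊎ T i' ≡ y → ⊥
      apart h with opp-vm {i'} (case h of λ { (inj₁ refl) → joins-inc {G} j' ; (inj₂ refl) → joins-inc {G} (joins-sym {G} j') })
      ... | k , p , q = p (T-inj q)

    at-T : ∀ {f f' y} → vm y ≡ u → Inc G (le f) y → Inc G (le f') y → f ≡ f'
    at-T h i i' with T-cases h
    ... | k , refl = trans (le-at i) (sym (le-at i'))

    -- If `y` were a new corner, there would be two cases. With `z` also in the new triangle, `H`
    -- would have parallel edges; with `z` outside it, `y` would have two spokes.
    avoid-T : ∀ {x y z} → vm x ≢ u → Adj G x y → Adj G y z → Adj G x z → vm y ≢ u
    avoid-T {x} {y} {z} ne xy yz xz h with adj-old ne xy | adj-old ne xz | adj-vm yz
    ... | f , j | f' , j' | inj₁ (_ , h') = adj-≢ yz (joins-unique {G} j (subst (λ g → Joins G (le g) x z) (sym f≡) j'))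
      where
      f≡ : f ≡ f'
      f≡ = simple (subst (Joins H f (vm x)) h (le-joins j)) (subst (Joins H f' (vm x)) h' (le-joins j'))
    ... | f , j | f' , j' | inj₂ (f'' , j'') = adj-≢ xz (joins-unique {G} (joins-sym {G} j) (subst (λ g → Joins G (le g) y z) (sym (at-T h (joins-inc {G} (joins-sym {G} j)) (joins-inc {G} j''))) j''))

    adj-down : ∀ {x y} → vm x ≢ u → Adj G x y → Adj H (vm x) (vm y)
    adj-down ne h with adj-old ne h
    ... | f , j = f , le-joins j

    tri-down : ∀ {x y z} → vm x ≢ u → Tri G x y z → vm y ≢ u × vm z ≢ u × Tri H (vm x) (vm y) (vm z)
    tri-down ne (xy , yz , xz) = hy , avoid-T ne xz (adj-flip yz) xy , adj-down ne xy , adj-down hy yz , adj-down ne xz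
      where hy = avoid-T ne xy yz xz

    in-T : ∀ {x y z} → vm x ≡ u → Tri G x y z → vm y ≡ u
    in-T {x} {y} h (xy , yz , xz) with vm y ≟ u
    ... | yes q = q
    ... | no ne = ⊥-elim (proj₁ (tri-down ne (adj-flip xy , xz , yz)) h)

    tri-unique' : ∀ {v y z p q} → Tri G v y z → Tri G v p q → p ≡ y ⊎ p ≡ z
    tri-unique' {v} {y} {z} {p} {q} t@(vy , yz , vz) t'@(vp , pq , vq) with vm v ≟ u
    ... | no ne with tri-down ne t | tri-down ne t'
    ... | _ , _ , h | p∉ , _ , h' with tri-unique h h'
    ... | inj₁ e = inj₁ (vm-inj p∉ e)
    ... | inj₂ e = inj₂ (vm-inj p∉ e)
    tri-unique' {v} {y} {z} {p} {q} t@(vy , yz , vz) t'@(vp , pq , vq) | yes h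
      with T-cases h | T-cases (in-T h t) | T-cases (in-T h (vz , adj-flip yz , vy)) | T-cases (in-T h t')
    ... | i , refl | j , refl | k , refl | l , refl with fin3 i j k l (λ { refl → adj-≢ vy refl }) (λ { refl → adj-≢ vz refl }) (λ { refl → adj-≢ yz refl }) (λ { refl → adj-≢ vp refl })
    ... | inj₁ refl = inj₁ refl
    ... | inj₂ refl = inj₂ refl

    joins-fab : ∀ {w} → Inc H fab w → (∃ λ w' → Tri H w u w') × w ≢ u
    joins-fab i with inc-cases {H} jab i
    ... | inj₁ refl = (b , (fu (# 0) , joins-sym {H} ja) , (fu (# 1) , jb) , (fab , jab)) , a≢u
    ... | inj₂ refl = (a , (fu (# 1) , joins-sym {H} jb) , (fu (# 0) , ja) , (fab , joins-sym {H} jab)) , b≢u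

    -- Edges of and at the new triangle are settled above, other old edges in `H`, except `fab`. A
    -- triangle of `G` at `a` or `b` projects to one avoiding `u`, which would be a second triangle
    -- there besides `u a b`.
    tri-edges' : ∀ {x g} → InTriangle G x → Inc G g x → ¬ Removable G g
    tri-edges' {x} {g} (y , z , t) i with e-cases g
    ... | inj₂ (k , refl) = opp-nonremovable k
    ... | inj₁ (f , refl) with inc? {H} f u
    ... | yes h with fu-cases h
    ... | k , refl = spoke-nonremovable k
    tri-edges' {x} {g} (y , z , t@(xy , yz , xz)) i | inj₁ (f , refl) | no h = λ r → case (f ≟ fab) of λ where
        (no ne) → tri-edges (vm y , vm z , proj₂ (proj₂ down)) (le-inc i) (transfer-old h ne r)
        (yes refl) → not-fab (proj₁ (joins-fab (le-inc i)))
      where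
      x∉ : vm x ≢ u
      x∉ q with T-cases q
      ... | k , refl = h (subst (λ f → Inc H f u) (sym (le-at i)) (fu-inc k))
      down = tri-down x∉ t
      not-fab : (∃ λ w' → Tri H (vm x) u w') → ⊥
      not-fab (w' , t') with tri-unique t' (proj₂ (proj₂ down)) | tri-unique t' (proj₂ (proj₂ (tri-down x∉ (xz , adj-flip yz , xy))))
      ... | inj₁ e | _ = proj₁ down e
      ... | inj₂ _ | inj₁ e = proj₁ (proj₂ down) e
      ... | inj₂ e | inj₂ e' = adj-≢ yz (vm-inj (proj₁ down) (trans e (sym e')))

    -- Only `fab` can become removable: one more list entry for two more vertices.
    complete' : ∀ {g} → Removable G g → g ∈ˡ (le fab ∷ map le edges)
    complete' {g} r with e-cases g
    ... | inj₂ (k , refl) = ⊥-elim (opp-nonremovable k r)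
    ... | inj₁ (f , refl) with inc? {H} f u
    ... | yes h with fu-cases h
    ... | k , refl = ⊥-elim (spoke-nonremovable k r)
    complete' {g} r | inj₁ (f , refl) | no h with f ≟ fab
    ... | yes refl = here refl
    ... | no ne = there (∈-map⁺ le (complete (transfer-old h ne r)))

    size : 2 + n H ≤ n G
    size = injective⇒≤ {f = emb} (λ {x} {y} → emb-inj x y)
      where
      embv : ∀ v → Dec (v ≡ u) → Fin (n G)
      -- The third corner stands for `u`, so that the first two are the additional vertices.
      embv v (yes _) = T (# 2)
      embv v (no ne) = proj₁ (lift v ne)
      embv-vm : ∀ v d → vm (embv v d) ≡ v
      embv-vm v (yes refl) = vm-T (# 2)
      embv-vm v (no ne) = proj₂ (lift v ne)
      emb : Fin (2 + n H) → Fin (n G)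
      emb zero = T (# 0)
      emb (suc zero) = T (# 1)
      emb (suc (suc v)) = embv v (v ≟ u)
      clash : ∀ k v d → k ≢ # 2 → T k ≡ embv v d → ⊥
      clash k v (yes refl) ne e = ne (T-inj e)
      clash k v (no ne') ne e = ne' (trans (sym (proj₂ (lift v ne'))) (trans (cong vm (sym e)) (vm-T k)))
      emb-inj : ∀ x y → emb x ≡ emb y → x ≡ y
      emb-inj zero zero e = refl
      emb-inj zero (suc zero) e = case T-inj e of λ ()
      emb-inj (suc zero) zero e = case T-inj e of λ ()
      emb-inj (suc zero) (suc zero) e = refl
      emb-inj zero (suc (suc v)) e = ⊥-elim (clash (# 0) v (v ≟ u) (λ ()) e)
      emb-inj (suc zero) (suc (suc v)) e = ⊥-elim (clash (# 1) v (v ≟ u) (λ ()) e)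
      emb-inj (suc (suc v)) zero e = ⊥-elim (clash (# 0) v (v ≟ u) (λ ()) (sym e))
      emb-inj (suc (suc v)) (suc zero) e = ⊥-elim (clash (# 1) v (v ≟ u) (λ ()) (sym e))
      emb-inj (suc (suc v)) (suc (suc w)) e = cong (λ v → suc (suc v)) (trans (sym (embv-vm v (v ≟ u))) (trans (cong vm e) (embv-vm w (w ≟ u))))

    expanded-bound : TriBound G
    expanded-bound = record { simple = simple' ; tri-unique = tri-unique' ; tri-edges = tri-edges' ; edges = le fab ∷ map le edges ; complete = complete'
      ; bound = ≤-trans (≤-trans (≤-reflexive (trans (cong (λ k → 2 * suc k + 6) (length-map le edges)) (arith (length edges)))) (s≤s (s≤s bound))) size }
      where
      arith : ∀ k → 2 * suc k + 6 ≡ 2 + (2 * k + 6)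
      arith k = cong suc (trans (cong (_+ 6) (+-suc k (k + 0))) refl)

-- From a splicing with `K4` to an expansion

opaque
  -- Two edges at `w` are prescribed by the triangle of `H`. Which edge and corner remain, and which
  -- edges form the opposite triangle, is found by checking all cases.
  K4-rest : ∀ (w : Fin 4) (ka : Fin 6) (ta : Fin 4) → Joins K4 ka w ta → ∀ (kb : Fin 6) (tb : Fin 4) → Joins K4 kb w tb → ka ≢ kb →
    ∃ λ tc → (∃ λ kc → Joins K4 kc w tc × (∀ e → Inc K4 e w → e ≡ ka ⊎ e ≡ kb ⊎ e ≡ kc))
           × (∀ v → v ≢ w → v ≡ ta ⊎ v ≡ tb ⊎ v ≡ tc)
           × (∃ λ kbc → Joins K4 kbc tb tc × ∃ λ kac → Joins K4 kac ta tc × ∃ λ kab → Joins K4 kab ta tb × (∀ e → ¬ Inc K4 e w → e ≡ kbc ⊎ e ≡ kac ⊎ e ≡ kab))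
  K4-rest = decided (all? λ w → all? λ ka → all? λ ta → joins? {K4} ka w ta →-dec all? λ kb → all? λ tb → joins? {K4} kb w tb →-dec (¬? (ka ≟ kb) →-dec
    any? λ tc → (any? λ kc → joins? {K4} kc w tc ×-dec all? λ e → inc? {K4} e w →-dec ((e ≟ ka) ⊎-dec ((e ≟ kb) ⊎-dec (e ≟ kc))))
      ×-dec ((all? λ v → ¬? (v ≟ w) →-dec ((v ≟ ta) ⊎-dec ((v ≟ tb) ⊎-dec (v ≟ tc))))
      ×-dec any? λ kbc → joins? {K4} kbc tb tc ×-dec any? λ kac → joins? {K4} kac ta tc ×-dec any? λ kab → joins? {K4} kab ta tb ×-dec
              all? λ e → ¬? (inc? {K4} e w) →-dec ((e ≟ kbc) ⊎-dec ((e ≟ kac) ⊎-dec (e ≟ kab))))))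

module FromSplicing {G H : Graph} {u a b : Fin (n H)} {w : Fin 4} (S : Splicing G H u K4 w)
  {fa fb fab : Fin (m H)} (ja : Joins H fa u a) (jb : Joins H fb u b) (jab : Joins H fab a b) where
  open Splicing S

  same-flip : ∀ {A : Set} {x y x' y' : A} → SamePair x y x' y' → SamePair x' y' x y
  same-flip (inj₁ (refl , refl)) = inj₁ (refl , refl)
  same-flip (inj₂ (refl , refl)) = inj₂ (refl , refl)

  point : Fin (n H) ⊎ Fin 4 → Fin (n H)
  point (inj₁ v) = v
  point (inj₂ _) = u

  vm : Fin (n G) → Fin (n H)
  vm x = point (vmap x)

  vm-inj : ∀ {x y} → vm x ≢ u → vm x ≡ vm y → x ≡ y
  vm-inj {x} {y} ne e with vmap x in p | vmap y in q
  ... | inj₁ v | inj₁ v' = vmap-inj x y (trans p (trans (cong inj₁ e) (sym q)))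
  ... | inj₁ v | inj₂ _ = ⊥-elim (ne e)
  ... | inj₂ _ | _ = ⊥-elim (ne refl)

  lift : ∀ v → v ≢ u → ∃ λ x → vm x ≡ v
  lift v ne with vmap-on₁ v ne
  ... | x , q = x , cong point q

  data Lifted (f : Fin (m H)) : Set where
    old : ∀ g → ¬ Inc H f u → emap g ≡ inj₁ f → Lifted f
    cut : ∀ g k → emap g ≡ inj₂ (inj₂ (f , k)) → Lifted f

  edge-of : ∀ {f} → Lifted f → Fin (m G)
  edge-of (old g _ _) = g
  edge-of (cut g _ _) = g

  lifted : ∀ f → Lifted f
  lifted f with inc? {H} f u
  ... | yes i = case new-on₁ f i of λ { (g , k , e) → cut g k e }
  ... | no ni = case old₁-on f ni of λ { (g , e) → old g ni e }

  le : Fin (m H) → Fin (m G)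
  le f = edge-of (lifted f)

  le-inj : ∀ {f f'} → le f ≡ le f' → f ≡ f'
  le-inj {f} {f'} e with lifted f | lifted f'
  ... | old g _ p | old g' _ q = case trans (sym p) (trans (cong emap e) q) of λ { refl → refl }
  ... | old g _ p | cut g' _ q = case trans (sym p) (trans (cong emap e) q) of λ ()
  ... | cut g _ p | old g' _ q = case trans (sym p) (trans (cong emap e) q) of λ ()
  ... | cut g _ p | cut g' _ q = case trans (sym p) (trans (cong emap e) q) of λ { refl → refl }

  le-old : ∀ {f g} → emap g ≡ inj₁ f → g ≡ le f
  le-old {f} {g} e with lifted f
  ... | old g' _ p = emap-inj g g' (trans e (sym p))
  ... | cut g' k p = ⊥-elim (proj₁ (old₁ g f e) (case new g' f k p of λ { (x , _ , j , _) → joins-inc {H} j }))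

  le-cut : ∀ {f g k} → emap g ≡ inj₂ (inj₂ (f , k)) → g ≡ le f
  le-cut {f} {g} {k} e with lifted f
  ... | old g' ni p = ⊥-elim (ni (case new g f k e of λ { (x , _ , j , _) → joins-inc {H} j }))
  ... | cut g' k' p = new-fun₁ g g' f k k' e p

  le-ends : ∀ f → Joins H f (vm (end₁ G (le f))) (vm (end₂ G (le f)))
  le-ends f with lifted f
  ... | old g _ p = same-flip (image (proj₂ (old₁ g f p)))
    where
    image : ∀ {x y v v'} → SamePair x y (inj₁ v) (inj₁ v') → SamePair (point x) (point y) v v'
    image (inj₁ (refl , refl)) = inj₁ (refl , refl)
    image (inj₂ (refl , refl)) = inj₂ (refl , refl)
  ... | cut g k p with new g f k p
  ... | v , t , j , _ , s = image s
    where
    image : ∀ {x y} → SamePair x y (inj₁ v) (inj₂ t) → Joins H f (point x) (point y)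
    image (inj₁ (refl , refl)) = joins-sym {H} j
    image (inj₂ (refl , refl)) = j

  le-joins : ∀ {f x y} → Joins G (le f) x y → Joins H f (vm x) (vm y)
  le-joins {f} (inj₁ (p , q)) = subst₂ (Joins H f) (cong vm p) (cong vm q) (le-ends f)
  le-joins {f} (inj₂ (p , q)) = joins-sym {H} (subst₂ (Joins H f) (cong vm p) (cong vm q) (le-ends f))

  record Spoke (f : Fin (m H)) (z : Fin (n H)) : Set where
    field
      g   : Fin (m G)
      k   : Fin 6
      τ   : Fin 4
      eg  : emap g ≡ inj₂ (inj₂ (f , k))
      jτ  : Joins K4 k w τ
      ends : SamePair (vmap (end₁ G g)) (vmap (end₂ G g)) (inj₁ z) (inj₂ τ)

  spoke : ∀ {f z} → Joins H f u z → Spoke f z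
  spoke {f} {z} j with new-on₁ f (joins-inc {H} j)
  ... | g , k , eg with new g f k eg
  ... | z' , τ , j' , jτ , s = record { g = g ; k = k ; τ = τ ; eg = eg ; jτ = jτ ; ends = subst (λ z → SamePair _ _ (inj₁ z) (inj₂ τ)) (joins-unique {H} j' j) s }

  open Spoke (spoke ja) using () renaming (g to ga; k to ka; τ to ta; eg to ega; jτ to jta)
  open Spoke (spoke jb) using () renaming (g to gb; k to kb; τ to tb; eg to egb; jτ to jtb)

  emap-f : ∀ {g g' f f' k k'} → g ≡ g' → emap g ≡ inj₂ (inj₂ (f , k)) → emap g' ≡ inj₂ (inj₂ (f' , k')) → f ≡ f'
  emap-f refl p q with trans (sym p) q
  ... | refl = refl

  -- Equal edges of `K4` would come from one edge of `G`, so `fa` and `fb` would agree, and with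
  -- them `a` and `b`, which `fab` joins.
  ka≢kb : ka ≢ kb
  ka≢kb e = joins-≢ {H} jab (joins-unique {H} ja (subst (λ f → Joins H f u b) (sym (emap-f (new-fun₂ ga gb fa fb kb (subst (λ k → emap ga ≡ inj₂ (inj₂ (fa , k))) e ega) egb) ega egb)) jb))

  rest = K4-rest w ka ta jta kb tb jtb ka≢kb
  tc = proj₁ rest
  kc = proj₁ (proj₁ (proj₂ rest))
  jtc : Joins K4 kc w tc
  jtc = proj₁ (proj₂ (proj₁ (proj₂ rest)))
  k-cases = proj₂ (proj₂ (proj₁ (proj₂ rest)))
  t-cases = proj₁ (proj₂ (proj₂ rest))
  kT-rest = proj₂ (proj₂ (proj₂ rest))

  third-spoke : ∃₂ λ g f → emap g ≡ inj₂ (inj₂ (f , kc))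
  third-spoke = new-on₂ kc (joins-inc {K4} {kc} jtc)

  fu : Fin 3 → Fin (m H)
  fu zero = fa
  fu (suc zero) = fb
  fu (suc (suc zero)) = proj₁ (proj₂ third-spoke)

  κ : Fin 3 → Fin 6
  κ zero = ka
  κ (suc zero) = kb
  κ (suc (suc zero)) = kc

  gu : Fin 3 → Fin (m G)
  gu zero = ga
  gu (suc zero) = gb
  gu (suc (suc zero)) = proj₁ third-spoke

  gu-emap : ∀ i → emap (gu i) ≡ inj₂ (inj₂ (fu i , κ i))
  gu-emap zero = ega
  gu-emap (suc zero) = egb
  gu-emap (suc (suc zero)) = proj₂ (proj₂ third-spoke)

  τ : Fin 3 → Fin 4
  τ zero = ta
  τ (suc zero) = tb
  τ (suc (suc zero)) = tc

  τ-joins : ∀ i → Joins K4 (κ i) w (τ i)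
  τ-joins zero = jta
  τ-joins (suc zero) = jtb
  τ-joins (suc (suc zero)) = jtc

  kT : Fin 3 → Fin 6
  kT zero = proj₁ kT-rest
  kT (suc zero) = proj₁ (proj₂ (proj₂ kT-rest))
  kT (suc (suc zero)) = proj₁ (proj₂ (proj₂ (proj₂ (proj₂ kT-rest))))

  kbc-joins : Joins K4 (kT (# 0)) tb tc
  kbc-joins = proj₁ (proj₂ kT-rest)
  kac-joins : Joins K4 (kT (# 1)) ta tc
  kac-joins = proj₁ (proj₂ (proj₂ (proj₂ kT-rest)))
  kab-joins : Joins K4 (kT (# 2)) ta tb
  kab-joins = proj₁ (proj₂ (proj₂ (proj₂ (proj₂ (proj₂ kT-rest)))))

  kT-joins : ∀ i j k → i ≢ j → i ≢ k → j ≢ k → Joins K4 (kT i) (τ j) (τ k)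
  kT-joins zero (suc zero) (suc (suc zero)) _ _ _ = kbc-joins
  kT-joins zero (suc (suc zero)) (suc zero) _ _ _ = joins-sym {K4} {kT (# 0)} kbc-joins
  kT-joins (suc zero) zero (suc (suc zero)) _ _ _ = kac-joins
  kT-joins (suc zero) (suc (suc zero)) zero _ _ _ = joins-sym {K4} {kT (# 1)} kac-joins
  kT-joins (suc (suc zero)) zero (suc zero) _ _ _ = kab-joins
  kT-joins (suc (suc zero)) (suc zero) zero _ _ _ = joins-sym {K4} {kT (# 2)} kab-joins
  kT-joins zero zero _ p _ _ = ⊥-elim (p refl)
  kT-joins zero _ zero _ p _ = ⊥-elim (p refl)
  kT-joins (suc zero) (suc zero) _ p _ _ = ⊥-elim (p refl)
  kT-joins (suc zero) _ (suc zero) _ p _ = ⊥-elim (p refl)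
  kT-joins (suc (suc zero)) (suc (suc zero)) _ p _ _ = ⊥-elim (p refl)
  kT-joins (suc (suc zero)) _ (suc (suc zero)) _ p _ = ⊥-elim (p refl)
  kT-joins zero (suc zero) (suc zero) _ _ p = ⊥-elim (p refl)
  kT-joins zero (suc (suc zero)) (suc (suc zero)) _ _ p = ⊥-elim (p refl)
  kT-joins (suc zero) zero zero _ _ p = ⊥-elim (p refl)
  kT-joins (suc zero) (suc (suc zero)) (suc (suc zero)) _ _ p = ⊥-elim (p refl)
  kT-joins (suc (suc zero)) zero zero _ _ p = ⊥-elim (p refl)
  kT-joins (suc (suc zero)) (suc zero) (suc zero) _ _ p = ⊥-elim (p refl)

  τ-inj : ∀ {i j} → τ i ≡ τ j → i ≡ j
  τ-inj {i} {j} e with i ≟ j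
  ... | yes q = q
  ... | no ne with third₃ i j ne
  ... | k , p , q = ⊥-elim (joins-≢ {K4} {kT k} (kT-joins k i j (p ∘ sym) (q ∘ sym) ne) e)

  τ≢w : ∀ i → τ i ≢ w
  τ≢w i e = joins-≢ {K4} {κ i} (τ-joins i) (sym e)

  not-w : ∀ i → ¬ Inc K4 (kT i) w
  not-w i h with others i
  ... | j , k , p , q , r with inc-cases {K4} {kT i} (kT-joins i j k p q r) h
  ... | inj₁ e = τ≢w j (sym e)
  ... | inj₂ e = τ≢w k (sym e)

  T : Fin 3 → Fin (n G)
  T i = proj₁ (vmap-on₂ (τ i) (τ≢w i))

  T-vmap : ∀ i → vmap (T i) ≡ inj₂ (τ i)
  T-vmap i = proj₂ (vmap-on₂ (τ i) (τ≢w i))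

  T-at : ∀ {x} i → vmap x ≡ inj₂ (τ i) → x ≡ T i
  T-at i e = vmap-inj _ _ (trans e (sym (T-vmap i)))

  T-cases : ∀ {x} → vm x ≡ u → ∃ λ i → x ≡ T i
  T-cases {x} e with vmap x in p
  ... | inj₁ v = ⊥-elim (vmap-no₁ x (trans p (cong inj₁ e)))
  ... | inj₂ t with t-cases t (λ q → vmap-no₂ x (trans p (cong inj₂ q)))
  ... | inj₁ q = # 0 , T-at (# 0) (trans p (cong inj₂ q))
  ... | inj₂ (inj₁ q) = # 1 , T-at (# 1) (trans p (cong inj₂ q))
  ... | inj₂ (inj₂ q) = # 2 , T-at (# 2) (trans p (cong inj₂ q))

  opp : Fin 3 → Fin (m G)
  opp i = proj₁ (old₂-on (kT i) (not-w i))

  opp-emap : ∀ i → emap (opp i) ≡ inj₂ (inj₁ (kT i))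
  opp-emap i = proj₂ (old₂-on (kT i) (not-w i))

  opp-joins : ∀ {i j k} → i ≢ j → i ≢ k → j ≢ k → Joins G (opp i) (T j) (T k)
  opp-joins {i} {j} {k} p q r = go (proj₂ (old₂ (opp i) (kT i) (opp-emap i))) (kT-joins i j k p q r)
    where
    at : ∀ {x t} l → vmap x ≡ inj₂ t → t ≡ τ l → x ≡ T l
    at l e refl = T-at l e
    go : SamePair (vmap (end₁ G (opp i))) (vmap (end₂ G (opp i))) (inj₂ (end₁ K4 (kT i))) (inj₂ (end₂ K4 (kT i))) → Joins K4 (kT i) (τ j) (τ k) → Joins G (opp i) (T j) (T k)
    go (inj₁ (x , y)) (inj₁ (z , v)) = inj₁ (at j x z , at k y v)
    go (inj₁ (x , y)) (inj₂ (z , v)) = inj₂ (at k x z , at j y v)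
    go (inj₂ (x , y)) (inj₁ (z , v)) = inj₂ (at k x v , at j y z)
    go (inj₂ (x , y)) (inj₂ (z , v)) = inj₁ (at j x v , at k y z)

  e-cases : ∀ g → (∃ λ f → g ≡ le f) ⊎ (∃ λ i → g ≡ opp i)
  e-cases g with emap g in p
  ... | inj₁ f = inj₁ (f , le-old p)
  ... | inj₂ (inj₂ (f , k)) = inj₁ (f , le-cut p)
  ... | inj₂ (inj₁ k) with proj₂ (proj₂ (proj₂ (proj₂ (proj₂ (proj₂ kT-rest))))) k (proj₁ (old₂ g k p))
  ... | inj₁ q = inj₂ (# 0 , emap-inj _ _ (trans p (trans (cong (λ k → inj₂ (inj₁ k)) q) (sym (opp-emap (# 0))))))
  ... | inj₂ (inj₁ q) = inj₂ (# 1 , emap-inj _ _ (trans p (trans (cong (λ k → inj₂ (inj₁ k)) q) (sym (opp-emap (# 1))))))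
  ... | inj₂ (inj₂ q) = inj₂ (# 2 , emap-inj _ _ (trans p (trans (cong (λ k → inj₂ (inj₁ k)) q) (sym (opp-emap (# 2))))))

  fu-inc : ∀ i → Inc H (fu i) u
  fu-inc i with new (gu i) (fu i) (κ i) (gu-emap i)
  ... | z , _ , j , _ = joins-inc {H} j

  fu-cases : ∀ {f} → Inc H f u → ∃ λ i → f ≡ fu i
  fu-cases {f} h with new-on₁ f h
  ... | g , k , e with new g f k e
  ... | z , t , j , jt , _ = at (k-cases k (joins-inc {K4} {k} jt))
    where
    hit : ∀ i → k ≡ κ i → ∃ λ i → f ≡ fu i
    hit i q = i , emap-f (new-fun₂ g (gu i) f (fu i) (κ i) (subst (λ k → emap g ≡ inj₂ (inj₂ (f , k))) q e) (gu-emap i)) e (gu-emap i)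
    at : k ≡ ka ⊎ k ≡ kb ⊎ k ≡ kc → ∃ λ i → f ≡ fu i
    at (inj₁ q) = hit (# 0) q
    at (inj₂ (inj₁ q)) = hit (# 1) q
    at (inj₂ (inj₂ q)) = hit (# 2) q

  le-fu : ∀ i → Inc G (le (fu i)) (T i)
  le-fu i = subst (λ g → Inc G g (T i)) (le-cut (gu-emap i)) at
    where
    at : Inc G (gu i) (T i)
    at with new (gu i) (fu i) (κ i) (gu-emap i)
    ... | z , t , j , jt , inj₁ (_ , q) = inj₂ (T-at i (trans q (cong inj₂ (joins-unique {K4} {κ i} jt (τ-joins i)))))
    ... | z , t , j , jt , inj₂ (q , _) = inj₁ (T-at i (trans q (cong inj₂ (joins-unique {K4} {κ i} jt (τ-joins i)))))

  expansion : Expansion G H u a b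
  expansion = record
    { vm = vm ; vm-inj = vm-inj ; lift = lift ; T = T ; T-inj = λ {i} {j} e → τ-inj (inj₂-inj (trans (sym (T-vmap i)) (trans (cong vmap e) (T-vmap j)))) ; vm-T = λ i → cong point (T-vmap i)
    ; T-cases = T-cases ; le = le ; le-inj = le-inj ; le-joins = le-joins ; opp = opp ; opp-joins = opp-joins ; e-cases = e-cases
    ; fu = fu ; fu-inc = fu-inc ; fu-cases = fu-cases ; le-fu = le-fu ; ja = ja ; jb = jb ; fab = fab ; jab = jab }
    where
    inj₂-inj : ∀ {x y : Fin 4} → _≡_ {A = Fin (n H) ⊎ Fin 4} (inj₂ x) (inj₂ y) → x ≡ y
    inj₂-inj refl = refl

-- The three edges between the triangles are forced at one end, the six triangle edges by looking at
-- both ends.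
prism-nonremovable : ∀ e → ¬ Removable C6bar e
prism-nonremovable = go
  where
  meet : ∀ (e f : Fin 9) (v : Fin 6) {_ : True (¬? (e ≟ f) ×-dec (inc? {C6bar} e v ×-dec inc? {C6bar} f v))} → Meet {C6bar} e f
  meet e f v {w} = proj₁ (toWitness w) , v , proj₂ (toWitness w)
  at : ∀ (t : Fin 6) (e g h : Fin 9) {_ : True (all? λ x → inc? {C6bar} x t →-dec ((x ≟ e) ⊎-dec ((x ≟ g) ⊎-dec (x ≟ h))))} → ∀ {x} → Inc C6bar x t → x ≡ e ⊎ x ≡ g ⊎ x ≡ h
  at t e g h {w} {x} = toWitness w x
  matching : ∀ (t : Fin 6) (e g h f : Fin 9) → f ≢ e → (∀ {x} → Inc C6bar x t → x ≡ e ⊎ x ≡ g ⊎ x ≡ h) → Meet {C6bar} g f → Meet {C6bar} h f → ¬ Removable C6bar e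
  matching t e g h f ne ex mg mh = forced-at {C6bar} {t} {e} {g} {h} {f} ne ex mg mh
  side : ∀ (t t' : Fin 6) (e g h g' h' f : Fin 9) → f ≢ e → (∀ {x} → Inc C6bar x t → x ≡ e ⊎ x ≡ g ⊎ x ≡ h) → (∀ {x} → Inc C6bar x t' → x ≡ e ⊎ x ≡ g' ⊎ x ≡ h') →
    Meet {C6bar} g f → Meet {C6bar} g' f → Meet {C6bar} h h' → ¬ Removable C6bar e
  side t t' e g h g' h' f ne ex ex' mg mg' mh = forced-between {C6bar} {t} {t'} {e} {g} {h} {g'} {h'} {f} ne ex ex' mg mg' mh
  go : ∀ e → ¬ Removable C6bar e
  go zero = side (# 0) (# 2) (# 0) (# 1) (# 2) (# 7) (# 6) (# 8) (λ ()) (λ {x} → at (# 0) (# 0) (# 1) (# 2) {x = x}) (λ {x} → at (# 2) (# 0) (# 7) (# 6) {x = x}) (meet (# 1) (# 8) (# 3)) (meet (# 7) (# 8) (# 5)) (meet (# 2) (# 6) (# 4))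
  go (suc zero) = matching (# 0) (# 1) (# 0) (# 2) (# 6) (λ ()) (λ {x} → at (# 0) (# 1) (# 0) (# 2) {x = x}) (meet (# 0) (# 6) (# 2)) (meet (# 2) (# 6) (# 4))
  go (suc (suc zero)) = side (# 0) (# 4) (# 2) (# 1) (# 0) (# 4) (# 6) (# 3) (λ ()) (λ {x} → at (# 0) (# 2) (# 1) (# 0) {x = x}) (λ {x} → at (# 4) (# 2) (# 4) (# 6) {x = x}) (meet (# 1) (# 3) (# 3)) (meet (# 4) (# 3) (# 1)) (meet (# 0) (# 6) (# 2))
  go (suc (suc (suc zero))) = side (# 1) (# 3) (# 3) (# 4) (# 5) (# 1) (# 8) (# 2) (λ ()) (λ {x} → at (# 1) (# 3) (# 4) (# 5) {x = x}) (λ {x} → at (# 3) (# 3) (# 1) (# 8) {x = x}) (meet (# 4) (# 2) (# 4)) (meet (# 1) (# 2) (# 0)) (meet (# 5) (# 8) (# 5))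
  go (suc (suc (suc (suc zero)))) = matching (# 4) (# 4) (# 2) (# 6) (# 0) (λ ()) (λ {x} → at (# 4) (# 4) (# 2) (# 6) {x = x}) (meet (# 2) (# 0) (# 0)) (meet (# 6) (# 0) (# 2))
  go (suc (suc (suc (suc (suc zero))))) = side (# 1) (# 5) (# 5) (# 4) (# 3) (# 7) (# 8) (# 6) (λ ()) (λ {x} → at (# 1) (# 5) (# 4) (# 3) {x = x}) (λ {x} → at (# 5) (# 5) (# 7) (# 8) {x = x}) (meet (# 4) (# 6) (# 4)) (meet (# 7) (# 6) (# 2)) (meet (# 3) (# 8) (# 3))
  go (suc (suc (suc (suc (suc (suc zero)))))) = side (# 2) (# 4) (# 6) (# 7) (# 0) (# 4) (# 2) (# 5) (λ ()) (λ {x} → at (# 2) (# 6) (# 7) (# 0) {x = x}) (λ {x} → at (# 4) (# 6) (# 4) (# 2) {x = x}) (meet (# 7) (# 5) (# 5)) (meet (# 4) (# 5) (# 1)) (meet (# 0) (# 2) (# 0))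
  go (suc (suc (suc (suc (suc (suc (suc zero))))))) = matching (# 2) (# 7) (# 0) (# 6) (# 2) (λ ()) (λ {x} → at (# 2) (# 7) (# 0) (# 6) {x = x}) (meet (# 0) (# 2) (# 0)) (meet (# 6) (# 2) (# 4))
  go (suc (suc (suc (suc (suc (suc (suc (suc zero)))))))) = side (# 3) (# 5) (# 8) (# 1) (# 3) (# 7) (# 5) (# 0) (λ ()) (λ {x} → at (# 3) (# 8) (# 1) (# 3) {x = x}) (λ {x} → at (# 5) (# 8) (# 7) (# 5) {x = x}) (meet (# 1) (# 0) (# 0)) (meet (# 7) (# 0) (# 2)) (meet (# 3) (# 5) (# 1))

adj? : ∀ {G} u v → Dec (Adj G u v)
adj? {G} u v = any? λ e → joins? {G} e u v

prism-bound : TriBound C6bar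
prism-bound = record { simple = λ {e} {e'} → prism-simple {e} {e'} ; tri-unique = λ {v} {u} {w} {p} {q} → uniq v u w p q ; tri-edges = λ {_} {e} _ _ → prism-nonremovable e
  ; edges = [] ; complete = λ {e} r → ⊥-elim (prism-nonremovable e r) ; bound = ≤-refl }
  where
  table : ∀ v u → Adj C6bar v u → ∀ w → Adj C6bar u w → Adj C6bar v w → ∀ p → Adj C6bar v p → ∀ q → Adj C6bar p q → Adj C6bar v q → p ≡ u ⊎ p ≡ w
  table = decided (all? λ v → all? λ u → adj? {C6bar} v u →-dec all? λ w → adj? {C6bar} u w →-dec (adj? {C6bar} v w →-dec all? λ p → adj? {C6bar} v p →-dec all? λ q → adj? {C6bar} p q →-dec (adj? {C6bar} v q →-dec ((p ≟ u) ⊎-dec (p ≟ w)))))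
  uniq : ∀ v u w p q → Tri C6bar v u w → Tri C6bar v p q → p ≡ u ⊎ p ≡ w
  uniq v u w p q (x , y , z) (x' , y' , z') = table v u x w y z p x' q y' z'

-- Invariance under isomorphism

module _ {G H : Graph} (i : Iso G H) where
  open Iso i
  open Inverse

  private
    fv : Fin (n G) → Fin (n H)
    fv = to vbij
    fe : Fin (m G) → Fin (m H)
    fe = to ebij
    be : Fin (m H) → Fin (m G)
    be = from ebij
    fe-be : ∀ h → fe (be h) ≡ h
    fe-be = strictlyInverseˡ ebij
    be-fe : ∀ g → be (fe g) ≡ g
    be-fe = strictlyInverseʳ ebij
    fv-inj : ∀ {x y} → fv x ≡ fv y → x ≡ y
    fv-inj {x} {y} e = trans (sym (strictlyInverseʳ vbij x)) (trans (cong (from vbij) e) (strictlyInverseʳ vbij y))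

  joins-iso : ∀ {g x y} → Joins G g x y → Joins H (fe g) (fv x) (fv y)
  joins-iso {g} (inj₁ (refl , refl)) with ends g
  ... | inj₁ (p , q) = inj₁ (sym p , sym q)
  ... | inj₂ (p , q) = inj₂ (sym q , sym p)
  joins-iso {g} (inj₂ (refl , refl)) with ends g
  ... | inj₁ (p , q) = inj₂ (sym p , sym q)
  ... | inj₂ (p , q) = inj₁ (sym q , sym p)

  inc-iso : ∀ {g x} → Inc G g x → Inc H (fe g) (fv x)
  inc-iso {g} h with inc-joins {G} h
  ... | y , j = joins-inc {H} (joins-iso j)

  inc-iso⁻ : ∀ {h x} → Inc H h (fv x) → Inc G (be h) x
  inc-iso⁻ {h} {x} k with inc-cases {H} (joins-iso (joins-ends {G} (be h))) (subst (λ h → Inc H h (fv x)) (sym (fe-be h)) k)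
  ... | inj₁ e = inj₁ (sym (fv-inj e))
  ... | inj₂ e = inj₂ (sym (fv-inj e))

  adj-iso : ∀ {x y} → Adj G x y → Adj H (fv x) (fv y)
  adj-iso (g , j) = fe g , joins-iso j

  tri-iso : ∀ {x y z} → Tri G x y z → Tri H (fv x) (fv y) (fv z)
  tri-iso (p , q , r) = adj-iso p , adj-iso q , adj-iso r

  removable-iso : ∀ {e} → Removable G e → Removable H (fe e)
  removable-iso {e} (two , con , cov) = ≤-trans two (injective⇒≤ {f = fv} fv-inj) , con' , cov'
    where
    walk : ∀ {x y} → Reach G (Minus1 G e) x y → Reach H (Minus1 H (fe e)) (fv x) (fv y)
    walk here = here
    walk (step g ne j r) = step (fe g) (λ q → ne (trans (sym (be-fe g)) (trans (cong be q) (be-fe e)))) (joins-iso j) (walk r)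
    con' : Connected H (Minus1 H (fe e))
    con' x y = subst₂ (Reach H (Minus1 H (fe e))) (strictlyInverseˡ vbij x) (strictlyInverseˡ vbij y) (walk (con (from vbij x) (from vbij y)))
    cov' : ∀ h → Minus1 H (fe e) h → ∃ λ M → PerfectMatching H (Minus1 H (fe e)) M × h ∈ M
    cov' h ne with cov (be h) (λ q → ne (trans (sym (fe-be h)) (cong fe q)))
    ... | M , (sub , cover , uniq) , be∈ = tabulate K , ((λ g g∈ q → sub (be g) (out g∈) (trans (cong be q) (be-fe e))) , cover' , uniq') , ∈-tabulate {X = K} (⌊⌋-intro (be h ∈? M) be∈)
      where
      K : FSet (m H)
      K g = ⌊ be g ∈? M ⌋
      out : ∀ {g} → g ∈ tabulate K → be g ∈ M
      out {g} p = ⌊⌋-elim (be g ∈? M) (tabulate-∈ {X = K} p)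
      cover' : ∀ y → ∃ λ g → g ∈ tabulate K × Inc H g y
      cover' y with cover (from vbij y)
      ... | g , g∈ , inc = fe g , ∈-tabulate {X = K} (⌊⌋-intro (be (fe g) ∈? M) (subst (_∈ M) (sym (be-fe g)) g∈)) , subst (Inc H (fe g)) (strictlyInverseˡ vbij y) (inc-iso inc)
      uniq' : ∀ y g g' → g ∈ tabulate K → g' ∈ tabulate K → Inc H g y → Inc H g' y → g ≡ g'
      uniq' y g g' p q h h' = trans (sym (fe-be g)) (trans (cong fe (uniq (from vbij y) (be g) (be g') (out p) (out q) (pull' h) (pull' h'))) (fe-be g'))
        where
        pull' : ∀ {g} → Inc H g y → Inc G (be g) (from vbij y)
        pull' {g} h = inc-iso⁻ (subst (Inc H g) (sym (strictlyInverseˡ vbij y)) h)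

  bound-iso : TriBound H → TriBound G
  bound-iso I = record
    { simple = λ j j' → trans (sym (be-fe _)) (trans (cong be (simple (joins-iso j) (joins-iso j'))) (be-fe _))
    ; tri-unique = λ t t' → case tri-unique (tri-iso t) (tri-iso t') of λ { (inj₁ e) → inj₁ (fv-inj e) ; (inj₂ e) → inj₂ (fv-inj e) }
    ; tri-edges = λ { (y , z , t) h r → tri-edges (fv y , fv z , tri-iso t) (inc-iso h) (removable-iso r) }
    ; edges = map be edges ; complete = λ {e} r → subst (_∈ˡ map be edges) (be-fe e) (∈-map⁺ be (complete (removable-iso r)))
    ; bound = ≤-trans (≤-reflexive (cong (λ k → 2 * k + 6) (length-map be edges))) (≤-trans bound (injective⇒≤ {f = from vbij} λ {x} {y} e → trans (sym (strictlyInverseˡ vbij x)) (trans (cong fv e) (strictlyInverseˡ vbij y)))) }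
    where open TriBound I

triLadder-bound : ∀ {G} → TriLadder G → TriBound G
triLadder-bound (base i) = bound-iso i prism-bound
triLadder-bound (splice tl u (a , b , (fa , ja) , (fab , jab) , (fb , jb)) w S) = Expanded.Bound.expanded-bound (FromSplicing.expansion S ja jb jab) (triLadder-bound tl)

card≤length : ∀ {k} (X : FSet k) (xs : List (Fin k)) → (∀ {x} → x ∊ X → x ∈ˡ xs) → card X ≤ length xs
card≤length X [] h = ≤-reflexive (card-∅ {X = X} λ v → ¬∊⇒∉ λ p → case h p of λ ())
card≤length X (x ∷ xs) h = ≤-trans (card-delete-≤ x X) (s≤s (card≤length (delete x X) xs λ p → case h (delete-sub {a = x} {X} p) of λ { (here q) → ⊥-elim (delete-≢ {X = X} p q) ; (there q) → q }))

theorem1p2 : (G : Graph) → NearBipartite G → Brick G → ¬ Iso G K4 →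
    (Σ (Subset (m G)) (λ R → (∀ e → e ∈ R → Removable G e) × n G ≤ 2 * ∣ R ∣ + 6))
    × ((Σ (Subset (m G)) (λ R → (∀ e → (e ∈ R ⇔ Removable G e)) × 2 * ∣ R ∣ + 6 ≡ n G))
       ⇔ TriLadder G)
theorem1p2 G nb (mcG , _ , no-tight) _ with 6 ≤? n G
-- Below six vertices the empty set meets the bound, and both sides of the equivalence fail, as each
-- implies `6 ≤ n G`.
... | no small = (tabulate ∅ , (λ e p → case tabulate-∈ {X = ∅} p of λ ()) , ≤-trans (≤-trans (n≤1+n _) (≰⇒> small)) (m≤n+m 6 (2 * ∣ tabulate {n = m G} ∅ ∣)))
    , mk⇔ (λ { (R , _ , q) → ⊥-elim (small (≤-trans (m≤n+m 6 (2 * ∣ R ∣)) (≤-reflexive q))) }) (λ tl → ⊥-elim (small (≤-trans (m≤n+m 6 _) (TriBound.bound (triLadder-bound tl)))))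
... | yes six = (tabulate R , (λ e p → R-elim (tabulate-∈ {X = R} p)) , lower') , mk⇔ ladder exact
  where
  open Count G mcG no-tight (setup G nb) six
  double : ∀ k → 2 * k + 6 ≡ (k + k) + 6
  double k = cong (λ j → (k + j) + 6) (+-identityʳ k)
  lower' : n G ≤ 2 * ∣ tabulate R ∣ + 6
  lower' = ≤-trans lower (≤-reflexive (trans (sym (double (card R))) (cong (λ k → 2 * k + 6) (sym (∣tabulate∣ R)))))
  ladder : (Σ (Subset (m G)) λ R → (∀ e → (e ∈ R ⇔ Removable G e)) × 2 * ∣ R ∣ + 6 ≡ n G) → TriLadder G
  ladder (R' , h , q) = Climb.extremal⇒triLadder G mcG no-tight (setup G nb) six (trans (sym (double (card R))) (trans (cong (λ k → 2 * k + 6) size) q))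
    where
    size : card R ≡ ∣ R' ∣
    size = trans (card-cong {X = R} {lookup R'} (λ {e} p → []=⇒lookup (Equivalence.from (h e) (R-elim p))) (λ {e} p → R-intro (Equivalence.to (h e) (lookup⇒[]= e R' p))))
      (trans (sym (∣tabulate∣ (lookup R'))) (cong ∣_∣ (tabulate∘lookup R')))
  exact : TriLadder G → Σ (Subset (m G)) λ R → (∀ e → (e ∈ R ⇔ Removable G e)) × 2 * ∣ R ∣ + 6 ≡ n G
  exact tl = tabulate R , (λ e → mk⇔ (λ p → R-elim (tabulate-∈ {X = R} p)) (λ r → ∈-tabulate {X = R} (R-intro r))) , ≤-antisym upper lower'
    where
    open TriBound (triLadder-bound tl)
    -- The list of `TriBound` contains every removable edge, so its length bounds their number from
    -- above.
    upper : 2 * ∣ tabulate R ∣ + 6 ≤ n G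
    upper = ≤-trans (+-mono-≤ (*-monoʳ-≤ 2 (≤-trans (≤-reflexive (∣tabulate∣ R)) (card≤length R edges λ p → complete (R-elim p)))) ≤-refl) bound
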